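{- Let $p_1,p_2$ be distinct odd primes. Then there exists an odd prime $p_0$ such that $p_2$ is the smallest odd prime dividing $p_0+p_1$. -}

module Defs where

open import Data.Nat using (ℕ; _≤_)
open import Data.Nat.Divisibility using (_∣_)
open import Data.Nat.Primality using (Prime)
open import Data.Product using (_×_)
open import Relation.Nullary using (¬_)

Odd : ℕ → Set
Odd n = ¬ (2 ∣ n)

OddPrime : ℕ → Set
OddPrime p = Prime p × Odd p

SmallestOddPrimeDivisor : ℕ → ℕ → Set
SmallestOddPrimeDivisor p n = OddPrime p × p ∣ n × (∀ q → OddPrime q → q ∣ n → p ≤ q)

{-# OPTIONS --safe #-}
-- Let M = p₂! and a = p₂ m − p₁ modulo M, where m is even and no odd prime below p₂ divides m or a. Then a is prime to M, and every
-- p ≡ a modulo M satisfies p₂ ∣ p + p₁ while no odd prime below p₂ divides p + p₁. It remains to find a prime in the class of a.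
--
-- Dirichlet's theorem is proved by finite computations with rational inequalities, for a search bound X depending only on M. Logarithms
-- are replaced by a completely additive rational function L built from partial sums of the harmonic series, and all sums over n are
-- weighted by powers of (T − L n)⁺ / n. A Möbius inversion bound turns Selberg's identity into the statement that Λ log + Λ * Λ has the
-- same weighted mass in each of the N = φ(M) reduced classes, up to one power of T less than the main term. If the class a contains
-- no prime up to X, then the class a of Λ * Λ carries the whole mass, which forces each class h to have density either nearly 0 or
-- nearly twice its share, according as its partner a / h is dense or not. The dense classes are the complement of a subgroup of index
-- two, so they define a real character ψ with ψ = −1 on nearly all primes. But r = 1 * ψ is nonnegative and at least 1 at squares,
-- which bounds Σ ψ(d) / d below, and hence Σ Λ(n) (1 + ψ(n)) / n grows like log: a contradiction.
module Submission where

open import Defs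
open import Data.Nat using (ℕ; _+_)
open import Data.Product using (Σ; _×_)
open import Relation.Binary.PropositionalEquality using (_≢_)
open import Data.Bool as Bool using (Bool; true; false; _∧_; if_then_else_)
open import Data.Empty using (⊥; ⊥-elim)
open import Data.Integer using (-[1+_])
open import Data.List using (List; []; _∷_; _++_; length)
open import Data.List.Relation.Binary.Permutation.Propositional as Perm using (_↭_)
open import Data.List.Relation.Unary.All using (All; []; _∷_)
open import Data.List.Relation.Unary.All.Properties using (++⁺)
open import Data.Nat using (zero; suc; _*_; _≤_; _<_; z≤n; s≤s; NonZero; _∸_; _^_; _≡ᵇ_; _<ᵇ_; _≤?_; _≟_; >-nonZero; _/_; nonTrivial⇒n>1; _%_; _!)
open import Data.Nat.Coprimality using (1-coprimeTo; Coprime; coprime?; coprime-Bézout; coprime-divisor)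
open import Data.Nat.DivMod using (m*n/n≡m; m/n*n≡m; m%n<n; m%n%n≡m%n; %-distribˡ-*; %-distribˡ-+; [m+kn]%n≡m%n; n%n≡0; m<n⇒m%n≡m; m*n%n≡0; [m+n]%n≡m%n; m≡m%n+[m/n]*n; m%n≤m; m/n*n≤m; m/n≤m; /-monoˡ-≤)
open import Data.Nat.Divisibility using (_∣_; _∣?_; divides; ∣1⇒≡1; ∣-trans; m∣m*n; n∣m*n; ∣⇒≤; ∣n⇒∣m*n; *-monoʳ-∣; *-cancelˡ-∣; ∣n∣m%n⇒∣m; %-presˡ-∣; 0∣⇒≡0; ∣-refl; _∣0; ∣m∣n⇒∣m+n; ∣m+n∣m⇒∣n; m≤n⇒m!∣n!)
open import Data.Nat.GCD using (module Bézout)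
open import Data.Nat.Induction using (<-rec)
open import Data.Nat.ListAction using (product)
open import Data.Nat.ListAction.Properties using (product-++)
open import Data.Nat.Primality using (Prime; prime?; prime⇒irreducible; euclidsLemma; ¬prime[1]; prime⇒nonTrivial; prime[2])
open import Data.Nat.Primality.Factorisation using (PrimeFactorisation; factorise; factorisationUnique)
open import Data.Nat.Tactic.RingSolver using (solve-∀)
open import Data.Product using (_,_; proj₁; proj₂)
open import Data.Rational using (ℚ; mkℚ; 0ℚ)
open import Data.Sum using (_⊎_; inj₁; inj₂; [_,_]′)
open import Data.Unit using (tt)
open import Function using (_∘_; _|>_)
open import Relation.Binary.Definitions using (tri<; tri≈; tri>)
open import Relation.Binary.PropositionalEquality using (_≡_; refl; sym; trans; cong; cong₂; subst; subst₂; module ≡-Reasoning)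
open import Relation.Nullary using (¬_; Dec; yes; no)
open import Relation.Nullary.Decidable using (_×-dec_; ¬?)
import Data.Nat.Properties as ℕₚ
import Data.Integer as ℤ
import Data.Integer.Properties as ℤₚ
import Data.Rational as ℚ
import Data.Rational.Properties as ℚₚ
import Data.Rational.Unnormalised as ℚᵘ
import Data.Rational.Unnormalised.Properties as ℚᵘₚ
import Data.Nat.Coprimality as Cop

-- Rational arithmetic

-- The true logarithm is irrational, but little of it matters: convolution identities need exact
-- additivity, estimates only need increments near 1/m. Keeping the first exact and the second
-- approximate avoids real numbers and limits. The price is a range of validity, X², since products
-- of two numbers up to X occur. Selberg's identity cannot tell an even number of prime factors from
-- an odd one. Its bound for one class is therefore twice the expected value, and a missing class is
-- consistent with it if some real character is -1 at almost all primes. Only this character has to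
-- be excluded, so no other characters arise; a lower bound for L(1, ψ) must come from outside the
-- sieve. The parameters are chosen in the order M, B (from the bound on L(1, ψ)), j, a lower bound
-- for τ, X. With T = 3 j τ, a large j makes densities extremal up to a fraction of order 1/j, and a
-- large τ beats errors one power of T smaller even times powers of j. Most inequalities are
-- polynomial certificates checked by `linear`, whose content is the list of nonnegative products.

infixl 6 _⊕_ _⊝_
infixl 7 _⊗_
infix 8 ⊖_
infix 4 _≼_ _≺_

opaque
  -- Opaque, so that type checking never evaluates fractions; the arguments below rest on the
  -- ordered-field laws of the next block.
  F : Set
  F = ℚ

  _⊕_ _⊗_ : F → F → F
  _⊕_ = ℚ._+_
  _⊗_ = ℚ._*_

  ⊖_ : F → F
  ⊖_ = ℚ.-_

  _≼_ _≺_ : F → F → Set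
  _≼_ = ℚ._≤_
  _≺_ = ℚ._<_

  ι : ℕ → F
  ι n = mkℚ (ℤ.+ n) 0 (Cop.sym (1-coprimeTo n))

  -- The default `inv 0 = 0` frees `inv-nonneg` and `inv≼1` from side conditions.
  inv : ℕ → F
  inv zero = 0ℚ
  inv (suc n) = ℚ.1/ ι (suc n)

_⊝_ : F → F → F
a ⊝ b = a ⊕ ⊖ b

opaque
  unfolding F

  ⊕-assoc : ∀ a b c → (a ⊕ b) ⊕ c ≡ a ⊕ (b ⊕ c)
  ⊕-assoc = ℚₚ.+-assoc
  ⊕-comm : ∀ a b → a ⊕ b ≡ b ⊕ a
  ⊕-comm = ℚₚ.+-comm
  ⊕-identityˡ : ∀ a → ι 0 ⊕ a ≡ a
  ⊕-identityˡ = ℚₚ.+-identityˡ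
  ⊕-inverseʳ : ∀ a → a ⊕ ⊖ a ≡ ι 0
  ⊕-inverseʳ = ℚₚ.+-inverseʳ
  ⊗-assoc : ∀ a b c → (a ⊗ b) ⊗ c ≡ a ⊗ (b ⊗ c)
  ⊗-assoc = ℚₚ.*-assoc
  ⊗-comm : ∀ a b → a ⊗ b ≡ b ⊗ a
  ⊗-comm = ℚₚ.*-comm
  ⊗-identityˡ : ∀ a → ι 1 ⊗ a ≡ a
  ⊗-identityˡ = ℚₚ.*-identityˡ
  ⊗-zeroˡ : ∀ a → ι 0 ⊗ a ≡ ι 0
  ⊗-zeroˡ = ℚₚ.*-zeroˡ
  ⊗-distribˡ : ∀ a b c → a ⊗ (b ⊕ c) ≡ a ⊗ b ⊕ a ⊗ c
  ⊗-distribˡ = ℚₚ.*-distribˡ-+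

  ι-+ : ∀ m n → ι (m + n) ≡ ι m ⊕ ι n
  ι-+ m n = ℚₚ.toℚᵘ-injective (ℚᵘₚ.≃-trans
    (ℚᵘ.*≡* (cong (ℤ._* (ℤ.+ 1)) (cong₂ ℤ._+_ (sym (ℤₚ.*-identityʳ (ℤ.+ m))) (sym (ℤₚ.*-identityʳ (ℤ.+ n))))))
    (ℚᵘₚ.≃-sym (ℚₚ.toℚᵘ-homo-+ (ι m) (ι n))))

  ι-* : ∀ m n → ι (m * n) ≡ ι m ⊗ ι n
  ι-* m n = ℚₚ.toℚᵘ-injective (ℚᵘₚ.≃-trans (ℚᵘ.*≡* (cong (ℤ._* (ℤ.+ 1)) (ℤₚ.pos-* m n)))
    (ℚᵘₚ.≃-sym (ℚₚ.toℚᵘ-homo-* (ι m) (ι n))))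

  ι-mono : ∀ {m n} → m ≤ n → ι m ≼ ι n
  ι-mono m≤n = ℚ.*≤* (ℤₚ.*-monoʳ-≤-nonNeg (ℤ.+ 1) (ℤ.+≤+ m≤n))

  ι-cancel-≤ : ∀ {m n} → ι m ≼ ι n → m ≤ n
  ι-cancel-≤ {m} {n} h = ℤₚ.drop‿+≤+ (subst₂ ℤ._≤_ (ℤₚ.*-identityʳ (ℤ.+ m)) (ℤₚ.*-identityʳ (ℤ.+ n)) (ℚₚ.drop-*≤* h))

  archimedean : ∀ a → Σ ℕ λ n → a ≼ ι n
  archimedean (mkℚ (ℤ.+ n) d _) = n , ℚ.*≤* (ℤₚ.*-monoˡ-≤-nonNeg (ℤ.+ n) (ℤ.+≤+ (s≤s z≤n)))
  archimedean (mkℚ -[1+ n ] d _) = 0 , ℚ.*≤* ℤ.-≤+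

  inv-ι : ∀ n → 1 ≤ n → inv n ⊗ ι n ≡ ι 1
  inv-ι (suc n) _ = ℚₚ.*-inverseˡ (ι (suc n))

  inv-nonneg : ∀ n → ι 0 ≼ inv n
  inv-nonneg zero = ℚₚ.≤-refl
  inv-nonneg (suc n) = ℚₚ.nonNegative⁻¹ (inv (suc n)) {{ℚₚ.pos⇒nonNeg (inv (suc n)) {{ℚₚ.1/pos⇒pos (ι (suc n))}}}}

  ≼-refl : ∀ {a} → a ≼ a
  ≼-refl = ℚₚ.≤-refl
  ≼-trans : ∀ {a b c} → a ≼ b → b ≼ c → a ≼ c
  ≼-trans = ℚₚ.≤-trans
  ≺⇒≼ : ∀ {a b} → a ≺ b → a ≼ b
  ≺⇒≼ = ℚₚ.<⇒≤
  ≼? : ∀ a b → a ≼ b ⊎ b ≺ a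
  ≼? a b with a ℚₚ.≤? b
  ... | yes p = inj₁ p
  ... | no ¬p = inj₂ (ℚₚ.≰⇒> ¬p)
  _≼dec_ : ∀ a b → Dec (a ≼ b)
  _≼dec_ = ℚₚ._≤?_
  ≺⇒⋡ : ∀ {a b} → a ≺ b → b ≼ a → ⊥
  ≺⇒⋡ p q = ℚₚ.<-irrefl refl (ℚₚ.<-≤-trans p q)
  ⋡⇒≺ : ∀ {a b} → ¬ (a ≼ b) → b ≺ a
  ⋡⇒≺ = ℚₚ.≰⇒>
  ⊕-mono : ∀ {a b c d} → a ≼ b → c ≼ d → a ⊕ c ≼ b ⊕ d
  ⊕-mono = ℚₚ.+-mono-≤
  ⊗-monoʳ : ∀ {a b c} → ι 0 ≼ c → a ≼ b → c ⊗ a ≼ c ⊗ b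
  ⊗-monoʳ {c = c} p q = ℚₚ.*-monoˡ-≤-nonNeg c {{ℚ.nonNegative p}} q
  ⊗-cancelˡ : ∀ {a b c} → ι 0 ≺ c → c ⊗ a ≼ c ⊗ b → a ≼ b
  ⊗-cancelˡ {c = c} p = ℚₚ.*-cancelˡ-≤-pos c {{ℚ.positive p}}

ι0≺ι1+ : ∀ n → ι 0 ≺ ι (suc n)
ι0≺ι1+ n = ⋡⇒≺ λ h → ℕₚ.1+n≰n (ℕₚ.≤-trans (ι-cancel-≤ h) z≤n)

-- Reflective proofs of polynomial identities and inequalities

⊕-interchange : ∀ a b c d → (a ⊕ b) ⊕ (c ⊕ d) ≡ (a ⊕ c) ⊕ (b ⊕ d)
⊕-interchange a b c d = trans (⊕-assoc a b (c ⊕ d)) (trans (cong (a ⊕_)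
  (trans (sym (⊕-assoc b c d)) (trans (cong (_⊕ d) (⊕-comm b c)) (⊕-assoc c b d)))) (sym (⊕-assoc a c (b ⊕ d))))

⊗-interchange : ∀ a b c d → (a ⊗ b) ⊗ (c ⊗ d) ≡ (a ⊗ c) ⊗ (b ⊗ d)
⊗-interchange a b c d = trans (⊗-assoc a b (c ⊗ d)) (trans (cong (a ⊗_)
  (trans (sym (⊗-assoc b c d)) (trans (cong (_⊗ d) (⊗-comm b c)) (⊗-assoc c b d)))) (sym (⊗-assoc a c (b ⊗ d))))

⊕-identityʳ : ∀ a → a ⊕ ι 0 ≡ a
⊕-identityʳ a = trans (⊕-comm a (ι 0)) (⊕-identityˡ a)

⊗-zeroʳ : ∀ a → a ⊗ ι 0 ≡ ι 0
⊗-zeroʳ a = trans (⊗-comm a (ι 0)) (⊗-zeroˡ a)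

⊗-identityʳ : ∀ a → a ⊗ ι 1 ≡ a
⊗-identityʳ a = trans (⊗-comm a (ι 1)) (⊗-identityˡ a)

⊗-distribʳ : ∀ a b c → (b ⊕ c) ⊗ a ≡ b ⊗ a ⊕ c ⊗ a
⊗-distribʳ a b c = trans (⊗-comm (b ⊕ c) a) (trans (⊗-distribˡ a b c) (cong₂ _⊕_ (⊗-comm a b) (⊗-comm a c)))

⊖-unique : ∀ a b → a ⊕ b ≡ ι 0 → b ≡ ⊖ a
⊖-unique a b h = begin
  b ≡⟨ sym (⊕-identityˡ b) ⟩
  ι 0 ⊕ b ≡⟨ cong (_⊕ b) (sym (trans (⊕-comm (⊖ a) a) (⊕-inverseʳ a))) ⟩
  (⊖ a ⊕ a) ⊕ b ≡⟨ ⊕-assoc (⊖ a) a b ⟩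
  ⊖ a ⊕ (a ⊕ b) ≡⟨ cong (⊖ a ⊕_) h ⟩
  ⊖ a ⊕ ι 0 ≡⟨ ⊕-identityʳ (⊖ a) ⟩
  ⊖ a ∎ where open ≡-Reasoning

⊖-⊕ : ∀ a b → ⊖ (a ⊕ b) ≡ ⊖ a ⊕ ⊖ b
⊖-⊕ a b = sym (⊖-unique (a ⊕ b) (⊖ a ⊕ ⊖ b) (trans (⊕-interchange a b (⊖ a) (⊖ b))
  (trans (cong₂ _⊕_ (⊕-inverseʳ a) (⊕-inverseʳ b)) (⊕-identityˡ (ι 0)))))

⊖-⊗ : ∀ a b → ⊖ (a ⊗ b) ≡ ⊖ a ⊗ b
⊖-⊗ a b = sym (⊖-unique (a ⊗ b) (⊖ a ⊗ b) (trans (sym (⊗-distribʳ b a (⊖ a)))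
  (trans (cong (_⊗ b) (⊕-inverseʳ a)) (⊗-zeroˡ b))))

⊖-involutive : ∀ a → ⊖ ⊖ a ≡ a
⊖-involutive a = sym (⊖-unique (⊖ a) a (trans (⊕-comm (⊖ a) a) (⊕-inverseʳ a)))

infixl 6 _:+_ _:-_
infixl 7 _:*_
infix 8 :-_

data Expr : Set where
  con var : ℕ → Expr
  _:+_ _:*_ : Expr → Expr → Expr
  :-_ : Expr → Expr

_:-_ : Expr → Expr → Expr
a :- b = a :+ :- b

Env : Set
Env = List F

atom : Env → ℕ → F
atom [] _ = ι 0
atom (x ∷ ρ) zero = x
atom (x ∷ ρ) (suc i) = atom ρ i

⟦_⟧ : Expr → Env → F
⟦ con n ⟧ ρ = ι n
⟦ var i ⟧ ρ = atom ρ i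
⟦ a :+ b ⟧ ρ = ⟦ a ⟧ ρ ⊕ ⟦ b ⟧ ρ
⟦ a :* b ⟧ ρ = ⟦ a ⟧ ρ ⊗ ⟦ b ⟧ ρ
⟦ :- a ⟧ ρ = ⊖ ⟦ a ⟧ ρ

-- A coefficient (m , n) stands for m − n.
Coeff Mono Poly : Set
Coeff = ℕ × ℕ
Mono = List ℕ
Poly = List (Coeff × Mono)

private
  coeff : Coeff → F
  coeff (m , n) = ι m ⊝ ι n

  mono : Env → Mono → F
  mono ρ [] = ι 1
  mono ρ (i ∷ m) = atom ρ i ⊗ mono ρ m

  poly : Env → Poly → F
  poly ρ [] = ι 0
  poly ρ ((c , m) ∷ p) = coeff c ⊗ mono ρ m ⊕ poly ρ p

_+c_ _*c_ : Coeff → Coeff → Coeff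
(a , b) +c (c , d) = a + c , b + d
(a , b) *c (c , d) = a * c + b * d , a * d + b * c

sameMono : Mono → Mono → Bool
sameMono [] [] = true
sameMono (i ∷ m) (j ∷ n) = (i ≡ᵇ j) ∧ sameMono m n
sameMono _ _ = false

lessMono : Mono → Mono → Bool
lessMono [] [] = false
lessMono [] (_ ∷ _) = true
lessMono (_ ∷ _) [] = false
lessMono (i ∷ m) (j ∷ n) = if i <ᵇ j then true else (if i ≡ᵇ j then lessMono m n else false)

insertVar : ℕ → Mono → Mono
insertVar i [] = i ∷ []
insertVar i (j ∷ m) = if i <ᵇ j then i ∷ j ∷ m else j ∷ insertVar i m

mulMono : Mono → Mono → Mono
mulMono [] n = n
mulMono (i ∷ m) n = insertVar i (mulMono m n)

insertTerm : Coeff → Mono → Poly → Poly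
insertTerm c m [] = (c , m) ∷ []
insertTerm c m ((d , n) ∷ p) =
  if sameMono m n then (c +c d , n) ∷ p
  else (if lessMono m n then (c , m) ∷ (d , n) ∷ p else (d , n) ∷ insertTerm c m p)

addPoly : Poly → Poly → Poly
addPoly [] q = q
addPoly ((c , m) ∷ p) q = insertTerm c m (addPoly p q)

scale : Coeff → Mono → Poly → Poly
scale c m [] = []
scale c m ((d , n) ∷ p) = insertTerm (c *c d) (mulMono m n) (scale c m p)

mulPoly : Poly → Poly → Poly
mulPoly [] q = []
mulPoly ((c , m) ∷ p) q = addPoly (scale c m q) (mulPoly p q)

normal : Expr → Poly
normal (con n) = ((n , 0) , []) ∷ []
normal (var i) = ((1 , 0) , i ∷ []) ∷ []
normal (a :+ b) = addPoly (normal a) (normal b)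
normal (a :* b) = mulPoly (normal a) (normal b)
normal (:- a) = scale (0 , 1) [] (normal a)

-- `insertTerm` keeps terms whose coefficient has cancelled, so the zero polynomial is recognised by
-- its coefficients and not by being empty.
vanishes : Poly → Bool
vanishes [] = true
vanishes (((m , n) , _) ∷ p) = (m ≡ᵇ n) ∧ vanishes p

private
  ∧-split : ∀ a b → Bool.T (a ∧ b) → Bool.T a × Bool.T b
  ∧-split true true _ = tt , tt

  coeff-+ : ∀ c d → coeff (c +c d) ≡ coeff c ⊕ coeff d
  coeff-+ (a , b) (c , d) = trans (cong₂ (λ x y → x ⊕ ⊖ y) (ι-+ a c) (ι-+ b d))
    (trans (cong ((ι a ⊕ ι c) ⊕_) (⊖-⊕ (ι b) (ι d))) (⊕-interchange (ι a) (ι c) (⊖ ι b) (⊖ ι d)))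

  ι-*+* : ∀ a b c d → ι (a * b + c * d) ≡ ι a ⊗ ι b ⊕ ι c ⊗ ι d
  ι-*+* a b c d = trans (ι-+ (a * b) (c * d)) (cong₂ _⊕_ (ι-* a b) (ι-* c d))

  coeff-* : ∀ c d → coeff (c *c d) ≡ coeff c ⊗ coeff d
  coeff-* (a , b) (c , d) = begin
    ι (a * c + b * d) ⊕ ⊖ ι (a * d + b * c)
      ≡⟨ cong₂ (λ x y → x ⊕ ⊖ y) (ι-*+* a c b d) (ι-*+* a d b c) ⟩
    (A ⊗ C ⊕ B ⊗ D) ⊕ ⊖ (A ⊗ D ⊕ B ⊗ C)
      ≡⟨ cong ((A ⊗ C ⊕ B ⊗ D) ⊕_) (⊖-⊕ (A ⊗ D) (B ⊗ C)) ⟩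
    (A ⊗ C ⊕ B ⊗ D) ⊕ (⊖ (A ⊗ D) ⊕ ⊖ (B ⊗ C))
      ≡⟨ cong ((A ⊗ C ⊕ B ⊗ D) ⊕_) (⊕-comm _ _) ⟩
    (A ⊗ C ⊕ B ⊗ D) ⊕ (⊖ (B ⊗ C) ⊕ ⊖ (A ⊗ D))
      ≡⟨ ⊕-interchange (A ⊗ C) (B ⊗ D) (⊖ (B ⊗ C)) (⊖ (A ⊗ D)) ⟩
    (A ⊗ C ⊕ ⊖ (B ⊗ C)) ⊕ (B ⊗ D ⊕ ⊖ (A ⊗ D))
      ≡⟨ cong₂ _⊕_ (trans (cong (A ⊗ C ⊕_) (⊖-⊗ B C)) (sym (⊗-distribʳ C A (⊖ B))))
          (trans (⊕-comm _ _) (trans (cong₂ _⊕_ (trans (⊖-⊗ A D) refl) (trans (cong (_⊗ D) (sym (⊖-involutive B))) refl))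
          (trans (sym (⊗-distribʳ D (⊖ A) (⊖ ⊖ B))) (trans (cong (_⊗ D) (sym (⊖-⊕ A (⊖ B))))
            (trans (sym (⊖-⊗ (A ⊕ ⊖ B) D)) (trans (cong ⊖_ (⊗-comm _ D)) (trans (⊖-⊗ D _) (⊗-comm _ _)))))))) ⟩
    (A ⊕ ⊖ B) ⊗ C ⊕ (A ⊕ ⊖ B) ⊗ ⊖ D
      ≡⟨ sym (⊗-distribˡ (A ⊕ ⊖ B) C (⊖ D)) ⟩
    (A ⊕ ⊖ B) ⊗ (C ⊕ ⊖ D) ∎
    where
    open ≡-Reasoning
    A = ι a
    B = ι b
    C = ι c
    D = ι d

  sameMono-sound : ∀ m n → Bool.T (sameMono m n) → m ≡ n
  sameMono-sound [] [] _ = refl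
  sameMono-sound (i ∷ m) (j ∷ n) h with ∧-split (i ≡ᵇ j) (sameMono m n) h
  ... | p , q = cong₂ _∷_ (ℕₚ.≡ᵇ⇒≡ i j p) (sameMono-sound m n q)

  module _ (ρ : Env) where
    insertVar-sound : ∀ i m → mono ρ (insertVar i m) ≡ atom ρ i ⊗ mono ρ m
    insertVar-sound i [] = refl
    insertVar-sound i (j ∷ m) with i <ᵇ j
    ... | true = refl
    ... | false = trans (cong (atom ρ j ⊗_) (insertVar-sound i m))
      (trans (sym (⊗-assoc _ _ _)) (trans (cong (_⊗ mono ρ m) (⊗-comm _ _)) (⊗-assoc _ _ _)))

    mulMono-sound : ∀ m n → mono ρ (mulMono m n) ≡ mono ρ m ⊗ mono ρ n
    mulMono-sound [] n = sym (⊗-identityˡ _)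
    mulMono-sound (i ∷ m) n = trans (insertVar-sound i (mulMono m n))
      (trans (cong (atom ρ i ⊗_) (mulMono-sound m n)) (sym (⊗-assoc _ _ _)))

    insertTerm-sound : ∀ c m p → poly ρ (insertTerm c m p) ≡ coeff c ⊗ mono ρ m ⊕ poly ρ p
    insertTerm-sound c m [] = refl
    insertTerm-sound c m ((d , n) ∷ p) with sameMono m n | sameMono-sound m n
    ... | true | eq = trans (cong (_⊕ poly ρ p) (trans (cong (_⊗ mono ρ n) (coeff-+ c d))
            (trans (⊗-distribʳ (mono ρ n) (coeff c) (coeff d)) (cong (λ k → coeff c ⊗ mono ρ k ⊕ _) (sym (eq tt))))))
            (⊕-assoc _ _ _)
    ... | false | _ with lessMono m n
    ...   | true = refl
    ...   | false = trans (cong (coeff d ⊗ mono ρ n ⊕_) (insertTerm-sound c m p))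
              (trans (sym (⊕-assoc _ _ _)) (trans (cong (_⊕ poly ρ p) (⊕-comm _ _)) (⊕-assoc _ _ _)))

    addPoly-sound : ∀ p q → poly ρ (addPoly p q) ≡ poly ρ p ⊕ poly ρ q
    addPoly-sound [] q = sym (⊕-identityˡ _)
    addPoly-sound ((c , m) ∷ p) q = trans (insertTerm-sound c m (addPoly p q))
      (trans (cong (coeff c ⊗ mono ρ m ⊕_) (addPoly-sound p q)) (sym (⊕-assoc _ _ _)))

    scale-sound : ∀ c m p → poly ρ (scale c m p) ≡ (coeff c ⊗ mono ρ m) ⊗ poly ρ p
    scale-sound c m [] = sym (⊗-zeroʳ _)
    scale-sound c m ((d , n) ∷ p) = trans (insertTerm-sound (c *c d) (mulMono m n) (scale c m p))
      (trans (cong₂ _⊕_ (trans (cong₂ _⊗_ (coeff-* c d) (mulMono-sound m n)) (⊗-interchange _ _ _ _)) (scale-sound c m p))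
        (sym (⊗-distribˡ _ _ _)))

    mulPoly-sound : ∀ p q → poly ρ (mulPoly p q) ≡ poly ρ p ⊗ poly ρ q
    mulPoly-sound [] q = sym (⊗-zeroˡ _)
    mulPoly-sound ((c , m) ∷ p) q = trans (addPoly-sound (scale c m q) (mulPoly p q))
      (trans (cong₂ _⊕_ (scale-sound c m q) (mulPoly-sound p q)) (sym (⊗-distribʳ _ _ _)))

    ⊖ι0 : ⊖ ι 0 ≡ ι 0
    ⊖ι0 = sym (⊖-unique (ι 0) (ι 0) (⊕-identityˡ (ι 0)))

    coeff-ι : ∀ n → coeff (n , 0) ≡ ι n
    coeff-ι n = trans (cong (ι n ⊕_) ⊖ι0) (⊕-identityʳ (ι n))

    normal-sound : ∀ e → poly ρ (normal e) ≡ ⟦ e ⟧ ρ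
    normal-sound (con n) = trans (⊕-identityʳ _) (trans (⊗-identityʳ _) (coeff-ι n))
    normal-sound (var i) = trans (⊕-identityʳ _) (trans (cong₂ _⊗_ (coeff-ι 1) (⊗-identityʳ _)) (⊗-identityˡ _))
    normal-sound (a :+ b) = trans (addPoly-sound (normal a) (normal b)) (cong₂ _⊕_ (normal-sound a) (normal-sound b))
    normal-sound (a :* b) = trans (mulPoly-sound (normal a) (normal b)) (cong₂ _⊗_ (normal-sound a) (normal-sound b))
    normal-sound (:- a) = trans (scale-sound (0 , 1) [] (normal a))
      (trans (cong (_⊗ poly ρ (normal a)) (trans (⊗-identityʳ _) (⊕-identityˡ _)))
        (trans (sym (⊖-⊗ (ι 1) _)) (cong ⊖_ (trans (⊗-identityˡ _) (normal-sound a)))))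

    vanishes-sound : ∀ p → Bool.T (vanishes p) → poly ρ p ≡ ι 0
    vanishes-sound [] _ = refl
    vanishes-sound (((m , n) , k) ∷ p) h with ∧-split (m ≡ᵇ n) (vanishes p) h
    ... | h₁ , h₂ with ℕₚ.≡ᵇ⇒≡ m n h₁
    ... | refl = trans (cong₂ _⊕_ (trans (cong (_⊗ mono ρ k) (⊕-inverseʳ (ι m))) (⊗-zeroˡ _)) (vanishes-sound p h₂))
      (⊕-identityˡ (ι 0))

⊝≡0⇒≡ : ∀ {a b} → a ⊝ b ≡ ι 0 → a ≡ b
⊝≡0⇒≡ {a} {b} h = trans (sym (⊖-involutive a)) (trans (cong ⊖_ (sym (⊖-unique a (⊖ b) h))) (⊖-involutive b))

sameValue : Expr → Expr → Bool
sameValue a b = vanishes (normal (a :- b))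

sameValue-sound : ∀ ρ a b → Bool.T (sameValue a b) → ⟦ a ⟧ ρ ≡ ⟦ b ⟧ ρ
sameValue-sound ρ a b h = ⊝≡0⇒≡ (trans (sym (normal-sound ρ (a :- b))) (vanishes-sound ρ (normal (a :- b)) h))

Fun : Set → ℕ → Set
Fun A zero = A
Fun A (suc n) = Expr → Fun A n

applyVars : ∀ {A} n → ℕ → Fun A n → A
applyVars zero i f = f
applyVars (suc n) i f = applyVars n (suc i) (f (var i))

Forall : (n : ℕ) → (Env → Set) → Set
Forall zero P = P []
Forall (suc n) P = ∀ x → Forall n (λ ρ → P (x ∷ ρ))

forall-intro : (n : ℕ) {P : Env → Set} → (∀ ρ → P ρ) → Forall n P
forall-intro zero h = h []
forall-intro (suc n) h x = forall-intro n (λ ρ → h (x ∷ ρ))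

infix 4 _:=_

data Equation : Set where
  _:=_ : Expr → Expr → Equation

validEq : Equation → Bool
validEq (a := b) = sameValue a b

⟦_⟧eq : Equation → Env → Set
⟦ a := b ⟧eq ρ = ⟦ a ⟧ ρ ≡ ⟦ b ⟧ ρ

ring : ∀ n (f : Fun Equation n) → {Bool.T (validEq (applyVars n 0 f))} → Forall n ⟦ applyVars n 0 f ⟧eq
ring n f {h} = forall-intro n λ ρ → sound (applyVars n 0 f) h ρ
  where
  sound : ∀ e → Bool.T (validEq e) → ∀ ρ → ⟦ e ⟧eq ρ
  sound (a := b) h ρ = sameValue-sound ρ a b h

infix 4 _:≤_
infixr 5 _•_
infixr 3 _⊢_ _⨾_

-- A hypothesis k • p is p, used k times.
data Inequality : Set where
  _:≤_ : Expr → Expr → Inequality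
  _•_ : ℕ → Inequality → Inequality

data Sequent : Set where
  end : Inequality → Sequent
  _⨾_ : Inequality → Sequent → Sequent

_⊢_ : Inequality → Inequality → Sequent
p ⊢ q = p ⨾ end q

slack : Inequality → Expr
slack (a :≤ b) = b :- a
slack (k • p) = con k :* slack p

conclusion slacks : Sequent → Expr
conclusion (end p) = slack p
conclusion (p ⨾ s) = conclusion s
slacks (end p) = con 0
slacks (p ⨾ s) = slack p :+ slacks s

-- Only a polynomial identity is tested, so a hypothesis may state that a product of nonnegative
-- factors is nonnegative; this is how nonlinear inequalities are certified.
validSeq : Sequent → Bool
validSeq s = sameValue (conclusion s) (slacks s)

⟦_⟧≤ : Inequality → Env → Set
⟦ a :≤ b ⟧≤ ρ = ⟦ a ⟧ ρ ≼ ⟦ b ⟧ ρ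
⟦ _ • p ⟧≤ ρ = ⟦ p ⟧≤ ρ

-- As a conclusion, `k • p` yields only that k times the slack of p is nonnegative; `unscale` then
-- divides by k. As a hypothesis it asks for p alone.
⟦_⟧goal : Inequality → Env → Set
⟦ a :≤ b ⟧goal ρ = ⟦ a ⟧ ρ ≼ ⟦ b ⟧ ρ
⟦ k • p ⟧goal ρ = ι 0 ≼ ⟦ slack (k • p) ⟧ ρ

⟦_⟧seq : Sequent → Env → Set
⟦ end p ⟧seq ρ = ⟦ p ⟧goal ρ
⟦ p ⨾ s ⟧seq ρ = ⟦ p ⟧≤ ρ → ⟦ s ⟧seq ρ

≼-reflexive : ∀ {a b} → a ≡ b → a ≼ b
≼-reflexive refl = ≼-refl

a≼b⇒0≼b-a : ∀ {a b} → a ≼ b → ι 0 ≼ b ⊝ a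
a≼b⇒0≼b-a {a} {b} h = subst (_≼ b ⊝ a) (⊕-inverseʳ a) (⊕-mono h ≼-refl)

0≼b-a⇒a≼b : ∀ {a b} → ι 0 ≼ b ⊝ a → a ≼ b
0≼b-a⇒a≼b {a} {b} h = subst₂ _≼_ (⊕-identityˡ a)
  (trans (⊕-assoc b (⊖ a) a) (trans (cong (b ⊕_) (trans (⊕-comm (⊖ a) a) (⊕-inverseʳ a))) (⊕-identityʳ b)))
  (⊕-mono h (≼-refl {a}))

0≼⊕ : ∀ {a b} → ι 0 ≼ a → ι 0 ≼ b → ι 0 ≼ a ⊕ b
0≼⊕ {a} {b} p q = subst (_≼ a ⊕ b) (⊕-identityˡ (ι 0)) (⊕-mono p q)

0≼⊗ : ∀ {a b} → ι 0 ≼ a → ι 0 ≼ b → ι 0 ≼ a ⊗ b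
0≼⊗ {a} {b} p q = subst (_≼ a ⊗ b) (⊗-zeroʳ a) (⊗-monoʳ p q)

0≼ι : ∀ n → ι 0 ≼ ι n
0≼ι n = ι-mono z≤n

-- The conclusion holds because its slack is the sum of those of the hypotheses, as polynomials.
linear : ∀ n (f : Fun Sequent n) → {Bool.T (validSeq (applyVars n 0 f))} → Forall n ⟦ applyVars n 0 f ⟧seq
linear n f {h} = forall-intro n λ ρ → sound ρ (applyVars n 0 f) h
  where
  slack-nonneg : ∀ ρ p → ⟦ p ⟧≤ ρ → ι 0 ≼ ⟦ slack p ⟧ ρ
  slack-nonneg ρ (a :≤ b) q = a≼b⇒0≼b-a q
  slack-nonneg ρ (k • p) q = 0≼⊗ (0≼ι k) (slack-nonneg ρ p q)

  goal : ∀ ρ p → ι 0 ≼ ⟦ slack p ⟧ ρ → ⟦ p ⟧goal ρ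
  goal ρ (a :≤ b) q = 0≼b-a⇒a≼b q
  goal ρ (k • p) q = q

  collect : ∀ ρ s acc → ι 0 ≼ acc → (acc ⊕ ⟦ slacks s ⟧ ρ ≡ ⟦ conclusion s ⟧ ρ) → ⟦ s ⟧seq ρ
  collect ρ (end p) acc q e = goal ρ p (subst (ι 0 ≼_) (trans (sym (⊕-identityʳ acc)) e) q)
  collect ρ (p ⨾ s) acc q e r = collect ρ s (acc ⊕ ⟦ slack p ⟧ ρ) (0≼⊕ q (slack-nonneg ρ p r)) (trans (⊕-assoc _ _ _) e)

  sound : ∀ ρ s → Bool.T (validSeq s) → ⟦ s ⟧seq ρ
  sound ρ s h = collect ρ s (ι 0) ≼-refl
    (trans (⊕-identityˡ _) (sym (sameValue-sound ρ (conclusion s) (slacks s) h)))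

-- Finite sums

≼≡ : ∀ {a b c} → a ≼ b → b ≡ c → a ≼ c
≼≡ p refl = p

≡≼ : ∀ {a b c} → a ≡ b → b ≼ c → a ≼ c
≡≼ refl p = p

⊕-cong : ∀ {a b c d} → a ≡ b → c ≡ d → a ⊕ c ≡ b ⊕ d
⊕-cong = cong₂ _⊕_

⊗-cong : ∀ {a b c d} → a ≡ b → c ≡ d → a ⊗ c ≡ b ⊗ d
⊗-cong = cong₂ _⊗_

unscale : ∀ k {a b} → ι 0 ≼ ι (suc k) ⊗ (b ⊝ a) → a ≼ b
unscale k h = 0≼b-a⇒a≼b (⊗-cancelˡ (ι0≺ι1+ k) (≡≼ (⊗-zeroʳ _) h))

⊗-mono : ∀ {a b c d} → ι 0 ≼ b → ι 0 ≼ c → a ≼ b → c ≼ d → a ⊗ c ≼ b ⊗ d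
⊗-mono {a} {b} {c} {d} 0≼b 0≼c a≼b c≼d =
  ≼-trans (subst₂ _≼_ (⊗-comm c a) (⊗-comm c b) (⊗-monoʳ 0≼c a≼b)) (⊗-monoʳ 0≼b c≼d)

⊗-monoˡ : ∀ {a b c} → ι 0 ≼ c → a ≼ b → a ⊗ c ≼ b ⊗ c
⊗-monoˡ {a} {b} {c} 0≼c a≼b = subst₂ _≼_ (⊗-comm c a) (⊗-comm c b) (⊗-monoʳ 0≼c a≼b)

≼-total : ∀ a b → a ≼ b ⊎ b ≼ a
≼-total a b with ≼? a b
... | inj₁ p = inj₁ p
... | inj₂ q = inj₂ (≺⇒≼ q)

≺-≼-trans : ∀ {a b c} → a ≺ b → b ≼ c → a ≺ c
≺-≼-trans p q = ⋡⇒≺ λ r → ≺⇒⋡ p (≼-trans q r)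

≼-≺-trans : ∀ {a b c} → a ≼ b → b ≺ c → a ≺ c
≼-≺-trans p q = ⋡⇒≺ λ r → ≺⇒⋡ q (≼-trans r p)

0≼1 : ι 0 ≼ ι 1
0≼1 = 0≼ι 1

square-nonneg : ∀ a → ι 0 ≼ a ⊗ a
square-nonneg a with ≼-total (ι 0) a
... | inj₁ p = 0≼⊗ p p
... | inj₂ p = subst (ι 0 ≼_) (ring 1 (λ a → (con 0 :- a) :* (con 0 :- a) := a :* a) a) (0≼⊗ q q)
  where q = a≼b⇒0≼b-a p

infix 4 _within_

_within_ : F → F → Set
a within b = (⊖ b ≼ a) × (a ≼ b)

within-nonneg : ∀ {a b} → a within b → ι 0 ≼ b
within-nonneg (p , q) = unscale 1 (linear 2 (λ a b → :- b :≤ a ⨾ a :≤ b ⊢ 2 • (con 0 :≤ b)) _ _ p q)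

within-mono : ∀ {a b c} → a within b → b ≼ c → a within c
within-mono (p , q) r = linear 3 (λ a b c → :- b :≤ a ⨾ b :≤ c ⊢ :- c :≤ a) _ _ _ p r , ≼-trans q r

within-⊕ : ∀ {a b c d} → a within b → c within d → a ⊕ c within b ⊕ d
within-⊕ (p , q) (r , s) =
  linear 4 (λ a b c d → :- b :≤ a ⨾ :- d :≤ c ⊢ :- (b :+ d) :≤ a :+ c) _ _ _ _ p r , ⊕-mono q s

within-⊖ : ∀ {a b} → a within b → ⊖ a within b
within-⊖ (p , q) = linear 2 (λ a b → a :≤ b ⊢ :- b :≤ :- a) _ _ q , linear 2 (λ a b → :- b :≤ a ⊢ :- a :≤ b) _ _ p

-- The slacks are half sums of products: 2 (b d + a c) = (b - a)(d - c) + (b + a)(d + c), and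
-- likewise for b d - a c.
within-⊗ : ∀ {a b c d} → a within b → c within d → a ⊗ c within b ⊗ d
within-⊗ {a} {b} {c} {d} (p , q) (r , s) =
  unscale 1 (linear 4 (λ a b c d → con 0 :≤ (b :- a) :* (d :- c) ⨾ con 0 :≤ (a :- :- b) :* (c :- :- d) ⊢
    2 • (:- (b :* d) :≤ a :* c)) a b c d
    (0≼⊗ (a≼b⇒0≼b-a q) (a≼b⇒0≼b-a s)) (0≼⊗ (a≼b⇒0≼b-a p) (a≼b⇒0≼b-a r))) ,
  unscale 1 (linear 4 (λ a b c d → con 0 :≤ (b :- a) :* (c :- :- d) ⨾ con 0 :≤ (a :- :- b) :* (d :- c) ⊢ 2 • (a :* c :≤ b :* d)) a
    b c d
    (0≼⊗ (a≼b⇒0≼b-a q) (a≼b⇒0≼b-a r)) (0≼⊗ (a≼b⇒0≼b-a p) (a≼b⇒0≼b-a s)))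

nonneg-within : ∀ {a} → ι 0 ≼ a → a within a
nonneg-within {a} p = linear 1 (λ a → 2 • (con 0 :≤ a) ⊢ :- a :≤ a) a p , ≼-refl

S : ℕ → (ℕ → F) → F
S zero f = ι 0
S (suc n) f = S n f ⊕ f (suc n)

S-cong : ∀ n {f g} → (∀ i → 1 ≤ i → i ≤ n → f i ≡ g i) → S n f ≡ S n g
S-cong zero h = refl
S-cong (suc n) h = cong₂ _⊕_ (S-cong n λ i p q → h i p (ℕₚ.m≤n⇒m≤1+n q)) (h (suc n) (s≤s z≤n) ℕₚ.≤-refl)

S-mono : ∀ n {f g} → (∀ i → 1 ≤ i → i ≤ n → f i ≼ g i) → S n f ≼ S n g
S-mono zero h = ≼-refl
S-mono (suc n) h = ⊕-mono (S-mono n λ i p q → h i p (ℕₚ.m≤n⇒m≤1+n q)) (h (suc n) (s≤s z≤n) ℕₚ.≤-refl)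

S-within : ∀ n {f g} → (∀ i → 1 ≤ i → i ≤ n → f i within g i) → S n f within S n g
S-within zero h = ≼-reflexive (ring 0 (:- con 0 := con 0)) , ≼-refl
S-within (suc n) h = within-⊕ (S-within n λ i p q → h i p (ℕₚ.m≤n⇒m≤1+n q)) (h (suc n) (s≤s z≤n) ℕₚ.≤-refl)

S-zero : ∀ n {f} → (∀ i → 1 ≤ i → i ≤ n → f i ≡ ι 0) → S n f ≡ ι 0
S-zero zero h = refl
S-zero (suc n) h = trans (cong₂ _⊕_ (S-zero n λ i p q → h i p (ℕₚ.m≤n⇒m≤1+n q)) (h (suc n) (s≤s z≤n) ℕₚ.≤-refl)) (⊕-identityˡ _)

S-nonneg : ∀ n {f} → (∀ i → 1 ≤ i → i ≤ n → ι 0 ≼ f i) → ι 0 ≼ S n f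
S-nonneg n h = ≡≼ (sym (S-zero n {λ _ → ι 0} λ _ _ _ → refl)) (S-mono n h)

S-⊕ : ∀ n f g → S n (λ i → f i ⊕ g i) ≡ S n f ⊕ S n g
S-⊕ zero f g = sym (⊕-identityˡ _)
S-⊕ (suc n) f g = trans (⊕-cong (S-⊕ n f g) refl) (⊕-interchange _ _ _ _)

S-⊗ : ∀ n c f → S n (λ i → c ⊗ f i) ≡ c ⊗ S n f
S-⊗ zero c f = sym (⊗-zeroʳ c)
S-⊗ (suc n) c f = trans (⊕-cong (S-⊗ n c f) refl) (sym (⊗-distribˡ _ _ _))

S-⊝ : ∀ n f g → S n (λ i → f i ⊝ g i) ≡ S n f ⊝ S n g
S-⊝ zero f g = ring 0 (con 0 := con 0 :- con 0)
S-⊝ (suc n) f g = trans (⊕-cong (S-⊝ n f g) refl) (ring 4 (λ a b c d → (a :- b) :+ (c :- d) := (a :+ c) :- (b :+ d)) _ _ _ _)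

S-swap : ∀ m n (f : ℕ → ℕ → F) → S m (λ i → S n (f i)) ≡ S n (λ j → S m λ i → f i j)
S-swap zero n f = sym (S-zero n λ _ _ _ → refl)
S-swap (suc m) n f = trans (⊕-cong (S-swap m n f) refl) (sym (S-⊕ n _ _))

S-const : ∀ n c → S n (λ _ → c) ≡ ι n ⊗ c
S-const zero c = sym (⊗-zeroˡ c)
S-const (suc n) c = trans (cong (_⊕ c) (S-const n c))
  (trans (ring 2 (λ m c → m :* c :+ c := (con 1 :+ m) :* c) (ι n) c) (cong (_⊗ c) (sym (ι-+ 1 n))))

S-telescope : ∀ n (g : ℕ → F) → S n (λ i → g i ⊝ g (suc i)) ≡ g 1 ⊝ g (suc n)
S-telescope zero g = sym (⊕-inverseʳ (g 1))
S-telescope (suc n) g = trans (⊕-cong (S-telescope n g) refl) (ring 3 (λ a b c → (a :- b) :+ (b :- c) := a :- c) _ _ _)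

S-+ : ∀ m n f → S (m + n) f ≡ S m f ⊕ S n (λ i → f (m + i))
S-+ m zero f = trans (cong (λ k → S k f) (ℕₚ.+-identityʳ m)) (sym (⊕-identityʳ _))
S-+ m (suc n) f = trans (cong (λ k → S k f) (ℕₚ.+-suc m n)) (trans (cong₂ _⊕_ (S-+ m n f) (cong f (sym (ℕₚ.+-suc m n))))
  (⊕-assoc _ _ _))

S-extend : ∀ {m n f} → m ≤ n → (∀ i → m < i → i ≤ n → f i ≡ ι 0) → S n f ≡ S m f
S-extend {m} {n} {f} m≤n h = trans (cong (λ k → S k f) (sym (ℕₚ.m+[n∸m]≡n m≤n))) (trans (S-+ m (n ∸ m) f)
  (trans (cong (S m f ⊕_) (S-zero (n ∸ m) λ i p q →
    h (m + i) (ℕₚ.m<m+n m p) (subst (m + i ≤_) (ℕₚ.m+[n∸m]≡n m≤n) (ℕₚ.+-monoʳ-≤ m q)))) (⊕-identityʳ _)))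

S-mono-range : ∀ {m n f} → m ≤ n → (∀ i → m < i → i ≤ n → ι 0 ≼ f i) → S m f ≼ S n f
S-mono-range {m} {n} {f} m≤n h = subst₂ _≼_ (⊕-identityʳ _)
  (trans (sym (S-+ m (n ∸ m) f)) (cong (λ k → S k f) (ℕₚ.m+[n∸m]≡n m≤n)))
  (⊕-mono ≼-refl (S-nonneg (n ∸ m) λ i p q → h (m + i) (ℕₚ.m<m+n m p) (subst (m + i ≤_) (ℕₚ.m+[n∸m]≡n m≤n) (ℕₚ.+-monoʳ-≤ m q))))

S-single : ∀ n {f} c → 1 ≤ c → c ≤ n → (∀ i → 1 ≤ i → i ≤ n → i ≢ c → f i ≡ ι 0) → S n f ≡ f c
S-single n {f} (suc c) _ c≤n h = trans (S-extend c≤n λ i p q → h i (ℕₚ.≤-trans (s≤s z≤n) p) q λ { refl → ℕₚ.1+n≰n p })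
  (trans (cong (_⊕ f (suc c)) (S-zero c λ i p q → h i p (ℕₚ.≤-trans (ℕₚ.m≤n⇒m≤1+n q) c≤n) λ { refl → ℕₚ.1+n≰n q }))
    (⊕-identityˡ _))

S-term : ∀ n {f} c → 1 ≤ c → c ≤ n → (∀ i → 1 ≤ i → i ≤ n → ι 0 ≼ f i) → f c ≼ S n f
S-term n {f} (suc c) _ c≤n h = ≼-trans (≡≼ (sym (⊕-identityˡ _))
  (⊕-mono (S-nonneg c λ i p q → h i p (ℕₚ.≤-trans (ℕₚ.m≤n⇒m≤1+n q) c≤n)) ≼-refl))
  (S-mono-range c≤n λ i p q → h i (ℕₚ.≤-trans (s≤s z≤n) p) q)

ind : {P : Set} → Dec P → F
ind (yes _) = ι 1
ind (no _) = ι 0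

ind-yes : {P : Set} (d : Dec P) → P → ind d ≡ ι 1
ind-yes (yes _) p = refl
ind-yes (no ¬p) p = ⊥-elim (¬p p)

ind-no : {P : Set} (d : Dec P) → ¬ P → ind d ≡ ι 0
ind-no (yes p) ¬p = ⊥-elim (¬p p)
ind-no (no _) ¬p = refl

ind-⇔ : {P Q : Set} (d : Dec P) (e : Dec Q) → (P → Q) → (Q → P) → ind d ≡ ind e
ind-⇔ (yes p) e f g = sym (ind-yes e (f p))
ind-⇔ (no ¬p) e f g = sym (ind-no e λ q → ¬p (g q))

ind-nonneg : {P : Set} (d : Dec P) → ι 0 ≼ ind d
ind-nonneg (yes _) = 0≼1
ind-nonneg (no _) = ≼-refl

ind≼1 : {P : Set} (d : Dec P) → ind d ≼ ι 1
ind≼1 (yes _) = ≼-refl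
ind≼1 (no _) = 0≼1

ind-cong : {P : Set} (d : Dec P) {a b : F} → (P → a ≡ b) → ind d ⊗ a ≡ ind d ⊗ b
ind-cong (yes p) h = cong (ι 1 ⊗_) (h p)
ind-cong (no _) {a} {b} h = trans (⊗-zeroˡ a) (sym (⊗-zeroˡ b))

ind-mono : {P : Set} (d : Dec P) {a b : F} → (P → a ≼ b) → ind d ⊗ a ≼ ind d ⊗ b
ind-mono (yes p) h = ⊗-monoʳ 0≼1 (h p)
ind-mono (no _) {a} {b} h = ≼-reflexive (trans (⊗-zeroˡ a) (sym (⊗-zeroˡ b)))

ind-zero : {P : Set} (d : Dec P) {a : F} → ¬ P → ind d ⊗ a ≡ ι 0
ind-zero d {a} ¬p = trans (cong (_⊗ a) (ind-no d ¬p)) (⊗-zeroˡ a)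

ind-one : {P : Set} (d : Dec P) {a : F} → P → ind d ⊗ a ≡ a
ind-one d {a} p = trans (cong (_⊗ a) (ind-yes d p)) (⊗-identityˡ a)

S-delta : ∀ n (f : ℕ → F) c → 1 ≤ c → (n < c → f c ≡ ι 0) → S n (λ i → ind (i ≟ c) ⊗ f i) ≡ f c
S-delta n f c 1≤c h with c ≤? n
... | yes c≤n = trans (S-single n c 1≤c c≤n λ i _ _ i≢c → ind-zero (i ≟ c) i≢c) (ind-one (c ≟ c) refl)
... | no c≰n = trans (S-zero n λ i _ i≤n → ind-zero (i ≟ c) λ { refl → c≰n i≤n }) (sym (h (ℕₚ.≰⇒> c≰n)))

-- Counting the representations n = φ m turns a sum over m into one over n.
S-reindex : ∀ X Y (φ : ℕ → ℕ) (f : ℕ → F) → (∀ m → 1 ≤ m → m ≤ Y → 1 ≤ φ m) → (∀ m → 1 ≤ m → m ≤ Y → X < φ m → f (φ m) ≡ ι 0) →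
  S Y (λ m → f (φ m)) ≡ S X (λ n → f n ⊗ S Y (λ m → ind (n ≟ φ m)))
S-reindex X Y φ f pos van = begin
  S Y (λ m → f (φ m)) ≡⟨ S-cong Y (λ m p q → sym (S-delta X f (φ m) (pos m p q) (van m p q))) ⟩
  S Y (λ m → S X (λ n → ind (n ≟ φ m) ⊗ f n)) ≡⟨ S-swap Y X _ ⟩
  S X (λ n → S Y (λ m → ind (n ≟ φ m) ⊗ f n)) ≡⟨ S-cong X (λ n _ _ → trans (S-cong Y λ m _ _ → ⊗-comm _ _) (S-⊗ Y (f n) _)) ⟩
  S X (λ n → f n ⊗ S Y (λ m → ind (n ≟ φ m))) ∎ where open ≡-Reasoning

S-count-multiples : ∀ X d n → 1 ≤ d → 1 ≤ n → n ≤ X → S X (λ m → ind (n ≟ d * m)) ≡ ind (d ∣? n)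
S-count-multiples X d n 1≤d 1≤n n≤X with d ∣? n
... | no d∤n = S-zero X λ m _ _ → ind-no (n ≟ d * m) λ e → d∤n (divides m (trans e (ℕₚ.*-comm d m)))
... | yes (divides zero refl) = ⊥-elim (ℕₚ.1+n≰n 1≤n)
... | yes (divides q@(suc _) refl) = trans (S-single X q (s≤s z≤n)
  (ℕₚ.≤-trans (subst (_≤ q * d) (ℕₚ.*-identityʳ q) (ℕₚ.*-monoʳ-≤ q 1≤d)) n≤X)
     λ i _ _ i≢q → ind-no (q * d ≟ d * i) λ e → i≢q (ℕₚ.*-cancelˡ-≡ i q d {{>-nonZero 1≤d}} (trans (sym e) (ℕₚ.*-comm q d))))
     (ind-yes (q * d ≟ d * q) (ℕₚ.*-comm q d))

-- For a function supported up to X, m may run up to X instead of X / d; with all ranges equal,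
-- double sums can be swapped freely.
S-multiples : ∀ X d (f : ℕ → F) → 1 ≤ d → (∀ n → X < n → f n ≡ ι 0) →
  S X (λ m → f (d * m)) ≡ S X (λ n → ind (d ∣? n) ⊗ f n)
S-multiples X d f 1≤d van = trans (S-reindex X X (d *_) f (λ m p _ → ℕₚ.*-mono-≤ 1≤d p) λ m _ _ → van (d * m))
  (S-cong X λ n p q → trans (cong (f n ⊗_) (S-count-multiples X d n 1≤d p q)) (⊗-comm _ _))

-- Möbius inversion

prime-divisor : ∀ k → 2 ≤ k → Σ ℕ λ p → Prime p × p ∣ k
prime-divisor k@(suc _) 2≤k with factorise k
... | record { factors = [] ; isFactorisation = e } = ⊥-elim (ℕₚ.<⇒≢ 2≤k (sym e))
... | record { factors = p ∷ ps ; isFactorisation = e ; factorsPrime = pr ∷ _ } = p , pr , subst (p ∣_) (sym e) (m∣m*n _)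

prime>1 : ∀ {p} → Prime p → 2 ≤ p
prime>1 {p} pr = nonTrivial⇒n>1 p {{prime⇒nonTrivial pr}}

prime≥1 : ∀ {p} → Prime p → 1 ≤ p
prime≥1 pr = ℕₚ.≤-trans (s≤s z≤n) (prime>1 pr)

prime∣prime : ∀ {p q} → Prime p → Prime q → p ∣ q → p ≡ q
prime∣prime pp pq h with prime⇒irreducible pq h
... | inj₁ refl = ⊥-elim (¬prime[1] pp)
... | inj₂ e = e

prime∣*⇒ : ∀ {p q m} → Prime p → Prime q → p ≢ q → p ∣ q * m → p ∣ m
prime∣*⇒ {p} {q} {m} pp pq p≢q h with euclidsLemma q m pp h
... | inj₁ p∣q = ⊥-elim (p≢q (prime∣prime pp pq p∣q))
... | inj₂ p∣m = p∣m

-- μ y is the Möbius function restricted to y-smooth numbers, and ρ y is the indicator of y-rough numbers.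
μ ρ : ℕ → ℕ → F
μ zero d = ind (d ≟ 1)
μ (suc y) d = μ y d ⊝ ind (prime? (suc y)) ⊗ (ind (suc y ∣? d) ⊗ μ y (d / suc y))
ρ zero k = ι 1
ρ (suc y) k = ρ y k ⊝ ind (prime? (suc y)) ⊗ (ind (suc y ∣? k) ⊗ ρ y k)

private
  no-term : ∀ {a b} → b ≡ ι 0 → a ⊝ b ≡ a
  no-term {a} e = trans (cong (λ b → a ⊝ b) e) (ring 1 (λ a → a :- con 0 := a) a)

  split-prime : ∀ y (d : Dec (Prime (suc y))) a b → (Prime (suc y) → ι 0 ≡ b) → a ⊝ ind d ⊗ b ≡ a
  split-prime y (yes p) a b h = no-term (trans (⊗-identityˡ b) (sym (h p)))
  split-prime y (no _) a b h = no-term (⊗-zeroˡ b)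

μ-vanishes : ∀ y q d → Prime q → y < q → q ∣ d → μ y d ≡ ι 0
μ-vanishes zero q d pq _ q∣d = ind-no (d ≟ 1) λ { refl → ¬prime[1] (subst Prime (∣1⇒≡1 q∣d) pq) }
μ-vanishes (suc y) q d pq y<q q∣d with μ-vanishes y q d pq (ℕₚ.<-trans ℕₚ.≤-refl y<q) q∣d
... | e = trans (split-prime y (prime? (suc y)) _ _ vanish) e
  where
  vanish : Prime (suc y) → ι 0 ≡ ind (suc y ∣? d) ⊗ μ y (d / suc y)
  vanish pp with suc y ∣? d
  ... | no _ = sym (⊗-zeroˡ _)
  ... | yes p∣d = sym (trans (⊗-identityˡ _) (μ-vanishes y q (d / suc y) pq (ℕₚ.<-trans ℕₚ.≤-refl y<q)
      (prime∣*⇒ {m = d / suc y} pq pp (λ e → ℕₚ.<⇒≢ y<q (sym e))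
        (subst (q ∣_) (trans (sym (m/n*n≡m p∣d)) (ℕₚ.*-comm (d / suc y) (suc y))) q∣d))))

-- When the new prime divides d, `μ y d` is 0 by `μ-vanishes`, so the recursion never keeps more
-- than one of its two terms.
μ-within-1 : ∀ y d → μ y d within ι 1
μ-within-1 zero d = within-mono (nonneg-within (ind-nonneg (d ≟ 1))) (ind≼1 (d ≟ 1))
μ-within-1 (suc y) d with prime? (suc y)
... | no _ = subst (_within ι 1) (sym (no-term (⊗-zeroˡ _))) (μ-within-1 y d)
... | yes pp with suc y ∣? d
... | no _ = subst (_within ι 1) (sym (no-term (trans (⊗-identityˡ _) (⊗-zeroˡ _)))) (μ-within-1 y d)
... | yes p∣d = subst (_within ι 1) (sym (trans (cong₂ _⊝_ (μ-vanishes y (suc y) d pp ℕₚ.≤-refl p∣d) refl)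
    (ring 1 (λ a → con 0 :- con 1 :* (con 1 :* a) := :- a) _))) (within-⊖ (μ-within-1 y (d / suc y)))

ρ-multiple : ∀ y q k → Prime q → y < q → ρ y (q * k) ≡ ρ y k
ρ-multiple zero q k pq _ = refl
ρ-multiple (suc y) q k pq y<q with ρ-multiple y q k pq (ℕₚ.<-trans ℕₚ.≤-refl y<q)
... | e with prime? (suc y)
... | no _ = trans (no-term (⊗-zeroˡ _)) (trans e (sym (no-term (⊗-zeroˡ _))))
... | yes pp = cong₂ _⊝_ e (cong (ι 1 ⊗_) (⊗-cong
    (ind-⇔ (suc y ∣? q * k) (suc y ∣? k) (prime∣*⇒ pp pq (ℕₚ.<⇒≢ y<q)) (∣n⇒∣m*n q)) e))

ρ-vanishes : ∀ y q k → Prime q → q ≤ y → q ∣ k → ρ y k ≡ ι 0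
ρ-vanishes zero q k pq q≤0 _ = ⊥-elim (ℕₚ.1+n≰n (ℕₚ.≤-trans (prime≥1 pq) q≤0))
ρ-vanishes (suc y) q k pq q≤y q∣k with q ≟ suc y
... | yes refl = trans (cong (λ c → ρ y k ⊝ c) (trans (ind-one (prime? q) pq) (ind-one (q ∣? k) q∣k))) (⊕-inverseʳ _)
... | no q≢ = trans (cong (λ c → c ⊝ ind (prime? (suc y)) ⊗ (ind (suc y ∣? k) ⊗ c))
  (ρ-vanishes y q k pq (ℕₚ.≤-pred (ℕₚ.≤∧≢⇒< q≤y q≢)) q∣k))
   (ring 2 (λ a b → con 0 :- a :* (b :* con 0) := con 0) _ _)

ρ-one : ∀ y → ρ y 1 ≡ ι 1
ρ-one zero = refl
ρ-one (suc y) = trans (split-prime y (prime? (suc y)) _ _ λ pp → sym (trans (cong (_⊗ ρ y 1)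
  (ind-no (suc y ∣? 1) λ h → ¬prime[1] (subst Prime (∣1⇒≡1 h) pp))) (⊗-zeroˡ _))) (ρ-one y)

module _ (X : ℕ) (1≤X : 1 ≤ X) (h : ℕ → F) (vanish : ∀ n → X < n → h n ≡ ι 0) where
  dilates : ℕ → F
  dilates n = S X λ k → h (n * k)

  private
    big : ∀ m n → X < m → 1 ≤ n → X < n * m
    big m n@(suc _) X<m _ = ℕₚ.≤-trans X<m (ℕₚ.m≤n*m m n)

    big′ : ∀ m n → X < m → 1 ≤ n → X < m * n
    big′ m n X<m p = subst (X <_) (ℕₚ.*-comm n m) (big m n X<m p)

    S-prime-step : ∀ y (f g : ℕ → F) → (∀ d → X < d → g d ≡ ι 0) → Prime (suc y) →
      S X (λ d → f d ⊝ ind (prime? (suc y)) ⊗ (ind (suc y ∣? d) ⊗ g d)) ≡ S X f ⊝ S X (λ m → g (suc y * m))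
    S-prime-step y f g van pp = trans (S-⊝ X f _) (cong (λ b → S X f ⊝ b)
      (trans (S-cong X λ d _ _ → ind-one (prime? (suc y)) pp) (sym (S-multiples X (suc y) g (s≤s z≤n) van))))

  -- Legendre's sieve, by induction on y for all n at once: if suc y is a prime p, each side loses
  -- its own value at n p in place of n.
  sieve : ∀ y n → 1 ≤ n → S X (λ d → μ y d ⊗ dilates (n * d)) ≡ S X (λ k → ρ y k ⊗ h (n * k))
  sieve zero n _ = trans (S-delta X (λ d → dilates (n * d)) 1 ℕₚ.≤-refl λ q → ⊥-elim (ℕₚ.<⇒≱ q 1≤X))
    (S-cong X λ k _ _ → trans (cong (λ m → h (m * k)) (ℕₚ.*-identityʳ n)) (sym (⊗-identityˡ _)))
  sieve (suc y) n 1≤n = trans (S-cong X λ d _ _ → distr (μ y d) _ _ _ (dilates (n * d)))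
    (trans (step (prime? (suc y))) (sym (S-cong X λ k _ _ → distr (ρ y k) _ _ _ (h (n * k)))))
    where
    distr : ∀ a i j b z → (a ⊝ i ⊗ (j ⊗ b)) ⊗ z ≡ a ⊗ z ⊝ i ⊗ (j ⊗ (b ⊗ z))
    distr a i j b z = ring 5 (λ a i j b z → (a :- i :* (j :* b)) :* z := a :* z :- i :* (j :* (b :* z))) a i j b z

    step : Dec (Prime (suc y)) →
      S X (λ d → μ y d ⊗ dilates (n * d) ⊝ ind (prime? (suc y)) ⊗ (ind (suc y ∣? d) ⊗ (μ y (d / suc y) ⊗ dilates (n * d))))
      ≡ S X (λ k → ρ y k ⊗ h (n * k) ⊝ ind (prime? (suc y)) ⊗ (ind (suc y ∣? k) ⊗ (ρ y k ⊗ h (n * k))))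
    step (no ¬p) = trans (S-cong X λ d _ _ → no-term (ind-zero (prime? (suc y)) ¬p))
      (trans (sieve y n 1≤n) (sym (S-cong X λ k _ _ → no-term (ind-zero (prime? (suc y)) ¬p))))
    step (yes pp) = begin
      _ ≡⟨ S-prime-step y (λ d → μ y d ⊗ dilates (n * d)) (λ d → μ y (d / suc y) ⊗ dilates (n * d))
             (λ d X<d → trans (cong (_ ⊗_) (S-zero X λ k p _ → vanish (n * d * k) (big′ (n * d) k (big d n X<d 1≤n) p)))
               (⊗-zeroʳ _)) pp ⟩
      S X (λ d → μ y d ⊗ dilates (n * d)) ⊝ S X (λ m → μ y (suc y * m / suc y) ⊗ dilates (n * (suc y * m)))
        ≡⟨ cong₂ _⊝_ (sieve y n 1≤n) (trans (S-cong X λ m _ _ → ⊗-cong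
             (cong (μ y) (trans (cong (_/ suc y) (ℕₚ.*-comm (suc y) m)) (m*n/n≡m m (suc y))))
               (cong dilates (sym (ℕₚ.*-assoc n (suc y) m))))
             (sieve y (n * suc y) (ℕₚ.*-mono-≤ 1≤n (s≤s z≤n)))) ⟩
      S X (λ k → ρ y k ⊗ h (n * k)) ⊝ S X (λ m → ρ y m ⊗ h (n * suc y * m))
        ≡⟨ cong₂ _⊝_ refl (S-cong X λ m _ _ → ⊗-cong (sym (ρ-multiple y (suc y) m pp ℕₚ.≤-refl))
          (cong h (ℕₚ.*-assoc n (suc y) m))) ⟩
      S X (λ k → ρ y k ⊗ h (n * k)) ⊝ S X (λ m → ρ y (suc y * m) ⊗ h (n * (suc y * m)))
        ≡⟨ sym (S-prime-step y (λ k → ρ y k ⊗ h (n * k)) (λ k → ρ y k ⊗ h (n * k))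
             (λ d X<d → trans (cong (_ ⊗_) (vanish (n * d) (big d n X<d 1≤n))) (⊗-zeroʳ _)) pp) ⟩
      _ ∎ where open ≡-Reasoning

  -- At y = X the only rough k up to X is 1, and the Möbius function is at most 1 in absolute value.
  möbius-bound : (b : ℕ → F) → (∀ d → 1 ≤ d → d ≤ X → dilates d within b d) → h 1 within S X b
  möbius-bound b bound = subst (_within S X b) (trans (sieve X 1 ℕₚ.≤-refl) last)
    (subst (S X (λ d → μ X d ⊗ dilates (1 * d)) within_) (S-cong X λ d _ _ → ⊗-identityˡ (b d))
      (S-within X λ d p q → within-⊗ (μ-within-1 X d) (subst (λ n → dilates n within b d) (sym (ℕₚ.*-identityˡ d))
        (bound d p q))))
    where
    last : S X (λ k → ρ X k ⊗ h (1 * k)) ≡ h 1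
    last = trans (S-single X 1 ℕₚ.≤-refl 1≤X λ k p q k≢1 → rough k p q k≢1) (trans (cong (_⊗ h 1) (ρ-one X)) (⊗-identityˡ _))
      where
      rough : ∀ k → 1 ≤ k → k ≤ X → k ≢ 1 → ρ X k ⊗ h (1 * k) ≡ ι 0
      rough k p q k≢1 with prime-divisor k (ℕₚ.≤∧≢⇒< p (k≢1 ∘ sym))

      ... | r , pr , r∣k = trans (cong (_⊗ _) (ρ-vanishes X r k pr (ℕₚ.≤-trans (∣⇒≤ {{>-nonZero p}} r∣k) q) r∣k)) (⊗-zeroˡ _)

-- An approximate logarithm

ι-inv : ∀ n → 1 ≤ n → ι n ⊗ inv n ≡ ι 1
ι-inv n p = trans (⊗-comm _ _) (inv-ι n p)

inv-unique : ∀ n a → 1 ≤ n → ι n ⊗ a ≡ ι 1 → a ≡ inv n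
inv-unique n a p h = begin
  a ≡⟨ sym (⊗-identityˡ a) ⟩
  ι 1 ⊗ a ≡⟨ ⊗-cong (sym (inv-ι n p)) refl ⟩
  (inv n ⊗ ι n) ⊗ a ≡⟨ ⊗-assoc _ _ _ ⟩
  inv n ⊗ (ι n ⊗ a) ≡⟨ ⊗-cong refl h ⟩
  inv n ⊗ ι 1 ≡⟨ ⊗-identityʳ _ ⟩
  inv n ∎ where open ≡-Reasoning

inv-* : ∀ m n → 1 ≤ m → 1 ≤ n → inv (m * n) ≡ inv m ⊗ inv n
inv-* m n p q = sym (inv-unique (m * n) _ (ℕₚ.*-mono-≤ p q) (trans (⊗-cong (ι-* m n) refl)
  (trans (⊗-interchange _ _ _ _) (trans (⊗-cong (ι-inv m p) (ι-inv n q)) (⊗-identityˡ _)))))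

inv-1 : inv 1 ≡ ι 1
inv-1 = sym (inv-unique 1 (ι 1) ℕₚ.≤-refl (⊗-identityˡ _))

inv-antitone : ∀ {m n} → 1 ≤ m → m ≤ n → inv n ≼ inv m
inv-antitone {m} {n} 1≤m m≤n = subst₂ _≼_ cancelˡ cancelʳ (⊗-monoʳ (0≼⊗ (inv-nonneg m) (inv-nonneg n)) (ι-mono m≤n))
  where
  cancelˡ : inv m ⊗ inv n ⊗ ι m ≡ inv n
  cancelˡ = trans (ring 3 (λ a b c → a :* b :* c := c :* a :* b) _ _ _) (trans (⊗-cong (ι-inv m 1≤m) refl) (⊗-identityˡ _))

  cancelʳ : inv m ⊗ inv n ⊗ ι n ≡ inv m
  cancelʳ = trans (⊗-assoc _ _ _) (trans (⊗-cong refl (inv-ι n (ℕₚ.≤-trans 1≤m m≤n))) (⊗-identityʳ _))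

inv≼1 : ∀ n → inv n ≼ ι 1
inv≼1 zero = ≼-trans (≼-reflexive inv0) 0≼1
  where
  opaque
    unfolding F
    inv0 : inv 0 ≡ ι 0
    inv0 = refl
inv≼1 (suc n) = ≼≡ (inv-antitone {1} (s≤s z≤n) (s≤s z≤n)) inv-1

block : ℕ → ℕ → F
block m a = S m (λ r → inv (m * a + r))

block-upper : ∀ m a → 1 ≤ m → 1 ≤ a → block m a ≼ inv a
block-upper m a 1≤m 1≤a = ≼≡ (S-mono m λ r _ _ → inv-antitone {m * a} (ℕₚ.*-mono-≤ 1≤m 1≤a) (ℕₚ.m≤m+n _ r))
  (trans (S-const m _) (trans (⊗-cong refl (inv-* m a 1≤m 1≤a))
    (trans (sym (⊗-assoc _ _ _)) (trans (⊗-cong (ι-inv m 1≤m) refl) (⊗-identityˡ _)))))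

block-lower : ∀ m a → 1 ≤ m → inv (suc a) ≼ block m a
block-lower m a 1≤m = ≡≼ (sym (trans (S-const m _) (trans (⊗-cong refl (inv-* m (suc a) 1≤m (s≤s z≤n)))
  (trans (sym (⊗-assoc _ _ _)) (trans (⊗-cong (ι-inv m 1≤m) refl) (⊗-identityˡ _))))))
  (S-mono m λ r p r≤m → inv-antitone {m * a + r} (ℕₚ.≤-trans p (ℕₚ.m≤n+m r (m * a)))
    (subst (m * a + r ≤_) (trans (ℕₚ.+-comm (m * a) m) (sym (ℕₚ.*-suc m a))) (ℕₚ.+-monoʳ-≤ (m * a) r≤m)))

harmonic : ℕ → F
harmonic n = S n inv

harmonic-step : ∀ m a → harmonic (m * suc a) ≡ harmonic (m * a) ⊕ block m a
harmonic-step m a = trans (cong harmonic (trans (ℕₚ.*-suc m a) (ℕₚ.+-comm m (m * a)))) (S-+ (m * a) m inv)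

-- The sum of 1/i over K < i ≤ K n tends to log n as K grows, and is additive in n up to 1/K.
module _ (K : ℕ) (1≤K : 1 ≤ K) where
  E : ℕ → F
  E n = harmonic (K * n) ⊝ harmonic K

  E-step : ∀ n → E (suc n) ⊝ E n ≡ block K n
  E-step n = trans (cong (λ h → (h ⊝ harmonic K) ⊝ E n) (harmonic-step K n))
    (ring 3 (λ a b c → ((a :+ b) :- c) :- (a :- c) := b) _ _ _)

  E-1 : E 1 ≡ ι 0
  E-1 = trans (cong (λ k → harmonic k ⊝ harmonic K) (ℕₚ.*-identityʳ K)) (⊕-inverseʳ _)

  private
    -- For fixed m this increases in j, and beyond j by at most 1 / j in all; by `E-*` the defect of
    -- additivity of E is its increase from K to K n.
    D : ℕ → ℕ → F
    D m j = harmonic (m * j) ⊝ harmonic j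

    D-step : ∀ m j → D m (suc j) ⊝ D m j ≡ block m j ⊝ inv (suc j)
    D-step m j = trans (cong (λ h → (h ⊝ harmonic (suc j)) ⊝ D m j) (harmonic-step m j))
      (ring 4 (λ a b c d → ((a :+ b) :- (c :+ d)) :- (a :- c) := b :- d) _ _ _ _)

    D-lower : ∀ m j i → 1 ≤ m → D m j ≼ D m (j + i)
    D-lower m j zero p = ≼-reflexive (cong (D m) (sym (ℕₚ.+-identityʳ j)))
    D-lower m j (suc i) p = ≼-trans (D-lower m j i p) (≼≡ (linear 4 (λ a b c d → d :≤ c ⨾ c :- d :≤ b :- a ⊢ a :≤ b) _ _ _ _
      (block-lower m (j + i) p) (≼-reflexive (sym (D-step m (j + i))))) (cong (D m) (sym (ℕₚ.+-suc j i))))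

    D-upper : ∀ m j i → 1 ≤ m → 1 ≤ j → D m (j + i) ≼ D m j ⊕ inv j ⊝ inv (j + i)
    D-upper m j zero p q = ≼-reflexive (trans (cong (D m) (ℕₚ.+-identityʳ j))
      (trans (ring 2 (λ a b → a := a :+ b :- b) (D m j) (inv j)) (cong (λ k → D m j ⊕ inv j ⊝ inv k) (sym (ℕₚ.+-identityʳ j)))))
    D-upper m j (suc i) p q = subst (λ k → D m k ≼ D m j ⊕ inv j ⊝ inv k) (sym (ℕₚ.+-suc j i))
      (linear 7 (λ a b c d e f g → a :≤ f :+ g :- e ⨾ b :- a :≤ c :- d ⨾ c :≤ e ⊢ b :≤ f :+ g :- d) _ _ _ _ _ _ _
        (D-upper m j i p q) (≼-reflexive (D-step m (j + i))) (block-upper m (j + i) p (ℕₚ.≤-trans q (ℕₚ.m≤m+n j i))))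

    E-* : ∀ m n → E (m * n) ⊝ E m ⊝ E n ≡ D m (K * n) ⊝ D m K
    E-* m n = trans (cong₂ (λ k l → (harmonic k ⊝ harmonic K) ⊝ (harmonic l ⊝ harmonic K) ⊝ E n)
        (trans (sym (ℕₚ.*-assoc K m n)) (trans (cong (_* n) (ℕₚ.*-comm K m)) (ℕₚ.*-assoc m K n))) (ℕₚ.*-comm K m))
      (ring 4 (λ a b c d → (a :- b) :- (c :- b) :- (d :- b) := (a :- d) :- (c :- b)) _ _ _ _)

    K≤Kn : ∀ n → 1 ≤ n → K + (K * n ∸ K) ≡ K * n
    K≤Kn n@(suc _) _ = ℕₚ.m+[n∸m]≡n (ℕₚ.m≤m*n K n)

  E-superadditive : ∀ m n → 1 ≤ m → 1 ≤ n → E m ⊕ E n ≼ E (m * n)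
  E-superadditive m n p q = linear 5 (λ a b c d e → d :≤ e ⨾ e :- d :≤ c :- a :- b ⊢ a :+ b :≤ c) _ _ _ _ _
    (≼≡ (D-lower m K (K * n ∸ K) p) (cong (D m) (K≤Kn n q))) (≼-reflexive (sym (E-* m n)))

  E-subadditive : ∀ m n → 1 ≤ m → 1 ≤ n → E (m * n) ≼ E m ⊕ E n ⊕ inv K
  E-subadditive m n p q = linear 7 (λ a b c d e f g → e :≤ d :+ f :- g ⨾ con 0 :≤ g ⨾ c :- a :- b :≤ e :- d ⊢ c :≤ a :+ b :+ f) _
    _ _ _ _ _ _
    (subst (λ k → D m k ≼ D m K ⊕ inv K ⊝ inv k) (K≤Kn n q) (D-upper m K (K * n ∸ K) p 1≤K)) (inv-nonneg (K * n))
      (≼-reflexive (E-* m n))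

  sumE : List ℕ → F
  sumE [] = ι 0
  sumE (q ∷ qs) = E q ⊕ sumE qs

  sumE-↭ : ∀ {ps qs} → ps ↭ qs → sumE ps ≡ sumE qs
  sumE-↭ Perm.refl = refl
  sumE-↭ (Perm.prep x r) = cong (E x ⊕_) (sumE-↭ r)
  sumE-↭ (Perm.swap x y r) = trans (cong (λ s → E x ⊕ (E y ⊕ s)) (sumE-↭ r)) (ring 3 (λ a b c → a :+ (b :+ c) := b :+ (a :+ c)) _
    _ _)
  sumE-↭ (Perm.trans r s) = trans (sumE-↭ r) (sumE-↭ s)

  sumE-++ : ∀ ps qs → sumE (ps ++ qs) ≡ sumE ps ⊕ sumE qs
  sumE-++ [] qs = sym (⊕-identityˡ _)
  sumE-++ (p ∷ ps) qs = trans (cong (E p ⊕_) (sumE-++ ps qs)) (sym (⊕-assoc _ _ _))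

  product≥1 : ∀ {ps} → All Prime ps → 1 ≤ product ps
  product≥1 [] = ℕₚ.≤-refl
  product≥1 (p ∷ ps) = ℕₚ.*-mono-≤ (prime≥1 p) (product≥1 ps)

  sumE-upper : ∀ {ps} → All Prime ps → sumE ps ≼ E (product ps)
  sumE-upper [] = ≼-reflexive (sym E-1)
  sumE-upper {p ∷ ps} (pr ∷ prs) = ≼-trans (⊕-mono ≼-refl (sumE-upper prs))
    (E-superadditive p (product ps) (prime≥1 pr) (product≥1 prs))

  sumE-lower : ∀ {ps} → All Prime ps → E (product ps) ≼ sumE ps ⊕ ι (length ps) ⊗ inv K
  sumE-lower [] = ≼-reflexive (trans E-1 (ring 1 (λ k → con 0 := con 0 :+ con 0 :* k) (inv K)))
  sumE-lower {p ∷ ps} (pr ∷ prs) = ≼-trans (E-subadditive p (product ps) (prime≥1 pr) (product≥1 prs))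
    (≼≡ (⊕-mono (⊕-mono ≼-refl (sumE-lower prs)) ≼-refl)
      (trans (ring 4 (λ a b c k → a :+ (b :+ c :* k) :+ k := a :+ b :+ (con 1 :+ c) :* k) _ _ _ _)
        (⊕-cong refl (⊗-cong (sym (ι-+ 1 (length ps))) refl))))

  length≤product : ∀ {ps} → All Prime ps → length ps ≤ product ps
  length≤product [] = z≤n
  length≤product {p ∷ ps} (pr ∷ prs) = ℕₚ.≤-trans (ℕₚ.+-mono-≤ (product≥1 prs) (length≤product prs))
    (subst (_≤ p * product ps) (cong (product ps +_) (ℕₚ.+-identityʳ _)) (ℕₚ.*-monoˡ-≤ (product ps) (prime>1 pr)))

  -- Adding up E over the prime factors makes additivity exact. Each factor loses at most 1 / K
  -- against E n, and there are at most n factors.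
  log : ℕ → F
  log zero = ι 0
  log n@(suc _) = sumE (PrimeFactorisation.factors (factorise n))

  private
    log-factors : ∀ n → 1 ≤ n → (f : PrimeFactorisation n) → log n ≡ sumE (PrimeFactorisation.factors f)
    log-factors n@(suc _) _ f = sumE-↭ (factorisationUnique (factorise n) f)

    factorisation : ∀ n → 1 ≤ n → PrimeFactorisation n
    factorisation n@(suc _) _ = factorise n

  log-* : ∀ m n → 1 ≤ m → 1 ≤ n → log (m * n) ≡ log m ⊕ log n
  log-* m n p q = trans (log-factors (m * n) (ℕₚ.*-mono-≤ p q) (record
      { factors = fs ++ gs
      ; isFactorisation = trans (cong₂ _*_ (PrimeFactorisation.isFactorisation f) (PrimeFactorisation.isFactorisation g))
        (sym (product-++ fs gs))
      ; factorsPrime = ++⁺ (PrimeFactorisation.factorsPrime f) (PrimeFactorisation.factorsPrime g) }))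
    (trans (sumE-++ fs gs) (sym (cong₂ _⊕_ (log-factors m p f) (log-factors n q g))))
    where
    f = factorisation m p
    g = factorisation n q
    fs = PrimeFactorisation.factors f
    gs = PrimeFactorisation.factors g

  log-upper : ∀ n → 1 ≤ n → log n ≼ E n
  log-upper n p = subst₂ _≼_ (sym (log-factors n p f)) (cong E (sym (PrimeFactorisation.isFactorisation f)))
    (sumE-upper (PrimeFactorisation.factorsPrime f))
    where f = factorisation n p

  log-lower : ∀ n → 1 ≤ n → E n ≼ log n ⊕ ι n ⊗ inv K
  log-lower n p = ≼-trans (subst₂ (λ m l → E m ≼ l ⊕ ι (length (PrimeFactorisation.factors f)) ⊗ inv K)
    (sym (PrimeFactorisation.isFactorisation f)) (sym (log-factors n p f)) (sumE-lower (PrimeFactorisation.factorsPrime f)))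
    (⊕-mono ≼-refl (⊗-monoˡ (inv-nonneg K) (ι-mono (subst (length (PrimeFactorisation.factors f) ≤_)
      (sym (PrimeFactorisation.isFactorisation f)) (length≤product (PrimeFactorisation.factorsPrime f))))))
    where f = factorisation n p

-- A rational substitute for the logarithm: completely additive, with the increments of log up to X².
record Logarithm (X : ℕ) : Set where
  field
    L : ℕ → F
    L-* : ∀ m n → 1 ≤ m → 1 ≤ n → L (m * n) ≡ L m ⊕ L n
    L-lower : ∀ m → 1 ≤ m → m ≤ X * X → inv (suc m) ⊝ inv (suc m) ⊗ inv (suc m) ≼ L (suc m) ⊝ L m
    L-upper : ∀ m → 1 ≤ m → m ≤ X * X → L (suc m) ⊝ L m ≼ inv m ⊕ inv m ⊗ inv m

logarithm : ∀ X → Logarithm X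
logarithm X = record
  { L = log K 1≤K
  ; L-* = log-* K 1≤K
  ; L-lower = λ m p q → linear 7 (λ l l′ e e′ b i δ → i :≤ b ⨾ b :≤ e′ :- e ⨾ l :≤ e ⨾ e′ :≤ l′ :+ δ ⨾ δ :≤ i :* i ⊢
    i :- i :* i :≤ l′ :- l) _ _ _ _ _ _ _
      (block-lower K m 1≤K) (≼-reflexive (sym (E-step K 1≤K m))) (log-upper K 1≤K m p) (log-lower K 1≤K (suc m) (s≤s z≤n))
        (small (suc m) (s≤s z≤n) (s≤s q))
  ; L-upper = λ m p q → linear 7 (λ l l′ e e′ b i δ → b :≤ i ⨾ e′ :- e :≤ b ⨾ l′ :≤ e′ ⨾ e :≤ l :+ δ ⨾ δ :≤ i :* i ⊢
    l′ :- l :≤ i :+ i :* i) _ _ _ _ _ _ _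
      (block-upper K m 1≤K p) (≼-reflexive (E-step K 1≤K m)) (log-upper K 1≤K (suc m) (s≤s z≤n)) (log-lower K 1≤K m p)
        (small m p (ℕₚ.m≤n⇒m≤1+n q))
  }
  where
  Y K : ℕ
  -- Increments up to X² involve numbers n ≤ Y. The error n / K of `log` is at most Y / Y³, hence at
  -- most 1 / n².
  Y = suc (X * X)
  K = Y * (Y * Y)

  1≤K : 1 ≤ K
  1≤K = ℕₚ.*-mono-≤ {1} {Y} {1} (s≤s z≤n) (ℕₚ.*-mono-≤ {1} {Y} {1} (s≤s z≤n) (s≤s z≤n))

  small : ∀ n → 1 ≤ n → n ≤ Y → ι n ⊗ inv K ≼ inv n ⊗ inv n
  small n p q = ≼-trans (⊗-monoˡ (inv-nonneg K) (ι-mono q))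
    (≼≡ (≡≼ (trans (⊗-cong refl (inv-* Y (Y * Y) (s≤s z≤n) (ℕₚ.*-mono-≤ {1} {Y} {1} (s≤s z≤n) (s≤s z≤n))))
     (trans (sym (⊗-assoc _ _ _)) (trans (⊗-cong (ι-inv Y (s≤s z≤n)) refl) (⊗-identityˡ _))))
       (inv-antitone {n * n} (ℕₚ.*-mono-≤ p p) (ℕₚ.*-mono-≤ q q))) (inv-* n n p p))

-- The von Mangoldt function

prime-power≢1 : ∀ {p} j → Prime p → 1 ≤ j → p ^ j ∣ 1 → ⊥
prime-power≢1 {p} (suc j) pp _ h = ¬prime[1] (subst Prime (∣1⇒≡1 (∣-trans (m∣m*n (p ^ j)) h)) pp)

power-pos : ∀ {p} j → 1 ≤ p → 1 ≤ p ^ j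
power-pos zero _ = ℕₚ.≤-refl
power-pos (suc j) h = ℕₚ.*-mono-≤ h (power-pos j h)

exponent<power : ∀ {p} j → 2 ≤ p → j < p ^ j
exponent<power zero _ = ℕₚ.≤-refl
exponent<power {p} (suc j) h = ℕₚ.≤-trans (subst (suc (suc j) ≤_) (cong (p ^ j +_) (sym (ℕₚ.+-identityʳ (p ^ j))))
  (ℕₚ.+-mono-≤ (power-pos j (ℕₚ.≤-trans (s≤s z≤n) h)) (exponent<power j h))) (ℕₚ.*-monoˡ-≤ (p ^ j) h)

power-∣-cancel : ∀ {p q} j m → Prime p → Prime q → p ≢ q → p ^ j ∣ q * m → p ^ j ∣ m
power-∣-cancel zero m pp pq p≢q h = divides m (sym (ℕₚ.*-identityʳ m))
power-∣-cancel {p} {q} (suc j) m pp pq p≢q h with prime∣*⇒ {m = m} pp pq p≢q (∣-trans (m∣m*n (p ^ j)) h)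
... | divides k refl = subst (p ^ suc j ∣_) (ℕₚ.*-comm p k) (*-monoʳ-∣ p (power-∣-cancel j k pp pq p≢q
      (*-cancelˡ-∣ p {{>-nonZero (prime≥1 pp)}} (subst (p ^ suc j ∣_) (trans (sym (ℕₚ.*-assoc q k p)) (ℕₚ.*-comm (q * k) p)) h))))

module VonMangoldt (X : ℕ) (1≤X : 1 ≤ X) (lg : Logarithm X) where
  open Logarithm lg public

  L-1 : L 1 ≡ ι 0
  L-1 = trans (ring 1 (λ a → a := a :+ a :- a) (L 1)) (trans (cong (_⊝ L 1) (sym (L-* 1 1 ℕₚ.≤-refl ℕₚ.≤-refl))) (⊕-inverseʳ _))

  L-^ : ∀ m k → 1 ≤ m → L (m ^ k) ≡ ι k ⊗ L m
  L-^ m zero p = trans L-1 (sym (⊗-zeroˡ _))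
  L-^ m (suc k) p = trans (L-* m (m ^ k) p (power-pos k p)) (trans (⊕-cong refl (L-^ m k p))
    (trans (ring 2 (λ a k → a :+ k :* a := (con 1 :+ k) :* a) _ _) (⊗-cong (sym (ι-+ 1 k)) refl)))

  private
    inv-sq≼inv : ∀ n → inv n ⊗ inv n ≼ inv n
    inv-sq≼inv n = ≼≡ (⊗-monoʳ (inv-nonneg n) (inv≼1 n)) (⊗-identityʳ _)

  L-increasing : ∀ m → 1 ≤ m → m ≤ X * X → L m ≼ L (suc m)
  L-increasing m p q = linear 4 (λ a b c d → c :≤ d ⨾ d :- c :≤ b :- a ⊢ a :≤ b) _ _ _ _ (inv-sq≼inv (suc m)) (L-lower m p q)

  L-step≼2inv : ∀ m → 1 ≤ m → m ≤ X * X → L (suc m) ⊝ L m ≼ ι 2 ⊗ inv m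
  L-step≼2inv m p q = linear 4 (λ a b c d → b :- a :≤ c :+ d ⨾ d :≤ c ⊢ b :- a :≤ con 2 :* c) _ _ _ _ (L-upper m p q)
    (inv-sq≼inv m)

  L-step≼2 : ∀ m → 1 ≤ m → m ≤ X * X → L (suc m) ≼ L m ⊕ ι 2
  L-step≼2 m p q = linear 3 (λ a b c → b :- a :≤ con 2 :* c ⨾ 2 • (c :≤ con 1) ⊢ b :≤ a :+ con 2) _ _ _ (L-step≼2inv m p q)
    (inv≼1 m)

  private
    L-mono′ : ∀ m i → 1 ≤ m → m + i ≤ suc (X * X) → L m ≼ L (m + i)
    L-mono′ m zero p q = ≼-reflexive (cong L (sym (ℕₚ.+-identityʳ m)))
    L-mono′ m (suc i) p q = ≼-trans (L-mono′ m i p (ℕₚ.≤-trans (ℕₚ.+-monoʳ-≤ m (ℕₚ.n≤1+n i)) q))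
      (≼≡ (L-increasing (m + i) (ℕₚ.≤-trans p (ℕₚ.m≤m+n m i)) (ℕₚ.≤-pred (subst (_≤ suc (X * X)) (ℕₚ.+-suc m i) q)))
        (cong L (sym (ℕₚ.+-suc m i))))

  L-mono : ∀ {m n} → 1 ≤ m → m ≤ n → n ≤ suc (X * X) → L m ≼ L n
  L-mono {m} {n} p q r = subst (λ k → L m ≼ L k) (ℕₚ.m+[n∸m]≡n q)
    (L-mono′ m (n ∸ m) p (subst (_≤ suc (X * X)) (sym (ℕₚ.m+[n∸m]≡n q)) r))

  X≤XX : X ≤ X * X
  X≤XX = subst (_≤ X * X) (ℕₚ.*-identityʳ X) (ℕₚ.*-monoʳ-≤ X 1≤X)

  L-nonneg : ∀ {n} → 1 ≤ n → n ≤ suc (X * X) → ι 0 ≼ L n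
  L-nonneg p q = ≡≼ (sym L-1) (L-mono ℕₚ.≤-refl p q)

  inv-pos : ∀ n → 1 ≤ n → ι 0 ≺ inv n
  inv-pos n p = ⋡⇒≺ λ h → ≺⇒⋡ (ι0≺ι1+ 0) (≡≼ (sym (ι-inv n p)) (≼≡ (⊗-monoʳ (0≼ι n) h) (⊗-zeroʳ _)))

  L-strict : ∀ {n} → X < n → n ≤ suc (X * X) → L X ≺ L n
  L-strict {n} X<n q = ≺-≼-trans (⋡⇒≺ λ h → ≺⇒⋡ pos (linear 4 (λ a b c d → c :- d :≤ b :- a ⨾ b :≤ a ⊢ c :- d :≤ con 0) _ _ _ _
    (L-lower X 1≤X X≤XX) h))
    (L-mono (s≤s z≤n) X<n q)
    where
    pos : ι 0 ≺ inv (suc X) ⊝ inv (suc X) ⊗ inv (suc X)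
    pos = ⋡⇒≺ λ h → ≺⇒⋡ (inv-pos (suc X) (s≤s z≤n))
      (linear 1 (λ i → 2 • (i :- i :* i :≤ con 0) ⨾ con 0 :≤ i :* (con 1 :- con 2 :* i) ⊢ i :≤ con 0) _ h
      (0≼⊗ (inv-nonneg (suc X)) (a≼b⇒0≼b-a (≼≡ (⊗-monoˡ (inv-nonneg (suc X)) (ι-mono {2} (s≤s 1≤X))) (ι-inv (suc X) (s≤s z≤n))))))

  -- Letting p and j run up to X suffices for d ≤ X, because j < p ^ j.
  Λ : ℕ → F
  Λ d = S X λ p → ind (prime? p) ⊗ S X λ j → ind (d ≟ p ^ j) ⊗ L p

  L-prime-nonneg : ∀ {p} → 1 ≤ p → p ≤ X → ι 0 ≼ L p
  L-prime-nonneg p q = L-nonneg p (ℕₚ.≤-trans q (ℕₚ.m≤n⇒m≤1+n X≤XX))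

  Λ-nonneg : ∀ d → ι 0 ≼ Λ d
  Λ-nonneg d = S-nonneg X λ p 1≤p p≤X → 0≼⊗ (ind-nonneg (prime? p)) (S-nonneg X λ j _ _ →
    0≼⊗ (ind-nonneg (d ≟ p ^ j)) (L-prime-nonneg 1≤p p≤X))

  -- A sum against Λ is a sum over prime powers.
  Λ-sum : ∀ (G : ℕ → F) → (∀ n → X < n → G n ≡ ι 0) →
    S X (λ d → Λ d ⊗ G d) ≡ S X λ p → ind (prime? p) ⊗ (L p ⊗ S X λ j → G (p ^ j))
  Λ-sum G van = begin
    S X (λ d → Λ d ⊗ G d) ≡⟨ S-cong X (λ d _ _ → trans (⊗-comm _ _) (trans (sym (S-⊗ X (G d) _)) (S-cong X λ p _ _ →
        trans (ring 3 (λ g i s → g :* (i :* s) := i :* (g :* s)) _ _ _) (⊗-cong refl (sym (S-⊗ X (G d) _)))))) ⟩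
    S X (λ d → S X λ p → ind (prime? p) ⊗ S X λ j → G d ⊗ (ind (d ≟ p ^ j) ⊗ L p)) ≡⟨ S-swap X X _ ⟩
    S X (λ p → S X λ d → ind (prime? p) ⊗ S X λ j → G d ⊗ (ind (d ≟ p ^ j) ⊗ L p))
      ≡⟨ S-cong X (λ p 1≤p _ → trans (S-⊗ X (ind (prime? p)) _) (⊗-cong refl (trans (S-swap X X _) (trans (S-cong X λ j _ _ →
           trans (S-cong X λ d _ _ → ring 3 (λ g i l → g :* (i :* l) := l :* (i :* g)) _ _ _) (trans (S-⊗ X (L p) _) (⊗-cong refl
             (S-delta X G (p ^ j) (power-pos j 1≤p) (van (p ^ j))))))
           (S-⊗ X (L p) _))))) ⟩
    S X (λ p → ind (prime? p) ⊗ (L p ⊗ S X λ j → G (p ^ j))) ∎ where open ≡-Reasoning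

  valuation : ℕ → ℕ → F
  valuation p n = S X λ j → ind (p ^ j ∣? n)

  private
    valuation-1 : ∀ {p} → Prime p → valuation p 1 ≡ ι 0
    valuation-1 {p} pp = S-zero X λ j q _ → ind-no (p ^ j ∣? 1) (prime-power≢1 j pp q)

    valuation-other : ∀ {p q} m → Prime p → Prime q → p ≢ q → valuation p (q * m) ≡ valuation p m
    valuation-other {p} {q} m pp pq p≢q = S-cong X λ j _ _ → ind-⇔ (p ^ j ∣? q * m) (p ^ j ∣? m) (power-∣-cancel j m pp pq p≢q)
      (∣n⇒∣m*n q)

    valuation-same : ∀ {p} m → Prime p → 1 ≤ m → m ≤ X → valuation p (p * m) ≡ ι 1 ⊕ valuation p m
    valuation-same {p} m pp 1≤m m≤X = begin
      S X f ≡⟨ cong (λ k → S k f) (sym X≡) ⟩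
      S (1 + (X ∸ 1)) f ≡⟨ S-+ 1 (X ∸ 1) f ⟩
      (ι 0 ⊕ f 1) ⊕ S (X ∸ 1) (λ i → f (1 + i)) ≡⟨ ⊕-cong
        (trans (⊕-identityˡ _) (ind-yes (p ^ 1 ∣? p * m) (*-monoʳ-∣ p (divides m (sym (ℕₚ.*-identityʳ m))))))
          (S-cong (X ∸ 1) λ i _ _ → ind-⇔ (p ^ suc i ∣? p * m) (p ^ i ∣? m) (*-cancelˡ-∣ p {{>-nonZero (prime≥1 pp)}})
            (*-monoʳ-∣ p)) ⟩
      -- The sum up to X ∸ 1 may be extended to X: the additional term vanishes because p ^ X > X ≥
      -- m.
      ι 1 ⊕ S (X ∸ 1) (λ i → ind (p ^ i ∣? m)) ≡⟨ ⊕-cong refl (sym (S-extend (ℕₚ.m∸n≤m X 1) λ i a b → ind-no (p ^ i ∣? m) λ h →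
          ℕₚ.<⇒≱ (exponent<power i (prime>1 pp)) (ℕₚ.≤-trans (∣⇒≤ {{>-nonZero 1≤m}} h) (ℕₚ.≤-trans m≤X (subst (_≤ i) X≡ a))))) ⟩
      ι 1 ⊕ valuation p m ∎
      where
      open ≡-Reasoning
      X≡ : 1 + (X ∸ 1) ≡ X
      X≡ = ℕₚ.m+[n∸m]≡n 1≤X
      f = λ j → ind (p ^ j ∣? p * m)

    weighted : ℕ → F
    weighted n = S X λ p → ind (prime? p) ⊗ (L p ⊗ valuation p n)

    weighted-step : ∀ q m → Prime q → 1 ≤ m → q * m ≤ X → weighted (q * m) ≡ weighted m ⊕ L q
    weighted-step q m pq 1≤m qm≤X = trans (S-cong X λ p _ _ → term p (prime? p) (p ≟ q)) (trans (S-⊕ X _ _) (⊕-cong refl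
       (trans (S-delta X (λ p → ind (prime? p) ⊗ L p) q (prime≥1 pq) (λ X<q → ⊥-elim (ℕₚ.<⇒≱ X<q q≤X))) (ind-one (prime? q) pq))))
      where
      q≤X : q ≤ X
      q≤X = ℕₚ.≤-trans (ℕₚ.m≤m*n q m {{>-nonZero 1≤m}}) qm≤X
      m≤X : m ≤ X
      m≤X = ℕₚ.≤-trans (ℕₚ.m≤n*m m q {{>-nonZero (prime≥1 pq)}}) qm≤X
      term : ∀ p (d : Dec (Prime p)) (e : Dec (p ≡ q)) → ind d ⊗ (L p ⊗ valuation p (q * m)) ≡ ind d ⊗ (L p ⊗ valuation p m) ⊕ ind
        e ⊗ (ind d ⊗ L p)
      term p (no _) e = ring 4 (λ a b c d → con 0 :* (a :* b) := con 0 :* (a :* c) :+ d :* (con 0 :* a)) (L p) _ _ (ind e)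
      term p (yes pp) (yes refl) = trans (cong (λ v → ι 1 ⊗ (L p ⊗ v)) (valuation-same m pp 1≤m m≤X))
        (ring 2 (λ a b → con 1 :* (a :* (con 1 :+ b)) := con 1 :* (a :* b) :+ con 1 :* (con 1 :* a)) (L p) _)
      term p (yes pp) (no p≢q) = trans (cong (λ v → ι 1 ⊗ (L p ⊗ v)) (valuation-other m pp pq p≢q))
        (ring 2 (λ a b → con 1 :* (a :* b) := con 1 :* (a :* b) :+ con 0 :* (con 1 :* a)) (L p) _)

    weighted≡L : ∀ n → 1 ≤ n → n ≤ X → weighted n ≡ L n
    weighted≡L = <-rec (λ n → 1 ≤ n → n ≤ X → weighted n ≡ L n) step
      where
      step : ∀ n → (∀ {m} → m < n → 1 ≤ m → m ≤ X → weighted m ≡ L m) → 1 ≤ n → n ≤ X → weighted n ≡ L n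
      step n rec 1≤n n≤X with n ≟ 1
      ... | yes refl = trans (S-zero X λ p _ _ → trans (ind-cong (prime? p) λ pp →
        trans (⊗-cong refl (valuation-1 pp)) (⊗-zeroʳ _)) (⊗-zeroʳ _)) (sym L-1)
      ... | no n≢1 with prime-divisor n (ℕₚ.≤∧≢⇒< 1≤n (n≢1 ∘ sym))
      ... | q , pq , divides zero refl = ⊥-elim (ℕₚ.1+n≰n 1≤n)
      ... | q , pq , divides m@(suc _) refl = trans (cong weighted (ℕₚ.*-comm m q))
        (trans (weighted-step q m pq (s≤s z≤n) (subst (_≤ X) (ℕₚ.*-comm m q) n≤X))
            (trans (⊕-cong (rec m<n (s≤s z≤n) (ℕₚ.<⇒≤ (ℕₚ.<-≤-trans m<n n≤X))) refl) (sym (L-* m q (s≤s z≤n) (prime≥1 pq)))))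
        where
        m<n : m < m * q
        m<n = ℕₚ.m<m*n m q {{_}} (prime>1 pq)

  -- `Λ-sum` turns the left side into the sum of L p times the valuation of n at p. When n gains a
  -- prime factor q, this changes by L q, just as L does.
  Λ-divisor-sum : ∀ n → 1 ≤ n → n ≤ X → S X (λ d → ind (d ∣? n) ⊗ Λ d) ≡ L n
  Λ-divisor-sum n 1≤n n≤X = trans (S-cong X λ d _ _ → ⊗-comm _ _)
    (trans (Λ-sum (λ d → ind (d ∣? n)) λ d X<d → ind-no (d ∣? n) λ h →
    ℕₚ.<⇒≱ X<d (ℕₚ.≤-trans (∣⇒≤ {{>-nonZero 1≤n}} h) n≤X)) (weighted≡L n 1≤n n≤X))

  log-convolution : ∀ (f : ℕ → F) → (∀ n → X < n → f n ≡ ι 0) →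
    S X (λ n → f n ⊗ L n) ≡ S X (λ d → Λ d ⊗ S X λ m → f (d * m))
  log-convolution f van = begin
    S X (λ n → f n ⊗ L n) ≡⟨ S-cong X (λ n p q → trans (⊗-cong refl (sym (Λ-divisor-sum n p q))) (sym (S-⊗ X (f n) _))) ⟩
    S X (λ n → S X λ d → f n ⊗ (ind (d ∣? n) ⊗ Λ d)) ≡⟨ S-swap X X _ ⟩
    S X (λ d → S X λ n → f n ⊗ (ind (d ∣? n) ⊗ Λ d)) ≡⟨ S-cong X (λ d p _ →
      trans (S-cong X λ n _ _ → ring 3 (λ f i l → f :* (i :* l) := l :* (i :* f)) _ _ _)
        (trans (S-⊗ X (Λ d) _) (⊗-cong refl (sym (S-multiples X d f p van))))) ⟩
    S X (λ d → Λ d ⊗ S X λ m → f (d * m)) ∎ where open ≡-Reasoning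

  Λ-1 : Λ 1 ≡ ι 0
  Λ-1 = S-zero X λ p _ _ → trans (ind-cong (prime? p) λ pp → S-zero X λ j 1≤j _ → ind-zero (1 ≟ p ^ j) λ e →
    prime-power≢1 j pp 1≤j (subst (_∣ 1) e (divides 1 refl))) (⊗-zeroʳ _)

  -- The increment from 1 to 2 is at least 1/2 - 1/4. This makes L positive beyond 1 and large at
  -- powers of 2.
  1≼4L2 : ι 1 ≼ ι 4 ⊗ L 2
  1≼4L2 = linear 3 (λ i l l′ → 4 • (i :- i :* i :≤ l′ :- l) ⨾ 4 • (con 0 :≤ l) ⨾ (con 1 :≤ con 4 :* (i :- i :* i)) ⊢
    con 1 :≤ con 4 :* l′) _ _ _
    (L-lower 1 ℕₚ.≤-refl (ℕₚ.*-mono-≤ 1≤X 1≤X)) (≼-reflexive (sym L-1))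
      (≼-reflexive (sym (trans (ring 1 (λ i → con 4 :* (i :- i :* i) := con 2 :* (i :* con 2) :- i :* con 2 :* (i :* con 2)) _)
      (trans (cong (λ z → ι 2 ⊗ z ⊝ z ⊗ z) (inv-ι 2 (s≤s z≤n))) (ring 0 (con 2 :* con 1 :- con 1 :* con 1 := con 1))))))

-- Sums of Λ over sparse sets of prime powers

geometric-sum : ∀ p n → 2 ≤ p → S n (λ j → inv (p ^ j)) ≼ ι 2 ⊗ inv p
geometric-sum p n 2≤p = ≼-trans (S-mono n {g = λ j → ι 2 ⊗ (inv (p ^ j) ⊝ inv (p ^ suc j))} λ j _ _ → halving j)
  (≼-trans (≼-reflexive (trans (S-⊗ n (ι 2) _) (⊗-cong refl (S-telescope n (λ j → inv (p ^ j))))))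
    (≼≡ (linear 2 (λ a b → 2 • (con 0 :≤ b) ⊢ con 2 :* (a :- b) :≤ con 2 :* a) _ _ (inv-nonneg (p ^ suc n)))
      (cong (λ m → ι 2 ⊗ inv m) (ℕₚ.*-identityʳ p))))
  where
  1≤p : 1 ≤ p
  1≤p = ℕₚ.≤-trans (s≤s z≤n) 2≤p

  halving : ∀ j → inv (p ^ j) ≼ ι 2 ⊗ (inv (p ^ j) ⊝ inv (p ^ suc j))
  halving j = subst (λ e → inv (p ^ j) ≼ ι 2 ⊗ (inv (p ^ j) ⊝ e)) (sym (inv-* p (p ^ j) 1≤p (power-pos j 1≤p)))
    (linear 2 (λ a b → con 0 :≤ a :* (con 1 :- con 2 :* b) ⊢ a :≤ con 2 :* (a :- b :* a)) _ _
      (0≼⊗ (inv-nonneg (p ^ j)) (a≼b⇒0≼b-a (≼≡ (⊗-monoˡ (inv-nonneg p) (ι-mono 2≤p)) (ι-inv p 1≤p)))))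

S-count-≤ : ∀ X M → S X (λ n → ind (n ≤? M)) ≼ ι M
S-count-≤ X M with ℕₚ.≤-total M X
... | inj₁ M≤X = ≡≼ (S-extend M≤X λ i M<i _ → ind-no (i ≤? M) (ℕₚ.<⇒≱ M<i))
   (≼-trans (S-mono M λ i _ _ → ind≼1 (i ≤? M)) (≼-reflexive (trans (S-const M (ι 1)) (⊗-identityʳ _))))
... | inj₂ X≤M = ≼-trans (S-mono X λ i _ _ → ind≼1 (i ≤? M)) (≼-trans (≼-reflexive (trans (S-const X (ι 1)) (⊗-identityʳ _)))
  (ι-mono X≤M))

inv-difference : ∀ n → 1 ≤ n → inv n ⊝ inv (suc n) ≡ inv n ⊗ inv (suc n)
inv-difference n p = begin
  inv n ⊝ inv (suc n) ≡⟨ sym (cong₂ _⊝_ (trans (⊗-cong refl (ι-inv (suc n) (s≤s z≤n))) (⊗-identityʳ _))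
    (trans (⊗-cong refl (ι-inv n p)) (⊗-identityʳ _))) ⟩
  inv n ⊗ (ι (suc n) ⊗ inv (suc n)) ⊝ inv (suc n) ⊗ (ι n ⊗ inv n) ≡⟨ cong (λ m → inv n ⊗ (m ⊗ inv (suc n)) ⊝ inv (suc n) ⊗
    (ι n ⊗ inv n)) (ι-+ 1 n) ⟩
  inv n ⊗ ((ι 1 ⊕ ι n) ⊗ inv (suc n)) ⊝ inv (suc n) ⊗ (ι n ⊗ inv n) ≡⟨ ring 3 (λ u v n → u :* ((con 1 :+ n) :* v) :- v :* (n :* u)
    := u :* v) _ _ _ ⟩
  inv n ⊗ inv (suc n) ∎ where open ≡-Reasoning

module VonMangoldtEstimates (X : ℕ) (1≤X : 1 ≤ X) (lg : Logarithm X) where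
  open VonMangoldt X 1≤X lg

  L-linear : ∀ m → 1 ≤ m → m ≤ suc (X * X) → L m ≼ ι 2 ⊗ ι m
  L-linear (suc zero) _ _ = ≡≼ L-1 (0≼⊗ (0≼ι 2) (0≼ι 1))
  L-linear (suc (suc m)) _ q = ≼-trans (L-step≼2 (suc m) (s≤s z≤n) (ℕₚ.≤-pred q))
    (≼≡ (⊕-mono (L-linear (suc m) (s≤s z≤n) (ℕₚ.<⇒≤ q)) ≼-refl)
    (trans (ring 1 (λ m → con 2 :* m :+ con 2 := con 2 :* (con 1 :+ m)) _) (⊗-cong refl (sym (ι-+ 1 (suc m))))))

  -- Telescopes against (L n + 4) / n, modelled on (log n + 1) / n, whose derivative is - log n /
  -- n²; the larger constant absorbs the errors of L. The first value gives the bound 4.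
  S-L/n² : S X (λ n → L n ⊗ (inv n ⊗ inv n)) ≼ ι 4
  S-L/n² = subst (λ k → S k f ≼ ι 4) X≡ (≼-trans (≼-reflexive (S-+ 1 (X ∸ 1) f))
    (≼-trans (⊕-mono (≼-reflexive (trans (⊕-identityˡ _) (trans (⊗-cong L-1 refl) (⊗-zeroˡ _)))) (S-mono (X ∸ 1) λ i p q →
      step i p (≤X i q)))
      (≼-trans (≼-reflexive (trans (⊕-identityˡ _) (S-telescope (X ∸ 1) b)))
        (linear 2 (λ a c → a :≤ con 4 ⨾ con 0 :≤ c ⊢ a :- c :≤ con 4) _ _
        (≼-reflexive (trans (⊗-cong (⊕-cong L-1 refl) inv-1) (ring 0 ((con 0 :+ con 4) :* con 1 := con 4))))
        (0≼⊗ (0≼⊕ (L-nonneg (s≤s z≤n) (s≤s (ℕₚ.≤-trans (ℕₚ.m∸n≤m X 1) X≤XX))) (0≼ι 4)) (inv-nonneg _))))))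
    where
    f b : ℕ → F
    f n = L n ⊗ (inv n ⊗ inv n)
    b n = (L n ⊕ ι 4) ⊗ inv n
    X≡ : 1 + (X ∸ 1) ≡ X
    X≡ = ℕₚ.m+[n∸m]≡n 1≤X
    ≤X : ∀ i → i ≤ X ∸ 1 → i ≤ X * X
    ≤X i q = ℕₚ.≤-trans q (ℕₚ.≤-trans (ℕₚ.m∸n≤m X 1) X≤XX)
    step : ∀ i → 1 ≤ i → i ≤ X * X → f (suc i) ≼ b i ⊝ b (suc i)
    step i p q = linear 4 (λ l l′ u v → (l :+ con 4) :* (u :* v) :≤ (l :+ con 4) :* (u :- v) ⨾
      con 0 :≤ (con 2 :* u :- (l′ :- l)) :* v ⨾
        con 0 :≤ u :* v :* (l :+ con 2 :- l′) ⨾ con 0 :≤ l′ :* v :* (u :- v) ⊢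
          l′ :* (v :* v) :≤ (l :+ con 4) :* u :- (l′ :+ con 4) :* v) _ _ _ _
      (≼-reflexive (⊗-cong refl (sym (inv-difference i p))))
      (0≼⊗ (a≼b⇒0≼b-a (L-step≼2inv i p q)) (inv-nonneg (suc i)))
      (0≼⊗ (0≼⊗ (inv-nonneg i) (inv-nonneg (suc i))) (a≼b⇒0≼b-a (L-step≼2 i p q)))
      (0≼⊗ (0≼⊗ (L-nonneg (s≤s z≤n) (s≤s q)) (inv-nonneg (suc i))) (a≼b⇒0≼b-a (inv-antitone p (ℕₚ.n≤1+n i))))

  S-excluding-first : ∀ (G : ℕ → F) → G 1 ≼ ι 0 → S X G ≼ S (X ∸ 1) (λ i → G (suc i))
  S-excluding-first G h = subst (λ k → S k G ≼ S (X ∸ 1) (λ i → G (suc i))) (ℕₚ.m+[n∸m]≡n 1≤X)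
    (≼-trans (≼-reflexive (S-+ 1 (X ∸ 1) G))
    (linear 2 (λ a b → a :≤ con 0 ⊢ con 0 :+ a :+ b :≤ b) _ _ h))

  -- The exponents j ≥ 2 of a prime p contribute at most L p · 2 / p², and these sum to at most 2 ·
  -- 4.
  Λ-no-primes : ∀ (G : ℕ → F) → (∀ n → X < n → G n ≡ ι 0) → (∀ d → 1 ≤ d → G d ≼ inv d) →
    (∀ p → Prime p → p ≤ X → G p ≼ ι 0) → S X (λ d → Λ d ⊗ G d) ≼ ι 8
  Λ-no-primes G van small none = ≼-trans (≼-reflexive (Λ-sum G van)) (≼-trans (S-mono X λ p 1≤p p≤X → term p (prime? p) 1≤p p≤X)
    (≼-trans (≼-reflexive (S-⊗ X (ι 2) _)) (≼≡ (⊗-monoʳ (0≼ι 2) S-L/n²) (sym (ι-* 2 4)))))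
    where
    term : ∀ p (d : Dec (Prime p)) → 1 ≤ p → p ≤ X → ind d ⊗ (L p ⊗ S X λ j → G (p ^ j)) ≼ ι 2 ⊗ (L p ⊗ (inv p ⊗ inv p))
    term p (no _) 1≤p p≤X = ≡≼ (⊗-zeroˡ _) (0≼⊗ (0≼ι 2) (0≼⊗ (L-prime-nonneg 1≤p p≤X) (0≼⊗ (inv-nonneg p) (inv-nonneg p))))
    term p (yes pp) 1≤p p≤X = ≡≼ (⊗-identityˡ _) (≼≡ (⊗-monoʳ (L-prime-nonneg 1≤p p≤X)
      (≼-trans (S-excluding-first (λ j → G (p ^ j)) (≡≼ (cong G (ℕₚ.*-identityʳ p)) (none p pp p≤X)))
      (≼-trans (S-mono (X ∸ 1) λ i _ _ → ≼≡ (small (p ^ suc i) (power-pos (suc i) 1≤p)) (inv-* p (p ^ i) 1≤p (power-pos i 1≤p)))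
      (≡≼ (S-⊗ (X ∸ 1) (inv p) _) (⊗-monoʳ (inv-nonneg p) (geometric-sum p (X ∸ 1) (prime>1 pp)))))))
      (ring 2 (λ l i → l :* (i :* (con 2 :* i)) := con 2 :* (l :* (i :* i))) _ _))

  -- By `L-linear` each prime p ≤ M contributes at most 2 p · 2 / p = 4.
  Λ-few-primes : ∀ M (G : ℕ → F) → (∀ n → X < n → G n ≡ ι 0) → (∀ d → 1 ≤ d → G d ≼ inv d) →
    (∀ p j → Prime p → ¬ (p ≤ M) → G (p ^ j) ≼ ι 0) → S X (λ d → Λ d ⊗ G d) ≼ ι (4 * M)
  Λ-few-primes M G van small none = ≼-trans (≼-reflexive (Λ-sum G van))
    (≼-trans (S-mono X λ p 1≤p p≤X → term p (prime? p) (p ≤? M) 1≤p p≤X)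
    (≼-trans (≼-reflexive (S-⊗ X (ι 4) _)) (≼≡ (⊗-monoʳ (0≼ι 4) (S-count-≤ X M)) (sym (ι-* 4 M)))))
    where
    term : ∀ p (d : Dec (Prime p)) (e : Dec (p ≤ M)) → 1 ≤ p → p ≤ X → ind d ⊗ (L p ⊗ S X λ j → G (p ^ j)) ≼ ι 4 ⊗ ind e
    term p (no _) e 1≤p p≤X = ≡≼ (⊗-zeroˡ _) (0≼⊗ (0≼ι 4) (ind-nonneg e))
    term p (yes pp) (no p≰M) 1≤p p≤X = ≡≼ (⊗-identityˡ _) (≼-trans (⊗-monoʳ (L-prime-nonneg 1≤p p≤X)
      (≼-trans (S-mono X λ j _ _ → none p j pp p≰M) (≼-reflexive (S-zero X λ _ _ _ → refl))))
        (≼-reflexive (trans (⊗-zeroʳ _) (sym (⊗-zeroʳ _)))))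
    term p (yes pp) (yes _) 1≤p p≤X = ≡≼ (⊗-identityˡ _)
      (≼-trans (⊗-mono (0≼⊗ (0≼ι 2) (0≼ι p)) (S-nonneg X λ j _ _ → inv-nonneg (p ^ j))
      (L-linear p 1≤p (ℕₚ.m≤n⇒m≤1+n (ℕₚ.≤-trans p≤X X≤XX))) ≼-refl |>
      λ h → ≼-trans (⊗-monoʳ (L-prime-nonneg 1≤p p≤X) (S-mono X λ j _ _ → small (p ^ j) (power-pos j 1≤p))) h)
      (≼≡ (⊗-monoʳ (0≼⊗ (0≼ι 2) (0≼ι p)) (geometric-sum p X (prime>1 pp)))
        (trans (ring 2 (λ p i → con 2 :* p :* (con 2 :* i) := con 4 :* (p :* i)) _ _) (⊗-cong refl (ι-inv p 1≤p)))))

  -- The exponent j of c on the left becomes 2 j on the right; the odd exponents there are dropped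
  -- as nonnegative. `r-square` needs this.
  Λ-square : ∀ c → 1 ≤ c → c * c ≤ X → Λ c ≼ Λ (c * c)
  Λ-square c 1≤c cc≤X = S-mono X λ p _ p≤X → ind-mono (prime? p) λ pp → ≼-trans (≼-reflexive (S-cong X λ j _ _ →
      ⊗-cong (ind-⇔ (c ≟ p ^ j) (c * c ≟ p ^ (2 * j)) (λ { refl → sym (doubled p j) })
        (λ e → square-injective (trans e (doubled p j)))) refl))
    (≡≼ (S-multiples X 2 (λ j → ind (c * c ≟ p ^ j) ⊗ L p) (s≤s z≤n) λ n X<n → ind-zero (c * c ≟ p ^ n) λ e →
          ℕₚ.<⇒≱ (exponent<power n (prime>1 pp)) (subst (_≤ n) e (ℕₚ.≤-trans cc≤X (ℕₚ.<⇒≤ X<n))))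
      (S-mono X λ n _ _ → ≼≡ (⊗-monoˡ (0≼⊗ (ind-nonneg (c * c ≟ p ^ n)) (L-prime-nonneg (prime≥1 pp) p≤X)) (ind≼1 (2 ∣? n)))
        (⊗-identityˡ _)))
    where
    doubled : ∀ p j → p ^ (2 * j) ≡ p ^ j * p ^ j
    doubled p j = trans (ℕₚ.^-distribˡ-+-* p j (j + 0)) (cong (λ k → p ^ j * p ^ k) (ℕₚ.+-identityʳ j))
    square-injective : ∀ {a} → c * c ≡ a * a → c ≡ a
    square-injective {a} e with ℕₚ.<-cmp c a
    ... | tri< c<a _ _ = ⊥-elim (ℕₚ.<⇒≢ (ℕₚ.*-mono-< c<a c<a) e)
    ... | tri≈ _ c≡a _ = c≡a
    ... | tri> _ _ a<c = ⊥-elim (ℕₚ.<⇒≢ (ℕₚ.*-mono-< a<c a<c) (sym e))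

-- Smooth weights

infixr 8 _^^_

_^^_ : F → ℕ → F
u ^^ zero = ι 1
u ^^ suc k = u ⊗ u ^^ k

^^-nonneg : ∀ {u} k → ι 0 ≼ u → ι 0 ≼ u ^^ k
^^-nonneg zero _ = 0≼1
^^-nonneg (suc k) p = 0≼⊗ p (^^-nonneg k p)

^^-mono : ∀ {u v} k → ι 0 ≼ u → u ≼ v → u ^^ k ≼ v ^^ k
^^-mono zero _ _ = ≼-refl
^^-mono (suc k) p q = ⊗-mono (≼-trans p q) (^^-nonneg k p) q (^^-mono k p q)

-- The power u^k of the positive part of u; for k = 0 it is the indicator of u ≥ 0.
pw : ℕ → F → F
pw k u = ind (ι 0 ≼dec u) ⊗ u ^^ k

pw-pos : ∀ k {u} → ι 0 ≼ u → pw k u ≡ u ^^ k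
pw-pos k {u} p = ind-one (ι 0 ≼dec u) p

pw-neg : ∀ k {u} → u ≺ ι 0 → pw k u ≡ ι 0
pw-neg k {u} p = ind-zero (ι 0 ≼dec u) (≺⇒⋡ p)

pw-nonneg : ∀ k u → ι 0 ≼ pw k u
pw-nonneg k u with ≼? (ι 0) u
... | inj₁ p = ≼≡ (^^-nonneg k p) (sym (pw-pos k p))
... | inj₂ p = ≼-reflexive (sym (pw-neg k p))

pw-mono : ∀ k {u v} → u ≼ v → pw k u ≼ pw k v
pw-mono k {u} {v} h with ≼? (ι 0) u
... | inj₁ p = subst₂ _≼_ (sym (pw-pos k p)) (sym (pw-pos k (≼-trans p h))) (^^-mono k p h)
... | inj₂ p = ≡≼ (pw-neg k p) (pw-nonneg k v)

pw-suc : ∀ k u → pw (suc k) u ≡ u ⊗ pw k u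
pw-suc k u = ring 3 (λ i u p → i :* (u :* p) := u :* (i :* p)) _ _ _

^^-difference-upper : ∀ k {u v} → ι 0 ≼ v → v ≼ u → u ^^ suc k ⊝ v ^^ suc k ≼ ι (suc k) ⊗ ((u ⊝ v) ⊗ u ^^ k)
^^-difference-upper zero p q = ≼-reflexive (ring 2 (λ u v → u :* con 1 :- v :* con 1 := con 1 :* ((u :- v) :* con 1)) _ _)
^^-difference-upper (suc k) {u} {v} p q = subst (λ c → u ^^ suc (suc k) ⊝ v ^^ suc (suc k) ≼ c ⊗ ((u ⊝ v) ⊗ u ^^ suc k))
  (sym (ι-+ 1 (suc k)))
  (linear 5 (λ u v a b c → u :* (u :* a :- v :* b) :≤ u :* (c :* ((u :- v) :* a)) ⨾ (u :- v) :* (v :* b) :≤ (u :- v) :* (u :* a) ⊢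
    u :* (u :* a) :- v :* (v :* b) :≤ (con 1 :+ c) :* ((u :- v) :* (u :* a))) _ _ _ _ _
    (⊗-monoʳ (≼-trans p q) (^^-difference-upper k p q)) (⊗-monoʳ (a≼b⇒0≼b-a q) (^^-mono (suc k) p q)))

^^-difference-lower : ∀ k {u v} → ι 0 ≼ v → v ≼ u → ι (suc k) ⊗ ((u ⊝ v) ⊗ v ^^ k) ≼ u ^^ suc k ⊝ v ^^ suc k
^^-difference-lower zero p q = ≼-reflexive (ring 2 (λ u v → con 1 :* ((u :- v) :* con 1) := u :* con 1 :- v :* con 1) _ _)
^^-difference-lower (suc k) {u} {v} p q = subst (λ c → c ⊗ ((u ⊝ v) ⊗ v ^^ suc k) ≼ u ^^ suc (suc k) ⊝ v ^^ suc (suc k))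
  (sym (ι-+ 1 (suc k)))
  (linear 5 (λ u v a b c → v :* (c :* ((u :- v) :* b)) :≤ v :* (u :* a :- v :* b) ⨾ (u :- v) :* (v :* b) :≤ (u :- v) :* (u :* a) ⊢
    (con 1 :+ c) :* ((u :- v) :* (v :* b)) :≤ u :* (u :* a) :- v :* (v :* b)) _ _ _ _ _
    (⊗-monoʳ p (^^-difference-lower k p q)) (⊗-monoʳ (a≼b⇒0≼b-a q) (^^-mono (suc k) p q)))

-- Mean value inequality for the positive part. When b is negative and a is not, a ≤ (k + 1)(a - b)
-- is enough.
pw-difference-upper : ∀ k {a b} → b ≼ a → pw (suc k) a ⊝ pw (suc k) b ≼ ι (suc k) ⊗ ((a ⊝ b) ⊗ pw k a)
pw-difference-upper k {a} {b} h with ≼? (ι 0) b | ≼? (ι 0) a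
... | inj₁ q | inj₂ p = ⊥-elim (≺⇒⋡ p (≼-trans q h))
... | inj₁ q | inj₁ p = subst₂ _≼_ (cong₂ _⊝_ (sym (pw-pos (suc k) p)) (sym (pw-pos (suc k) q)))
  (cong (λ c → ι (suc k) ⊗ ((a ⊝ b) ⊗ c)) (sym (pw-pos k p))) (^^-difference-upper k q h)
... | inj₂ q | inj₂ p = ≡≼ (trans (cong₂ _⊝_ (pw-neg (suc k) p) (pw-neg (suc k) q)) (⊕-inverseʳ _))
  (0≼⊗ (0≼ι (suc k)) (0≼⊗ (a≼b⇒0≼b-a h) (pw-nonneg k a)))
... | inj₂ q | inj₁ p = subst₂ _≼_ (trans (ring 1 (λ a → a := a :- con 0) _)
  (cong₂ _⊝_ (sym (pw-pos (suc k) p)) (sym (pw-neg (suc k) q)))) (cong (λ c → ι (suc k) ⊗ ((a ⊝ b) ⊗ c)) (sym (pw-pos k p)))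
    (subst (λ c → a ^^ suc k ≼ c ⊗ ((a ⊝ b) ⊗ a ^^ k)) (sym (ι-+ 1 k))
      (linear 4 (λ a b c k → con 0 :≤ (con 0 :- b) :* c ⨾ con 0 :≤ k :* ((a :- b) :* c) ⊢
        a :* c :≤ (con 1 :+ k) :* ((a :- b) :* c)) _ _ _ _
        (0≼⊗ (a≼b⇒0≼b-a (≺⇒≼ q)) (^^-nonneg k p)) (0≼⊗ (0≼ι k) (0≼⊗ (a≼b⇒0≼b-a h) (^^-nonneg k p)))))

pw-difference-lower : ∀ k {a b} → b ≼ a → ι (suc k) ⊗ ((a ⊝ b) ⊗ pw k b) ≼ pw (suc k) a ⊝ pw (suc k) b
pw-difference-lower k {a} {b} h with ≼? (ι 0) b
... | inj₁ q = subst₂ _≼_ (cong (λ c → ι (suc k) ⊗ ((a ⊝ b) ⊗ c)) (sym (pw-pos k q)))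
  (cong₂ _⊝_ (sym (pw-pos (suc k) (≼-trans q h))) (sym (pw-pos (suc k) q))) (^^-difference-lower k q h)
... | inj₂ q = ≡≼ (trans (cong (λ c → ι (suc k) ⊗ ((a ⊝ b) ⊗ c)) (pw-neg k q)) (ring 2 (λ k d → k :* (d :* con 0) := con 0) _ _))
  (a≼b⇒0≼b-a (pw-mono (suc k) h))

S-inv² : ∀ n → S n (λ m → inv m ⊗ inv m) ≼ ι 2
S-inv² zero = 0≼ι 2
S-inv² (suc n) = ≼-trans (≼-reflexive (S-+ 1 n _)) (≼-trans (⊕-mono ≼-refl (S-mono n λ i p _ →
    ≼≡ (⊗-monoˡ (inv-nonneg (suc i)) (inv-antitone p (ℕₚ.n≤1+n i))) (sym (inv-difference i p))))
  (≼-trans (⊕-mono ≼-refl (≼-reflexive (S-telescope n inv))) (linear 2 (λ a b → 2 • (a :≤ con 1) ⨾ con 0 :≤ b ⨾ a :* a :≤ a ⊢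
    (con 0 :+ a :* a) :+ (a :- b) :≤ con 2) _ _
    (≼-reflexive inv-1) (inv-nonneg (suc n)) (≼≡ (⊗-monoʳ (inv-nonneg 1) (inv≼1 1)) (⊗-identityʳ _)))))

abel-summation : ∀ (c Φ : ℕ → F) n → S n (λ m → c m ⊗ Φ m) ≡ S n c ⊗ Φ (suc n) ⊕ S n (λ m → S m c ⊗ (Φ m ⊝ Φ (suc m)))
abel-summation c Φ zero = ring 1 (λ p → con 0 := con 0 :* p :+ con 0) _
abel-summation c Φ (suc n) = trans (⊕-cong (abel-summation c Φ n) refl)
  (ring 5 (λ s x p p′ t → (s :* p :+ t) :+ x :* p := (s :+ x) :* p′ :+ (t :+ (s :+ x) :* (p :- p′))) _ _ _ _ _)

-- Cancellation over residue classes and character values enters most estimates through this bound.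
-- The decrements of Φ telescope, so only Φ 1 remains.
abel-bound : ∀ (c Φ : ℕ → F) B n → (∀ y → S y c within B) → (∀ m → 1 ≤ m → m ≤ n → Φ (suc m) ≼ Φ m) → ι 0 ≼ Φ (suc n) →
  S n (λ m → c m ⊗ Φ m) within B ⊗ Φ 1
abel-bound c Φ B n D dec pos = subst₂ _within_ (sym (abel-summation c Φ n))
  (trans (⊕-cong refl (trans (S-⊗ n B _) (⊗-cong refl (S-telescope n Φ)))) (ring 3 (λ B p q → B :* q :+ B :* (p :- q) := B :* p) _
    _ _))
  (within-⊕ (within-⊗ (D n) (nonneg-within pos)) (S-within n λ m p q → within-⊗ (D m) (nonneg-within (a≼b⇒0≼b-a (dec m p q)))))

-- Full periods cancel, so y can be reduced to at most M, where the trivial bound is good enough.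
periodic-bound : ∀ (c : ℕ → F) M B → 1 ≤ M → (∀ i → 1 ≤ i → c (M + i) ≡ c i) → S M c ≡ ι 0 → (∀ i → c i within B) → ∀ y →
  S y c within ι M ⊗ B
periodic-bound c M B 1≤M per zero-sum bound = <-rec (λ y → S y c within ι M ⊗ B) step
  where
  step : ∀ y → (∀ {z} → z < y → S z c within ι M ⊗ B) → S y c within ι M ⊗ B
  step y rec with ℕₚ.≤-total y M
  ... | inj₁ y≤M = within-mono (subst (S y c within_) (S-const y B) (S-within y λ i _ _ → bound i))
    (⊗-monoˡ (within-nonneg (bound 0)) (ι-mono y≤M))
  ... | inj₂ M≤y = subst (_within ι M ⊗ B) (sym (trans (cong (λ k → S k c) (sym (ℕₚ.m+[n∸m]≡n M≤y))) (trans (S-+ M (y ∸ M) c)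
        (trans (⊕-cong zero-sum (S-cong (y ∸ M) λ i p _ → per i p)) (⊕-identityˡ _)))))
          (rec (ℕₚ.≤-trans (subst (suc (y ∸ M) ≤_) (ℕₚ.m+[n∸m]≡n M≤y) (ℕₚ.+-monoˡ-≤ (y ∸ M) 1≤M)) ℕₚ.≤-refl))

module SmoothSums (X : ℕ) (1≤X : 1 ≤ X) (lg : Logarithm X) where
  open VonMangoldt X 1≤X lg

  w : ℕ → F → ℕ → F
  w k s m = pw k (s ⊝ L m) ⊗ inv m

  w-nonneg : ∀ k s m → ι 0 ≼ w k s m
  w-nonneg k s m = 0≼⊗ (pw-nonneg k _) (inv-nonneg m)

  pw≼ : ∀ k {s m} → ι 0 ≼ s → 1 ≤ m → m ≤ suc (X * X) → pw k (s ⊝ L m) ≼ s ^^ k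
  pw≼ k {s} p q r = ≼≡ (pw-mono k (linear 2 (λ s l → con 0 :≤ l ⊢ s :- l :≤ s) _ _ (L-nonneg q r))) (pw-pos k p)

  w-decreasing : ∀ k s m → 1 ≤ m → m ≤ X → w k s (suc m) ≼ w k s m
  w-decreasing k s m p q = ⊗-mono (pw-nonneg k _) (inv-nonneg (suc m))
    (pw-mono k (linear 3 (λ s l l′ → l :≤ l′ ⊢ s :- l′ :≤ s :- l) _ _ _ (L-increasing m p (ℕₚ.≤-trans q X≤XX))))
      (inv-antitone p (ℕₚ.n≤1+n m))

  s-L1 : ∀ s → s ⊝ L 1 ≡ s
  s-L1 s = trans (cong (s ⊝_) L-1) (ring 1 (λ s → s :- con 0 := s) s)

  w-1 : ∀ k {s} → ι 0 ≼ s → w k s 1 ≡ s ^^ k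
  w-1 k {s} p = trans (⊗-cong (trans (cong (pw k) (s-L1 s)) (pw-pos k p)) inv-1) (⊗-identityʳ _)

  pw-beyond : ∀ k {s n} → s ≼ L X → X < n → n ≤ suc (X * X) → pw k (s ⊝ L n) ≡ ι 0
  pw-beyond k {s} {n} h p q = pw-neg k (⋡⇒≺ λ r →
    ≺⇒⋡ (L-strict p q) (linear 3 (λ s l n → s :≤ l ⨾ con 0 :≤ s :- n ⊢ n :≤ l) _ _ _ h r))

  -- A sum against the integral of u^k over 0 ≤ u ≤ s. The powers (s - L m)₊^(k+1) telescope to
  -- s^(k+1), by s ≤ L X, and the mean value inequality with the increments of L compares each step
  -- with (k + 1)(s - L m)₊^k / m.
  S-w-approx : ∀ k {s} → ι 0 ≼ s → s ≼ L X → (ι (suc k) ⊗ S X (w k s) ⊝ s ^^ suc k) within (ι 2 ⊗ ι (suc k) ⊗ s ^^ k)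
  S-w-approx k {s} 0≼s s≼ =
    linear 4 (λ c K p q → q :≤ c :* (K :+ con 2 :* p) ⊢ :- (con 2 :* c :* p) :≤ c :* K :- q) _ _ _ _ above ,
    linear 4 (λ c K p q → c :* (K :- con 2 :* p) :≤ q ⊢ c :* K :- q :≤ con 2 :* c :* p) _ _ _ _ below
    where
    g : ℕ → F
    g m = pw (suc k) (s ⊝ L m)

    total : s ^^ suc k ≡ S X (λ m → g m ⊝ g (suc m))
    total = sym (trans (S-telescope X g) (trans (cong₂ _⊝_ (trans (cong (pw (suc k)) (s-L1 s)) (pw-pos (suc k) 0≼s))
      (pw-beyond (suc k) s≼ ℕₚ.≤-refl (s≤s X≤XX))) (ring 1 (λ a → a :- con 0 := a) _)))

    L≼ : ∀ m → 1 ≤ m → m ≤ X → s ⊝ L (suc m) ≼ s ⊝ L m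
    L≼ m p q = linear 3 (λ s l l′ → l :≤ l′ ⊢ s :- l′ :≤ s :- l) _ _ _ (L-increasing m p (ℕₚ.≤-trans q X≤XX))

    tail : S X (λ m → pw k (s ⊝ L m) ⊗ (inv m ⊗ inv m)) ≼ ι 2 ⊗ s ^^ k
    tail = ≼-trans (S-mono X λ m p q → ⊗-monoˡ (0≼⊗ (inv-nonneg m) (inv-nonneg m))
      (pw≼ k 0≼s p (ℕₚ.m≤n⇒m≤1+n (ℕₚ.≤-trans q X≤XX))))
      (≼-trans (≼-reflexive (S-⊗ X _ _)) (≼≡ (⊗-monoʳ (^^-nonneg k 0≼s) (S-inv² X)) (⊗-comm _ _)))

    above : s ^^ suc k ≼ ι (suc k) ⊗ (S X (w k s) ⊕ ι 2 ⊗ s ^^ k)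
    above = ≡≼ total (≼-trans (S-mono X {g = λ m → ι (suc k) ⊗ (w k s m ⊕ pw k (s ⊝ L m) ⊗ (inv m ⊗ inv m))} λ m p q →
      ≼-trans (pw-difference-upper k (L≼ m p q))
      (⊗-monoʳ (0≼ι (suc k)) (≼-trans (⊗-monoˡ (pw-nonneg k _) (≡≼ (ring 3 (λ s l l′ → (s :- l) :- (s :- l′) := l′ :- l) _ _ _)
        (L-upper m p (ℕₚ.≤-trans q X≤XX))))
        (≼-reflexive (ring 2 (λ i p → (i :+ i :* i) :* p := p :* i :+ p :* (i :* i)) _ _)))))
      (≼-trans (≼-reflexive (trans (S-⊗ X _ _) (⊗-cong refl (S-⊕ X _ _)))) (⊗-monoʳ (0≼ι (suc k)) (⊕-mono ≼-refl tail))))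

    e : ℕ → F
    e m = w k s m ⊝ pw k (s ⊝ L m) ⊗ (inv m ⊗ inv m)

    e-nonneg : ∀ m → ι 0 ≼ e m
    e-nonneg m = ≼≡ (0≼⊗ (w-nonneg k s m) (a≼b⇒0≼b-a (inv≼1 m)))
      (ring 2 (λ p i → p :* i :* (con 1 :- i) := p :* i :- p :* (i :* i)) _ _)

    -- The lower bounds for the increments sit at suc m, so the sum has to move by one place; this
    -- is free because e 1 = 0.
    e-shift : S X e ≼ S X (λ m → e (suc m))
    e-shift = linear 4 (λ a b c d → a :+ b :≤ (con 0 :+ c) :+ d ⨾ c :≤ con 0 ⨾ con 0 :≤ b ⊢ a :≤ d) _ _ _ _
      (≼-reflexive (S-+ 1 X e))
      (≼-reflexive (trans (cong (λ i → pw k (s ⊝ L 1) ⊗ i ⊝ pw k (s ⊝ L 1) ⊗ (i ⊗ i)) inv-1)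
        (ring 1 (λ p → p :* con 1 :- p :* (con 1 :* con 1) := con 0) _))) (e-nonneg (suc X))

    below : ι (suc k) ⊗ (S X (w k s) ⊝ ι 2 ⊗ s ^^ k) ≼ s ^^ suc k
    below = ≼≡ (≼-trans (⊗-monoʳ (0≼ι (suc k)) (≼-trans (linear 3 (λ a b c → b :≤ c ⊢ a :- c :≤ a :- b) _ _ _ tail)
      (≡≼ (sym (S-⊝ X _ _)) e-shift)))
      (≡≼ (sym (S-⊗ X _ _)) (S-mono X λ m p q → ≼-trans
        (⊗-monoʳ (0≼ι (suc k)) (≡≼ (ring 2 (λ p i → p :* i :- p :* (i :* i) := (i :- i :* i) :* p) _ _)
        (⊗-monoˡ (pw-nonneg k _) (≼≡ (L-lower m p (ℕₚ.≤-trans q X≤XX)) (ring 3 (λ s l l′ → l′ :- l := (s :- l) :- (s :- l′)) _ _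
          _))))) (pw-difference-lower k (L≼ m p q))))) (sym total)

-- Residue classes

module Residues (M : ℕ) {{M≢0 : NonZero M}} where

  infix 4 _≈_ _≈?_

  _≈_ : ℕ → ℕ → Set
  a ≈ b = a % M ≡ b % M

  _≈?_ : ∀ a b → Dec (a ≈ b)
  a ≈? b = a % M ≟ b % M

  ≈-* : ∀ {a b c d} → a ≈ b → c ≈ d → a * c ≈ b * d
  ≈-* {a} {b} {c} {d} p q = trans (%-distribˡ-* a c M) (trans (cong₂ (λ x y → x * y % M) p q) (sym (%-distribˡ-* b d M)))

  ≈-+ : ∀ {a b c d} → a ≈ b → c ≈ d → a + c ≈ b + d
  ≈-+ {a} {b} {c} {d} p q = trans (%-distribˡ-+ a c M) (trans (cong₂ (λ x y → (x + y) % M) p q) (sym (%-distribˡ-+ b d M)))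

  ≈-≡ : ∀ {a b} → a ≡ b → a ≈ b
  ≈-≡ = cong (_% M)

  1≤M : 1 ≤ M
  1≤M = ℕₚ.≤-trans (s≤s z≤n) (m%n<n 0 M)

  multiple≈0 : ∀ k → k * M ≈ 0
  multiple≈0 k = trans (m*n%n≡0 k M) (sym (m<n⇒m%n≡m 1≤M))

  -- `z * (M ∸ 1)` serves as - z.
  ≈-+-cancelʳ : ∀ {a b} z → a + z ≈ b + z → a ≈ b
  ≈-+-cancelʳ {a} {b} z h = trans (sym (absorb a)) (trans (≈-+ {a + z} {b + z} {z * (M ∸ 1)} h refl) (absorb b))
    where
    absorb : ∀ a → a + z + z * (M ∸ 1) ≈ a
    absorb a = trans (≈-≡ (trans (ℕₚ.+-assoc a z _)
      (cong (a +_) (trans (sym (ℕₚ.*-suc z (M ∸ 1))) (cong (z *_) (ℕₚ.m+[n∸m]≡n 1≤M)))))) ([m+kn]%n≡m%n a z M)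

  inverse : ∀ {d} → Coprime d M → Σ ℕ λ d′ → d * d′ ≈ 1
  inverse {d} c with coprime-Bézout c
  ... | Bézout.+- x y e = x , trans (≈-≡ (trans (ℕₚ.*-comm d x) (sym e))) ([m+kn]%n≡m%n 1 y M)
  -- Here x d ≡ -1, so (x d)² ≡ 1 and the inverse of d is x (x d).
  ... | Bézout.-+ x y e = x * (x * d) , trans (≈-≡ (trans (sym (ℕₚ.*-assoc d x _)) (cong (_* (x * d)) (ℕₚ.*-comm d x))))
      (≈-+-cancelʳ (x * d) (trans (≈-≡ (trans (ℕₚ.+-comm _ (x * d)) (sym (ℕₚ.*-suc (x * d) (x * d)))))
        (trans (≈-* {x * d} {x * d} refl z) (trans (≈-≡ (ℕₚ.*-zeroʳ (x * d))) (sym z)))))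
    where
    z : 1 + x * d ≈ 0
    z = trans (≈-≡ e) (multiple≈0 y)

  coprime-≈ : ∀ {a b} → a ≈ b → Coprime a M → Coprime b M
  coprime-≈ {a} {b} e c {i} (i∣b , i∣M) = c (∣n∣m%n⇒∣m i∣M (subst (i ∣_) (sym e) (%-presˡ-∣ i∣b i∣M)) , i∣M)

  coprime-* : ∀ {a b} → Coprime a M → Coprime b M → Coprime (a * b) M
  coprime-* {a} {b} ca cb {i} (i∣ab , i∣M) = cb (coprime-divisor {i} {a} {b} (λ (j∣i , j∣a) → ca (j∣a , ∣-trans j∣i i∣M)) i∣ab ,
    i∣M)

  coprime-*ˡ : ∀ {a} b → Coprime (a * b) M → Coprime a M
  coprime-*ˡ b c (i∣a , i∣M) = c (∣-trans i∣a (m∣m*n b) , i∣M)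

  coprime-*ʳ : ∀ a {b} → Coprime (a * b) M → Coprime b M
  coprime-*ʳ a c (i∣b , i∣M) = c (∣-trans i∣b (n∣m*n a) , i∣M)

  coprime-1 : Coprime 1 M
  coprime-1 (i∣1 , _) with i∣1
  ... | divides q e = ℕₚ.m*n≡1⇒n≡1 q _ (sym e)

  ≈-cancelˡ : ∀ {d a b} → Coprime d M → d * a ≈ d * b → a ≈ b
  ≈-cancelˡ {d} {a} {b} c h with inverse c
  ... | d′ , e = trans (sym (strip a)) (trans (≈-* {d′} {d′} refl h) (strip b))
    where
    strip : ∀ a → d′ * (d * a) ≈ a
    strip a = trans (≈-≡ (trans (sym (ℕₚ.*-assoc d′ d a)) (cong (_* a) (ℕₚ.*-comm d′ d))))
      (trans (≈-* {c = a} {a} e refl) (≈-≡ (ℕₚ.+-identityʳ a)))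

  -- The principal character modulo M.
  χ₀ : ℕ → F
  χ₀ n = ind (coprime? n M)

  χ₀-≈ : ∀ {a b} → a ≈ b → χ₀ a ≡ χ₀ b
  χ₀-≈ {a} {b} e = ind-⇔ (coprime? a M) (coprime? b M) (coprime-≈ e) (coprime-≈ (sym e))

  𝟙 : ℕ → ℕ → F
  𝟙 l n = ind (n ≈? l)

  𝟙-nonneg : ∀ l n → ι 0 ≼ 𝟙 l n
  𝟙-nonneg l n = ind-nonneg (n ≈? l)

  private
    rep : ℕ → ℕ
    rep c with c % M
    ... | zero = M
    ... | r@(suc _) = r

    rep-≈ : ∀ c → rep c ≈ c
    rep-≈ c with c % M in e
    ... | zero = n%n≡0 M
    ... | suc r = trans (cong (_% M) (sym e)) (trans (m%n%n≡m%n c M) e)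

    rep-bounds : ∀ c → 1 ≤ rep c × rep c ≤ M
    rep-bounds c with c % M in e
    ... | zero = 1≤M , ℕₚ.≤-refl
    ... | suc r = s≤s z≤n , subst (_≤ M) e (ℕₚ.<⇒≤ (m%n<n c M))

    range-unique : ∀ {a b} → 1 ≤ a → a ≤ M → 1 ≤ b → b ≤ M → a ≈ b → a ≡ b
    range-unique {a} {b} p q r s e with ℕₚ.m≤n⇒m<n∨m≡n q | ℕₚ.m≤n⇒m<n∨m≡n s
    ... | inj₁ a<M | inj₁ b<M = trans (sym (m<n⇒m%n≡m a<M)) (trans e (m<n⇒m%n≡m b<M))
    ... | inj₂ refl | inj₂ refl = refl
    ... | inj₁ a<M | inj₂ refl = ⊥-elim (ℕₚ.<⇒≢ p (sym (trans (sym (m<n⇒m%n≡m a<M)) (trans e (n%n≡0 M)))))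
    ... | inj₂ refl | inj₁ b<M = ⊥-elim (ℕₚ.<⇒≢ r (sym (trans (sym (m<n⇒m%n≡m b<M)) (trans (sym e) (n%n≡0 M)))))

  -- Residue classes are summed over the representatives 1, …, M.
  Periodic : (ℕ → F) → Set
  Periodic f = ∀ {a b} → a ≈ b → f a ≡ f b

  χ₀-periodic : Periodic χ₀
  χ₀-periodic = χ₀-≈

  𝟙-periodic : ∀ l → Periodic (𝟙 l)
  𝟙-periodic l {a} {b} e = ind-⇔ (a ≈? l) (b ≈? l) (trans (sym e)) (trans e)

  S-residue : ∀ (f : ℕ → F) c → Periodic f → S M (λ m → 𝟙 c m ⊗ f m) ≡ f c
  S-residue f c per = trans (S-single M (rep c) (proj₁ (rep-bounds c)) (proj₂ (rep-bounds c)) λ i p q i≢ →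
      ind-zero (i ≈? c) λ e → i≢ (range-unique p q (proj₁ (rep-bounds c)) (proj₂ (rep-bounds c)) (trans e (sym (rep-≈ c)))))
    (trans (ind-one (rep c ≈? c) (rep-≈ c)) (per (rep-≈ c)))

  S-𝟙 : ∀ c → S M (𝟙 c) ≡ ι 1
  S-𝟙 c = trans (S-cong M λ m _ _ → sym (⊗-identityʳ _)) (S-residue (λ _ → ι 1) c λ _ → refl)

  𝟙-sym : ∀ a b → 𝟙 a b ≡ 𝟙 b a
  𝟙-sym a b = ind-⇔ (b ≈? a) (a ≈? b) sym sym

  𝟙-quotient : ∀ l d (c : Coprime d M) → ∀ m → 𝟙 l (d * m) ≡ 𝟙 (proj₁ (inverse c) * l) m
  𝟙-quotient l d c m = ind-⇔ (d * m ≈? l) (m ≈? d′ * l)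
    (λ h → ≈-cancelˡ c (trans h (sym (dd′ l)))) (λ h → trans (≈-* {d} {d} refl h) (dd′ l))
    where
    d′ = proj₁ (inverse c)
    dd′ : ∀ l → d * (d′ * l) ≈ l
    dd′ l = trans (≈-≡ (sym (ℕₚ.*-assoc d d′ l))) (trans (≈-* {c = l} {l} (proj₂ (inverse c)) refl) (≈-≡ (ℕₚ.+-identityʳ l)))

  S-𝟙-multiple : ∀ l {d} → Coprime d M → S M (λ m → 𝟙 l (d * m)) ≡ ι 1
  S-𝟙-multiple l {d} c = trans (S-cong M λ m _ _ → 𝟙-quotient l d c m) (S-𝟙 _)

  χ₀-multiple : ∀ {d} → Coprime d M → ∀ m → χ₀ (d * m) ≡ χ₀ m
  χ₀-multiple {d} c m = ind-⇔ (coprime? (d * m) M) (coprime? m M) (coprime-*ʳ d) (coprime-* c)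

  𝟙-noncoprime : ∀ {l d} → Coprime l M → ¬ Coprime d M → ∀ m → 𝟙 l (d * m) ≡ ι 0
  𝟙-noncoprime {l} {d} cl ¬cd m = ind-no (d * m ≈? l) λ e → ¬cd (coprime-*ˡ m (coprime-≈ (sym e) cl))

  S-shift : ∀ (f : ℕ → F) → Periodic f → ∀ {g} → Coprime g M → S M (λ h → f (g * h)) ≡ S M f
  S-shift f per {g} c = begin
    S M (λ h → f (g * h)) ≡⟨ S-cong M (λ h _ _ → sym (S-residue f (g * h) per)) ⟩
    S M (λ h → S M λ k → 𝟙 (g * h) k ⊗ f k) ≡⟨ S-swap M M _ ⟩
    S M (λ k → S M λ h → 𝟙 (g * h) k ⊗ f k) ≡⟨ S-cong M (λ k _ _ →
      trans (S-cong M λ h _ _ → trans (⊗-comm _ _) (⊗-cong refl (𝟙-sym (g * h) k)))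
        (trans (S-⊗ M (f k) _) (trans (⊗-cong refl (S-𝟙-multiple k c)) (⊗-identityʳ _)))) ⟩
    S M f ∎ where open ≡-Reasoning

  periodic-shift : ∀ {f} → Periodic f → ∀ d i → f (d * (M + i)) ≡ f (d * i)
  periodic-shift {f} per d i = per (trans (≈-≡ (trans (ℕₚ.*-distribˡ-+ d M i) (ℕₚ.+-comm (d * M) (d * i))))
    ([m+kn]%n≡m%n (d * i) d M))

  -- Euler's φ(M), as a rational.
  N : F
  N = S M χ₀

  -- A decreasing weight sees all residue classes equally, up to its first value.
  class-equidistribution : ∀ X {d} l (Φ : ℕ → F) → Coprime d M → (∀ m → 1 ≤ m → m ≤ X → Φ (suc m) ≼ Φ m) → ι 0 ≼ Φ (suc X) →
    (ι M ⊗ S X (λ m → 𝟙 l (d * m) ⊗ Φ m) ⊝ S X Φ) within ι M ⊗ ι M ⊗ Φ 1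
  class-equidistribution X {d} l Φ c dec pos = subst (_within ι M ⊗ ι M ⊗ Φ 1)
    (trans (S-cong X λ m _ _ → ring 3 (λ M i p → (M :* i :- con 1) :* p := M :* (i :* p) :- p) _ _ _)
      (trans (S-⊝ X _ _) (cong₂ _⊝_ (S-⊗ X _ _) refl)))
    (abel-bound _ Φ _ X (periodic-bound (λ m → ι M ⊗ 𝟙 l (d * m) ⊝ ι 1) M (ι M) 1≤M
      (λ i _ → cong (λ z → ι M ⊗ z ⊝ ι 1) (periodic-shift (𝟙-periodic l) d i))
      (trans (S-⊝ M _ _) (trans (cong₂ _⊝_ (trans (S-⊗ M _ _) (trans (⊗-cong refl (S-𝟙-multiple l c)) (⊗-identityʳ _)))
        (trans (S-const M (ι 1)) (⊗-identityʳ _))) (⊕-inverseʳ _)))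
      λ i → linear 2 (λ M z → con 1 :≤ M ⨾ con 0 :≤ M :* z ⊢ :- M :≤ M :* z :- con 1) _ _ (ι-mono 1≤M)
        (0≼⊗ (0≼ι M) (𝟙-nonneg l (d * i))) ,
        linear 2 (λ M z → con 0 :≤ M :* (con 1 :- z) ⨾ con 0 :≤ con 1 ⊢ M :* z :- con 1 :≤ M) _ _
          (0≼⊗ (0≼ι M) (a≼b⇒0≼b-a (ind≼1 (d * i ≈? l)))) 0≼1) dec pos)

  -- Subtracting two classes removes the mean at once, so that no approximation of `S X Φ` enters.
  class-difference : ∀ X {d} l l′ (Φ : ℕ → F) → Coprime d M → (∀ m → 1 ≤ m → m ≤ X → Φ (suc m) ≼ Φ m) → ι 0 ≼ Φ (suc X) →
    S X (λ m → (𝟙 l (d * m) ⊝ 𝟙 l′ (d * m)) ⊗ Φ m) within ι M ⊗ ι 1 ⊗ Φ 1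
  class-difference X {d} l l′ Φ c dec pos = abel-bound _ Φ _ X (periodic-bound (λ m → 𝟙 l (d * m) ⊝ 𝟙 l′ (d * m)) M (ι 1) 1≤M
      (λ i _ → cong₂ _⊝_ (periodic-shift (𝟙-periodic l) d i) (periodic-shift (𝟙-periodic l′) d i))
      (trans (S-⊝ M _ _) (trans (cong₂ _⊝_ (S-𝟙-multiple l c) (S-𝟙-multiple l′ c)) (⊕-inverseʳ _)))
      λ i → linear 2 (λ z z′ → con 0 :≤ z ⨾ z′ :≤ con 1 ⊢ :- con 1 :≤ z :- z′) _ _ (𝟙-nonneg l (d * i)) (ind≼1 (d * i ≈? l′)) ,
        linear 2 (λ z z′ → con 0 :≤ z′ ⨾ z :≤ con 1 ⊢ z :- z′ :≤ con 1) _ _ (𝟙-nonneg l′ (d * i)) (ind≼1 (d * i ≈? l))) dec pos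

  S-classes : ∀ n → S M (λ l → χ₀ l ⊗ 𝟙 l n) ≡ χ₀ n
  S-classes n = trans (S-cong M λ l _ _ → trans (⊗-comm _ _) (⊗-cong (𝟙-sym l n) refl)) (S-residue χ₀ n χ₀-periodic)

-- Selberg's identity in residue classes

within-scale : ∀ {a b c} → ι 0 ≼ c → a within b → c ⊗ a within c ⊗ b
within-scale p h = within-⊗ (nonneg-within p) h

within-≡ : ∀ {a b c} → a within b → b ≡ c → a within c
within-≡ h refl = h

zero-within : ∀ {b} → ι 0 ≼ b → ι 0 within b
zero-within {b} p = linear 1 (λ b → con 0 :≤ b ⊢ :- b :≤ con 0) _ p , p

-- Chebyshev and Mertens estimates with smooth weights

module Moments (X : ℕ) (1≤X : 1 ≤ X) (lg : Logarithm X) (M : ℕ) {{M≢0 : NonZero M}} where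
  open VonMangoldt X 1≤X lg public
  open SmoothSums X 1≤X lg public
  open Residues M public

  beyond-square : ∀ {d m} → d ≤ X → m ≤ X → d * m ≤ suc (X * X)
  beyond-square p q = ℕₚ.m≤n⇒m≤1+n (ℕₚ.*-mono-≤ p q)

  L-shift : ∀ t d m → 1 ≤ d → 1 ≤ m → t ⊝ L (d * m) ≡ (t ⊝ L d) ⊝ L m
  L-shift t d m p q = trans (cong (t ⊝_) (L-* d m p q)) (ring 3 (λ t a b → t :- (a :+ b) := (t :- a) :- b) _ _ _)

  -- Additivity makes the weight of a product exactly the weight of m at the remaining time t - L d.
  -- For d m > X both sides vanish, as t ≤ L X < L (d m); this needs L to increase up to X².
  w-product : ∀ k {t} a d m → t ≼ L X → 1 ≤ d → d ≤ X → 1 ≤ m → m ≤ X →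
    ind (d * m ≤? X) ⊗ (a ⊗ w k t (d * m)) ≡ inv d ⊗ (a ⊗ w k (t ⊝ L d) m)
  w-product k {t} a d m t≼ p q r s with d * m ≤? X
  ... | yes _ = trans (⊗-identityˡ _) (trans (⊗-cong refl (⊗-cong (cong (pw k) (L-shift t d m p r)) (inv-* d m p r)))
     (ring 4 (λ a p d m → a :* (p :* (d :* m)) := d :* (a :* (p :* m))) _ _ _ _))
  ... | no dm≰X = trans (⊗-zeroˡ _) (sym (trans
    (⊗-cong refl (⊗-cong refl (⊗-cong (trans (cong (pw k) (sym (L-shift t d m p r)))
    (pw-beyond k t≼ (ℕₚ.≰⇒> dm≰X) (beyond-square q s))) refl)))
     (ring 3 (λ d a i → d :* (a :* (con 0 :* i)) := con 0) _ _ _)))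

  smooth-convolution : ∀ (c : ℕ → F) k {t} → t ≼ L X →
    S X (λ n → (c n ⊗ w k t n) ⊗ L n) ≡ S X (λ d → Λ d ⊗ (inv d ⊗ S X (λ m → c (d * m) ⊗ w k (t ⊝ L d) m)))
  smooth-convolution c k {t} t≼ = begin
    S X (λ n → (c n ⊗ w k t n) ⊗ L n) ≡⟨ S-cong X (λ n _ q → ⊗-cong (sym (ind-one (n ≤? X) q)) refl) ⟩
    S X (λ n → f n ⊗ L n) ≡⟨ log-convolution f (λ n X<n → ind-zero (n ≤? X) (ℕₚ.<⇒≱ X<n)) ⟩
    S X (λ d → Λ d ⊗ S X λ m → f (d * m)) ≡⟨ S-cong X (λ d p q →
      ⊗-cong refl (trans (S-cong X λ m r s → w-product k (c (d * m)) d m t≼ p q r s) (S-⊗ X (inv d) _))) ⟩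
    S X (λ d → Λ d ⊗ (inv d ⊗ S X (λ m → c (d * m) ⊗ w k (t ⊝ L d) m))) ∎
    where
    open ≡-Reasoning
    f : ℕ → F
    f n = ind (n ≤? X) ⊗ (c n ⊗ w k t n)

  t-L≼t : ∀ t {d} → 1 ≤ d → d ≤ X → t ⊝ L d ≼ t
  t-L≼t t p q = linear 2 (λ t l → con 0 :≤ l ⊢ t :- l :≤ t) _ _ (L-prime-nonneg p q)

  w-neg : ∀ k {s} m → 1 ≤ m → m ≤ X → s ≺ ι 0 → w k s m ≡ ι 0
  w-neg k {s} m p q h = trans (⊗-cong (pw-neg k (≼-≺-trans (t-L≼t s p q) h)) refl) (⊗-zeroˡ _)

  w-suc : ∀ k t n → w (suc k) t n ≡ t ⊗ w k t n ⊝ w k t n ⊗ L n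
  w-suc k t n = trans (⊗-cong (pw-suc k _) refl) (ring 4 (λ t l p i → (t :- l) :* p :* i := t :* (p :* i) :- p :* i :* l) _ _ _ _)

  w-mono : ∀ k {s t} n → s ≼ t → w k s n ≼ w k t n
  w-mono k n h = ⊗-monoˡ (inv-nonneg n) (pw-mono k (linear 3 (λ s t l → s :≤ t ⊢ s :- l :≤ t :- l) _ _ _ h))

  c₀ : F
  c₀ = ι M ⊗ ι M ⊕ ι 2

  c₀-nonneg : ι 0 ≼ c₀
  c₀-nonneg = 0≼⊕ (0≼⊗ (0≼ι M) (0≼ι M)) (0≼ι 2)

  class-sum : ℕ → ℕ → ℕ → F → F
  class-sum l d k s = S X (λ m → 𝟙 l (d * m) ⊗ w k s m)

  class-sum-coprime : ∀ l k {d s} → Coprime d M → ι 0 ≼ s → s ≼ L X →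
    (ι (suc k) ⊗ (ι M ⊗ class-sum l d k s) ⊝ s ^^ suc k) within (ι (suc k) ⊗ c₀) ⊗ s ^^ k
  class-sum-coprime l k {d} {s} c 0≼s s≼ = subst₂ _within_
    (ring 5 (λ k M a K p → k :* (M :* a :- K) :+ (k :* K :- p) := k :* (M :* a) :- p) _ _ _ _ _)
    (trans (⊕-cong (cong (λ z → ι (suc k) ⊗ (ι M ⊗ ι M ⊗ z)) (w-1 k 0≼s)) refl)
      (ring 3 (λ k M p → k :* (M :* M :* p) :+ con 2 :* k :* p := k :* (M :* M :+ con 2) :* p) _ _ _))
    (within-⊕ (within-scale (0≼ι (suc k)) (class-equidistribution X l (w k s) c (w-decreasing k s) (w-nonneg k s (suc X))))
      (S-w-approx k 0≼s s≼))

  -- The factor χ₀ d and the positive parts cover the degenerate cases: no d m lies in the reduced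
  -- class l unless d is a unit, and no weight is left when s < 0.
  class-sum-approx : ∀ {l} k {d s} → Coprime l M → s ≼ L X →
    (ι (suc k) ⊗ (ι M ⊗ class-sum l d k s) ⊝ χ₀ d ⊗ pw (suc k) s) within (ι (suc k) ⊗ c₀) ⊗ (χ₀ d ⊗ pw k s)
  class-sum-approx {l} k {d} {s} cl s≼ with coprime? d M
  ... | no ¬c = subst (_within (ι (suc k) ⊗ c₀) ⊗ (ι 0 ⊗ pw k s))
    (sym (trans (cong (λ z → ι (suc k) ⊗ (ι M ⊗ z) ⊝ ι 0 ⊗ pw (suc k) s)
        (S-zero X λ m _ _ → trans (⊗-cong (𝟙-noncoprime cl ¬c m) refl) (⊗-zeroˡ _)))
          (ring 3 (λ k M p → k :* (M :* con 0) :- con 0 :* p := con 0) _ _ _)))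
      (zero-within (0≼⊗ (0≼⊗ (0≼ι (suc k)) c₀-nonneg) (0≼⊗ ≼-refl (pw-nonneg k s))))
  ... | yes c with ≼? (ι 0) s
  ...   | inj₁ 0≼s = subst₂ _within_ (cong (ι (suc k) ⊗ (ι M ⊗ class-sum l d k s) ⊝_)
    (trans (sym (pw-pos (suc k) 0≼s)) (sym (⊗-identityˡ _))))
            (⊗-cong refl (trans (sym (pw-pos k 0≼s)) (sym (⊗-identityˡ _)))) (class-sum-coprime l k c 0≼s s≼)
  ...   | inj₂ s<0 = subst₂ _within_ (sym (trans (cong₂ (λ y z → ι (suc k) ⊗ (ι M ⊗ y) ⊝ ι 1 ⊗ z)
            (S-zero X λ m p q → trans (⊗-cong refl (w-neg k m p q s<0)) (⊗-zeroʳ _)) (pw-neg (suc k) s<0))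
              (ring 2 (λ k M → k :* (M :* con 0) :- con 1 :* con 0 := con 0) _ _)))
          refl (zero-within (0≼⊗ (0≼⊗ (0≼ι (suc k)) c₀-nonneg) (0≼⊗ 0≼1 (pw-nonneg k s))))

  -- For k ≥ 1 it is t^(k+1) / (k+1) up to lower order, by `moment-approx`: a smoothed form of
  -- Mertens' theorem.
  moment : ℕ → F → F
  moment k t = S X (λ d → Λ d ⊗ (χ₀ d ⊗ w k t d))

  log-class-sum : ℕ → ℕ → F → F
  log-class-sum l k t = S X (λ n → (𝟙 l n ⊗ w k t n) ⊗ L n)

  log-class-sum-moment : ∀ {l} k {t} → Coprime l M → t ≼ L X →
    (ι (suc k) ⊗ (ι M ⊗ log-class-sum l k t) ⊝ moment (suc k) t) within (ι (suc k) ⊗ c₀) ⊗ moment k t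
  log-class-sum-moment {l} k {t} cl t≼ = subst₂ _within_
    (trans (S-cong X λ d _ _ → ring 7 (λ Λ i k M a c p → Λ :* (i :* (k :* (M :* a) :- c :* p)) := k :* (M :* (Λ :* (i :* a))) :- Λ
      :* (c :* (p :* i))) _ _ _ _ _ _ _)
      (trans (S-⊝ X _ _) (cong₂ _⊝_ (trans (S-⊗ X _ _)
        (⊗-cong refl (trans (S-⊗ X _ _) (⊗-cong refl (sym (smooth-convolution (𝟙 l) k t≼)))))) refl)))
    (trans (S-cong X λ d _ _ → ring 6 (λ Λ i k c₀ c p → Λ :* (i :* (k :* c₀ :* (c :* p))) := k :* c₀ :* (Λ :* (c :* (p :* i)))) _
      _ _ _ _ _) (S-⊗ X _ _))
    (S-within X λ d p q → within-scale (Λ-nonneg d)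
      (within-scale (inv-nonneg d) (class-sum-approx {l} k {d} cl (≼-trans (t-L≼t t p q) t≼))))

  -- Writing L w_k = t w_k - w_(k+1), M times the sum has the main term t^(k+2) / ((k+1)(k+2)).
  -- `log-class-sum-moment` computes the same sum through Λ, and equating the two yields the
  -- moments.
  log-class-sum-value : ∀ l k {t} → ι 0 ≼ t → t ≼ L X →
    (ι (suc (suc k)) ⊗ (ι (suc k) ⊗ (ι M ⊗ log-class-sum l k t)) ⊝ t ^^ suc (suc k)) within
      (ι 2 ⊗ (ι (suc k) ⊗ (ι (suc (suc k)) ⊗ c₀))) ⊗ t ^^ suc k
  log-class-sum-value l k {t} 0≼t t≼ = subst₂ _within_
    (trans (cong (λ j → j ⊗ t ⊗ (ι (suc k) ⊗ (ι M ⊗ A) ⊝ t ^^ suc k) ⊕ ⊖ (ι (suc k) ⊗ (j ⊗ (ι M ⊗ B) ⊝ t ^^ suc (suc k))))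
      (ι-+ 1 (suc k)))
      (trans (ring 6 (λ k M a b t p → (con 1 :+ k) :* t :* (k :* (M :* a) :- p) :+ :- (k :* ((con 1 :+ k) :* (M :* b) :- t :* p))
        := (con 1 :+ k) :* (k :* (M :* (t :* a :- b))) :- t :* p) (ι (suc k)) (ι M) A B t (t ^^ suc k))
        (cong₂ (λ j s → j ⊗ (ι (suc k) ⊗ (ι M ⊗ s)) ⊝ t ^^ suc (suc k)) (sym (ι-+ 1 (suc k))) (sym split))))
    (ring 5 (λ j k c t p → j :* t :* (k :* c :* p) :+ k :* (j :* c :* (t :* p)) := con 2 :* (k :* (j :* c)) :* (t :* p)) _ _ _ _
      _)
    (within-⊕ (within-scale (0≼⊗ (0≼ι (suc (suc k))) 0≼t) (class-sum-coprime l k coprime-1 0≼t t≼))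
      (within-⊖ (within-scale (0≼ι (suc k)) (class-sum-coprime l (suc k) coprime-1 0≼t t≼))))
    where
    A B : F
    A = class-sum l 1 k t
    B = class-sum l 1 (suc k) t
    split : log-class-sum l k t ≡ t ⊗ A ⊝ B
    split = trans (S-cong X λ n _ _ → trans (ring 4 (λ i t w l → i :* w :* l := t :* (i :* w) :- i :* (t :* w :- w :* l)) _ _ _ _)
       (cong₂ (λ a b → t ⊗ (a ⊗ w k t n) ⊝ a ⊗ b) (cong (𝟙 l) (sym (ℕₚ.*-identityˡ n))) (sym (w-suc k t n))))
         (trans (S-⊝ X _ _) (cong₂ _⊝_ (S-⊗ X t _) refl))

  Chebyshev : F → F
  Chebyshev t = S X (λ d → Λ d ⊗ w 0 t d)

  Chebyshev-nonneg : ∀ t → ι 0 ≼ Chebyshev t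
  Chebyshev-nonneg t = S-nonneg X λ d _ _ → 0≼⊗ (Λ-nonneg d) (w-nonneg 0 t d)

  private
    -- The sum of L n / n over L n ≤ 2 t is at most 2 t (2 t + 2). It is also at least `Chebyshev t`
    -- times t - 2, because every d with L d ≤ t leaves at least the time t to its cofactor.
    Chebyshev-large : ∀ {t} → ι 4 ≼ t → t ⊕ t ≼ L X → Chebyshev t ≼ ι 8 ⊗ t ⊕ ι 8
    Chebyshev-large {t} 4≼t 2t≼ = ⊗-cancelˡ {c = t} (≺-≼-trans (ι0≺ι1+ 3) 4≼t)
      (linear 3 (λ t c R → 2 • (c :* (t :- con 2) :≤ R) ⨾ 2 • (R :≤ (t :+ t) :* (t :+ t :+ con 2)) ⨾ con 0 :≤ c :* (t :- con 4) ⊢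
      t :* c :≤ t :* (con 8 :* t :+ con 8)) _ _ _
        below above (0≼⊗ (Chebyshev-nonneg t) (a≼b⇒0≼b-a 4≼t)))
      where
      0≼t : ι 0 ≼ t
      0≼t = ≼-trans (0≼ι 4) 4≼t
      0≼2t : ι 0 ≼ t ⊕ t
      0≼2t = 0≼⊕ 0≼t 0≼t
      R : F
      R = S X (λ n → (ι 1 ⊗ w 0 (t ⊕ t) n) ⊗ L n)
      K-bounds : ∀ {s} → ι 0 ≼ s → s ≼ L X → (s ⊝ ι 2 ≼ S X (λ m → ι 1 ⊗ w 0 s m)) × (S X (λ m → ι 1 ⊗ w 0 s m) ≼ s ⊕ ι 2)
      K-bounds {s} p q = subst (λ K → (s ⊝ ι 2 ≼ K) × (K ≼ s ⊕ ι 2)) (sym (trans (S-⊗ X (ι 1) _) (⊗-identityˡ _)))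
        (linear 2 (λ s K → :- (con 2 :* con 1 :* con 1) :≤ con 1 :* K :- s :* con 1 ⊢ s :- con 2 :≤ K) _ _
          (proj₁ (S-w-approx 0 p q)) ,
         linear 2 (λ s K → con 1 :* K :- s :* con 1 :≤ con 2 :* con 1 :* con 1 ⊢ K :≤ s :+ con 2) _ _ (proj₂ (S-w-approx 0 p q)))
      above : R ≼ (t ⊕ t) ⊗ (t ⊕ t ⊕ ι 2)
      above = ≼-trans (S-mono X {g = λ n → (t ⊕ t) ⊗ (ι 1 ⊗ w 0 (t ⊕ t) n)} λ n _ _ →
        linear 3 (λ t v l → con 0 :≤ (t :* v :- v :* l) ⊢ con 1 :* v :* l :≤ t :* (con 1 :* v)) _ _ _
          (≼≡ (w-nonneg 1 (t ⊕ t) n) (w-suc 0 (t ⊕ t) n)))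
        (≼-trans (≼-reflexive (S-⊗ X _ _)) (⊗-monoʳ 0≼2t (proj₂ (K-bounds 0≼2t 2t≼))))
      below : Chebyshev t ⊗ (t ⊝ ι 2) ≼ R
      below = ≼-trans (≼-reflexive (trans (⊗-comm _ _) (sym (S-⊗ X _ _))))
        (≼≡ (S-mono X λ d p q → ≼-trans (≼-reflexive (ring 4 (λ t l p i → t :* (l :* (p :* i)) := l :* (i :* (p :* t))) _ _ _ _))
          (⊗-monoʳ (Λ-nonneg d) (⊗-monoʳ (inv-nonneg d) (term d p q)))) (sym (smooth-convolution (λ _ → ι 1) 0 2t≼)))
        where
        term : ∀ d → 1 ≤ d → d ≤ X → pw 0 (t ⊝ L d) ⊗ (t ⊝ ι 2) ≼ S X (λ m → ι 1 ⊗ w 0 (t ⊕ t ⊝ L d) m)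
        term d p q with ≼? (ι 0) (t ⊝ L d)
        ... | inj₁ h = ≡≼ (trans (⊗-cong (pw-pos 0 h) refl) (⊗-identityˡ _))
          (≼-trans (linear 2 (λ t l → con 0 :≤ t :- l ⊢ t :- con 2 :≤ t :+ t :- l :- con 2) _ _ h)
               (proj₁ (K-bounds (linear 2 (λ t l → con 0 :≤ t :- l ⨾ con 0 :≤ t ⊢ con 0 :≤ t :+ t :- l) _ _ h 0≼t)
                 (≼-trans (t-L≼t _ p q) 2t≼))))
        ... | inj₂ h = ≡≼ (trans (⊗-cong (pw-neg 0 h) refl) (⊗-zeroˡ _)) (S-nonneg X λ m _ _ → 0≼⊗ 0≼1 (w-nonneg 0 _ m))

  Chebyshev-mono : ∀ {s t} → s ≼ t → Chebyshev s ≼ Chebyshev t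
  Chebyshev-mono h = S-mono X λ d _ _ → ⊗-monoʳ (Λ-nonneg d) (w-mono 0 d h)

  -- Used at t + 4, the previous bound loses its condition 4 ≤ t. This is why each horizon provides
  -- for twice t + 4.
  Chebyshev-bound : ∀ {t} → ι 0 ≼ t → (t ⊕ ι 4) ⊕ (t ⊕ ι 4) ≼ L X → Chebyshev t ≼ ι 40 ⊗ (t ⊕ ι 1)
  Chebyshev-bound {t} 0≼t h = ≼-trans (Chebyshev-mono (linear 1 (λ t → con 0 :≤ con 4 ⊢ t :≤ t :+ con 4) t (0≼ι 4)))
    (≼-trans (Chebyshev-large (linear 1 (λ t → con 0 :≤ t ⊢ con 4 :≤ t :+ con 4) _ 0≼t) h)
    (linear 1 (λ t → 32 • (con 0 :≤ t) ⊢ con 8 :* (t :+ con 4) :+ con 8 :≤ con 40 :* (t :+ con 1)) _ 0≼t))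

  moment≼Chebyshev : ∀ k {t} → ι 0 ≼ t → moment k t ≼ t ^^ k ⊗ Chebyshev t
  moment≼Chebyshev k {t} 0≼t = ≼≡ (S-mono X {g = λ d → t ^^ k ⊗ (Λ d ⊗ w 0 t d)} λ d p q → ≼≡ (⊗-monoʳ (Λ-nonneg d)
      (≼-trans (⊗-monoˡ (w-nonneg k t d) (ind≼1 (coprime? d M)))
        (≡≼ (⊗-identityˡ _) (≼≡ (⊗-monoˡ (inv-nonneg d) (pw≼pw0 d p q)) (⊗-assoc _ _ _)))))
      (ring 3 (λ l p w → l :* (p :* w) := p :* (l :* w)) _ _ _)) (S-⊗ X _ _)
    where
    pw≼pw0 : ∀ d → 1 ≤ d → d ≤ X → pw k (t ⊝ L d) ≼ t ^^ k ⊗ pw 0 (t ⊝ L d)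
    pw≼pw0 d p q with ≼? (ι 0) (t ⊝ L d)
    ... | inj₁ h = ≼≡ (pw≼ k 0≼t p (ℕₚ.m≤n⇒m≤1+n (ℕₚ.≤-trans q X≤XX))) (sym (trans (⊗-cong refl (pw-pos 0 h)) (⊗-identityʳ _)))
    ... | inj₂ h = ≡≼ (pw-neg k h) (0≼⊗ (^^-nonneg k 0≼t) (pw-nonneg 0 _))

  -- 42 = 2 + 40, from `log-class-sum-value` and from `moment k` via `Chebyshev-bound`.
  moment-constant : ℕ → F
  moment-constant k = ι 42 ⊗ (ι (suc k) ⊗ (ι (suc (suc k)) ⊗ c₀))

  moment-approx : ∀ k {t} → ι 0 ≼ t → (t ⊕ ι 4) ⊕ (t ⊕ ι 4) ≼ L X →
    (ι (suc (suc k)) ⊗ moment (suc k) t ⊝ t ^^ suc (suc k)) within moment-constant k ⊗ (t ^^ suc k ⊕ t ^^ k)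
  moment-approx k {t} 0≼t h = within-mono (subst
    (_within ((ι 2 ⊗ (ι (suc k) ⊗ (ι (suc (suc k)) ⊗ c₀))) ⊗ t ^^ suc k ⊕ ι (suc (suc k)) ⊗ ((ι (suc k) ⊗ c₀) ⊗ moment k t)))
      (ring 4 (λ j s m p → (j :* s :- p) :+ :- (j :* (s :- m)) := j :* m :- p) _ _ _ _)
      (within-⊕ (log-class-sum-value 1 k 0≼t t≼) (within-⊖
        (within-scale (0≼ι (suc (suc k))) (log-class-sum-moment k coprime-1 t≼)))))
    (linear 6 (λ k j c t p m → con 0 :≤ k :* (j :* c) :* (p :* (con 40 :* (t :+ con 1)) :- m) ⨾
      2 • (con 0 :≤ k :* (j :* c) :* p) ⊢ con 2 :* (k :* (j :* c)) :* (t :* p) :+ j :* (k :* c :* m) :≤ con 42 :* (k :* (j :* c))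
      :* (t :* p :+ p)) _ _ _ _ _ _
      (0≼⊗ pos (a≼b⇒0≼b-a (≼-trans (moment≼Chebyshev k 0≼t) (⊗-monoʳ (^^-nonneg k 0≼t) (Chebyshev-bound 0≼t h)))))
        (0≼⊗ pos (^^-nonneg k 0≼t)))
    where
    pos : ι 0 ≼ ι (suc k) ⊗ (ι (suc (suc k)) ⊗ c₀)
    pos = 0≼⊗ (0≼ι (suc k)) (0≼⊗ (0≼ι (suc (suc k))) c₀-nonneg)
    t≼ : t ≼ L X
    t≼ = linear 2 (λ t l → (t :+ con 4) :+ (t :+ con 4) :≤ l ⨾ con 0 :≤ t ⨾ 8 • (con 0 :≤ con 1) ⊢ t :≤ l) _ _ h 0≼t 0≼1

-- Selberg's sums and their independence of the class

module Selberg (X : ℕ) (1≤X : 1 ≤ X) (lg : Logarithm X) (M : ℕ) {{M≢0 : NonZero M}} where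
  open Moments X 1≤X lg M public

  -- Selberg's identity log² = 1 * (Λ log + Λ * Λ), summed against f.
  module _ (f : ℕ → F) (vanish : ∀ n → X < n → f n ≡ ι 0) where
    Λ₂-sum : ℕ → F
    Λ₂-sum n = S X (λ e → Λ e ⊗ (L e ⊗ f (n * e))) ⊕ S X (λ e → Λ e ⊗ S X λ e′ → Λ e′ ⊗ f (n * e * e′))

    private
      big : ∀ m n → X < m → 1 ≤ n → X < n * m
      big m n X<m p = ℕₚ.≤-trans X<m (ℕₚ.m≤n*m m n {{>-nonZero p}})

      big′ : ∀ m n → X < m → 1 ≤ n → X < m * n
      big′ m n X<m p = subst (X <_) (ℕₚ.*-comm n m) (big m n X<m p)

    Λ₂-sum-vanishes : ∀ n → X < n → Λ₂-sum n ≡ ι 0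
    Λ₂-sum-vanishes n X<n = trans (⊕-cong
        (S-zero X λ e p _ → trans (⊗-cong refl (trans (⊗-cong refl (vanish (n * e) (big′ n e X<n p))) (⊗-zeroʳ _))) (⊗-zeroʳ _))
        (S-zero X λ e p _ → trans (⊗-cong refl (S-zero X λ e′ q _ →
          trans (⊗-cong refl (vanish (n * e * e′) (big′ (n * e) e′ (big′ n e X<n p) q))) (⊗-zeroʳ _))) (⊗-zeroʳ _)))
      (⊕-identityˡ _)

    private
      common : ℕ → F
      common n = S X λ e → Λ e ⊗ (L e ⊗ S X (λ k → f (n * (e * k))) ⊕ S X (λ e′ → Λ e′ ⊗ S X λ k → f (n * (e * (e′ * k)))))

      left : ∀ n → S X (λ k → Λ₂-sum (n * k)) ≡ common n
      left n = begin
        S X (λ k → Λ₂-sum (n * k)) ≡⟨ S-⊕ X _ _ ⟩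
        S X (λ k → S X (λ e → Λ e ⊗ (L e ⊗ f (n * k * e)))) ⊕ S X (λ k → S X (λ e → Λ e ⊗ S X λ e′ → Λ e′ ⊗ f (n * k * e * e′)))
          ≡⟨ ⊕-cong (S-swap X X _) (S-swap X X _) ⟩
        S X (λ e → S X (λ k → Λ e ⊗ (L e ⊗ f (n * k * e)))) ⊕ S X (λ e → S X (λ k → Λ e ⊗ S X λ e′ → Λ e′ ⊗ f (n * k * e * e′)))
          ≡⟨ sym (S-⊕ X _ _) ⟩
        S X (λ e → S X (λ k → Λ e ⊗ (L e ⊗ f (n * k * e))) ⊕ S X (λ k → Λ e ⊗ S X λ e′ → Λ e′ ⊗ f (n * k * e * e′)))
          ≡⟨ S-cong X (λ e _ _ → trans (⊕-cong (trans (S-⊗ X (Λ e) _)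
            (⊗-cong refl (trans (S-⊗ X (L e) _) (⊗-cong refl (S-cong X λ k _ _ → cong f (rearrange k e))))))
               (trans (S-⊗ X (Λ e) _) (⊗-cong refl (trans (S-swap X X _) (S-cong X λ e′ _ _ →
                 trans (S-⊗ X (Λ e′) _) (⊗-cong refl (S-cong X λ k _ _ → cong f (rearrange′ k e e′))))))))
               (sym (⊗-distribˡ _ _ _))) ⟩
        common n ∎
        where
        open ≡-Reasoning
        rearrange : ∀ k e → n * k * e ≡ n * (e * k)
        rearrange k e = trans (ℕₚ.*-assoc n k e) (cong (n *_) (ℕₚ.*-comm k e))
        rearrange′ : ∀ k e e′ → n * k * e * e′ ≡ n * (e * (e′ * k))
        rearrange′ k e e′ = trans (cong (_* e′) (rearrange k e))
          (trans (ℕₚ.*-assoc n (e * k) e′) (cong (n *_) (trans (ℕₚ.*-assoc e k e′) (cong (e *_) (ℕₚ.*-comm k e′)))))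

      -- `log-convolution` opens one factor L m, giving Λ e and L (e k) = L e + L k. The part L e is
      -- the Λ log term, and opening L k gives Λ * Λ.
      right : ∀ n → 1 ≤ n → S X (λ m → (f (n * m) ⊗ L m) ⊗ L m) ≡ common n
      right n 1≤n = begin
        S X (λ m → (f (n * m) ⊗ L m) ⊗ L m) ≡⟨ log-convolution (λ m → f (n * m) ⊗ L m) (λ m X<m →
          trans (⊗-cong (vanish (n * m) (big m n X<m 1≤n)) refl) (⊗-zeroˡ _)) ⟩
        S X (λ e → Λ e ⊗ S X λ k → f (n * (e * k)) ⊗ L (e * k)) ≡⟨ S-cong X (λ e p _ →
          ⊗-cong refl (trans (S-cong X λ k q _ → trans (⊗-cong refl (L-* e k p q))
          (trans (⊗-distribˡ _ _ _) (⊕-cong (⊗-comm _ _) refl)))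
             (trans (S-⊕ X _ _) (⊕-cong (S-⊗ X (L e) _) (log-convolution (λ k → f (n * (e * k))) λ k X<k →
               vanish _ (big (e * k) n (big k e X<k p) 1≤n)))))) ⟩
        common n ∎ where open ≡-Reasoning

    -- Selberg's identity controls `Λ₂-sum` only through its sums over multiples of d;
    -- `möbius-bound` recovers the value at 1.
    Λ₂-sum-bound : (b : ℕ → F) → (∀ d → 1 ≤ d → d ≤ X → S X (λ m → (f (d * m) ⊗ L m) ⊗ L m) within b d) → Λ₂-sum 1 within S X b
    Λ₂-sum-bound b h = möbius-bound X 1≤X Λ₂-sum Λ₂-sum-vanishes b λ d p q →
      subst (_within b d) (trans (right d p) (sym (left d))) (h d p q)

  -- The parts Λ log and Λ * Λ of Selberg's sum in class l. The factor φ will be 1 or L.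
  diagonal cross selberg-sum : (ℕ → F) → ℕ → F → F
  diagonal φ l t = S X (λ n → Λ n ⊗ (L n ⊗ (𝟙 l n ⊗ (φ n ⊗ w 1 t n))))
  cross φ l t = S X (λ d → Λ d ⊗ (inv d ⊗ S X (λ e → Λ e ⊗ (𝟙 l (d * e) ⊗ (φ (d * e) ⊗ w 1 (t ⊝ L d) e)))))
  selberg-sum φ l t = diagonal φ l t ⊕ cross φ l t

  -- Taking the difference of two classes before the inversion cancels the main terms, so that only
  -- error bounds pass through the Möbius function.
  selberg-difference : ∀ φ l l′ {t} → t ≼ L X → (b : ℕ → F) →
    (∀ d → 1 ≤ d → d ≤ X → inv d ⊗ S X (λ m → ((𝟙 l (d * m) ⊝ 𝟙 l′ (d * m)) ⊗ φ (d * m)) ⊗ ((L m ⊗ L m) ⊗ w 1 (t ⊝ L d) m)) within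
      b d) →
    (selberg-sum φ l t ⊝ selberg-sum φ l′ t) within S X b
  selberg-difference φ l l′ {t} t≼ b h = subst (_within S X b)
    (trans (⊕-cong diag cros) (ring 4 (λ a b c d → (a :- b) :+ (c :- d) := (a :+ c) :- (b :+ d)) _ _ _ _))
    (Λ₂-sum-bound f (λ n X<n → ind-zero (n ≤? X) (ℕₚ.<⇒≱ X<n)) b λ d p q →
      subst (_within b d) (sym (trans (S-cong X λ m r s → trans (⊗-cong (⊗-cong (w-product 1 _ d m t≼ p q r s) refl) refl)
        (ring 4 (λ i a w l → i :* (a :* w) :* l :* l := i :* (a :* ((l :* l) :* w))) _ _ _ _)) (S-⊗ X _ _))) (h d p q))
    where
    c f : ℕ → F
    c n = 𝟙 l n ⊝ 𝟙 l′ n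
    f n = ind (n ≤? X) ⊗ ((c n ⊗ φ n) ⊗ w 1 t n)
    diag : S X (λ e → Λ e ⊗ (L e ⊗ f (1 * e))) ≡ diagonal φ l t ⊝ diagonal φ l′ t
    diag = trans (S-cong X λ e _ q → trans (cong (λ n → Λ e ⊗ (L e ⊗ f n)) (ℕₚ.*-identityˡ e))
      (trans (⊗-cong refl (⊗-cong refl (ind-one (e ≤? X) q)))
      (ring 6 (λ Λ l a b p w → Λ :* (l :* ((a :- b) :* p :* w)) := Λ :* (l :* (a :* (p :* w))) :- Λ :* (l :* (b :* (p :* w)))) _ _
        _ _ _ _))) (S-⊝ X _ _)
    cros : S X (λ e → Λ e ⊗ S X λ e′ → Λ e′ ⊗ f (1 * e * e′)) ≡ cross φ l t ⊝ cross φ l′ t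
    cros = trans (S-cong X λ e p q → trans (⊗-cong refl
      (trans (S-cong X λ e′ r s → trans (cong (λ n → Λ e′ ⊗ f (n * e′)) (ℕₚ.*-identityˡ e))
      (trans (⊗-cong refl (w-product 1 _ e e′ t≼ p q r s))
      (ring 6 (λ Λ i a b p w → Λ :* (i :* ((a :- b) :* p :* w)) := i :* (Λ :* (a :* (p :* w)) :- Λ :* (b :* (p :* w)))) _ _ _ _ _
        _))) (trans (S-⊗ X _ _) (⊗-cong refl (S-⊝ X _ _)))))
      (ring 4 (λ Λ i a b → Λ :* (i :* (a :- b)) := Λ :* (i :* a) :- Λ :* (i :* b)) _ _ _ _)) (S-⊝ X _ _)

  -- (log² m + 8) / m and (log³ m + 108) / m are decreasing.
  private
    module Step (m : ℕ) (p : 1 ≤ m) (q : m ≤ X) where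
      δ : F
      δ = L (suc m) ⊝ L m
      δ≥0 : ι 0 ≼ δ
      δ≥0 = a≼b⇒0≼b-a (L-increasing m p (ℕₚ.≤-trans q X≤XX))
      δ≤2u : δ ≼ ι 2 ⊗ inv m
      δ≤2u = L-step≼2inv m p (ℕₚ.≤-trans q X≤XX)
      δ²≤4u : δ ⊗ δ ≼ ι 4 ⊗ inv m
      δ²≤4u = ≼-trans (⊗-mono (0≼⊗ (0≼ι 2) (inv-nonneg m)) δ≥0 δ≤2u δ≤2u)
        (linear 1 (λ u → 4 • (u :* u :≤ u) ⊢ con 2 :* u :* (con 2 :* u) :≤ con 4 :* u) _ u²≤u)
        where
        u²≤u : inv m ⊗ inv m ≼ inv m
        u²≤u = ≼≡ (⊗-monoʳ (inv-nonneg m) (inv≼1 m)) (⊗-identityʳ _)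
      δ³≤8u : δ ⊗ (δ ⊗ δ) ≼ ι 8 ⊗ inv m
      δ³≤8u = ≼-trans (⊗-mono (0≼⊗ (0≼ι 2) (inv-nonneg m)) (0≼⊗ δ≥0 δ≥0) δ≤2u δ²≤4u)
        (linear 1 (λ u → 8 • (u :* u :≤ u) ⊢ con 2 :* u :* (con 4 :* u) :≤ con 8 :* u) _
        (≼≡ (⊗-monoʳ (inv-nonneg m) (inv≼1 m)) (⊗-identityʳ _)))
      L≥0 : ι 0 ≼ L m
      L≥0 = L-prime-nonneg p q
      v≥0 : ι 0 ≼ inv (suc m)
      v≥0 = inv-nonneg (suc m)
      uv≥0 : ι 0 ≼ inv m ⊗ inv (suc m)
      uv≥0 = 0≼⊗ (inv-nonneg m) v≥0
      L′ : L (suc m) ≡ L m ⊕ δ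
      L′ = ring 2 (λ l l′ → l′ := l :+ (l′ :- l)) _ _

    α₂ α₃ : ℕ → F
    α₂ m = L m ⊗ L m ⊕ ι 8
    α₃ m = L m ⊗ (L m ⊗ L m) ⊕ ι 108

    -- Given δ ≤ 2 / m and δ² ≤ 4 / m, it remains that l² + 8 - 4 l - 4 = (l - 2)² is nonnegative.
    α₂-decreasing : ∀ m → 1 ≤ m → m ≤ X → α₂ (suc m) ⊗ inv (suc m) ≼ α₂ m ⊗ inv m
    α₂-decreasing m p q = subst (λ l → (l ⊗ l ⊕ ι 8) ⊗ inv (suc m) ≼ α₂ m ⊗ inv m) (sym L′)
      (linear 4 (λ l d u v → (l :* l :+ con 8) :* (u :* v) :≤ (l :* l :+ con 8) :* (u :- v) ⨾
        con 0 :≤ (u :* v) :* ((l :- con 2) :* (l :- con 2)) ⨾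
          2 • (con 0 :≤ l :* v :* (con 2 :* u :- d)) ⨾ con 0 :≤ v :* (con 4 :* u :- d :* d) ⊢
            ((l :+ d) :* (l :+ d) :+ con 8) :* v :≤ (l :* l :+ con 8) :* u) _ _ _ _
        (≼-reflexive (⊗-cong refl (sym (inv-difference m p)))) (0≼⊗ uv≥0 (square-nonneg _)) (0≼⊗ (0≼⊗ L≥0 v≥0) (a≼b⇒0≼b-a δ≤2u))
          (0≼⊗ v≥0 (a≼b⇒0≼b-a δ²≤4u)))
      where open Step m p q

    -- As for the square, now with l³ + 108 - 6 l² - 12 l - 8 = (l - 5)² (l + 4) + 3 l.
    α₃-decreasing : ∀ m → 1 ≤ m → m ≤ X → α₃ (suc m) ⊗ inv (suc m) ≼ α₃ m ⊗ inv m
    α₃-decreasing m p q = subst (λ l → (l ⊗ (l ⊗ l) ⊕ ι 108) ⊗ inv (suc m) ≼ α₃ m ⊗ inv m) (sym L′)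
      (linear 4 (λ l d u v → (l :* (l :* l) :+ con 108) :* (u :* v) :≤ (l :* (l :* l) :+ con 108) :* (u :- v) ⨾
        con 0 :≤ (u :* v) :* (((l :- con 5) :* (l :- con 5)) :* (l :+ con 4)) ⨾ 3 • (con 0 :≤ u :* v :* l) ⨾
          3 • (con 0 :≤ l :* l :* v :* (con 2 :* u :- d)) ⨾ 3 • (con 0 :≤ l :* v :* (con 4 :* u :- d :* d)) ⨾
            con 0 :≤ v :* (con 8 :* u :- d :* (d :* d)) ⊢ ((l :+ d) :* ((l :+ d) :* (l :+ d)) :+ con 108) :* v :≤
            (l :* (l :* l) :+ con 108) :* u) _ _ _ _
        (≼-reflexive (⊗-cong refl (sym (inv-difference m p)))) (0≼⊗ uv≥0 (0≼⊗ (square-nonneg _) (0≼⊕ L≥0 (0≼ι 4)))) (0≼⊗ uv≥0 L≥0)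
          (0≼⊗ (0≼⊗ (0≼⊗ L≥0 L≥0) v≥0) (a≼b⇒0≼b-a δ≤2u))
        (0≼⊗ (0≼⊗ L≥0 v≥0) (a≼b⇒0≼b-a δ²≤4u)) (0≼⊗ v≥0 (a≼b⇒0≼b-a δ³≤8u)))
      where open Step m p q

  module _ {l l′ : ℕ} (cl : Coprime l M) (cl′ : Coprime l′ M) where
    private
      c : ℕ → F
      c n = 𝟙 l n ⊝ 𝟙 l′ n

      -- The quotient a m / m may increase at first. Adding and subtracting A gives two decreasing
      -- weights, (a + A) w and A w, with the same first value.
      weighted-bound : ∀ (a : ℕ → F) (A : ℕ) → (∀ m → 1 ≤ m → m ≤ suc X → ι 0 ≼ a m) → a 1 ≡ ι 0 →
        (∀ m → 1 ≤ m → m ≤ X → (a (suc m) ⊕ ι A) ⊗ inv (suc m) ≼ (a m ⊕ ι A) ⊗ inv m) →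
        ∀ d {s} → s ≼ L X → S X (λ m → c (d * m) ⊗ (a m ⊗ w 1 s m)) within (ι 2 ⊗ ι A ⊗ ι M) ⊗ pw 1 s
      weighted-bound a A nn a1 dec d {s} s≼ with coprime? d M
      ... | no ¬c = subst (_within _) (sym (S-zero X λ m _ _ →
        trans (⊗-cong (cong₂ _⊝_ (𝟙-noncoprime cl ¬c m) (𝟙-noncoprime cl′ ¬c m)) refl)
              (ring 1 (λ a → (con 0 :- con 0) :* a := con 0) _)))
                (zero-within (0≼⊗ (0≼⊗ (0≼⊗ (0≼ι 2) (0≼ι A)) (0≼ι M)) (pw-nonneg 1 s)))
      ... | yes cd with ≼? (ι 0) s
      ...   | inj₂ s<0 = subst (_within _) (sym (S-zero X λ m p q → trans (⊗-cong refl (⊗-cong refl (w-neg 1 m p q s<0)))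
        (ring 2 (λ c a → c :* (a :* con 0) := con 0) _ _)))
              (zero-within (0≼⊗ (0≼⊗ (0≼⊗ (0≼ι 2) (0≼ι A)) (0≼ι M)) (pw-nonneg 1 s)))
      ...   | inj₁ 0≼s = subst₂ _within_
              (trans (sym (S-⊝ X _ _)) (S-cong X λ m _ _ → ring 4 (λ c a A w → c :* ((a :+ A) :* w) :- c :* (A :* w) := c :*
                (a :* w)) _ _ _ _))
              (trans (⊕-cong (⊗-cong refl (⊗-cong (cong (_⊕ ι A) a1) w1)) (⊗-cong refl (⊗-cong refl w1)))
                (trans (ring 3 (λ M A p → M :* con 1 :* ((con 0 :+ A) :* p) :+ M :* con 1 :* (A :* p) := con 2 :* A :* M :* p) _ _
                _) refl))
              (within-⊕ (class-difference X l l′ (λ m → (a m ⊕ ι A) ⊗ w 1 s m) cd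
                  (λ m p q → subst₂ _≼_ (ring 3 (λ a i p → (a :* i) :* p := a :* (p :* i)) _ _ _)
                    (ring 3 (λ a i p → (a :* i) :* p := a :* (p :* i)) _ _ _)
                     (⊗-mono (0≼⊗ (0≼⊕ (nn m p (ℕₚ.m≤n⇒m≤1+n q)) (0≼ι A)) (inv-nonneg m)) (pw-nonneg 1 _) (dec m p q)
                       (pw-mono 1 (linear 3 (λ s l l′ → l :≤ l′ ⊢ s :- l′ :≤ s :- l) _ _ _
                       (L-increasing m p (ℕₚ.≤-trans q X≤XX))))))
                  (0≼⊗ (0≼⊕ (nn (suc X) (s≤s z≤n) ℕₚ.≤-refl) (0≼ι A)) (w-nonneg 1 s (suc X))))
                (within-⊖ (class-difference X l l′ (λ m → ι A ⊗ w 1 s m) cd (λ m p q → ⊗-monoʳ (0≼ι A) (w-decreasing 1 s m p q))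
                  (0≼⊗ (0≼ι A) (w-nonneg 1 s (suc X))))))
        where
        w1 : w 1 s 1 ≡ pw 1 s
        w1 = trans (w-1 1 0≼s) (sym (pw-pos 1 0≼s))

      L≥0′ : ∀ m → 1 ≤ m → m ≤ suc X → ι 0 ≼ L m
      L≥0′ m p q = L-nonneg p (ℕₚ.≤-trans q (s≤s X≤XX))

      log-square-bound : ∀ d {s} → s ≼ L X → S X (λ m → c (d * m) ⊗ ((L m ⊗ L m) ⊗ w 1 s m)) within (ι 2 ⊗ ι 8 ⊗ ι M) ⊗ pw 1 s
      log-square-bound = weighted-bound (λ m → L m ⊗ L m) 8 (λ m _ _ → square-nonneg _) (trans (⊗-cong L-1 refl) (⊗-zeroˡ _))
        α₂-decreasing

      log-cube-bound : ∀ d {s} → s ≼ L X → S X (λ m → c (d * m) ⊗ ((L m ⊗ (L m ⊗ L m)) ⊗ w 1 s m)) within (ι 2 ⊗ ι 108 ⊗ ι M) ⊗ pw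
        1 s
      log-cube-bound = weighted-bound (λ m → L m ⊗ (L m ⊗ L m)) 108 (λ m p q → 0≼⊗ (L≥0′ m p q) (square-nonneg _))
        (trans (⊗-cong L-1 refl) (⊗-zeroˡ _)) α₃-decreasing

    selberg-class-independent : ∀ {t} → t ≼ L X → (selberg-sum (λ _ → ι 1) l t ⊝ selberg-sum (λ _ → ι 1) l′ t) within
      (ι 2 ⊗ ι 8 ⊗ ι M) ⊗ S X (w 1 t)
    selberg-class-independent {t} t≼ = within-≡ (selberg-difference (λ _ → ι 1) l l′ t≼ (λ d → (ι 2 ⊗ ι 8 ⊗ ι M) ⊗ w 1 t d) λ d p
      q →
      subst₂ _within_ (⊗-cong refl (S-cong X λ m _ _ → ⊗-cong (sym (⊗-identityʳ _)) refl))
        (ring 3 (λ i K p → i :* (K :* p) := K :* (p :* i)) _ _ _)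
        (within-scale (inv-nonneg d) (log-square-bound d (≼-trans (t-L≼t t p q) t≼)))) (S-⊗ X _ _)

    -- With φ = L, additivity L (d m) = L d + L m reduces the claim to `log-square-bound` and
    -- `log-cube-bound`; L d is at most t wherever the weight is not 0.
    weighted-selberg-class-independent : ∀ {t} → ι 0 ≼ t → t ≼ L X → (selberg-sum L l t ⊝ selberg-sum L l′ t) within
      ((ι 2 ⊗ ι 8 ⊗ ι M) ⊗ t ⊕ ι 2 ⊗ ι 108 ⊗ ι M) ⊗ S X (w 1 t)
    weighted-selberg-class-independent {t} 0≼t t≼ =
      within-≡ (selberg-difference L l l′ t≼ (λ d → ((ι 2 ⊗ ι 8 ⊗ ι M) ⊗ t ⊕ ι 2 ⊗ ι 108 ⊗ ι M) ⊗ w 1 t d) λ d p q →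
      within-mono (subst (_within _) (⊗-cong refl (trans (⊕-cong (sym (S-⊗ X (L d) _)) refl)
        (trans (sym (S-⊕ X _ _)) (S-cong X λ m r s → trans
            (ring 4 (λ c l m w → l :* (c :* (m :* m :* w)) :+ c :* (m :* (m :* m) :* w) := c :* (l :+ m) :* ((m :* m) :* w)) _ _ _
              _) (⊗-cong (⊗-cong refl (sym (L-* d m p r))) refl)))))
          (within-scale (inv-nonneg d) (within-⊕ (within-scale (L-prime-nonneg p q)
            (log-square-bound d (≼-trans (t-L≼t t p q) t≼))) (log-cube-bound d (≼-trans (t-L≼t t p q) t≼)))))
        (linear 6 (λ i l t K K′ u → con 0 :≤ K :* i :* (t :* u :- u :* l) ⊢ i :* (l :* (K :* u) :+ K′ :* u) :≤ (K :* t :+ K′) :*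
          (u :* i)) _ _ _ _ _ _
          (0≼⊗ (0≼⊗ (0≼⊗ (0≼⊗ (0≼ι 2) (0≼ι 8)) (0≼ι M)) (inv-nonneg d))
            (≼≡ (pw-nonneg 2 (t ⊝ L d)) (trans (pw-suc 1 _) (ring 3 (λ t l p → (t :- l) :* p := t :* p :- p :* l) _ _ _))))))
            (S-⊗ X _ _)

-- Densities of the residue classes

module Densities (X : ℕ) (1≤X : 1 ≤ X) (lg : Logarithm X) (M : ℕ) {{M≢0 : NonZero M}} where
  open Selberg X 1≤X lg M public

  -- The mass of Λ log in class l. All reduced classes together carry about t³ / 6, so t³ / (6 N) is
  -- an even share, whereas Selberg's sum `P` is about t³ / (3 N) in every reduced class.
  Q : ℕ → F → F
  Q l t = S X (λ n → Λ n ⊗ (𝟙 l n ⊗ (L n ⊗ w 1 t n)))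

  Q-total : F → F
  Q-total t = S X (λ n → Λ n ⊗ (χ₀ n ⊗ (L n ⊗ w 1 t n)))

  A : ℕ → F → F
  A l t = S X (λ n → Λ n ⊗ (𝟙 l n ⊗ w 0 t n))

  P : ℕ → F → F
  P = selberg-sum (λ _ → ι 1)

  Lw-nonneg : ∀ k t n → 1 ≤ n → n ≤ X → ι 0 ≼ L n ⊗ w k t n
  Lw-nonneg k t n p q = 0≼⊗ (L-prime-nonneg p q) (w-nonneg k t n)

  Q-nonneg : ∀ l t → ι 0 ≼ Q l t
  Q-nonneg l t = S-nonneg X λ n p q → 0≼⊗ (Λ-nonneg n) (0≼⊗ (𝟙-nonneg l n) (Lw-nonneg 1 t n p q))

  A-nonneg : ∀ l t → ι 0 ≼ A l t
  A-nonneg l t = S-nonneg X λ n _ _ → 0≼⊗ (Λ-nonneg n) (0≼⊗ (𝟙-nonneg l n) (w-nonneg 0 t n))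

  Q-mono : ∀ l {s t} → s ≼ t → Q l s ≼ Q l t
  Q-mono l h = S-mono X λ n p q → ⊗-monoʳ (Λ-nonneg n) (⊗-monoʳ (𝟙-nonneg l n) (⊗-monoʳ (L-prime-nonneg p q) (w-mono 1 n h)))

  Lw-bound : ∀ {t} n → 1 ≤ n → n ≤ X → ι 0 ≼ t → L n ⊗ w 1 t n ≼ (t ⊗ t) ⊗ w 0 t n
  Lw-bound {t} n p q 0≼t with ≼? (ι 0) (t ⊝ L n)
  ... | inj₂ h = subst₂ _≼_ (sym (trans (⊗-cong refl (⊗-cong (pw-neg 1 h) refl))
    (ring 2 (λ l i → l :* (con 0 :* i) := con 0) _ _)))
          (sym (trans (⊗-cong refl (⊗-cong (pw-neg 0 h) refl)) (ring 2 (λ t i → t :* t :* (con 0 :* i) := con 0) _ _))) ≼-refl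
  ... | inj₁ h = subst₂ _≼_ (⊗-cong refl (⊗-cong (sym (pw-pos 1 h)) refl)) (⊗-cong refl (⊗-cong (sym (pw-pos 0 h)) refl))
      (linear 3 (λ t l i → con 0 :≤ i :* (t :* (t :- l)) ⨾ con 0 :≤ i :* (l :* l) ⊢ l :* ((t :- l) :* con 1 :* i) :≤ t :* t :*
        (con 1 :* i)) _ _ _
        (0≼⊗ (inv-nonneg n) (0≼⊗ 0≼t h)) (0≼⊗ (inv-nonneg n) (square-nonneg _)))

  Q≼A : ∀ l {t} → ι 0 ≼ t → Q l t ≼ (t ⊗ t) ⊗ A l t
  Q≼A l {t} 0≼t = ≼≡ (S-mono X {g = λ n → (t ⊗ t) ⊗ (Λ n ⊗ (𝟙 l n ⊗ w 0 t n))} λ n p q →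
    ≼≡ (⊗-monoʳ (Λ-nonneg n) (⊗-monoʳ (𝟙-nonneg l n) (Lw-bound n p q 0≼t)))
    (ring 4 (λ a b t c → a :* (b :* (t :* c)) := t :* (a :* (b :* c))) _ _ _ _)) (S-⊗ X _ _)

  Q≼P : ∀ l t → Q l t ≼ P l t
  Q≼P l t = linear 3 (λ q d c → q :≤ d ⨾ con 0 :≤ c ⊢ q :≤ d :+ c) _ _ _
    (≼-reflexive (S-cong X λ n _ _ → ring 4 (λ a b l c → a :* (b :* (l :* c)) := a :* (l :* (b :* (con 1 :* c)))) _ _ _ _))
    (S-nonneg X λ d _ _ → 0≼⊗ (Λ-nonneg d) (0≼⊗ (inv-nonneg d) (S-nonneg X λ e _ _ →
      0≼⊗ (Λ-nonneg e) (0≼⊗ (𝟙-nonneg l (d * e)) (0≼⊗ 0≼1 (w-nonneg 1 _ e))))))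

  S-S-classes : ∀ (f : ℕ → F) → S M (λ l → χ₀ l ⊗ S X (λ n → Λ n ⊗ (𝟙 l n ⊗ f n))) ≡ S X (λ n → Λ n ⊗ (χ₀ n ⊗ f n))
  S-S-classes f = trans (S-cong M λ l _ _ → sym (S-⊗ X _ _)) (trans (S-swap M X _) (S-cong X λ n _ _ →
    trans (S-cong M λ l _ _ → ring 4 (λ c a b f → c :* (a :* (b :* f)) := a :* f :* (c :* b)) _ _ _ _)
      (trans (S-⊗ M _ _) (trans (⊗-cong refl (S-classes n)) (ring 3 (λ a f c → a :* f :* c := a :* (c :* f)) _ _ _)))))

  Q-classes : ∀ t → S M (λ l → χ₀ l ⊗ Q l t) ≡ Q-total t
  Q-classes t = S-S-classes _

  χ₀-* : ∀ d e → χ₀ (d * e) ≡ χ₀ d ⊗ χ₀ e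
  χ₀-* d e with coprime? d M
  ... | yes c = trans (χ₀-multiple c e) (sym (⊗-identityˡ _))
  ... | no ¬c = trans (ind-no (coprime? (d * e) M) (¬c ∘ coprime-*ˡ e)) (sym (⊗-zeroˡ _))

  cross-total : (ℕ → F) → F → F
  cross-total φ t = S X (λ d → Λ d ⊗ (inv d ⊗ (χ₀ d ⊗ S X (λ e → Λ e ⊗ (χ₀ e ⊗ (φ (d * e) ⊗ w 1 (t ⊝ L d) e))))))

  cross-classes : ∀ φ t → S M (λ l → χ₀ l ⊗ cross φ l t) ≡ cross-total φ t
  cross-classes φ t = trans (S-cong M λ l _ _ →
    trans (sym (S-⊗ X _ _)) (S-cong X λ d _ _ → trans (ring 4 (λ c a i s → c :* (a :* (i :* s)) := a :* (i :* (c :* s))) _ _ _ _)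
    (⊗-cong refl (⊗-cong refl (sym (S-⊗ X _ _))))))
    (trans (S-swap M X _) (S-cong X λ d _ _ → trans (S-⊗ M _ _)
      (⊗-cong refl (trans (S-⊗ M _ _) (⊗-cong refl (trans (S-swap M X _) (trans (S-cong X λ e _ _ →
      trans (S-cong M λ l _ _ → ring 4 (λ c a b f → c :* (a :* (b :* f)) := a :* f :* (c :* b)) _ _ _ _)
        (trans (S-⊗ M _ _) (trans (⊗-cong refl (trans (S-classes (d * e)) (χ₀-* d e)))
        (ring 4 (λ a f c e → a :* f :* (c :* e) := c :* (a :* (e :* f))) _ _ _ _)))) (S-⊗ X _ _))))))))

  diagonal-total : (ℕ → F) → F → F
  diagonal-total φ t = S X (λ n → Λ n ⊗ (χ₀ n ⊗ (L n ⊗ (φ n ⊗ w 1 t n))))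

  diagonal-classes : ∀ φ t → S M (λ l → χ₀ l ⊗ diagonal φ l t) ≡ diagonal-total φ t
  diagonal-classes φ t = trans (S-cong M λ l _ _ →
    ⊗-cong refl (S-cong X λ n _ _ → ring 4 (λ a l i f → a :* (l :* (i :* f)) := a :* (i :* (l :* f))) _ _ _ _)) (S-S-classes _)

  selberg-classes : ∀ φ t → S M (λ l → χ₀ l ⊗ selberg-sum φ l t) ≡ diagonal-total φ t ⊕ cross-total φ t
  selberg-classes φ t = trans (S-cong M λ l _ _ → ⊗-distribˡ _ _ _)
    (trans (S-⊕ M _ _) (⊕-cong (diagonal-classes φ t) (cross-classes φ t)))

  -- If a class function varies by at most b, then N times each value is the total up to N b.
  class-average : ∀ (f : ℕ → F) b l → ι 0 ≼ b → (∀ l′ → Coprime l′ M → (f l ⊝ f l′) within b) →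
    (N ⊗ f l ⊝ S M (λ l′ → χ₀ l′ ⊗ f l′)) within N ⊗ b
  class-average f b l 0≼b h = subst₂ _within_
    (trans (S-cong M λ l′ _ _ → ring 3 (λ c a b → c :* (a :- b) := a :* c :- c :* b) _ _ _)
      (trans (S-⊝ M _ _) (cong₂ _⊝_ (trans (S-⊗ M _ _) (⊗-comm _ _)) refl)))
    (trans (S-cong M λ l′ _ _ → ⊗-comm _ _) (trans (S-⊗ M _ _) (⊗-comm _ _)))
    (S-within M λ l′ _ _ → term l′ (coprime? l′ M))
    where
    term : ∀ l′ (d : Dec (Coprime l′ M)) → ind d ⊗ (f l ⊝ f l′) within ind d ⊗ b
    term l′ (yes c) = within-scale 0≼1 (h l′ c)
    term l′ (no _) = subst₂ _within_ (sym (⊗-zeroˡ _)) (sym (⊗-zeroˡ _)) (zero-within ≼-refl)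

  N-nonneg : ι 0 ≼ N
  N-nonneg = S-nonneg M λ l _ _ → ind-nonneg (coprime? l M)

  -- 504 = 42 · 3 · 4 dominates the factors of `moment-constant k` for k = 0, 1, 2.
  κ : F
  κ = ι 504 ⊗ c₀

  κ-nonneg : ι 0 ≼ κ
  κ-nonneg = 0≼⊗ (0≼ι 504) c₀-nonneg

  -- Half of the errors met in `P-within`: (5 + 121) κ and 6 · 16 · 2 N M.
  κ₁ : F
  κ₁ = ι 63 ⊗ κ ⊕ ι 96 ⊗ (N ⊗ ι M)

  NM-nonneg : ι 0 ≼ N ⊗ ι M
  NM-nonneg = 0≼⊗ N-nonneg (0≼ι M)

  κ₁-nonneg : ι 0 ≼ κ₁
  κ₁-nonneg = 0≼⊕ (0≼⊗ (0≼ι 63) κ-nonneg) (0≼⊗ (0≼ι 96) NM-nonneg)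

  private
    κ-bound : ∀ k {t} → moment-constant k ≼ κ → ι 0 ≼ t → (t ⊕ ι 4) ⊕ (t ⊕ ι 4) ≼ L X →
      (ι (suc (suc k)) ⊗ moment (suc k) t ⊝ t ^^ suc (suc k)) within κ ⊗ (t ^^ suc k ⊕ t ^^ k)
    κ-bound k h 0≼t adm = within-mono (moment-approx k 0≼t adm) (⊗-monoˡ (0≼⊕ (^^-nonneg (suc k) 0≼t) (^^-nonneg k 0≼t)) h)

  -- All times below lie between 0 and T.
  module Horizon (T : F) (0≼T : ι 0 ≼ T) (horizon : (T ⊕ ι 4) ⊕ (T ⊕ ι 4) ≼ L X) where
    V : F
    V = T ⊕ ι 1

    0≼V : ι 0 ≼ V
    0≼V = 0≼⊕ 0≼T 0≼1

    admissible : ∀ {s} → s ≼ T → (s ⊕ ι 4) ⊕ (s ⊕ ι 4) ≼ L X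
    admissible h = ≼-trans (⊕-mono (⊕-mono h ≼-refl) (⊕-mono h ≼-refl)) horizon

    T≼LX : T ≼ L X
    T≼LX = linear 2 (λ t l → (t :+ con 4) :+ (t :+ con 4) :≤ l ⨾ con 0 :≤ t ⨾ 8 • (con 0 :≤ con 1) ⊢ t :≤ l) _ _ horizon 0≼T 0≼1

    module _ {s} (0≼s : ι 0 ≼ s) (s≼T : s ≼ T) where
      s≼LX : s ≼ L X
      s≼LX = ≼-trans s≼T T≼LX

      private
        adm = admissible s≼T

        le : ∀ (k : ℕ) (j : ℕ) → ι 42 ⊗ (ι (suc k) ⊗ ι (suc (suc k))) ⊕ ι j ≡ ι 504 → moment-constant k ≼ κ
        le k j e = subst (λ c → moment-constant k ≼ c ⊗ c₀) e
          (linear 4 (λ a b j c → con 0 :≤ j :* c ⊢ con 42 :* (a :* (b :* c)) :≤ (con 42 :* (a :* b) :+ j) :* c) _ _ _ _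
          (0≼⊗ (0≼ι j) c₀-nonneg))

      moment₁ : (ι 2 ⊗ moment 1 s ⊝ s ⊗ s) within κ ⊗ (s ⊕ ι 1)
      moment₁ = subst₂ _within_ (ring 2 (λ m s → con 2 :* m :- s :* (s :* con 1) := con 2 :* m :- s :* s) _ _)
        (ring 2 (λ k s → k :* (s :* con 1 :+ con 1) := k :* (s :+ con 1)) _ _)
        (κ-bound 0 (le 0 420 (ring 0 (con 42 :* (con 1 :* con 2) :+ con 420 := con 504))) 0≼s adm)

      moment₂ : (ι 3 ⊗ moment 2 s ⊝ s ⊗ (s ⊗ s)) within κ ⊗ (s ⊗ s ⊕ s)
      moment₂ = subst₂ _within_ (ring 2 (λ m s → con 3 :* m :- s :* (s :* (s :* con 1)) := con 3 :* m :- s :* (s :* s)) _ _)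
        (ring 2 (λ k s → k :* (s :* (s :* con 1) :+ s :* con 1) := k :* (s :* s :+ s)) _ _)
        (κ-bound 1 (le 1 252 (ring 0 (con 42 :* (con 2 :* con 3) :+ con 252 := con 504))) 0≼s adm)

      moment₃ : (ι 4 ⊗ moment 3 s ⊝ s ⊗ (s ⊗ (s ⊗ s))) within κ ⊗ (s ⊗ (s ⊗ s) ⊕ s ⊗ s)
      moment₃ = subst₂ _within_ (ring 2 (λ m s → con 4 :* m :- s :* (s :* (s :* (s :* con 1))) := con 4 :* m :- s :*
        (s :* (s :* s))) _ _) (ring 2 (λ k s → k :* (s :* (s :* (s :* con 1)) :+ s :* (s :* con 1)) := k :*
        (s :* (s :* s) :+ s :* s)) _ _)
        (κ-bound 2 (le 2 0 (ring 0 (con 42 :* (con 3 :* con 4) :+ con 0 := con 504))) 0≼s adm)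

      moment₀≼ : moment 0 s ≼ ι 40 ⊗ (s ⊕ ι 1)
      moment₀≼ = ≼-trans (moment≼Chebyshev 0 0≼s) (≡≼ (⊗-identityˡ _) (Chebyshev-bound 0≼s adm))

      moment₁≼ : moment 1 s ≼ s ⊗ (ι 40 ⊗ (s ⊕ ι 1))
      moment₁≼ = ≼-trans (moment≼Chebyshev 1 0≼s) (≡≼ (⊗-cong (⊗-identityʳ _) refl) (⊗-monoʳ 0≼s (Chebyshev-bound 0≼s adm)))

      Lw-split : ∀ n → L n ⊗ w 1 s n ≡ s ⊗ w 1 s n ⊝ w 2 s n
      Lw-split n = trans (ring 3 (λ l s w → l :* w := s :* w :- (s :* w :- w :* l)) _ _ _) (cong₂ _⊝_ refl (sym (w-suc 1 s n)))

      Q-total≡ : Q-total s ≡ s ⊗ moment 1 s ⊝ moment 2 s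
      Q-total≡ = trans (S-cong X λ n _ _ → trans (⊗-cong refl (⊗-cong refl (Lw-split n)))
        (ring 5 (λ a c s x y → a :* (c :* (s :* x :- y)) := s :* (a :* (c :* x)) :- a :* (c :* y)) _ _ _ _ _))
        (trans (S-⊝ X _ _) (cong₂ _⊝_ (S-⊗ X _ _) refl))

      -- L w₁ = s w₁ - w₂ gives s · s² / 2 - s³ / 3 = s³ / 6.
      Q-total-approx : (ι 6 ⊗ Q-total s ⊝ s ⊗ (s ⊗ s)) within ι 5 ⊗ (κ ⊗ (s ⊗ s ⊕ s))
      Q-total-approx = subst₂ _within_
        (trans (ring 3 (λ s m n → con 3 :* s :* (con 2 :* m :- s :* s) :+ :- (con 2 :* (con 3 :* n :- s :* (s :* s))) := con 6 :*
          (s :* m :- n) :- s :* (s :* s)) _ _ _) (cong (λ q → ι 6 ⊗ q ⊝ s ⊗ (s ⊗ s)) (sym Q-total≡)))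
        (ring 2 (λ s k → con 3 :* s :* (k :* (s :+ con 1)) :+ con 2 :* (k :* (s :* s :+ s)) := con 5 :* (k :* (s :* s :+ s))) _ _)
        (within-⊕ (within-scale (0≼⊗ (0≼ι 3) 0≼s) moment₁) (within-⊖ (within-scale (0≼ι 2) moment₂)))

    ss+s≼VV : ∀ {s} → ι 0 ≼ s → s ≼ T → s ⊗ s ⊕ s ≼ V ⊗ V
    ss+s≼VV {s} p q = linear 2 (λ s t → s :* s :≤ t :* t ⨾ s :≤ t ⨾ con 0 :≤ t ⨾ con 0 :≤ con 1 ⊢
      s :* s :+ s :≤ (t :+ con 1) :* (t :+ con 1)) _ _ (⊗-mono 0≼T p q q) q 0≼T 0≼1

    Q-total-within : ∀ {s} → ι 0 ≼ s → s ≼ T → (ι 6 ⊗ Q-total s ⊝ s ⊗ (s ⊗ s)) within ι 5 ⊗ (κ ⊗ (V ⊗ V))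
    Q-total-within p q = within-mono (Q-total-approx p q) (⊗-monoʳ (0≼ι 5) (⊗-monoʳ κ-nonneg (ss+s≼VV p q)))

    moment-neg : ∀ k {s} → s ≺ ι 0 → moment k s ≡ ι 0
    moment-neg k h = S-zero X λ d p q → trans (⊗-cong refl (⊗-cong refl (w-neg k d p q h)))
      (ring 2 (λ a c → a :* (c :* con 0) := con 0) _ _)

    moment₁-pw : ∀ {u} → u ≼ T → (ι 2 ⊗ moment 1 u ⊝ pw 2 u) within κ ⊗ (pw 1 u ⊕ pw 0 u)
    moment₁-pw {u} h with ≼? (ι 0) u
    ... | inj₁ p = subst₂ _within_ (cong₂ _⊝_ refl (trans (ring 1 (λ u → u :* u := u :* (u :* con 1)) _) (sym (pw-pos 2 p))))
      (⊗-cong refl (⊕-cong (trans (sym (⊗-identityʳ _)) (sym (pw-pos 1 p))) (sym (pw-pos 0 p)))) (moment₁ p h)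
    ... | inj₂ n = subst (_within _) (sym (trans (cong₂ (λ a b → ι 2 ⊗ a ⊝ b) (moment-neg 1 n) (pw-neg 2 n))
      (ring 0 (con 2 :* con 0 :- con 0 := con 0)))) (zero-within (0≼⊗ κ-nonneg (0≼⊕ (pw-nonneg 1 u) (pw-nonneg 0 u))))

    -- The inner sum is a first moment, about (s - L d)² / 2, so the double sum is about half a
    -- second moment: s³ / 6.
    cross-total₁ : ∀ {s} → ι 0 ≼ s → s ≼ T → (ι 6 ⊗ cross-total (λ _ → ι 1) s ⊝ s ⊗ (s ⊗ s)) within ι 121 ⊗ (κ ⊗ (V ⊗ V))
    cross-total₁ {s} 0≼s s≼T = within-mono (subst (_within (ι 3 ⊗ (κ ⊗ (moment 1 s ⊕ moment 0 s)) ⊕ κ ⊗ (s ⊗ s ⊕ s)))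
        (ring 3 (λ c m s → con 3 :* (con 2 :* c :- m) :+ (con 3 :* m :- s) := con 6 :* c :- s) _ _ _)
        (within-⊕ (within-scale (0≼ι 3) half) (moment₂ 0≼s s≼T)))
      (linear 5 (λ k m₁ m₀ s v → 3 • (con 0 :≤ k :* (s :* (con 40 :* (s :+ con 1)) :- m₁)) ⨾
        3 • (con 0 :≤ k :* (con 40 :* (s :+ con 1) :- m₀)) ⨾
          120 • (con 0 :≤ k :* (v :* v :- (s :+ con 1) :* (s :+ con 1))) ⨾ con 0 :≤ k :* (v :* v :- (s :* s :+ s)) ⊢
            con 3 :* (k :* (m₁ :+ m₀)) :+ k :* (s :* s :+ s) :≤ con 121 :* (k :* (v :* v))) _ _ _ _ _
        (0≼⊗ κ-nonneg (a≼b⇒0≼b-a (moment₁≼ 0≼s s≼T))) (0≼⊗ κ-nonneg (a≼b⇒0≼b-a (moment₀≼ 0≼s s≼T)))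
        (0≼⊗ κ-nonneg (a≼b⇒0≼b-a (⊗-mono 0≼V (0≼⊕ 0≼s 0≼1) (⊕-mono s≼T ≼-refl) (⊕-mono s≼T ≼-refl))))
          (0≼⊗ κ-nonneg (a≼b⇒0≼b-a (ss+s≼VV 0≼s s≼T))))
      where
      half : (ι 2 ⊗ cross-total (λ _ → ι 1) s ⊝ moment 2 s) within κ ⊗ (moment 1 s ⊕ moment 0 s)
      half = subst₂ _within_
        (trans (S-cong X λ d _ _ → trans (ring 5 (λ a i c m p → a :* (i :* (c :* (con 2 :* m :- p))) := con 2 :*
          (a :* (i :* (c :* m))) :- a :* (c :* (p :* i))) _ _ _ _ _)
          (cong₂ _⊝_ (cong (λ m → ι 2 ⊗ (Λ d ⊗ (inv d ⊗ (χ₀ d ⊗ m)))) (S-cong X λ e _ _ →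
          ⊗-cong refl (⊗-cong refl (sym (⊗-identityˡ _))))) refl))
          (trans (S-⊝ X _ _) (cong₂ _⊝_ (S-⊗ X _ _) refl)))
        (trans (S-cong X λ d _ _ → ring 6 (λ a i c k p q → a :* (i :* (c :* (k :* (p :+ q)))) := k :*
          (a :* (c :* (p :* i)) :+ a :* (c :* (q :* i)))) _ _ _ _ _ _) (trans (S-⊗ X _ _) (⊗-cong refl (S-⊕ X _ _))))
        (S-within X λ d p q → within-scale (Λ-nonneg d)
          (within-scale (inv-nonneg d) (within-scale (ind-nonneg (coprime? d M)) (moment₁-pw (≼-trans (t-L≼t s p q) s≼T)))))

    S-w₁≼ : ∀ {s} → ι 0 ≼ s → s ≼ T → S X (w 1 s) ≼ ι 2 ⊗ (V ⊗ V)
    S-w₁≼ {s} p q = unscale 1 (linear 3 (λ k s v → con 2 :* k :- s :* (s :* con 1) :≤ con 2 :* con 2 :* (s :* con 1) ⨾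
      s :* s :+ s :≤ v :* v ⨾ 3 • (s :* s :+ s :≤ v :* v) ⨾ 3 • (con 0 :≤ s :* s) ⊢ 2 • (k :≤ con 2 :* (v :* v))) _ _ _
      (proj₂ (S-w-approx 1 p (s≼LX p q))) (ss+s≼VV p q) (ss+s≼VV p q) (square-nonneg s))

    -- The reduced classes share `Q-total` and `cross-total`, s³ / 6 each, equally up to the bound
    -- of `selberg-class-independent`.
    P-within : ∀ {l s} → Coprime l M → ι 0 ≼ s → s ≼ T → (ι 3 ⊗ (N ⊗ P l s) ⊝ s ⊗ (s ⊗ s)) within κ₁ ⊗ (V ⊗ V)
    P-within {l} {s} cl 0≼s s≼T = halve (within-≡
      (subst (_within (ι 6 ⊗ (N ⊗ ((ι 2 ⊗ ι 8 ⊗ ι M) ⊗ (ι 2 ⊗ (V ⊗ V)))) ⊕ (ι 5 ⊗ (κ ⊗ (V ⊗ V)) ⊕ ι 121 ⊗ (κ ⊗ (V ⊗ V)))))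
        (ring 5 (λ n p q c s → con 6 :* (n :* p :- (q :+ c)) :+ ((con 6 :* q :- s) :+ (con 6 :* c :- s)) := con 2 :*
          (con 3 :* (n :* p) :- s)) _ _ _ _ _)
        (within-⊕ (within-scale (0≼ι 6) (subst (λ z → (N ⊗ P l s ⊝ z) within (N ⊗ ((ι 2 ⊗ ι 8 ⊗ ι M) ⊗ (ι 2 ⊗ (V ⊗ V))))) totals
           (class-average (λ l → P l s) _ l (0≼⊗ pos (0≼⊗ (0≼ι 2) (0≼⊗ 0≼V 0≼V))) λ l′ cl′ →
             within-mono (selberg-class-independent cl cl′ (s≼LX 0≼s s≼T)) (⊗-monoʳ pos (S-w₁≼ 0≼s s≼T)))))
          (within-⊕ (Q-total-within 0≼s s≼T) (cross-total₁ 0≼s s≼T))))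
        (ring 4 (λ n m v k → con 6 :* (n :* ((con 2 :* con 8 :* m) :* (con 2 :* (v :* v)))) :+
          (con 5 :* (k :* (v :* v)) :+ con 121 :* (k :* (v :* v))) := con 2 :* ((con 63 :* k :+ con 96 :* (n :* m)) :* (v :* v)))
          _ _ _ _))
      where
      pos : ι 0 ≼ ι 2 ⊗ ι 8 ⊗ ι M
      pos = 0≼⊗ (0≼⊗ (0≼ι 2) (0≼ι 8)) (0≼ι M)
      totals : S M (λ l′ → χ₀ l′ ⊗ P l′ s) ≡ Q-total s ⊕ cross-total (λ _ → ι 1) s
      totals = trans (selberg-classes (λ _ → ι 1) s)
        (⊕-cong (S-cong X λ n _ _ → ⊗-cong refl (⊗-cong refl (⊗-cong refl (⊗-identityˡ _)))) refl)
      halve : ∀ {a b} → ι 2 ⊗ a within ι 2 ⊗ b → a within b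
      halve {a} {b} (p , q) = unscale 1 (linear 2 (λ a b → :- (con 2 :* b) :≤ con 2 :* a ⊢ 2 • (:- b :≤ a)) a b p) , unscale 1
        (linear 2 (λ a b → con 2 :* a :≤ con 2 :* b ⊢ 2 • (a :≤ b)) a b q)

    -- Λ * Λ is nonnegative, so Λ log may hold at most the whole of `P`, twice its even share. The
    -- factor 2 is the parity barrier of Selberg's method.
    Q-upper : ∀ {l s} → Coprime l M → ι 0 ≼ s → s ≼ T → ι 3 ⊗ (N ⊗ Q l s) ≼ s ⊗ (s ⊗ s) ⊕ κ₁ ⊗ (V ⊗ V)
    Q-upper {l} {s} cl p q = linear 5 (λ n Q P s e → 3 • (con 0 :≤ n :* (P :- Q)) ⨾ con 3 :* (n :* P) :- s :≤ e ⊢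
      con 3 :* (n :* Q) :≤ s :+ e) _ _ _ _ _
      d (proj₂ (P-within cl p q))
      where
      d : ι 0 ≼ N ⊗ (P l s ⊝ Q l s)
      d = 0≼⊗ N-nonneg (a≼b⇒0≼b-a (Q≼P l s))

-- Selberg's sum with an additional logarithm, and a class without primes

module WeightedDensities (X : ℕ) (1≤X : 1 ≤ X) (lg : Logarithm X) (M : ℕ) {{M≢0 : NonZero M}}
  (T : F) (0≼T : ι 0 ≼ T) (horizon : (T ⊕ ι 4) ⊕ (T ⊕ ι 4) ≼ Logarithm.L lg X) where
  open Densities X 1≤X lg M public
  open Horizon T 0≼T horizon public
  open VonMangoldtEstimates X 1≤X lg using (Λ-no-primes) public

  V³ : F
  V³ = V ⊗ (V ⊗ V)

  1≼V : ι 1 ≼ V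
  1≼V = linear 1 (λ t → con 0 :≤ t ⊢ con 1 :≤ t :+ con 1) _ 0≼T

  0≼V³ : ι 0 ≼ V³
  0≼V³ = 0≼⊗ 0≼V (0≼⊗ 0≼V 0≼V)

  TTT+TT≼V³ : T ⊗ (T ⊗ T) ⊕ T ⊗ T ≼ V³
  TTT+TT≼V³ = linear 1 (λ t → 2 • (con 0 :≤ t :* t) ⨾ 3 • (con 0 :≤ t) ⨾ con 0 :≤ con 1 ⊢
    t :* (t :* t) :+ t :* t :≤ (t :+ con 1) :* ((t :+ con 1) :* (t :+ con 1))) _ (square-nonneg T) 0≼T 0≼1

  LLw-split : ∀ n → L n ⊗ (L n ⊗ w 1 T n) ≡ (T ⊗ T) ⊗ w 1 T n ⊝ ι 2 ⊗ (T ⊗ w 2 T n) ⊕ w 3 T n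
  LLw-split n = trans (⊗-cong refl (Lw-split 0≼T ≼-refl n))
    (trans (ring 4 (λ l t x y → l :* (t :* x :- y) := t :* (l :* x) :- t :* y :+ (t :* y :- y :* l)) (L n) T (w 1 T n) (w 2 T n))
    (trans (cong₂ (λ a b → T ⊗ a ⊝ T ⊗ w 2 T n ⊕ b) (Lw-split 0≼T ≼-refl n) (sym (w-suc 2 T n)))
      (ring 4 (λ t x y z → t :* (t :* x :- y) :- t :* y :+ z := t :* t :* x :- con 2 :* (t :* y) :+ z) _ _ _ _)))

  -- The moments combine to T² · T² / 2 - 2 T · T³ / 3 + T⁴ / 4 = T⁴ / 12.
  diagonal-total-lower : T ⊗ (T ⊗ (T ⊗ T)) ⊝ ι 17 ⊗ (κ ⊗ V³) ≼ ι 12 ⊗ diagonal-total L T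
  diagonal-total-lower = subst (λ D → T ⊗ (T ⊗ (T ⊗ T)) ⊝ ι 17 ⊗ (κ ⊗ V³) ≼ ι 12 ⊗ D) (sym value)
    (linear 6 (λ t k v m₁ m₂ m₃ → con 6 :* (t :* t) :* (:- (k :* (t :+ con 1))) :≤ con 6 :* (t :* t) :* (con 2 :* m₁ :- t :* t) ⨾
        con 8 :* t :* (con 3 :* m₂ :- t :* (t :* t)) :≤ con 8 :* t :* (k :* (t :* t :+ t)) ⨾
          3 • (:- (k :* (t :* (t :* t) :+ t :* t)) :≤ con 4 :* m₃ :- t :* (t :* (t :* t))) ⨾
        17 • (con 0 :≤ k :* (v :- (t :* (t :* t) :+ t :* t))) ⊢ t :* (t :* (t :* t)) :- con 17 :* (k :* v) :≤ con 12 :*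
          (t :* t :* m₁ :- con 2 :* (t :* m₂) :+ m₃)) _ _ _ _ _ _
      (⊗-monoʳ (0≼⊗ (0≼ι 6) (square-nonneg T)) (proj₁ (moment₁ 0≼T ≼-refl)))
        (⊗-monoʳ (0≼⊗ (0≼ι 8) 0≼T) (proj₂ (moment₂ 0≼T ≼-refl))) (proj₁ (moment₃ 0≼T ≼-refl))
      (0≼⊗ κ-nonneg (a≼b⇒0≼b-a TTT+TT≼V³)))
    where
    value : diagonal-total L T ≡ (T ⊗ T) ⊗ moment 1 T ⊝ ι 2 ⊗ (T ⊗ moment 2 T) ⊕ moment 3 T
    value = trans (S-cong X λ n _ _ → trans (⊗-cong refl (⊗-cong refl (LLw-split n)))
      (ring 7 (λ a c s t x y z → a :* (c :* (s :* x :- t :* y :+ z)) := s :* (a :* (c :* x)) :- t :* (a :* (c :* y)) :+ a :*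
      (c :* z)) (Λ n) (χ₀ n) (T ⊗ T) (ι 2 ⊗ T) (w 1 T n) (w 2 T n) (w 3 T n) |> λ e →
      trans (cong (λ z → Λ n ⊗ (χ₀ n ⊗ ((T ⊗ T) ⊗ w 1 T n ⊝ z ⊕ w 3 T n))) (sym (⊗-assoc _ _ _))) e))
      (trans (S-⊕ X _ _) (⊕-cong (trans (S-⊝ X _ _) (cong₂ _⊝_ (S-⊗ X _ _) (trans (S-⊗ X _ _) (⊗-assoc _ _ _)))) refl))

  -- Splitting L (d e) = L d + L e gives two sums that are exchanged by swapping d and e.
  symmetric-cross : ∀ (k : ℕ → ℕ → F) → (∀ d e → k d e ≡ k e d) →
    S X (λ d → Λ d ⊗ (inv d ⊗ S X (λ e → Λ e ⊗ (k d e ⊗ (L (d * e) ⊗ w 1 (T ⊝ L d) e))))) ≡ ι 2 ⊗ S X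
      (λ d → Λ d ⊗ (inv d ⊗ S X (λ e → Λ e ⊗ (k d e ⊗ (L e ⊗ w 1 (T ⊝ L d) e)))))
  symmetric-cross k k-sym = trans (S-cong X λ d p _ →
    trans (⊗-cong refl (⊗-cong refl (trans (S-cong X λ e q _ →
    trans (cong (λ l → Λ e ⊗ (k d e ⊗ (l ⊗ w 1 (T ⊝ L d) e))) (L-* d e p q))
        (ring 5 (λ a k l m w → a :* (k :* ((l :+ m) :* w)) := a :* (k :* (l :* w)) :+ a :* (k :* (m :* w))) _ _ _ _ _))
          (S-⊕ X _ _)))) (ring 4 (λ a i x y → a :* (i :* (x :+ y)) := a :* (i :* x) :+ a :* (i :* y)) _ _ _ _))
    (trans (S-⊕ X _ _) (trans (⊕-cong swapped refl) (ring 1 (λ a → a :+ a := con 2 :* a) _)))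
    where
    swapped : S X (λ d → Λ d ⊗ (inv d ⊗ S X (λ e → Λ e ⊗ (k d e ⊗ (L d ⊗ w 1 (T ⊝ L d) e))))) ≡ S X
      (λ d → Λ d ⊗ (inv d ⊗ S X (λ e → Λ e ⊗ (k d e ⊗ (L e ⊗ w 1 (T ⊝ L d) e)))))
    swapped = trans (S-cong X λ d _ _ → expand d _)
      (trans (S-swap X X _) (S-cong X λ e _ _ → trans (S-cong X λ d _ _ → term d e) (sym (expand e _))))
      where
      expand : ∀ d (f : ℕ → F) → Λ d ⊗ (inv d ⊗ S X f) ≡ S X (λ e → Λ d ⊗ (inv d ⊗ f e))
      expand d f = trans (⊗-cong refl (sym (S-⊗ X _ _))) (sym (S-⊗ X _ _))
      term : ∀ d e → Λ d ⊗ (inv d ⊗ (Λ e ⊗ (k d e ⊗ (L d ⊗ w 1 (T ⊝ L d) e)))) ≡ Λ e ⊗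
        (inv e ⊗ (Λ d ⊗ (k e d ⊗ (L d ⊗ w 1 (T ⊝ L e) d))))
      term d e = trans (cong₂ (λ x y → Λ d ⊗ (inv d ⊗ (Λ e ⊗ (x ⊗ (L d ⊗ (pw 1 y ⊗ inv e)))))) (k-sym d e)
        (ring 3 (λ t l m → (t :- l) :- m := (t :- m) :- l) _ _ _))
        (ring 7 (λ a i b x l p j → a :* (i :* (b :* (x :* (l :* (p :* j))))) := b :* (j :* (a :* (x :* (l :* (p :* i)))))) _ _ _ _
          _ _ _)

  -- For a unit d this is `Q` of the class l / d; the condition d e ≡ l avoids inverses and makes
  -- sense for all d.
  quotient-density : ℕ → ℕ → F → F
  quotient-density l d u = S X (λ e → Λ e ⊗ (𝟙 l (d * e) ⊗ (L e ⊗ w 1 u e)))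

  cross≡quotients : ∀ l → cross L l T ≡ ι 2 ⊗ S X (λ d → Λ d ⊗ (inv d ⊗ quotient-density l d (T ⊝ L d)))
  cross≡quotients l = symmetric-cross (λ d e → 𝟙 l (d * e)) (λ d e → cong (𝟙 l) (ℕₚ.*-comm d e))

  Q-total-neg : ∀ {u} → u ≺ ι 0 → Q-total u ≡ ι 0
  Q-total-neg h = S-zero X λ n p q → trans (⊗-cong refl (⊗-cong refl (⊗-cong refl (w-neg 1 n p q h))))
    (ring 3 (λ a b c → a :* (b :* (c :* con 0)) := con 0) _ _ _)

  Q-total-lower : ∀ {u} → u ≼ T → pw 3 u ⊝ ι 5 ⊗ (κ ⊗ (V ⊗ V)) ⊗ pw 0 u ≼ ι 6 ⊗ Q-total u
  Q-total-lower {u} h with ≼? (ι 0) u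
  ... | inj₂ n = ≼-reflexive (trans (cong₂ (λ a b → a ⊝ ι 5 ⊗ (κ ⊗ (V ⊗ V)) ⊗ b) (pw-neg 3 n) (pw-neg 0 n))
    (trans (ring 1 (λ a → con 0 :- a :* con 0 := con 6 :* con 0) _) (⊗-cong refl (sym (Q-total-neg n)))))
  ... | inj₁ p = subst₂ (λ a b → a ⊝ ι 5 ⊗ (κ ⊗ (V ⊗ V)) ⊗ b ≼ ι 6 ⊗ Q-total u) (sym (pw-pos 3 p)) (sym (pw-pos 0 p))
      (linear 3 (λ u q e → :- e :≤ q :- u :* (u :* u) ⊢ u :* (u :* (u :* con 1)) :- e :* con 1 :≤ q) _ _ _
        (proj₁ (Q-total-within p h)))

  -- By `symmetric-cross` it is twice a sum of `Q-total` at the times T - L d, hence a third of the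
  -- third moment: T⁴ / 12.
  cross-total-lower : T ⊗ (T ⊗ (T ⊗ T)) ⊝ ι 801 ⊗ (κ ⊗ V³) ≼ ι 12 ⊗ cross-total L T
  cross-total-lower = linear 7 (λ c c′ m₃ m₀ t k v → 12 • (con 2 :* c′ :≤ c) ⨾
      4 • (m₃ :- con 5 :* (k :* (v :* v)) :* m₀ :≤ con 6 :* c′) ⨾ :- (k :* (t :* (t :* t) :+ t :* t)) :≤ con 4 :* m₃ :- t :*
        (t :* (t :* t)) ⨾ 20 • (con 0 :≤ k :* (v :* v) :* (con 40 :* v :- m₀)) ⨾
      con 0 :≤ k :* (v :* (v :* v) :- (t :* (t :* t) :+ t :* t)) ⊢ t :* (t :* (t :* t)) :- con 801 :* (k :* (v :* (v :* v))) :≤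
        con 12 :* c) (cross-total L T) CT (moment 3 T) (moment 0 T) T κ V
      double lower (proj₁ (moment₃ 0≼T ≼-refl)) (0≼⊗ (0≼⊗ κ-nonneg (0≼⊗ 0≼V 0≼V)) (a≼b⇒0≼b-a (moment₀≼ 0≼T ≼-refl)))
        (0≼⊗ κ-nonneg (a≼b⇒0≼b-a TTT+TT≼V³))
    where
    CT : F
    CT = S X (λ d → Λ d ⊗ (inv d ⊗ (χ₀ d ⊗ Q-total (T ⊝ L d))))
    double : ι 2 ⊗ CT ≼ cross-total L T
    double = ≼-reflexive (sym (trans (S-cong X λ d _ _ →
      ⊗-cong refl (⊗-cong refl (trans (sym (S-⊗ X _ _)) (S-cong X λ e _ _ →
      ring 4 (λ c a b x → c :* (a :* (b :* x)) := a :* (c :* b :* x)) _ _ _ _))))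
      (trans (symmetric-cross (λ d e → χ₀ d ⊗ χ₀ e) (λ d e → ⊗-comm _ _))
        (⊗-cong refl (S-cong X λ d _ _ → ⊗-cong refl (⊗-cong refl
        (trans (S-cong X λ e _ _ → ring 4 (λ c a b x → a :* (c :* b :* x) := c :* (a :* (b :* x))) _ _ _ _) (S-⊗ X _ _))))))))
    lower : moment 3 T ⊝ ι 5 ⊗ (κ ⊗ (V ⊗ V)) ⊗ moment 0 T ≼ ι 6 ⊗ CT
    lower = subst₂ _≼_ (trans (S-cong X λ d _ _ →
      ring 6 (λ a i c p k q → a :* (i :* (c :* (p :- k :* q))) := a :* (c :* (p :* i)) :- k :* (a :* (c :* (q :* i)))) _ _ _ _ _
      _) (trans (S-⊝ X _ _) (cong₂ _⊝_ refl (S-⊗ X _ _))))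
      (trans (S-cong X λ d _ _ → ring 5 (λ a i c s q → a :* (i :* (c :* (s :* q))) := s :* (a :* (i :* (c :* q)))) _ _ _ _ _)
        (S-⊗ X _ _))
      (S-mono X λ d p q → ⊗-monoʳ (Λ-nonneg d) (⊗-monoʳ (inv-nonneg d)
        (⊗-monoʳ (ind-nonneg (coprime? d M)) (Q-total-lower (t-L≼t T p q)))))

  -- κ₂ halves the errors of `quotient-sum-lower`: 17 + 801, 12 · (16 + 216) · 2 and 12 · 8. In κ₃,
  -- 160 = 4 · 40.
  κ₂ κ₃ : F
  κ₂ = ι 409 ⊗ κ ⊕ ι 2784 ⊗ (N ⊗ ι M) ⊕ ι 48 ⊗ N
  κ₃ = κ ⊕ ι 160 ⊗ κ₁ ⊕ κ₂

  κ₃-nonneg : ι 0 ≼ κ₃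
  κ₃-nonneg = 0≼⊕ (0≼⊕ κ-nonneg (0≼⊗ (0≼ι 160) κ₁-nonneg)) (0≼⊕ (0≼⊕ (0≼⊗ (0≼ι 409) κ-nonneg) (0≼⊗ (0≼ι 2784) NM-nonneg))
    (0≼⊗ (0≼ι 48) N-nonneg))

  module MissingClass {a : ℕ} (ca : Coprime a M) (none : ∀ p → Prime p → p ≤ X → ¬ (p ≈ a)) where

    -- L² w₁ is at most T³ / n, and with no prime in the class `Λ-no-primes` bounds what remains.
    diagonal-small : diagonal L a T ≼ (T ⊗ (T ⊗ T)) ⊗ ι 8
    diagonal-small = ≼-trans (S-mono X {g = λ n → (T ⊗ (T ⊗ T)) ⊗ (Λ n ⊗ G n)} λ n p q →
      ≼-trans (⊗-monoʳ (Λ-nonneg n) (≡≼ (ring 3 (λ l i w → l :* (i :* (l :* w)) := i :* (l :* (l :* w))) _ _ _)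
      (⊗-monoʳ (𝟙-nonneg a n) (bound n p q))))
        (≼-reflexive (trans (ring 4 (λ a i t w → a :* (i :* (t :* w)) := t :* (a :* (con 1 :* (i :* w)))) _ _ _ _)
          (cong (λ z → (T ⊗ (T ⊗ T)) ⊗ (Λ n ⊗ (z ⊗ (𝟙 a n ⊗ inv n)))) (sym (ind-yes (n ≤? X) q))))))
      (≼-trans (≼-reflexive (S-⊗ X _ _)) (⊗-monoʳ 0≼TTT (Λ-no-primes G (λ n X<n → ind-zero (n ≤? X) (ℕₚ.<⇒≱ X<n))
        (λ d _ → ≼-trans (⊗-monoˡ (0≼⊗ (𝟙-nonneg a d) (inv-nonneg d)) (ind≼1 (d ≤? X)))
          (≡≼ (⊗-identityˡ _) (≼≡ (⊗-monoˡ (inv-nonneg d) (ind≼1 (d ≈? a))) (⊗-identityˡ _))))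
        λ p pp p≤X → ≼-reflexive (trans (⊗-cong refl (trans (⊗-cong (ind-no (p ≈? a) (none p pp p≤X)) refl) (⊗-zeroˡ _)))
          (⊗-zeroʳ _)))))
      where
      0≼TTT : ι 0 ≼ T ⊗ (T ⊗ T)
      0≼TTT = 0≼⊗ 0≼T (0≼⊗ 0≼T 0≼T)
      G : ℕ → F
      G n = ind (n ≤? X) ⊗ (𝟙 a n ⊗ inv n)
      bound : ∀ n → 1 ≤ n → n ≤ X → L n ⊗ (L n ⊗ w 1 T n) ≼ (T ⊗ (T ⊗ T)) ⊗ inv n
      bound n p q = ≼-trans (⊗-monoʳ (L-prime-nonneg p q) (Lw-bound n p q 0≼T))
        (linear 4 (λ t l w i → con 0 :≤ t :* t :* (t :* w :- w :* l) ⨾ con 0 :≤ t :* (t :* t) :* (i :- w) ⊢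
          l :* (t :* t :* w) :≤ t :* (t :* t) :* i) _ _ _ _
          (0≼⊗ (0≼⊗ 0≼T 0≼T) (≼≡ (w-nonneg 1 T n) (w-suc 0 T n)))
            (0≼⊗ 0≼TTT (a≼b⇒0≼b-a (≼≡ (⊗-monoˡ (inv-nonneg n) (pw≼ 0 0≼T p (ℕₚ.m≤n⇒m≤1+n (ℕₚ.≤-trans q X≤XX))))
            (⊗-identityˡ _)))))

    quotient-sum : F
    quotient-sum = S X (λ d → Λ d ⊗ (inv d ⊗ quotient-density a d (T ⊝ L d)))

    -- Class a must carry about T⁴ / (6 N). By `diagonal-small` its Λ log part is only O(T³), so Λ *
    -- Λ supplies the rest, and half of it is the quotient sum.
    quotient-sum-lower : T ⊗ (T ⊗ (T ⊗ T)) ⊝ κ₂ ⊗ V³ ≼ ι 12 ⊗ (N ⊗ quotient-sum)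
    quotient-sum-lower = unscale 1 (linear 10 (λ t k v n m D C d c q →
      con 12 :* (:- (n :* ((con 2 :* con 8 :* m :* v :+ con 2 :* con 108 :* m :* v) :* (con 2 :* (v :* v))))) :≤ con 12 :*
      (n :* (d :+ c) :- (D :+ C)) ⨾
        t :* (t :* (t :* t)) :- con 17 :* (k :* (v :* (v :* v))) :≤ con 12 :* D ⨾
          t :* (t :* (t :* t)) :- con 801 :* (k :* (v :* (v :* v))) :≤ con 12 :* C ⨾
          con 12 :* (n :* c) :≤ con 12 :* (n :* (con 2 :* q)) ⨾
        con 12 :* (n :* d) :≤ con 12 :* (n :* (v :* (v :* v) :* con 8)) ⊢
        2 • (t :* (t :* (t :* t)) :- (con 409 :* k :+ con 2784 :* (n :* m) :+ con 48 :* n) :* (v :* (v :* v)) :≤ con 12 :*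
          (n :* q))) T κ V N (ι M) (diagonal-total L T) (cross-total L T) (diagonal L a T) (cross L a T) quotient-sum
      (⊗-monoʳ (0≼ι 12) (proj₁ average)) diagonal-total-lower cross-total-lower
        (⊗-monoʳ (0≼ι 12) (⊗-monoʳ N-nonneg (≼-reflexive (cross≡quotients a))))
      (⊗-monoʳ (0≼ι 12) (⊗-monoʳ N-nonneg (≼-trans diagonal-small
        (⊗-monoˡ (0≼ι 8) (linear 3 (λ a b c → a :+ b :≤ c ⨾ con 0 :≤ b ⊢ a :≤ c) _ _ _ TTT+TT≼V³ (square-nonneg T)))))))
      where
      b : F
      b = (ι 2 ⊗ ι 8 ⊗ ι M ⊗ V ⊕ ι 2 ⊗ ι 108 ⊗ ι M ⊗ V) ⊗ (ι 2 ⊗ (V ⊗ V))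
      16M≥0 : ι 0 ≼ ι 2 ⊗ ι 8 ⊗ ι M
      16M≥0 = 0≼⊗ (0≼⊗ (0≼ι 2) (0≼ι 8)) (0≼ι M)
      216M≥0 : ι 0 ≼ ι 2 ⊗ ι 108 ⊗ ι M
      216M≥0 = 0≼⊗ (0≼⊗ (0≼ι 2) (0≼ι 108)) (0≼ι M)
      pos : ι 0 ≼ ι 2 ⊗ ι 8 ⊗ ι M ⊗ V ⊕ ι 2 ⊗ ι 108 ⊗ ι M ⊗ V
      pos = 0≼⊕ (0≼⊗ 16M≥0 0≼V) (0≼⊗ 216M≥0 0≼V)
      average : (N ⊗ selberg-sum L a T ⊝ (diagonal-total L T ⊕ cross-total L T)) within N ⊗ b
      average = subst (λ z → (N ⊗ selberg-sum L a T ⊝ z) within N ⊗ b) (selberg-classes L T)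
        (class-average (λ l → selberg-sum L l T) b a (0≼⊗ pos (0≼⊗ (0≼ι 2) (0≼⊗ 0≼V 0≼V)))
        λ l′ cl′ → within-mono (weighted-selberg-class-independent ca cl′ 0≼T T≼LX)
          (⊗-mono pos (S-nonneg X λ n _ _ → w-nonneg 1 T n)
            (⊕-mono (⊗-monoʳ 16M≥0 (linear 1 (λ t → con 0 :≤ con 1 ⊢ t :≤ t :+ con 1) T 0≼1))
            (≡≼ (sym (⊗-identityʳ _)) (⊗-monoʳ 216M≥0 1≼V))) (S-w₁≼ 0≼T ≼-refl)))

    -- The room that `Q-upper` leaves to the class a / d at time T - L d.
    slack-at : ℕ → F
    slack-at d = χ₀ d ⊗ (pw 3 (T ⊝ L d) ⊕ κ₁ ⊗ (V ⊗ V) ⊗ pw 0 (T ⊝ L d)) ⊝ ι 3 ⊗ (N ⊗ quotient-density a d (T ⊝ L d))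

    quotient-density-class : ∀ {d} (c : Coprime d M) u → quotient-density a d u ≡ Q (proj₁ (inverse c) * a) u
    quotient-density-class {d} c u = S-cong X λ e _ _ → ⊗-cong refl (⊗-cong (𝟙-quotient a d c e) refl)

    quotient-coprime : ∀ {d} (c : Coprime d M) → Coprime (proj₁ (inverse c) * a) M
    quotient-coprime {d} c = coprime-* (coprime-*ʳ d (coprime-≈ (sym (proj₂ (inverse c))) coprime-1)) ca

    slack-nonneg : ∀ d → 1 ≤ d → d ≤ X → ι 0 ≼ slack-at d
    slack-nonneg d p q with coprime? d M
    ... | no ¬c = ≼-reflexive (sym (trans (cong (λ z → ι 0 ⊗ (pw 3 (T ⊝ L d) ⊕ κ₁ ⊗ (V ⊗ V) ⊗ pw 0 (T ⊝ L d)) ⊝ ι 3 ⊗ (N ⊗ z))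
      (S-zero X λ e _ _ → trans (⊗-cong refl (trans (⊗-cong (𝟙-noncoprime ca ¬c e) refl) (⊗-zeroˡ _))) (⊗-zeroʳ _)))
           (ring 2 (λ a n → con 0 :* a :- con 3 :* (n :* con 0) := con 0) _ _)))
    ... | yes c with ≼? (ι 0) (T ⊝ L d)
    ...   | inj₁ 0≼u = a≼b⇒0≼b-a (≼-trans (≡≼ (cong (λ z → ι 3 ⊗ (N ⊗ z)) (quotient-density-class c _))
      (Q-upper (quotient-coprime c) 0≼u (t-L≼t T p q)))
            (≼-reflexive (trans (ring 2 (λ u e → u :* (u :* u) :+ e := con 1 :* (u :* (u :* (u :* con 1)) :+ e :* con 1)) _ _)
              (cong₂ (λ y z → ι 1 ⊗ (y ⊕ κ₁ ⊗ (V ⊗ V) ⊗ z)) (sym (pw-pos 3 0≼u)) (sym (pw-pos 0 0≼u))))))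
    ...   | inj₂ u<0 = ≼-trans (0≼⊗ 0≼1 (0≼⊕ (pw-nonneg 3 _) (0≼⊗ (0≼⊗ κ₁-nonneg (0≼⊗ 0≼V 0≼V)) (pw-nonneg 0 _))))
            (≼-reflexive (trans (ring 2 (λ a n → a := a :- con 3 :* (n :* con 0)) _ _)
              (cong (λ z → _ ⊝ ι 3 ⊗ (N ⊗ z)) (sym (S-zero X λ e r s →
              trans (⊗-cong refl (⊗-cong refl (⊗-cong refl (w-neg 1 e r s u<0))))
              (ring 3 (λ a b c → a :* (b :* (c :* con 0)) := con 0) _ _ _))))))

    total-slack : F
    total-slack = S X (λ d → Λ d ⊗ (inv d ⊗ slack-at d))

    -- Inserting `Q-upper` for every class a / d bounds N times the quotient sum by a third of the
    -- third moment, about T⁴ / 12. This matches `quotient-sum-lower`, so the bounds are nearly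
    -- attained on average.
    total-slack-small : ι 4 ⊗ total-slack ≼ κ₃ ⊗ V³
    total-slack-small = subst (λ z → ι 4 ⊗ z ≼ κ₃ ⊗ V³) (sym value)
      (linear 9 (λ t v k k₁ k₂ n m₃ m₀ q → con 4 :* m₃ :- t :* (t :* (t :* t)) :≤ k :* (t :* (t :* t) :+ t :* t) ⨾
        con 0 :≤ k :* (v :* (v :* v) :- (t :* (t :* t) :+ t :* t)) ⨾ t :* (t :* (t :* t)) :- k₂ :* (v :* (v :* v)) :≤ con 12 :*
        (n :* q) ⨾
          4 • (con 0 :≤ k₁ :* (v :* v) :* (con 40 :* v :- m₀)) ⊢ con 4 :* (m₃ :+ k₁ :* (v :* v) :* m₀ :- con 3 :* (n :* q)) :≤
            (k :+ con 160 :* k₁ :+ k₂) :* (v :* (v :* v))) T V κ κ₁ κ₂ N (moment 3 T) (moment 0 T) quotient-sum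
        (proj₂ (moment₃ 0≼T ≼-refl)) (0≼⊗ κ-nonneg (a≼b⇒0≼b-a TTT+TT≼V³)) quotient-sum-lower
          (0≼⊗ (0≼⊗ κ₁-nonneg (0≼⊗ 0≼V 0≼V)) (a≼b⇒0≼b-a (moment₀≼ 0≼T ≼-refl))))
      where
      value : total-slack ≡ moment 3 T ⊕ κ₁ ⊗ (V ⊗ V) ⊗ moment 0 T ⊝ ι 3 ⊗ (N ⊗ quotient-sum)
      value = trans (S-cong X λ d _ _ → ring 8 (λ a i c p k q n z → a :* (i :* (c :* (p :+ k :* q) :- con 3 :* (n :* z))) := a :*
        (c :* (p :* i)) :+ k :* (a :* (c :* (q :* i))) :- con 3 :* n :* (a :* (i :* z))) _ _ _ _ _ _ _ _)
        (trans (S-⊝ X _ _) (cong₂ _⊝_ (trans (S-⊕ X _ _) (⊕-cong refl (S-⊗ X _ _))) (trans (S-⊗ X _ _) (⊗-assoc _ _ _))))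

    -- Restrict the total slack to d ≡ h with L d ≤ τ. There T - L d ≥ T - τ, and `Q` grows with
    -- time, so each slack is at least the bracket. Hence h has little mass up to τ, or a / h is
    -- nearly as dense as possible.
    density-dichotomy : ∀ {h} → Coprime h M → ∀ {τ} → τ ≼ T →
      ι 4 ⊗ (A h τ ⊗ ((T ⊝ τ) ⊗ ((T ⊝ τ) ⊗ (T ⊝ τ)) ⊝ ι 3 ⊗ (N ⊗ quotient-density a h T))) ≼ κ₃ ⊗ V³
    density-dichotomy {h} ch {τ} τ≼T = ≼-trans (⊗-monoʳ (0≼ι 4) (≼-trans (≼-reflexive (trans (⊗-comm _ _) (sym (S-⊗ X _ _))))
      (S-mono X λ d p q → ≼-trans (≼-reflexive (ring 5 (λ b a i p j → b :* (a :* (i :* (p :* j))) := a :* (j :* (i :* p :* b))) _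
      _ _ _ _))
        (⊗-monoʳ (Λ-nonneg d) (⊗-monoʳ (inv-nonneg d) (term d p q (d ≈? h))))))) total-slack-small
      where
      br : F
      br = (T ⊝ τ) ⊗ ((T ⊝ τ) ⊗ (T ⊝ τ)) ⊝ ι 3 ⊗ (N ⊗ quotient-density a h T)
      term : ∀ d → 1 ≤ d → d ≤ X → (e : Dec (d ≈ h)) → ind e ⊗ pw 0 (τ ⊝ L d) ⊗ br ≼ slack-at d
      term d p q (no _) = ≡≼ (ring 2 (λ a b → con 0 :* a :* b := con 0) _ _) (slack-nonneg d p q)
      term d p q (yes e) with ≼? (ι 0) (τ ⊝ L d)
      ... | inj₂ n = ≡≼ (trans (⊗-cong (⊗-cong refl (pw-neg 0 n)) refl) (ring 1 (λ b → con 1 :* con 0 :* b := con 0) _))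
        (slack-nonneg d p q)
      ... | inj₁ 0≼ = ≡≼ (trans (⊗-cong (⊗-cong refl (pw-pos 0 0≼)) refl) (ring 1 (λ b → con 1 :* con 1 :* b := b) _))
          (subst₂ (λ c z → br ≼ c ⊗ (z ⊕ κ₁ ⊗ (V ⊗ V) ⊗ pw 0 (T ⊝ L d)) ⊝ ι 3 ⊗ (N ⊗ quotient-density a d (T ⊝ L d)))
            (sym (ind-yes (coprime? d M) (coprime-≈ (sym e) ch))) (sym (pw-pos 3 0≼u))
            (linear 7 (λ u s k z n q q′ → s :* (s :* s) :≤ u :* (u :* u) ⨾ con 0 :≤ k :* z ⨾ 3 • (con 0 :≤ n :* (q :- q′)) ⊢
              s :* (s :* s) :- con 3 :* (n :* q) :≤ con 1 :* (u :* (u :* (u :* con 1)) :+ k :* z) :- con 3 :* (n :* q′)) _ _ _ _ _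
              _ _
              (⊗-mono 0≼u (0≼⊗ 0≼s 0≼s) s≼u (⊗-mono 0≼u 0≼s s≼u s≼u)) (0≼⊗ (0≼⊗ κ₁-nonneg (0≼⊗ 0≼V 0≼V)) (pw-nonneg 0 _))
              (0≼⊗ N-nonneg (a≼b⇒0≼b-a (S-mono X λ e′ r s →
                ⊗-monoʳ (Λ-nonneg e′) (≼-trans (≡≼ (⊗-cong (𝟙-periodic a (≈-* {c = e′} {e′} e refl)) refl) ≼-refl)
                (⊗-monoʳ (𝟙-nonneg a _) (⊗-monoʳ (L-prime-nonneg r s) (w-mono 1 e′ (t-L≼t T p q))))))))))
        where
        0≼s : ι 0 ≼ T ⊝ τ
        0≼s = a≼b⇒0≼b-a τ≼T
        s≼u : T ⊝ τ ≼ T ⊝ L d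
        s≼u = linear 3 (λ t τ l → con 0 :≤ τ :- l ⊢ t :- τ :≤ t :- l) _ _ _ 0≼
        0≼u : ι 0 ≼ T ⊝ L d
        0≼u = ≼-trans 0≼s s≼u

-- The exceptional character

count : ∀ {P : ℕ → Set} → (∀ i → Dec (P i)) → ℕ → ℕ
count d zero = 0
count d (suc n) with d (suc n)
... | yes _ = suc (count d n)
... | no _ = count d n

S-count : ∀ {P : ℕ → Set} (d : ∀ i → Dec (P i)) n → S n (λ i → ind (d i)) ≡ ι (count d n)
S-count d zero = refl
S-count d (suc n) with d (suc n)
... | yes _ = trans (⊕-cong (S-count d n) refl) (trans (⊕-comm _ _) (sym (ι-+ 1 (count d n))))
... | no _ = trans (⊕-cong (S-count d n) refl) (⊕-identityʳ _)

search : ∀ {P : ℕ → Set} (d : ∀ i → Dec (P i)) n → (Σ ℕ λ i → P i) ⊎ (∀ i → 1 ≤ i → i ≤ n → ¬ P i)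
search d zero = inj₂ λ { (suc _) _ () }
search d (suc n) with d (suc n) | search d n
... | yes p | _ = inj₁ (suc n , p)
... | no _ | inj₁ r = inj₁ r
... | no ¬p | inj₂ h = inj₂ λ i p q → case-≤ i q (h i p)
  where
  case-≤ : ∀ i → i ≤ suc n → (i ≤ n → ¬ _) → ¬ _
  case-≤ i q k with ℕₚ.m≤n⇒m<n∨m≡n q
  ... | inj₁ i<1+n = k (ℕₚ.≤-pred i<1+n)
  ... | inj₂ refl = ¬p

record RealCharacter (M : ℕ) {{_ : NonZero M}} : Set where
  open Residues M
  field
    ψ : ℕ → F
    ψ-periodic : Periodic ψ
    ψ-* : ∀ m n → ψ (m * n) ≡ ψ m ⊗ ψ n
    ψ-sum : S M ψ ≡ ι 0
    ψ-unit : ∀ {n} → Coprime n M → ψ n ≡ ι 1 ⊎ ψ n ≡ ⊖ ι 1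
    ψ-nonunit : ∀ {n} → ¬ Coprime n M → ψ n ≡ ι 0

module Exceptional (X : ℕ) (1≤X : 1 ≤ X) (lg : Logarithm X) (M : ℕ) {{M≢0 : NonZero M}}
  (T : F) (0≼T : ι 0 ≼ T) (horizon : (T ⊕ ι 4) ⊕ (T ⊕ ι 4) ≼ Logarithm.L lg X) where
  open WeightedDensities X 1≤X lg M T 0≼T horizon public

  1≼N : ι 1 ≼ N
  1≼N = ≡≼ (sym (ind-yes (coprime? 1 M) coprime-1)) (S-term M {χ₀} 1 ℕₚ.≤-refl 1≤M λ i _ _ → ind-nonneg (coprime? i M))

  -- κ₄ collects the errors of `n≤2c`, and κ₅ those listed in `errors`, with the powers of V
  -- removed.
  κ₄ κ₅ : F
  κ₄ = ι 10 ⊗ (N ⊗ κ) ⊕ ι 4 ⊗ (N ⊗ κ₁) ⊕ ι 3 ⊗ (N ⊗ (N ⊗ κ₃))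
  κ₅ = ι 5 ⊗ (N ⊗ κ) ⊕ N ⊗ κ₁ ⊕ ι 5 ⊗ κ ⊕ κ₁

  Q-periodic : ∀ t → Periodic (λ l → Q l t)
  Q-periodic t {l} {l′} e = S-cong X λ n _ _ → ⊗-cong refl
    (⊗-cong (ind-⇔ (n ≈? l) (n ≈? l′) (λ h → trans h e) (λ h → trans h (sym e))) refl)

  P≡Q+cross : ∀ l t → P l t ≡ Q l t ⊕ cross (λ _ → ι 1) l t
  P≡Q+cross l t = ⊕-cong (S-cong X λ n _ _ → ring 4 (λ a l i w → a :* (l :* (i :* (con 1 :* w))) := a :* (i :* (l :* w))) _ _ _ _)
    refl

  -- Suppose no prime up to X lies in the class of a. Then the classes of nearly maximal density form the complement of a subgroup of index two.
  module FromMissingClass {a : ℕ} (ca : Coprime a M) (none : ∀ p → Prime p → p ≤ X → ¬ (p ≈ a))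
    (j : ℕ) (τ : F) (T≡ : T ≡ ι 3 ⊗ (ι j ⊗ τ)) (1≼τ : ι 1 ≼ τ) (j-large : ι 336 ⊗ N ⊕ ι 1 ≼ ι j)
    (V²-small : κ₅ ⊗ (V ⊗ V) ≺ τ ⊗ (τ ⊗ τ)) (V³-small : κ₄ ⊗ V³ ≺ τ ⊗ (τ ⊗ (τ ⊗ τ))) where
    open MissingClass ca none

    -- T = 3 θ and θ = J τ. The threshold lies below the maximum T³ of `Q-upper` by a fraction of
    -- order 1 / J, while its gap x to (T - τ)³ is what the dichotomy needs.
    J x θ thr : F
    J = ι j
    x = τ ⊗ (τ ⊗ τ)
    θ = J ⊗ τ
    thr = (T ⊝ τ) ⊗ ((T ⊝ τ) ⊗ (T ⊝ τ)) ⊝ x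

    0≼τ : ι 0 ≼ τ
    0≼τ = ≼-trans 0≼1 1≼τ
    0≼x : ι 0 ≼ x
    0≼x = 0≼⊗ 0≼τ (0≼⊗ 0≼τ 0≼τ)
    1≼J : ι 1 ≼ J
    1≼J = linear 2 (λ n j → con 336 :* n :+ con 1 :≤ j ⨾ 336 • (con 0 :≤ n) ⊢ con 1 :≤ j) _ _ j-large N-nonneg
    0≼J : ι 0 ≼ J
    0≼J = 0≼ι j
    0≼JJ : ι 0 ≼ J ⊗ J
    0≼JJ = 0≼⊗ 0≼J 0≼J
    0≼θ : ι 0 ≼ θ
    0≼θ = 0≼⊗ 0≼J 0≼τ
    τ≼θ : τ ≼ θ
    τ≼θ = ≡≼ (sym (⊗-identityˡ τ)) (⊗-monoˡ 0≼τ 1≼J)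
    θ≼T : θ ≼ T
    θ≼T = ≼≡ (linear 1 (λ a → 2 • (con 0 :≤ a) ⊢ a :≤ con 3 :* a) _ 0≼θ) (sym T≡)
    τ≼T : τ ≼ T
    τ≼T = ≼-trans τ≼θ θ≼T
    τ≼V : τ ≼ V
    τ≼V = linear 2 (λ s t → s :≤ t ⨾ con 0 :≤ con 1 ⊢ s :≤ t :+ con 1) _ _ τ≼T 0≼1
    1≼x : ι 1 ≼ x
    1≼x = ≼-trans (≼-reflexive (ring 0 (con 1 := con 1 :* (con 1 :* con 1))))
      (⊗-mono 0≼τ (0≼⊗ 0≼1 0≼1) 1≼τ (⊗-mono 0≼τ 0≼1 1≼τ 1≼τ))

    T³≡ : T ⊗ (T ⊗ T) ≡ ι 27 ⊗ (J ⊗ (J ⊗ J)) ⊗ x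
    T³≡ = trans (cong (λ t → t ⊗ (t ⊗ t)) T≡) (ring 2 (λ j t → con 3 :* (j :* t) :* (con 3 :* (j :* t) :* (con 3 :* (j :* t))) :=
      con 27 :* (j :* (j :* j)) :* (t :* (t :* t))) _ _)
    thr≡ : thr ≡ (ι 27 ⊗ (J ⊗ (J ⊗ J)) ⊝ ι 27 ⊗ (J ⊗ J) ⊕ ι 9 ⊗ J ⊝ ι 2) ⊗ x
    thr≡ = trans (cong (λ t → (t ⊝ τ) ⊗ ((t ⊝ τ) ⊗ (t ⊝ τ)) ⊝ x) T≡)
      (ring 2 (λ j t → (con 3 :* (j :* t) :- t) :* ((con 3 :* (j :* t) :- t) :* (con 3 :* (j :* t) :- t)) :- t :* (t :* t) :=
      (con 27 :* (j :* (j :* j)) :- con 27 :* (j :* j) :+ con 9 :* j :- con 2) :* (t :* (t :* t))) _ _)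

    κVV : ι 0 ≼ κ ⊗ (V ⊗ V)
    κVV = 0≼⊗ κ-nonneg (0≼⊗ 0≼V 0≼V)
    κ₁VV : ι 0 ≼ κ₁ ⊗ (V ⊗ V)
    κ₁VV = 0≼⊗ κ₁-nonneg (0≼⊗ 0≼V 0≼V)
    NκVV : ι 0 ≼ N ⊗ (κ ⊗ (V ⊗ V))
    NκVV = 0≼⊗ N-nonneg κVV
    Nκ₁VV : ι 0 ≼ N ⊗ (κ₁ ⊗ (V ⊗ V))
    Nκ₁VV = 0≼⊗ N-nonneg κ₁VV

    errors : ι 5 ⊗ (N ⊗ (κ ⊗ (V ⊗ V))) ⊕ N ⊗ (κ₁ ⊗ (V ⊗ V)) ⊕ ι 5 ⊗ (κ ⊗ (V ⊗ V)) ⊕ κ₁ ⊗ (V ⊗ V) ≼ x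
    errors = ≡≼ (ring 4 (λ n k l v → con 5 :* (n :* (k :* v)) :+ n :* (l :* v) :+ con 5 :* (k :* v) :+ l :* v :=
      (con 5 :* (n :* k) :+ n :* l :+ con 5 :* k :+ l) :* v) _ _ _ _) (≺⇒≼ V²-small)

    inS? : ∀ n → Dec (Coprime n M × thr ≼ ι 3 ⊗ (N ⊗ Q n T))
    inS? n = coprime? n M ×-dec (thr ≼dec (ι 3 ⊗ (N ⊗ Q n T)))

    s : ℕ → F
    s n = ind (inS? n)

    s-periodic : Periodic s
    s-periodic {m} {n} e = ind-⇔ (inS? m) (inS? n) (λ (c , h) →
      coprime-≈ e c , ≼≡ h (cong (λ z → ι 3 ⊗ (N ⊗ z)) (Q-periodic T e)))
      (λ (c , h) → coprime-≈ (sym e) c , ≼≡ h (cong (λ z → ι 3 ⊗ (N ⊗ z)) (sym (Q-periodic T e))))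

    C : F
    C = S M s

    n c : ℕ
    n = count (λ i → coprime? i M) M
    c = count inS? M

    N≡ : N ≡ ι n
    N≡ = S-count (λ i → coprime? i M) M
    C≡ : C ≡ ι c
    C≡ = S-count inS? M

    s≼χ₀ : ∀ n → s n ≼ χ₀ n
    s≼χ₀ n with inS? n
    ... | yes (cn , _) = ≼-reflexive (sym (ind-yes (coprime? n M) cn))
    ... | no _ = ind-nonneg (coprime? n M)

    C≼N : C ≼ N
    C≼N = S-mono M λ i _ _ → s≼χ₀ i

    private
      kernel : ∀ h k → χ₀ h ⊗ 𝟙 a (h * k) ≡ 𝟙 a (k * h)
      kernel h k with coprime? h M
      ... | yes _ = trans (⊗-identityˡ _) (cong (𝟙 a) (ℕₚ.*-comm h k))
      ... | no ¬c = trans (⊗-zeroˡ _) (sym (trans (cong (𝟙 a) (ℕₚ.*-comm k h)) (𝟙-noncoprime ca ¬c k)))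

      s-kernel : ∀ k → s k ⊗ S M (λ h → χ₀ h ⊗ 𝟙 a (h * k)) ≡ s k
      s-kernel k with inS? k
      ... | no _ = ⊗-zeroˡ _
      ... | yes (ck , _) = trans (⊗-identityˡ _) (trans (S-cong M λ h _ _ → kernel h k) (S-𝟙-multiple a ck))

      -- For a unit h, this tells whether a / h is dense; written as a sum, it can be added up over
      -- h to give C.
      partner : ℕ → F
      partner h = S M (λ k → (χ₀ h ⊗ 𝟙 a (h * k)) ⊗ s k)

      partner-sum : S M partner ≡ C
      partner-sum = trans (S-swap M M _) (S-cong M λ k _ _ →
        trans (S-cong M λ h _ _ → ⊗-comm _ _) (trans (S-⊗ M _ _) (s-kernel k)))

      partner-coprime : ∀ {h} (ch : Coprime h M) → partner h ≡ s (proj₁ (inverse ch) * a)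
      partner-coprime {h} ch = trans (S-cong M λ k _ _ →
        ⊗-cong (trans (⊗-cong (ind-yes (coprime? h M) ch) (𝟙-quotient a h ch k)) (⊗-identityˡ _)) refl) (S-residue s _ s-periodic)

      -- If a / h is dense, `Q-upper` applies. If not, the bracket in `density-dichotomy` exceeds x,
      -- so `A h τ` is small, and so is Q h τ ≤ τ² A h τ.
      τ-density : ∀ h → ι 12 ⊗ (N ⊗ (τ ⊗ (χ₀ h ⊗ Q h τ))) ≼ (ι 4 ⊗ (τ ⊗ x ⊕ κ₁ ⊗ (V ⊗ V) ⊗ τ)) ⊗ partner h ⊕
        (ι 3 ⊗ (N ⊗ (κ₃ ⊗ V³))) ⊗ χ₀ h
      τ-density h = go (coprime? h M)
        where
        pos₁ : ι 0 ≼ ι 3 ⊗ (N ⊗ (κ₃ ⊗ V³))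
        pos₁ = 0≼⊗ (0≼ι 3) (0≼⊗ N-nonneg (0≼⊗ κ₃-nonneg 0≼V³))
        go : Dec (Coprime h M) → _
        go (no ¬c) = ≡≼ (trans (cong (λ z → ι 12 ⊗ (N ⊗ (τ ⊗ (z ⊗ Q h τ)))) (ind-no (coprime? h M) ¬c))
          (ring 3 (λ n t q → con 12 :* (n :* (t :* (con 0 :* q))) := con 0) _ _ _))
          (0≼⊕ (0≼⊗ (0≼⊗ (0≼ι 4) (0≼⊕ (0≼⊗ 0≼τ 0≼x) (0≼⊗ κ₁VV 0≼τ))) (S-nonneg M λ k _ _ →
            0≼⊗ (0≼⊗ (ind-nonneg (coprime? h M)) (𝟙-nonneg a _)) (ind-nonneg (inS? k)))) (0≼⊗ pos₁ (ind-nonneg (coprime? h M))))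
        go (yes ch) = subst₂ (λ y z → ι 12 ⊗ (N ⊗ (τ ⊗ (y ⊗ Q h τ))) ≼ (ι 4 ⊗ (τ ⊗ x ⊕ κ₁ ⊗ (V ⊗ V) ⊗ τ)) ⊗ z ⊕
          (ι 3 ⊗ (N ⊗ (κ₃ ⊗ V³))) ⊗ y) (sym (ind-yes (coprime? h M) ch)) (sym (partner-coprime ch)) (by-partner (inS? q))
          where
          q : ℕ
          q = proj₁ (inverse ch) * a
          by-partner : (d : Dec (Coprime q M × thr ≼ ι 3 ⊗ (N ⊗ Q q T))) →
            ι 12 ⊗ (N ⊗ (τ ⊗ (ι 1 ⊗ Q h τ))) ≼ (ι 4 ⊗ (τ ⊗ x ⊕ κ₁ ⊗ (V ⊗ V) ⊗ τ)) ⊗ ind d ⊕ (ι 3 ⊗ (N ⊗ (κ₃ ⊗ V³))) ⊗ ι 1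
          by-partner (yes _) = linear 6 (λ n t q x e r → 4 • (con 0 :≤ t :* (x :+ e :- con 3 :* (n :* q))) ⨾ con 0 :≤ r ⊢
            con 12 :* (n :* (t :* (con 1 :* q))) :≤ con 4 :* (t :* x :+ e :* t) :* con 1 :+ r :* con 1) _ _ _ _ _ _
            (0≼⊗ 0≼τ (a≼b⇒0≼b-a (Q-upper ch 0≼τ τ≼T))) pos₁
          by-partner (no ¬s) = linear 9 (λ n t q e r α B Qq x → 12 • (con 0 :≤ n :* t :* (t :* t :* α :- q)) ⨾
            12 • (con 0 :≤ n :* α :* (B :- t :* (t :* t) :- con 3 :* (n :* Qq))) ⨾
            3 • (con 0 :≤ n :* (r :- con 4 :* (α :* (B :- con 3 :* (n :* Qq))))) ⊢ con 12 :* (n :* (t :* (con 1 :* q))) :≤ e :*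
            con 0 :+ con 3 :* (n :* r) :* con 1) _ _ _ _ _ (A h τ) ((T ⊝ τ) ⊗ ((T ⊝ τ) ⊗ (T ⊝ τ))) (Q q T) x
            (0≼⊗ (0≼⊗ N-nonneg 0≼τ) (a≼b⇒0≼b-a (Q≼A h 0≼τ)))
              (0≼⊗ (0≼⊗ N-nonneg (A-nonneg h τ)) (a≼b⇒0≼b-a (≺⇒≼ (⋡⇒≺ λ h′ → ¬s (quotient-coprime ch , h′)))))
            (0≼⊗ N-nonneg (a≼b⇒0≼b-a (subst (λ z → ι 4 ⊗ (A h τ ⊗ ((T ⊝ τ) ⊗ ((T ⊝ τ) ⊗ (T ⊝ τ)) ⊝ ι 3 ⊗ (N ⊗ z))) ≼ κ₃ ⊗ V³)
              (quotient-density-class ch T) (density-dichotomy ch τ≼T))))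

      C-lower : ι 12 ⊗ (N ⊗ (τ ⊗ Q-total τ)) ≼ (ι 4 ⊗ (τ ⊗ x ⊕ κ₁ ⊗ (V ⊗ V) ⊗ τ)) ⊗ C ⊕ (ι 3 ⊗ (N ⊗ (κ₃ ⊗ V³))) ⊗ N
      C-lower = subst₂ _≼_ (trans (S-⊗ M _ _) (⊗-cong refl
        (trans (S-⊗ M _ _) (⊗-cong refl (trans (S-⊗ M _ _) (⊗-cong refl (Q-classes τ)))))))
        (trans (S-⊕ M _ _) (⊕-cong (trans (S-⊗ M _ _) (⊗-cong refl partner-sum)) (S-⊗ M _ _)))
        (S-mono M λ h _ _ → τ-density h)

    -- Summed over h, `τ-density` compares 2 N τ⁴ with 4 C τ⁴. If N exceeded 2 C it would do so by
    -- at least 1, more than the error κ₄ V³ < τ⁴ permits.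
    n≤2c : n ≤ 2 * c
    n≤2c with n ≤? 2 * c
    ... | yes h = h
    ... | no h = ⊥-elim (≺⇒⋡ V³-small (linear 8 (λ n c t v k k₁ k₃ q →
      con 12 :* (n :* (t :* q)) :≤ con 4 :* (t :* (t :* (t :* t)) :+ k₁ :* (v :* v) :* t) :* c :+ con 3 :*
      (n :* (k₃ :* (v :* (v :* v)))) :* n ⨾
          2 • (con 0 :≤ n :* t :* ((con 6 :* q :- t :* (t :* t)) :- :- (con 5 :* (k :* (v :* v))))) ⨾
            2 • (con 0 :≤ t :* (t :* (t :* t)) :* (n :- (con 1 :+ con 2 :* c))) ⨾ con 0 :≤ t :* (t :* (t :* t)) ⨾
          4 • (con 0 :≤ k₁ :* (v :* v) :* t :* (n :- c)) ⨾ 4 • (con 0 :≤ n :* (k₁ :* (v :* v)) :* (v :- t)) ⨾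
            10 • (con 0 :≤ n :* (k :* (v :* v)) :* (v :- t)) ⊢
          t :* (t :* (t :* t)) :≤ (con 10 :* (n :* k) :+ con 4 :* (n :* k₁) :+ con 3 :* (n :* (n :* k₃))) :* (v :* (v :* v))) N C
            τ V κ κ₁ κ₃ (Q-total τ)
        C-lower (0≼⊗ (0≼⊗ N-nonneg 0≼τ) (a≼b⇒0≼b-a (proj₁ (Q-total-within 0≼τ τ≼T)))) (0≼⊗ 0≼τx (a≼b⇒0≼b-a gap)) 0≼τx
        (0≼⊗ (0≼⊗ κ₁VV 0≼τ) (a≼b⇒0≼b-a C≼N)) (0≼⊗ Nκ₁VV (a≼b⇒0≼b-a τ≼V)) (0≼⊗ NκVV (a≼b⇒0≼b-a τ≼V))))
      where
      0≼τx : ι 0 ≼ τ ⊗ x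
      0≼τx = 0≼⊗ 0≼τ 0≼x
      gap : ι 1 ⊕ ι 2 ⊗ C ≼ N
      gap = subst₂ _≼_ (trans (ι-+ 1 (2 * c)) (⊕-cong refl (trans (ι-* 2 c) (⊗-cong refl (sym C≡))))) (sym N≡) (ι-mono (ℕₚ.≰⇒> h))

    private
      S-density : C ⊗ thr ≼ ι 3 ⊗ (N ⊗ S M (λ l → s l ⊗ Q l T))
      S-density = subst₂ _≼_ (trans (S-⊗ M _ _) (⊗-comm _ _)) (trans (S-⊗ M _ _) (⊗-cong refl (S-⊗ M _ _))) (S-mono M λ l _ _ →
        term (inS? l))
        where
        term : ∀ {l} (d : Dec (Coprime l M × thr ≼ ι 3 ⊗ (N ⊗ Q l T))) → thr ⊗ ind d ≼ ι 3 ⊗ (N ⊗ (ind d ⊗ Q l T))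
        term (no _) = ≼-reflexive (ring 3 (λ t n q → t :* con 0 := con 3 :* (n :* (con 0 :* q))) _ _ _)
        term (yes (_ , h)) = linear 3 (λ t n q → t :≤ con 3 :* (n :* q) ⊢ t :* con 1 :≤ con 3 :* (n :* (con 1 :* q))) _ _ _ h

    rest : F
    rest = S M (λ l → (χ₀ l ⊝ s l) ⊗ Q l T)

    private
      rest≡ : rest ≡ Q-total T ⊝ S M (λ l → s l ⊗ Q l T)
      rest≡ = trans (S-cong M λ l _ _ → ring 3 (λ c s q → (c :- s) :* q := c :* q :- s :* q) _ _ _)
        (trans (S-⊝ M _ _) (cong₂ _⊝_ (Q-classes T) refl))

      rest-nonneg : ι 0 ≼ rest
      rest-nonneg = S-nonneg M λ l _ _ → 0≼⊗ (a≼b⇒0≼b-a (s≼χ₀ l)) (Q-nonneg l T)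

      rest-upper : ι 6 ⊗ (N ⊗ rest) ⊕ ι 2 ⊗ (C ⊗ thr) ≼ N ⊗ (ι 27 ⊗ (J ⊗ (J ⊗ J)) ⊗ x ⊕ ι 5 ⊗ (κ ⊗ (V ⊗ V)))
      rest-upper = linear 7 (λ n R q sq u t e → 6 • (con 0 :≤ n :* ((q :- sq) :- R)) ⨾ 2 • (u :≤ con 3 :* (n :* sq)) ⨾
        con 0 :≤ n :* (e :- (con 6 :* q :- t)) ⊢ con 6 :* (n :* R) :+ con 2 :* u :≤ n :* (t :+ e)) _ _ _ _ _ _ _
        (0≼⊗ N-nonneg (a≼b⇒0≼b-a (≼-reflexive rest≡))) S-density
          (0≼⊗ N-nonneg (a≼b⇒0≼b-a (subst (λ z → ι 6 ⊗ Q-total T ⊝ z ≼ ι 5 ⊗ (κ ⊗ (V ⊗ V))) T³≡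
          (proj₂ (Q-total-within 0≼T ≼-refl)))))

      rest-upper′ : ι 6 ⊗ (N ⊗ rest) ⊕ ι 2 ⊗ (C ⊗ ((ι 27 ⊗ (J ⊗ (J ⊗ J)) ⊝ ι 27 ⊗ (J ⊗ J) ⊕ ι 9 ⊗ J ⊝ ι 2) ⊗ x)) ≼ N ⊗
        (ι 27 ⊗ (J ⊗ (J ⊗ J)) ⊗ x ⊕ ι 5 ⊗ (κ ⊗ (V ⊗ V)))
      rest-upper′ = subst (λ z → ι 6 ⊗ (N ⊗ rest) ⊕ ι 2 ⊗ (C ⊗ z) ≼ N ⊗ (ι 27 ⊗ (J ⊗ (J ⊗ J)) ⊗ x ⊕ ι 5 ⊗ (κ ⊗ (V ⊗ V)))) thr≡
        rest-upper

      1≼JJ : ι 1 ≼ J ⊗ J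
      1≼JJ = ≡≼ (sym (⊗-identityˡ _)) (⊗-mono 0≼J 0≼1 1≼J 1≼J)

      0≼thr : ι 0 ≼ (ι 27 ⊗ (J ⊗ (J ⊗ J)) ⊝ ι 27 ⊗ (J ⊗ J) ⊕ ι 9 ⊗ J ⊝ ι 2) ⊗ x
      0≼thr = 0≼⊗ (linear 1 (λ j → 27 • (con 0 :≤ j :* j :* (j :- con 1)) ⨾ 9 • (con 1 :≤ j) ⨾ 7 • (con 0 :≤ con 1) ⊢
        con 0 :≤ con 27 :* (j :* (j :* j)) :- con 27 :* (j :* j) :+ con 9 :* j :- con 2) J
        (0≼⊗ 0≼JJ (a≼b⇒0≼b-a 1≼J)) 1≼J 0≼1) 0≼x

    -- Each of the C dense classes holds at least thr / (3 N) of a total of about T³ / 6. As thr is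
    -- so close to T³, there is no room for (N + 1) / 2 of them.
    2c≤n : 2 * c ≤ n
    2c≤n with 2 * c ≤? n
    ... | yes h = h
    ... | no h = ⊥-elim (≺⇒⋡ V²-small (linear 8 (λ n c j x R k k₁ v →
      con 6 :* (n :* R) :+ con 2 :* (c :* ((con 27 :* (j :* (j :* j)) :- con 27 :* (j :* j) :+ con 9 :* j :- con 2) :* x)) :≤ n :*
      (con 27 :* (j :* (j :* j)) :* x :+ con 5 :* (k :* v)) ⨾
          6 • (con 0 :≤ n :* R) ⨾ con 0 :≤ (con 27 :* (j :* (j :* j)) :- con 27 :* (j :* j) :+ con 9 :* j :- con 2) :* x :*
            (con 2 :* c :- (con 1 :+ n)) ⨾ 27 • (con 0 :≤ x :* (j :* j) :* (j :- (con 336 :* n :+ con 1))) ⨾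
          9 • (con 0 :≤ x :* (n :+ con 1) :* (j :- con 1)) ⨾ 7 • (con 0 :≤ x :* (n :+ con 1)) ⨾
            9045 • (con 0 :≤ x :* (n :* (j :* j) :- con 1)) ⨾ 9044 • (con 0 :≤ x) ⨾ con 0 :≤ n :* (k₁ :* v) ⨾
            5 • (con 0 :≤ k :* v) ⨾ con 0 :≤ k₁ :* v
          ⊢ x :≤ (con 5 :* (n :* k) :+ n :* k₁ :+ con 5 :* k :+ k₁) :* v) N C J x rest κ κ₁ (V ⊗ V)
        rest-upper′ (0≼⊗ N-nonneg rest-nonneg) (0≼⊗ 0≼thr (a≼b⇒0≼b-a gap)) (0≼⊗ (0≼⊗ 0≼x 0≼JJ) (a≼b⇒0≼b-a j-large))
          (0≼⊗ (0≼⊗ 0≼x (0≼⊕ N-nonneg 0≼1)) (a≼b⇒0≼b-a 1≼J)) (0≼⊗ 0≼x (0≼⊕ N-nonneg 0≼1))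
        (0≼⊗ 0≼x (a≼b⇒0≼b-a (≡≼ (sym (⊗-identityˡ _)) (⊗-mono N-nonneg 0≼1 1≼N 1≼JJ)))) 0≼x Nκ₁VV κVV κ₁VV))
      where
      gap : ι 1 ⊕ N ≼ ι 2 ⊗ C
      gap = subst₂ _≼_ (trans (ι-+ 1 n) (⊕-cong refl (sym N≡))) (trans (ι-* 2 c) (⊗-cong refl (sym C≡))) (ι-mono (ℕₚ.≰⇒> h))

    N≡2C : N ≡ ι 2 ⊗ C
    N≡2C = trans N≡ (trans (cong ι (ℕₚ.≤-antisym n≤2c 2c≤n)) (trans (ι-* 2 c) (⊗-cong refl (sym C≡))))

    -- The dense half holds at least thr / 6 of about T³ / 6, and T³ - thr is about 27 J² x.
    rest-small : rest ≼ ι 9 ⊗ (J ⊗ J) ⊗ x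
    rest-small = unscale 5 (linear 4 (λ j x R e → con 6 :* R :≤ (con 27 :* (j :* j) :- con 9 :* j :+ con 2) :* x :+ e ⨾ e :≤ x ⨾
      9 • (con 0 :≤ x :* (j :- con 1)) ⨾ 6 • (con 0 :≤ x) ⨾ 27 • (con 0 :≤ j :* j :* x) ⊢ 6 • (R :≤ con 9 :* (j :* j) :* x)) J x
      rest (ι 5 ⊗ (κ ⊗ (V ⊗ V)))
      (⊗-cancelˡ (≺-≼-trans (ι0≺ι1+ 0) 1≼N) (linear 6 (λ n c j x R e →
        con 6 :* (n :* R) :+ con 2 :* (c :* ((con 27 :* (j :* (j :* j)) :- con 27 :* (j :* j) :+ con 9 :* j :- con 2) :* x)) :≤ n
        :* (con 27 :* (j :* (j :* j)) :* x :+ e) ⨾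
            n :* ((con 27 :* (j :* (j :* j)) :- con 27 :* (j :* j) :+ con 9 :* j :- con 2) :* x) :≤ con 2 :* c :*
              ((con 27 :* (j :* (j :* j)) :- con 27 :* (j :* j) :+ con 9 :* j :- con 2) :* x) ⊢
            n :* (con 6 :* R) :≤ n :* ((con 27 :* (j :* j) :- con 9 :* j :+ con 2) :* x :+ e)) N C J x rest (ι 5 ⊗ (κ ⊗ (V ⊗ V)))
              rest-upper′ (≼-reflexive (⊗-cong N≡2C refl))))
      (linear 5 (λ a b c d x → con 5 :* a :+ b :+ c :+ d :≤ x ⨾ 5 • (con 0 :≤ a) ⨾ con 0 :≤ b ⨾ con 0 :≤ d ⊢ c :≤ x) _ _ _ _ _
        errors NκVV Nκ₁VV κ₁VV)
      (0≼⊗ 0≼x (a≼b⇒0≼b-a 1≼J)) 0≼x (0≼⊗ 0≼JJ 0≼x))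

-- The subgroup of index two and its character

module ExceptionalCharacter (X : ℕ) (1≤X : 1 ≤ X) (lg : Logarithm X) (M : ℕ) {{M≢0 : NonZero M}}
  (T : F) (0≼T : ι 0 ≼ T) (horizon : (T ⊕ ι 4) ⊕ (T ⊕ ι 4) ≼ Logarithm.L lg X) where
  open Exceptional X 1≤X lg M T 0≼T horizon

  module _ {a : ℕ} (ca : Coprime a M) (none : ∀ p → Prime p → p ≤ X → ¬ (p ≈ a))
    (j : ℕ) (τ : F) (T≡ : T ≡ ι 3 ⊗ (ι j ⊗ τ)) (1≼τ : ι 1 ≼ τ) (j-large : ι 336 ⊗ N ⊕ ι 1 ≼ ι j)
    (V²-small : κ₅ ⊗ (V ⊗ V) ≺ τ ⊗ (τ ⊗ τ)) (V³-small : κ₄ ⊗ V³ ≺ τ ⊗ (τ ⊗ (τ ⊗ τ))) where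
    open FromMissingClass ca none j τ T≡ 1≼τ j-large V²-small V³-small

    private
      InS : ℕ → Set
      InS n = Coprime n M × thr ≼ ι 3 ⊗ (N ⊗ Q n T)

      s-yes : ∀ {n} → InS n → s n ≡ ι 1
      s-yes {n} h = ind-yes (inS? n) h

      InS-≈ : ∀ {m n} → m ≈ n → InS m → InS n
      InS-≈ e (c , h) = coprime-≈ e c , ≼≡ h (cong (λ z → ι 3 ⊗ (N ⊗ z)) (Q-periodic T e))

      θ³≡ : θ ⊗ (θ ⊗ θ) ≡ J ⊗ (J ⊗ J) ⊗ x
      θ³≡ = ring 2 (λ j t → j :* t :* (j :* t :* (j :* t)) := j :* (j :* j) :* (t :* (t :* t))) _ _

      upper-θ : ∀ {h} → InS h → ∀ l → ι 3 ⊗ (N ⊗ (χ₀ l ⊗ Q l θ)) ≼ ι 3 ⊗ (N ⊗ Q h θ) ⊗ 𝟙 h l ⊕ (θ ⊗ (θ ⊗ θ) ⊕ κ₁ ⊗ (V ⊗ V)) ⊗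
        (s l ⊝ 𝟙 h l) ⊕ ι 3 ⊗ (N ⊗ ((χ₀ l ⊝ s l) ⊗ Q l T))
      upper-θ {h} inS l with l ≈? h
      ... | yes e = ≼-reflexive (trans (cong₂ (λ y z → ι 3 ⊗ (N ⊗ (y ⊗ z))) (ind-yes (coprime? l M) (proj₁ inSl))
        (Q-periodic θ e))
            (trans (ring 4 (λ n q u r → con 3 :* (n :* (con 1 :* q)) := con 3 :* (n :* q) :* con 1 :+ u :* (con 1 :- con 1) :+ con
              3 :* (n :* ((con 1 :- con 1) :* r))) N (Q h θ) (θ ⊗ (θ ⊗ θ) ⊕ κ₁ ⊗ (V ⊗ V)) (Q l T))
              (cong₂ (λ y z → ι 3 ⊗ (N ⊗ Q h θ) ⊗ ι 1 ⊕ (θ ⊗ (θ ⊗ θ) ⊕ κ₁ ⊗ (V ⊗ V)) ⊗ (y ⊝ ι 1) ⊕ ι 3 ⊗ (N ⊗ ((z ⊝ y) ⊗ Q l T)))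
                (sym (s-yes inSl)) (sym (ind-yes (coprime? l M) (proj₁ inSl))))))
        where
        inSl : InS l
        inSl = InS-≈ (sym e) inS
      ... | no _ = go (inS? l)
        where
        go : (d : Dec (InS l)) → ι 3 ⊗ (N ⊗ (χ₀ l ⊗ Q l θ)) ≼ ι 3 ⊗ (N ⊗ Q h θ) ⊗ ι 0 ⊕ (θ ⊗ (θ ⊗ θ) ⊕ κ₁ ⊗ (V ⊗ V)) ⊗
          (ind d ⊝ ι 0) ⊕ ι 3 ⊗ (N ⊗ ((χ₀ l ⊝ ind d) ⊗ Q l T))
        go (yes (cl , _)) = subst (λ y → ι 3 ⊗ (N ⊗ (y ⊗ Q l θ)) ≼ ι 3 ⊗ (N ⊗ Q h θ) ⊗ ι 0 ⊕ (θ ⊗ (θ ⊗ θ) ⊕ κ₁ ⊗ (V ⊗ V)) ⊗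
          (ι 1 ⊝ ι 0) ⊕ ι 3 ⊗ (N ⊗ ((y ⊝ ι 1) ⊗ Q l T))) (sym (ind-yes (coprime? l M) cl))
          (linear 5 (λ n q u r p → con 3 :* (n :* q) :≤ u ⊢ con 3 :* (n :* (con 1 :* q)) :≤ con 3 :* (n :* p) :* con 0 :+ u :*
            (con 1 :- con 0) :+ con 3 :* (n :* ((con 1 :- con 1) :* r))) _ _ _ _ _ (Q-upper cl 0≼θ θ≼T))
        go (no _) = linear 6 (λ n c q u r p → 3 • (con 0 :≤ n :* (c :* (r :- q))) ⊢ con 3 :* (n :* (c :* q)) :≤ con 3 :* (n :* p)
          :* con 0 :+ u :* (con 0 :- con 0) :+ con 3 :* (n :* ((c :- con 0) :* r))) _ _ _ _ _ _
          (0≼⊗ N-nonneg (0≼⊗ (ind-nonneg (coprime? l M)) (a≼b⇒0≼b-a (Q-mono l θ≼T))))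

      -- Of the total θ³ / 6 at time θ, the classes outside S hold at most `rest`, and the other C -
      -- 1 dense ones about θ³ / (3 N) each at most. With N = 2 C this leaves almost θ³ / (3 N) to
      -- h; half of that is claimed.
      Q-θ-lower : ∀ {h} → InS h → θ ⊗ (θ ⊗ θ) ≼ ι 6 ⊗ (N ⊗ Q h θ)
      Q-θ-lower {h} inS = ≡≼ θ³≡ (linear 11 (λ n c j x k k₁ v q qt R t →
        2 • (con 3 :* (n :* qt) :≤ con 3 :* (n :* q) :* con 1 :+ (t :+ k₁ :* v) :* (c :- con 1) :+ con 3 :* (n :* R)) ⨾
            con 0 :≤ n :* ((con 6 :* qt :- t) :- :- (con 5 :* (k :* v))) ⨾ con 2 :* c :* (t :+ k₁ :* v) :≤ n :* (t :+ k₁ :* v) ⨾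
            6 • (con 0 :≤ n :* (con 9 :* (j :* j) :* x :- R)) ⨾ con 0 :≤ x :* (j :* j) :* (j :- (con 336 :* n :+ con 1)) ⨾
              282 • (con 0 :≤ x :* (j :* j) :* n) ⨾ con 0 :≤ x :* (j :* j :- con 1) ⨾
            con 5 :* (n :* (k :* v)) :+ n :* (k₁ :* v) :+ con 5 :* (k :* v) :+ k₁ :* v :≤ x ⨾ 5 • (con 0 :≤ k :* v) ⨾
              3 • (con 0 :≤ k₁ :* v) ⨾ 2 • (j :* (j :* j) :* x :≤ t)
            ⊢ j :* (j :* j) :* x :≤ con 6 :* (n :* q)) N C J x κ κ₁ (V ⊗ V) (Q h θ) (Q-total θ) rest (θ ⊗ (θ ⊗ θ))
          total (0≼⊗ N-nonneg (a≼b⇒0≼b-a (proj₁ (Q-total-within 0≼θ θ≼T)))) (≼-reflexive (⊗-cong (sym N≡2C) refl))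
            (0≼⊗ N-nonneg (a≼b⇒0≼b-a rest-small))
          (0≼⊗ (0≼⊗ 0≼x 0≼JJ) (a≼b⇒0≼b-a j-large)) (0≼⊗ (0≼⊗ 0≼x 0≼JJ) N-nonneg) (0≼⊗ 0≼x (a≼b⇒0≼b-a 1≼JJ)) errors κVV κ₁VV
            (≼-reflexive (sym θ³≡)))
        where
        1≼JJ : ι 1 ≼ J ⊗ J
        1≼JJ = ≡≼ (sym (⊗-identityˡ _)) (⊗-mono 0≼J 0≼1 1≼J 1≼J)
        total : ι 3 ⊗ (N ⊗ Q-total θ) ≼ ι 3 ⊗ (N ⊗ Q h θ) ⊗ ι 1 ⊕ (θ ⊗ (θ ⊗ θ) ⊕ κ₁ ⊗ (V ⊗ V)) ⊗ (C ⊝ ι 1) ⊕ ι 3 ⊗ (N ⊗ rest)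
        total = subst₂ _≼_ (trans (S-⊗ M _ _) (⊗-cong refl (trans (S-⊗ M _ _) (⊗-cong refl (Q-classes θ)))))
          (trans (S-⊕ M _ _) (⊕-cong (trans (S-⊕ M _ _) (⊕-cong (trans (S-⊗ M _ _) (⊗-cong refl (S-𝟙 h)))
            (trans (S-⊗ M _ _) (⊗-cong refl (trans (S-⊝ M _ _) (cong₂ _⊝_ refl (S-𝟙 h)))))))
            (trans (S-⊗ M _ _) (⊗-cong refl (S-⊗ M _ _)))))
          (S-mono M λ l _ _ → upper-θ inS l)

      0≺θ : ι 0 ≺ θ
      0≺θ = ≺-≼-trans (ι0≺ι1+ 0) (≼-trans 1≼τ τ≼θ)

      A-θ-lower : ∀ {h} → InS h → θ ≼ ι 6 ⊗ (N ⊗ A h θ)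
      A-θ-lower {h} inS = ⊗-cancelˡ 0≺θ (⊗-cancelˡ 0≺θ (linear 4 (λ t n q α → t :* (t :* t) :≤ con 6 :* (n :* q) ⨾
        6 • (con 0 :≤ n :* (t :* t :* α :- q)) ⊢ t :* (t :* t) :≤ t :* (t :* (con 6 :* (n :* α)))) _ _ _ _
        (Q-θ-lower inS) (0≼⊗ N-nonneg (a≼b⇒0≼b-a (Q≼A h 0≼θ)))))

      -- Pairs d ≡ h, e ≡ g with L d and L e at most θ have T - L d - L e ≥ θ; this is the reason
      -- for T = 3 θ.
      cross-lower : ∀ h g → θ ⊗ (A h θ ⊗ A g θ) ≼ cross (λ _ → ι 1) (h * g) T
      cross-lower h g = ≡≼ (trans (ring 3 (λ t a b → t :* (a :* b) := (t :* b) :* a) _ _ _) (sym (S-⊗ X _ _))) (S-mono X λ d p q →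
        ≼-trans (≼-reflexive (ring 5 (λ t a i w b → t :* (a :* (i :* (w :* b))) := a :* (b :* (i :* (w :* t)))) (θ ⊗ A g θ) (Λ d)
          (𝟙 h d) (pw 0 (θ ⊝ L d)) (inv d)))
          (⊗-monoʳ (Λ-nonneg d) (⊗-monoʳ (inv-nonneg d)
            (≡≼ (trans (ring 4 (λ i w t a → i :* (w :* (t :* a)) := i :* w :* t :* a) _ _ _ _) (sym (S-⊗ X _ _)))
            (S-mono X λ e r u → ≼-trans (≼-reflexive (ring 5 (λ i a k w b →
              i :* (a :* (k :* (w :* b))) := a :* (i :* (k :* w) :* b)) _ _ _ _ _))
              (⊗-monoʳ (Λ-nonneg e) (≼≡ (⊗-monoˡ (inv-nonneg e) (term d e p q r u (d ≈? h) (e ≈? g)))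
                (ring 3 (λ i w b → i :* w :* b := i :* (con 1 :* (w :* b))) _ _ _))))))))
        where
        term : ∀ d e → 1 ≤ d → d ≤ X → 1 ≤ e → e ≤ X → (D : Dec (d ≈ h)) (E : Dec (e ≈ g)) →
          ind D ⊗ pw 0 (θ ⊝ L d) ⊗ θ ⊗ (ind E ⊗ pw 0 (θ ⊝ L e)) ≼ 𝟙 (h * g) (d * e) ⊗ pw 1 (T ⊝ L d ⊝ L e)
        term d e p q r u (no _) E = ≡≼ (ring 3 (λ a b c → con 0 :* a :* b :* c := con 0) _ _ _)
          (0≼⊗ (𝟙-nonneg (h * g) (d * e)) (pw-nonneg 1 _))
        term d e p q r u (yes _) (no _) = ≡≼ (ring 3 (λ a b c → a :* b :* (con 0 :* c) := con 0) _ _ _)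
          (0≼⊗ (𝟙-nonneg (h * g) (d * e)) (pw-nonneg 1 _))
        term d e p q r u (yes y) (yes z) with ≼? (ι 0) (θ ⊝ L d) | ≼? (ι 0) (θ ⊝ L e)
        ... | inj₂ m | _ = ≡≼ (trans (⊗-cong (⊗-cong (⊗-cong refl (pw-neg 0 m)) refl) refl)
          (ring 2 (λ t w → con 1 :* con 0 :* t :* w := con 0) _ _)) (0≼⊗ (𝟙-nonneg (h * g) (d * e)) (pw-nonneg 1 _))
        ... | inj₁ _ | inj₂ m = ≡≼ (trans (⊗-cong refl (⊗-cong refl (pw-neg 0 m)))
          (ring 1 (λ w → w :* (con 1 :* con 0) := con 0) _)) (0≼⊗ (𝟙-nonneg (h * g) (d * e)) (pw-nonneg 1 _))
        ... | inj₁ m | inj₁ m′ = subst₂ _≼_ (trans (ring 1 (λ t → t := con 1 :* con 1 :* t :* (con 1 :* con 1)) θ)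
          (sym (cong₂ (λ a b → ι 1 ⊗ a ⊗ θ ⊗ (ι 1 ⊗ b)) (pw-pos 0 m) (pw-pos 0 m′))))
            (trans (ring 1 (λ u → u := con 1 :* (u :* con 1)) _)
              (sym (⊗-cong (ind-yes (d * e ≈? h * g) (≈-* y z)) (pw-pos 1 (≼-trans 0≼θ θ≼)))))
            θ≼
          where
          θ≼ : θ ≼ T ⊝ L d ⊝ L e
          θ≼ = subst (λ t → θ ≼ t ⊝ L d ⊝ L e) (sym T≡) (linear 3 (λ t l m → con 0 :≤ t :- l ⨾ con 0 :≤ t :- m ⊢
            t :≤ con 3 :* t :- l :- m) _ _ _ m m′)

    -- If h g were dense too, 3 N times its cross term would be at most about 27 J² x, although
    -- `cross-lower` and `A-θ-lower` make 36 N² times it at least J³ x. So J would be at most 324 N,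
    -- against `j-large`.
    product-free : ∀ h g → InS h → InS g → ¬ InS (h * g)
    product-free h g inh ing (cq , hq) = ≺⇒⋡ (ι0≺ι1+ 0) (≼-trans 1≼x x≼0)
      where
      crossed : cross (λ _ → ι 1) (h * g) T ≡ P (h * g) T ⊝ Q (h * g) T
      crossed = trans (ring 2 (λ q c → c := (q :+ c) :- q) _ _) (cong₂ _⊝_ (sym (P≡Q+cross (h * g) T)) refl)
      x≼0 : x ≼ ι 0
      x≼0 = linear 9 (λ n j x e c α β t J² → t :* (t :* t) :≤ con 36 :* (n :* n) :* (t :* (α :* β)) ⨾
        36 • (con 0 :≤ n :* n :* (c :- t :* (α :* β))) ⨾
        12 • (con 0 :≤ n :* ((con 27 :* J² :- con 9 :* j :+ con 2) :* x :+ e :- con 3 :* (n :* c))) ⨾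
        12 • (con 0 :≤ n :* (x :- e)) ⨾
            108 • (con 0 :≤ n :* x :* (j :- con 1)) ⨾ 72 • (con 0 :≤ n :* x) ⨾ j :* J² :* x :≤ t :* (t :* t) ⨾
              con 0 :≤ x :* J² :* (j :- (con 336 :* n :+ con 1)) ⨾ 12 • (con 0 :≤ x :* J² :* n) ⨾ con 0 :≤ x :* (J² :- con 1) ⊢
              x :≤ con 0) N J x (κ₁ ⊗ (V ⊗ V)) (cross (λ _ → ι 1) (h * g) T) (A h θ) (A g θ) θ (J ⊗ J)
        (≼-trans (⊗-monoʳ 0≼θ (⊗-mono (0≼⊗ (0≼ι 6) (0≼⊗ N-nonneg (A-nonneg h θ))) 0≼θ (A-θ-lower inh) (A-θ-lower ing)))
          (≼-reflexive (ring 4 (λ n α β t → t :* (con 6 :* (n :* α) :* (con 6 :* (n :* β))) := con 36 :* (n :* n) :*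
          (t :* (α :* β))) _ _ _ _)))
        (0≼⊗ (0≼⊗ N-nonneg N-nonneg) (a≼b⇒0≼b-a (cross-lower h g)))
        (0≼⊗ N-nonneg (a≼b⇒0≼b-a (subst (λ z → ι 3 ⊗ (N ⊗ z) ≼ (ι 27 ⊗ (J ⊗ J) ⊝ ι 9 ⊗ J ⊕ ι 2) ⊗ x ⊕ κ₁ ⊗ (V ⊗ V)) (sym crossed)
          (linear 6 (λ n P Q j x e → con 3 :* (n :* P) :- con 27 :* (j :* (j :* j)) :* x :≤ e ⨾
            (con 27 :* (j :* (j :* j)) :- con 27 :* (j :* j) :+ con 9 :* j :- con 2) :* x :≤ con 3 :* (n :* Q) ⊢
            con 3 :* (n :* (P :- Q)) :≤ (con 27 :* (j :* j) :- con 9 :* j :+ con 2) :* x :+ e) _ _ _ _ _ _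
            (subst (λ z → ι 3 ⊗ (N ⊗ P (h * g) T) ⊝ z ≼ κ₁ ⊗ (V ⊗ V)) T³≡ (proj₂ (P-within cq 0≼T ≼-refl))) (≡≼ (sym thr≡) hq)))))
        (0≼⊗ N-nonneg (a≼b⇒0≼b-a (linear 5 (λ a b c d x → con 5 :* a :+ b :+ c :+ d :≤ x ⨾ 5 • (con 0 :≤ a) ⨾ con 0 :≤ b ⨾
          con 0 :≤ c ⊢ d :≤ x) _ _ _ _ _ errors NκVV Nκ₁VV (0≼⊗ (0≼ι 5) κVV))))
        (0≼⊗ (0≼⊗ N-nonneg 0≼x) (a≼b⇒0≼b-a 1≼J)) (0≼⊗ N-nonneg 0≼x)
          (≼-reflexive (trans (cong (_⊗ x) (⊗-cong refl refl)) (sym θ³≡)))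
        (0≼⊗ (0≼⊗ 0≼x 0≼JJ) (a≼b⇒0≼b-a j-large)) (0≼⊗ (0≼⊗ 0≼x 0≼JJ) N-nonneg)
          (0≼⊗ 0≼x (a≼b⇒0≼b-a (≡≼ (sym (⊗-identityˡ _)) (⊗-mono 0≼J 0≼1 1≼J 1≼J))))

    private
      R : ℕ → F
      R n = χ₀ n ⊝ s n

      R-periodic : Periodic R
      R-periodic e = cong₂ _⊝_ (χ₀-≈ e) (s-periodic e)

      R-nonneg : ∀ n → ι 0 ≼ R n
      R-nonneg n = a≼b⇒0≼b-a (s≼χ₀ n)

      R-sum : S M R ≡ C
      R-sum = trans (S-⊝ M _ _) (trans (cong (_⊝ C) N≡2C) (ring 1 (λ c → con 2 :* c :- c := c) C))

      R-yes : ∀ {n} → Coprime n M → ¬ InS n → R n ≡ ι 1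
      R-yes {n} cn ¬s = trans (cong₂ _⊝_ (ind-yes (coprime? n M) cn) (ind-no (inS? n) ¬s)) (ring 0 (con 1 :- con 0 := con 1))

      -- Multiplication by h sends S into its complement by `product-free`, and onto it since both
      -- have C classes; hence it sends the complement to S. The sum of `f` counts the exceptions.
      S-translates-R : ∀ {h r} → InS h → Coprime r M → ¬ InS r → InS (h * r)
      S-translates-R {h} {r} inh cr ¬r with inS? (h * r)
      ... | yes i = i
      ... | no ¬i = ⊥-elim (≺⇒⋡ (ι0≺ι1+ 0) (≼-trans one zero-sum))
        where
        f : ℕ → F
        f k = R k ⊗ R (h * k)
        f-periodic : Periodic f
        f-periodic e = ⊗-cong (R-periodic e) (R-periodic (≈-* {h} {h} refl e))
        one : ι 1 ≼ S M f
        one = ≼-trans (≼-reflexive (trans (ring 0 (con 1 := con 1 :* con 1))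
          (trans (sym (⊗-cong (R-yes cr ¬r) (R-yes (coprime-* (proj₁ inh) cr) ¬i))) (sym (S-residue f r f-periodic)))))
          (S-mono M λ k _ _ → ≼≡ (⊗-monoˡ (0≼⊗ (R-nonneg k) (R-nonneg (h * k))) (ind≼1 (k ≈? r))) (⊗-identityˡ _))
        s-part : ∀ k → s k ⊗ R (h * k) ≡ s k
        s-part k = go (inS? k)
          where
          go : (d : Dec (InS k)) → ind d ⊗ R (h * k) ≡ ind d
          go (no _) = ⊗-zeroˡ _
          go (yes i) = trans (⊗-identityˡ _) (R-yes (coprime-* (proj₁ inh) (proj₁ i)) (product-free h k inh i))
        zero-sum : S M f ≼ ι 0
        zero-sum = ≼-reflexive (trans (S-cong M λ k _ _ → trans (ring 3 (λ c s r → (c :- s) :* r := c :* r :- s :* r) _ _ _)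
          (cong₂ _⊝_ (χ₀R k) (s-part k)))
          (trans (S-⊝ M _ _) (trans (cong₂ _⊝_ (trans (S-shift R R-periodic (proj₁ inh)) R-sum) refl) (⊕-inverseʳ C))))
          where
          χ₀R : ∀ k → χ₀ k ⊗ R (h * k) ≡ R (h * k)
          χ₀R k = go (coprime? k M)
            where
            go : (d : Dec (Coprime k M)) → ind d ⊗ R (h * k) ≡ R (h * k)
            go (yes _) = ⊗-identityˡ _
            go (no ¬c) = trans (⊗-zeroˡ _) (sym (trans (cong₂ _⊝_ (ind-no (coprime? (h * k) M) (¬c ∘ coprime-*ʳ h))
              (ind-no (inS? (h * k)) (¬c ∘ coprime-*ʳ h ∘ proj₁))) (⊕-inverseʳ _)))

      S-inhabited : Σ ℕ InS
      S-inhabited with search inS? M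
      ... | inj₁ r = r
      ... | inj₂ e = ⊥-elim (≺⇒⋡ (ι0≺ι1+ 0) (≼-trans 1≼N
        (≼-reflexive (trans N≡2C (trans (⊗-cong refl (S-zero M λ i p q → ind-no (inS? i) (e i p q))) (⊗-zeroʳ _))))))

      -- For h in S also h r and then h r r′ are in S, so r r′ in S would contradict `product-free`.
      R-closed : ∀ {r r′} → Coprime r M → ¬ InS r → Coprime r′ M → ¬ InS r′ → ¬ InS (r * r′)
      R-closed {r} {r′} cr ¬r cr′ ¬r′ i with S-inhabited
      ... | h , inh = product-free h (r * r′) inh i
        (InS-≈ (≈-≡ (ℕₚ.*-assoc h r r′)) (S-translates-R (S-translates-R inh cr ¬r) cr′ ¬r′))

      ψ′ : ℕ → F
      ψ′ n = χ₀ n ⊝ ι 2 ⊗ s n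

      ψ-S : ∀ {n} → InS n → ψ′ n ≡ ⊖ ι 1
      ψ-S {n} i = trans (cong₂ (λ a b → a ⊝ ι 2 ⊗ b) (ind-yes (coprime? n M) (proj₁ i)) (s-yes i))
        (ring 0 (con 1 :- con 2 :* con 1 := :- con 1))

      ψ-R : ∀ {n} → Coprime n M → ¬ InS n → ψ′ n ≡ ι 1
      ψ-R {n} cn ¬i = trans (cong₂ (λ a b → a ⊝ ι 2 ⊗ b) (ind-yes (coprime? n M) cn) (ind-no (inS? n) ¬i))
        (ring 0 (con 1 :- con 2 :* con 0 := con 1))

      ψ-0 : ∀ {n} → ¬ Coprime n M → ψ′ n ≡ ι 0
      ψ-0 {n} ¬c = trans (cong₂ (λ a b → a ⊝ ι 2 ⊗ b) (ind-no (coprime? n M) ¬c) (ind-no (inS? n) (¬c ∘ proj₁)))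
        (ring 0 (con 0 :- con 2 :* con 0 := con 0))

      ψ-mul : ∀ m n → ψ′ (m * n) ≡ ψ′ m ⊗ ψ′ n
      ψ-mul m n = go (coprime? m M) (coprime? n M) (inS? m) (inS? n)
        where
        go : Dec (Coprime m M) → Dec (Coprime n M) → Dec (InS m) → Dec (InS n) → ψ′ (m * n) ≡ ψ′ m ⊗ ψ′ n
        go (no ¬c) _ _ _ = trans (ψ-0 (¬c ∘ coprime-*ˡ n)) (sym (trans (⊗-cong (ψ-0 ¬c) refl) (⊗-zeroˡ _)))
        go (yes _) (no ¬c) _ _ = trans (ψ-0 (¬c ∘ coprime-*ʳ m)) (sym (trans (⊗-cong refl (ψ-0 ¬c)) (⊗-zeroʳ _)))
        go (yes cm) (yes cn) (yes i) (yes k) = trans (ψ-R (coprime-* cm cn) (product-free m n i k))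
          (trans (ring 0 (con 1 := :- con 1 :* :- con 1)) (sym (⊗-cong (ψ-S i) (ψ-S k))))
        go (yes cm) (yes cn) (yes i) (no ¬k) = trans (ψ-S (S-translates-R i cn ¬k))
          (trans (ring 0 (:- con 1 := :- con 1 :* con 1)) (sym (⊗-cong (ψ-S i) (ψ-R cn ¬k))))
        go (yes cm) (yes cn) (no ¬i) (yes k) = trans (ψ-S (InS-≈ (≈-≡ (ℕₚ.*-comm n m)) (S-translates-R k cm ¬i)))
          (trans (ring 0 (:- con 1 := con 1 :* :- con 1)) (sym (⊗-cong (ψ-R cm ¬i) (ψ-S k))))
        go (yes cm) (yes cn) (no ¬i) (no ¬k) = trans (ψ-R (coprime-* cm cn) (R-closed cm ¬i cn ¬k))
          (trans (ring 0 (con 1 := con 1 :* con 1)) (sym (⊗-cong (ψ-R cm ¬i) (ψ-R cn ¬k))))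

    exceptional-character : RealCharacter M
    exceptional-character = record
      { ψ = ψ′
      ; ψ-periodic = λ e → cong₂ (λ a b → a ⊝ ι 2 ⊗ b) (χ₀-≈ e) (s-periodic e)
      ; ψ-* = ψ-mul
      ; ψ-sum = trans (S-⊝ M _ _) (trans (cong₂ _⊝_ N≡2C (S-⊗ M _ _)) (⊕-inverseʳ _))
      ; ψ-unit = unit
      ; ψ-nonunit = ψ-0
      }
      where
      unit : ∀ {n} → Coprime n M → ψ′ n ≡ ι 1 ⊎ ψ′ n ≡ ⊖ ι 1
      unit {n} cn = go (inS? n)
        where
        go : Dec (InS n) → ψ′ n ≡ ι 1 ⊎ ψ′ n ≡ ⊖ ι 1
        go (yes i) = inj₂ (ψ-S i)
        go (no ¬i) = inj₁ (ψ-R cn ¬i)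

    -- χ₀ + ψ is twice the indicator of the reduced classes outside S, and these hold only `rest`.
    exceptional-density : S X (λ n → Λ n ⊗ ((χ₀ n ⊕ RealCharacter.ψ exceptional-character n) ⊗ (L n ⊗ w 1 T n))) ≼ ι 18 ⊗ (J ⊗ J)
      ⊗ x
    exceptional-density = ≼-trans (≼-reflexive (trans (S-cong X λ n _ _ →
      trans (ring 4 (λ a c s f → a :* ((c :+ (c :- con 2 :* s)) :* f) := con 2 :* (a :* ((c :- s) :* f))) _ _ _ _) refl)
      (trans (S-⊗ X _ _) (⊗-cong refl (sym as-classes)))))
      (≼≡ (⊗-monoʳ (0≼ι 2) rest-small) (ring 2 (λ j x → con 2 :* (con 9 :* j :* x) := con 18 :* j :* x) _ _))
      where
      as-classes : rest ≡ S X (λ n → Λ n ⊗ (R n ⊗ (L n ⊗ w 1 T n)))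
      as-classes = trans (S-cong M λ l _ _ → sym (S-⊗ X _ _)) (trans (S-swap M X _) (S-cong X λ n _ _ →
        trans (S-cong M λ l _ _ → trans (ring 4 (λ c a b f → c :* (a :* (b :* f)) := a :* f :* (b :* c)) _ _ _ _)
          (⊗-cong refl (⊗-cong (𝟙-sym l n) refl)))
          (trans (S-⊗ M _ _) (trans (⊗-cong refl (S-residue R n R-periodic)) (ring 3 (λ a f c → a :* f :* c := a :* (c :* f)) _ _
            _)))))

-- Lower bounds for real characters

S-count-injective : ∀ Y (φ : ℕ → ℕ) n → (∀ {i j} → φ i ≡ φ j → i ≡ j) → S Y (λ m → ind (n ≟ φ m)) ≼ ι 1
S-count-injective zero φ n inj = 0≼1
S-count-injective (suc Y) φ n inj with n ≟ φ (suc Y)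
... | yes e = ≼-reflexive (trans (⊕-cong (S-zero Y λ m _ m≤Y → ind-no (n ≟ φ m) λ e′ → ℕₚ.<⇒≢ (s≤s m≤Y) (inj (trans (sym e′) e)))
  refl) (⊕-identityˡ _))
... | no _ = ≡≼ (⊕-identityʳ _) (S-count-injective Y φ n inj)

-- An injective φ represents each n at most once, so for f ≥ 0 nothing is counted twice.
S-subsum : ∀ X Y (φ : ℕ → ℕ) (f : ℕ → F) → (∀ {i j} → φ i ≡ φ j → i ≡ j) → (∀ m → 1 ≤ m → m ≤ Y → 1 ≤ φ m) →
  (∀ n → X < n → f n ≡ ι 0) →
  (∀ n → 1 ≤ n → n ≤ X → ι 0 ≼ f n) → S Y (λ m → f (φ m)) ≼ S X f
S-subsum X Y φ f inj pos van nonneg = ≡≼ (S-reindex X Y φ f pos (λ m _ _ → van (φ m)))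
  (S-mono X λ n p q → ≼≡ (⊗-monoʳ (nonneg n p q) (S-count-injective Y φ n inj)) (⊗-identityʳ _))

square-injective : ∀ {a b} → a * a ≡ b * b → a ≡ b
square-injective {a} {b} e with ℕₚ.m≤n⇒m<n∨m≡n (ℕₚ.≮⇒≥ {a} {b} λ a<b → ℕₚ.<⇒≢ (ℕₚ.*-mono-< a<b a<b) e)
... | inj₁ b<a = ⊥-elim (ℕₚ.<⇒≢ (ℕₚ.*-mono-< b<a b<a) (sym e))
... | inj₂ e′ = sym e′

S-divisors : ∀ X (u f : ℕ → F) → (∀ n → X < n → f n ≡ ι 0) →
  S X (λ n → S X (λ d → ind (d ∣? n) ⊗ u d) ⊗ f n) ≡ S X (λ d → u d ⊗ S X λ m → f (d * m))
S-divisors X u f van = begin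
  S X (λ n → S X (λ d → ind (d ∣? n) ⊗ u d) ⊗ f n) ≡⟨ S-cong X (λ n _ _ → trans (⊗-comm _ _) (sym (S-⊗ X (f n) _))) ⟩
  S X (λ n → S X λ d → f n ⊗ (ind (d ∣? n) ⊗ u d)) ≡⟨ S-swap X X _ ⟩
  S X (λ d → S X λ n → f n ⊗ (ind (d ∣? n) ⊗ u d)) ≡⟨ S-cong X (λ d p _ →
    trans (S-cong X λ n _ _ → ring 3 (λ f i l → f :* (i :* l) := l :* (i :* f)) _ _ _)
      (trans (S-⊗ X (u d) _) (⊗-cong refl (sym (S-multiples X d f p van))))) ⟩
  S X (λ d → u d ⊗ S X λ m → f (d * m)) ∎ where open ≡-Reasoning

module RealCharacterSums (X : ℕ) (1≤X : 1 ≤ X) (lg : Logarithm X) (M : ℕ) {{M≢0 : NonZero M}} (character : RealCharacter M) where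
  open VonMangoldt X 1≤X lg
  open VonMangoldtEstimates X 1≤X lg using (Λ-square)
  open Residues M
  open RealCharacter character

  ψ-1 : ψ 1 ≡ ι 1
  ψ-1 with ψ-unit coprime-1
  ... | inj₁ e = e
  ... | inj₂ e = trans (ψ-* 1 1) (trans (⊗-cong e e) (ring 0 (:- con 1 :* :- con 1 := con 1)))

  ψ-within : ∀ n → ψ n within ι 1
  ψ-within n with coprime? n M
  ... | no ¬c = subst (_within ι 1) (sym (ψ-nonunit ¬c)) (linear 0 (con 0 :≤ con 1 ⊢ :- con 1 :≤ con 0) 0≼1 , 0≼1)
  ... | yes c with ψ-unit c
  ...   | inj₁ e = subst (_within ι 1) (sym e) (nonneg-within 0≼1)
  ...   | inj₂ e = subst (_within ι 1) (sym e) (within-⊖ (nonneg-within 0≼1))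

  1+ψ-nonneg : ∀ n → ι 0 ≼ ι 1 ⊕ ψ n
  1+ψ-nonneg n = linear 1 (λ p → :- con 1 :≤ p ⊢ con 0 :≤ con 1 :+ p) _ (proj₁ (ψ-within n))

  ψ-square : ∀ {n} → Coprime n M → ψ (n * n) ≡ ι 1
  ψ-square {n} c with ψ-unit c
  ... | inj₁ e = trans (ψ-* n n) (trans (⊗-cong e e) (ring 0 (con 1 :* con 1 := con 1)))
  ... | inj₂ e = trans (ψ-* n n) (trans (⊗-cong e e) (ring 0 (:- con 1 :* :- con 1 := con 1)))

  r : ℕ → F
  r n = S X (λ d → ind (d ∣? n) ⊗ ψ d)

  r-sum : ∀ (f : ℕ → F) → (∀ n → X < n → f n ≡ ι 0) → S X (λ n → r n ⊗ f n) ≡ S X (λ d → ψ d ⊗ S X λ m → f (d * m))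
  r-sum f van = S-divisors X ψ f van

  private
    big : ∀ {n} d → 1 ≤ d → X < n → X < d * n
    big {n} d p q = ℕₚ.≤-trans q (ℕₚ.m≤n*m n d {{>-nonZero p}})

    flip : ∀ a b c → a * (b * c) ≡ b * (a * c)
    flip a b c = trans (sym (ℕₚ.*-assoc a b c)) (trans (cong (_* c) (ℕₚ.*-comm a b)) (ℕₚ.*-assoc b a c))

  -- The logarithmic derivative of the Dirichlet series of r is that of ζ plus that of ψ.
  r-log-sum : ∀ (f : ℕ → F) → (∀ n → X < n → f n ≡ ι 0) →
    S X (λ n → r n ⊗ (L n ⊗ f n)) ≡ S X (λ e → Λ e ⊗ ((ι 1 ⊕ ψ e) ⊗ S X λ n → r n ⊗ f (e * n)))
  r-log-sum f van = begin
    S X (λ n → r n ⊗ (L n ⊗ f n)) ≡⟨ r-sum (λ n → L n ⊗ f n) (λ n p → trans (⊗-cong refl (van n p)) (⊗-zeroʳ _)) ⟩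
    S X (λ d → ψ d ⊗ S X λ m → L (d * m) ⊗ f (d * m)) ≡⟨ S-cong X (λ d p _ →
      trans (sym (S-⊗ X _ _)) (trans (S-cong X λ m q _ → trans (cong (λ l → ψ d ⊗ (l ⊗ f (d * m))) (L-* d m p q))
        (ring 4 (λ p a b f → p :* ((a :+ b) :* f) := p :* f :* a :+ p :* (f :* b)) _ _ _ _)) (S-⊕ X _ _))) ⟩
    S X (λ d → S X (λ m → ψ d ⊗ f (d * m) ⊗ L d) ⊕ S X (λ m → ψ d ⊗ (f (d * m) ⊗ L m))) ≡⟨ trans (S-⊕ X _ _) (⊕-comm _ _) ⟩
    S X (λ d → S X (λ m → ψ d ⊗ (f (d * m) ⊗ L m))) ⊕ S X (λ d → S X (λ m → ψ d ⊗ f (d * m) ⊗ L d)) ≡⟨ ⊕-cong plain twisted ⟩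
    S X (λ e → Λ e ⊗ g e) ⊕ S X (λ e → Λ e ⊗ (ψ e ⊗ g e)) ≡⟨ trans (sym (S-⊕ X _ _)) (S-cong X λ e _ _ →
      ring 3 (λ l p g → l :* g :+ l :* (p :* g) := l :* ((con 1 :+ p) :* g)) _ _ _) ⟩
    S X (λ e → Λ e ⊗ ((ι 1 ⊕ ψ e) ⊗ g e)) ∎
    where
    open ≡-Reasoning
    g : ℕ → F
    g e = S X λ n → r n ⊗ f (e * n)
    g≡ : ∀ e → 1 ≤ e → g e ≡ S X (λ d → ψ d ⊗ S X λ m → f (e * (d * m)))
    g≡ e p = r-sum (λ n → f (e * n)) λ n q → van (e * n) (big e p q)
    plain : S X (λ d → S X (λ m → ψ d ⊗ (f (d * m) ⊗ L m))) ≡ S X (λ e → Λ e ⊗ g e)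
    plain = trans (S-cong X λ d p _ → trans (S-⊗ X _ _)
      (trans (⊗-cong refl (log-convolution (λ m → f (d * m)) λ m q → van (d * m) (big d p q)))
      (trans (sym (S-⊗ X _ _)) (S-cong X λ e _ _ →
        trans (ring 3 (λ p l s → p :* (l :* s) := l :* (p :* s)) _ _ _)
          (⊗-cong refl (⊗-cong refl (S-cong X λ m _ _ → cong f (flip d e m))))))))
      (trans (S-swap X X _) (S-cong X λ e p _ → trans (S-⊗ X _ _) (⊗-cong refl (sym (g≡ e p)))))
    twisted : S X (λ d → S X (λ m → ψ d ⊗ f (d * m) ⊗ L d)) ≡ S X (λ e → Λ e ⊗ (ψ e ⊗ g e))
    twisted = trans (S-swap X X _) (trans (S-cong X λ m p _ → trans (log-convolution (λ d → ψ d ⊗ f (d * m)) λ d q →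
      trans (⊗-cong refl (van (d * m) (subst (X <_) (ℕₚ.*-comm m d) (big m p q)))) (⊗-zeroʳ _))
        (S-cong X λ e _ _ → ⊗-cong refl (trans (S-cong X λ k _ _ → trans (⊗-cong (ψ-* e k) (cong f (ℕₚ.*-assoc e k m)))
          (⊗-assoc _ _ _)) (S-⊗ X _ _))))
      (trans (S-swap X X _) (S-cong X λ e p _ → trans (S-⊗ X _ _)
        (⊗-cong refl (trans (S-⊗ X _ _) (⊗-cong refl (trans (S-swap X X _)
        (trans (S-cong X λ k _ _ → S-⊗ X _ _) (sym (g≡ e p))))))))))

  L-positive : ∀ {n} → 2 ≤ n → n ≤ X → ι 0 ≺ L n
  L-positive {n} p q = ⋡⇒≺ λ h → ≺⇒⋡ (ι0≺ι1+ 0) (linear 2 (λ l l′ → con 1 :≤ con 4 :* l ⨾ 4 • (l :≤ l′) ⨾ 4 • (l′ :≤ con 0) ⊢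
    con 1 :≤ con 0) _ _ 1≼4L2 (L-mono (s≤s z≤n) p (ℕₚ.m≤n⇒m≤1+n (ℕₚ.≤-trans q X≤XX))) h)

  r-1 : r 1 ≡ ι 1
  r-1 = trans (S-single X 1 ℕₚ.≤-refl 1≤X λ d p _ d≢1 → ind-zero (d ∣? 1) λ h → d≢1 (ℕₚ.≤-antisym (∣⇒≤ h) p))
    (trans (ind-one (1 ∣? 1) (divides 1 refl)) ψ-1)

  private
    δ-sum : ℕ → ℕ → F
    δ-sum n e = S X λ k → r k ⊗ ind (e * k ≟ n)

    -- The case of `r-log-sum` where f is the indicator of n. It stands in for the multiplicativity
    -- of r in `r-nonneg` and `r-square`.
    r-recursion : ∀ n → 1 ≤ n → n ≤ X → L n ⊗ r n ≡ S X (λ e → Λ e ⊗ ((ι 1 ⊕ ψ e) ⊗ δ-sum n e))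
    r-recursion n p q = trans (sym (S-single X n p q λ i _ _ i≢n →
      trans (⊗-cong refl (trans (⊗-cong refl (ind-no (i ≟ n) i≢n)) (⊗-zeroʳ _))) (⊗-zeroʳ _)) |> trans (sym at-n))
        (r-log-sum (λ k → ind (k ≟ n)) λ k X<k → ind-no (k ≟ n) λ { refl → ℕₚ.<⇒≱ X<k q })
      where
      at-n : r n ⊗ (L n ⊗ ind (n ≟ n)) ≡ L n ⊗ r n
      at-n = trans (⊗-cong refl (trans (⊗-cong refl (ind-yes (n ≟ n) refl)) (⊗-identityʳ _))) (⊗-comm _ _)

    summand-nonneg : ∀ n → 1 ≤ n → (∀ {k} → k < n → 1 ≤ k → ι 0 ≼ r k) → ∀ e → 1 ≤ e → ι 0 ≼ Λ e ⊗ ((ι 1 ⊕ ψ e) ⊗ δ-sum n e)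
    summand-nonneg n 1≤n rec e p with e ≟ 1
    ... | yes refl = ≼-reflexive (sym (trans (⊗-cong Λ-1 refl) (⊗-zeroˡ _)))
    ... | no e≢1 = 0≼⊗ (Λ-nonneg e) (0≼⊗ (1+ψ-nonneg e) (S-nonneg X λ k 1≤k _ → term k 1≤k))
      where
      term : ∀ k → 1 ≤ k → ι 0 ≼ r k ⊗ ind (e * k ≟ n)
      term k 1≤k with e * k ≟ n
      ... | no _ = ≼-reflexive (sym (⊗-zeroʳ _))
      ... | yes refl = 0≼⊗ (rec (subst (_< e * k) (ℕₚ.*-identityˡ k) (ℕₚ.*-monoˡ-< k {{>-nonZero 1≤k}} (ℕₚ.≤∧≢⇒< p (e≢1 ∘ sym))))
        1≤k) 0≼1

  -- In `r-recursion` the factors Λ e and 1 + ψ e are nonnegative and Λ 1 = 0, so r n is built from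
  -- values at smaller numbers.
  r-nonneg : ∀ n → 1 ≤ n → n ≤ X → ι 0 ≼ r n
  r-nonneg = <-rec (λ n → 1 ≤ n → n ≤ X → ι 0 ≼ r n) step
    where
    step : ∀ n → (∀ {k} → k < n → 1 ≤ k → k ≤ X → ι 0 ≼ r k) → 1 ≤ n → n ≤ X → ι 0 ≼ r n
    step n rec 1≤n n≤X with n ≟ 1
    ... | yes refl = ≼≡ 0≼1 (sym r-1)
    ... | no n≢1 = ⊗-cancelˡ (L-positive (ℕₚ.≤∧≢⇒< 1≤n (n≢1 ∘ sym)) n≤X) (≡≼ (⊗-zeroʳ _) (≼≡ (S-nonneg X λ e p _ →
        summand-nonneg n 1≤n (λ k<n p → rec k<n p (ℕₚ.≤-trans (ℕₚ.<⇒≤ k<n) n≤X)) e p) (sym (r-recursion n 1≤n n≤X))))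

  -- In the recursion for m * m keep e = c * c with c dividing m. There 1 + ψ e = 2, the cofactor is
  -- a smaller square, Λ e is at least Λ c, and the sum of 2 Λ c is 2 L m = L (m * m).
  r-square : ∀ m → 1 ≤ m → m * m ≤ X → Coprime m M → ι 1 ≼ r (m * m)
  r-square = <-rec (λ m → 1 ≤ m → m * m ≤ X → Coprime m M → ι 1 ≼ r (m * m)) step
    where
    step : ∀ m → (∀ {k} → k < m → 1 ≤ k → k * k ≤ X → Coprime k M → ι 1 ≼ r (k * k)) → 1 ≤ m → m * m ≤ X → Coprime m M →
      ι 1 ≼ r (m * m)
    step m rec 1≤m mm≤X cm with m ≟ 1
    ... | yes refl = ≼-reflexive (sym r-1)
    ... | no m≢1 = ⊗-cancelˡ (L-positive 2≤mm mm≤X) (≡≼ (⊗-identityʳ _) (≼≡ lower (sym (r-recursion (m * m) 1≤mm mm≤X))))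
      where
      2≤m : 2 ≤ m
      2≤m = ℕₚ.≤∧≢⇒< 1≤m (m≢1 ∘ sym)
      1≤mm : 1 ≤ m * m
      1≤mm = ℕₚ.*-mono-≤ 1≤m 1≤m
      2≤mm : 2 ≤ m * m
      2≤mm = ℕₚ.*-mono-≤ 2≤m 1≤m
      m≤mm : m ≤ m * m
      m≤mm = subst (_≤ m * m) (ℕₚ.*-identityʳ m) (ℕₚ.*-monoʳ-≤ m 1≤m)
      G G′ : ℕ → F
      G e = Λ e ⊗ ((ι 1 ⊕ ψ e) ⊗ δ-sum (m * m) e)
      G′ e = ind (e ≤? X) ⊗ G e
      G-nonneg : ∀ e → 1 ≤ e → ι 0 ≼ G e
      G-nonneg = summand-nonneg (m * m) 1≤mm λ k< p → r-nonneg _ p (ℕₚ.≤-trans (ℕₚ.<⇒≤ k<) mm≤X)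
      term : ∀ c → 1 ≤ c → (d : Dec (c ∣ m)) → ι 2 ⊗ (ind d ⊗ Λ c) ≼ G′ (c * c)
      term c 1≤c (no _) = ≡≼ (ring 1 (λ l → con 2 :* (con 0 :* l) := con 0) _)
        (0≼⊗ (ind-nonneg (c * c ≤? X)) (G-nonneg (c * c) (ℕₚ.*-mono-≤ 1≤c 1≤c)))
      term c 1≤c (yes (divides q e)) with c ≟ 1
      ... | yes refl = ≡≼ (trans (cong (λ l → ι 2 ⊗ (ι 1 ⊗ l)) Λ-1) (ring 0 (con 2 :* (con 1 :* con 0) := con 0)))
        (0≼⊗ (ind-nonneg (1 ≤? X)) (G-nonneg 1 ℕₚ.≤-refl))
      ... | no c≢1 = ≼≡ (≼-trans (≼-reflexive (ring 1 (λ l → con 2 :* (con 1 :* l) := l :* ((con 1 :+ con 1) :* con 1)) _))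
            (⊗-mono (Λ-nonneg (c * c)) (0≼⊗ (0≼⊕ 0≼1 0≼1) 0≼1) (Λ-square c 1≤c cc≤X)
              (≼≡ (⊗-monoʳ (0≼⊕ 0≼1 0≼1) δ-sum≥1) (cong (λ z → (ι 1 ⊕ z) ⊗ δ-sum (m * m) (c * c)) (sym (ψ-square cc))))))
          (sym (ind-one (c * c ≤? X) cc≤X))
        where
        c∣m : c ∣ m
        c∣m = divides q e
        cc : Coprime c M
        cc = coprime-*ʳ q (subst (λ z → Coprime z M) e cm)
        cq : Coprime q M
        cq = coprime-*ˡ c (subst (λ z → Coprime z M) e cm)
        1≤q : 1 ≤ q
        1≤q = ℕₚ.n≢0⇒n>0 λ { refl → ℕₚ.<⇒≢ 1≤m (sym e) }
        q<m : q < m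
        q<m = subst (q <_) (sym e) (ℕₚ.m<m*n q c {{>-nonZero 1≤q}} (ℕₚ.≤∧≢⇒< 1≤c (c≢1 ∘ sym)))
        qq≤X : q * q ≤ X
        qq≤X = ℕₚ.≤-trans (ℕₚ.*-mono-≤ (ℕₚ.<⇒≤ q<m) (ℕₚ.<⇒≤ q<m)) mm≤X
        c≤m : c ≤ m
        c≤m = ∣⇒≤ {{>-nonZero 1≤m}} c∣m
        cc≤X : c * c ≤ X
        cc≤X = ℕₚ.≤-trans (ℕₚ.*-mono-≤ c≤m c≤m) mm≤X
        ccqq : c * c * (q * q) ≡ m * m
        ccqq = trans (ℕₚ.*-comm (c * c) (q * q)) (trans (ℕₚ.[m*n]*[o*p]≡[m*o]*[n*p] q q c c) (cong₂ _*_ (sym e) (sym e)))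
        δ-sum≥1 : ι 1 ≼ δ-sum (m * m) (c * c)
        δ-sum≥1 = ≼-trans (≼≡ (rec q<m 1≤q qq≤X cq) (sym (trans (⊗-cong refl (ind-yes (c * c * (q * q) ≟ m * m) ccqq))
          (⊗-identityʳ _))))
          (S-term X (q * q) (ℕₚ.*-mono-≤ 1≤q 1≤q) qq≤X λ k p k≤X → 0≼⊗ (r-nonneg k p k≤X) (ind-nonneg (c * c * k ≟ m * m)))
      lower : L (m * m) ≼ S X G
      lower = ≼-trans (≼-reflexive (trans (L-* m m 1≤m 1≤m)
        (trans (ring 1 (λ l → l :+ l := con 2 :* l) _) (⊗-cong refl (sym (Λ-divisor-sum m 1≤m (ℕₚ.≤-trans m≤mm mm≤X)))))))
        (≼-trans (≼-trans (≼-reflexive (sym (S-⊗ X _ _))) (S-mono X λ c p _ → term c p (c ∣? m)))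
          (≼-trans (S-subsum X X (λ c → c * c) G′ square-injective (λ c p _ → ℕₚ.*-mono-≤ p p) (λ n X<n →
            ind-zero (n ≤? X) (ℕₚ.<⇒≱ X<n)) λ n p _ → 0≼⊗ (ind-nonneg (n ≤? X)) (G-nonneg n p))
            (≼-reflexive (S-cong X λ n _ q → ind-one (n ≤? X) q))))

-- The mean value of r and the partial sums of L(1, ψ)

ι-∸ : ∀ {m n} → n ≤ m → ι (m ∸ n) ≡ ι m ⊝ ι n
ι-∸ {m} {n} h = trans (ring 2 (λ a b → b := (a :+ b) :- a) (ι n) _)
  (cong (_⊝ ι n) (trans (sym (ι-+ n (m ∸ n))) (cong ι (ℕₚ.m+[n∸m]≡n h))))

S-ι : ∀ n → ι 2 ⊗ S n ι ≡ ι n ⊗ (ι n ⊕ ι 1)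
S-ι zero = ring 0 (con 2 :* con 0 := con 0 :* (con 0 :+ con 1))
S-ι (suc n) = subst (λ s → ι 2 ⊗ (S n ι ⊕ s) ≡ s ⊗ (s ⊕ ι 1)) (sym (ι-+ 1 n))
  (trans (ring 2 (λ s n → con 2 :* (s :+ (con 1 :+ n)) := con 2 :* s :+ (con 2 :+ con 2 :* n)) _ _)
    (trans (⊕-cong (S-ι n) refl) (ring 1 (λ n → n :* (n :+ con 1) :+ (con 2 :+ con 2 :* n) := (con 1 :+ n) :*
    ((con 1 :+ n) :+ con 1)) _)))

module RealCharacterBound (X : ℕ) (1≤X : 1 ≤ X) (lg : Logarithm X) (M : ℕ) {{M≢0 : NonZero M}} (character : RealCharacter M) where
  open VonMangoldt X 1≤X lg
  open Residues M
  open RealCharacter character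
  open RealCharacterSums X 1≤X lg M character

  ψ-partial : ∀ y → S y ψ within ι M
  ψ-partial y = within-≡ (periodic-bound ψ M (ι 1) 1≤M (λ i _ → ψ-periodic (trans (≈-≡ (ℕₚ.+-comm M i)) ([m+n]%n≡m%n i M))) ψ-sum
    ψ-within y) (⊗-identityʳ _)

  ψ-tail : ∀ y k (Φ : ℕ → F) → (∀ d → 1 ≤ d → Φ (suc d) ≼ Φ d) → (∀ d → ι 0 ≼ Φ d) → S k (λ i → ψ (y + i) ⊗ Φ (y + i)) within
    (ι 2 ⊗ ι M) ⊗ Φ (suc y)
  ψ-tail y k Φ dec nonneg = subst (λ d → S k (λ i → ψ (y + i) ⊗ Φ (y + i)) within (ι 2 ⊗ ι M) ⊗ Φ d) (ℕₚ.+-comm y 1)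
    (abel-bound (λ i → ψ (y + i)) (λ i → Φ (y + i)) (ι 2 ⊗ ι M) k partial (λ m p _ →
      ≡≼ (cong Φ (ℕₚ.+-suc y m)) (dec (y + m) (ℕₚ.≤-trans p (ℕₚ.m≤n+m m y)))) (nonneg _))
    where
    partial : ∀ i → S i (λ i → ψ (y + i)) within ι 2 ⊗ ι M
    partial i = subst₂ _within_ (trans (cong₂ _⊝_ (S-+ y i ψ) refl) (ring 2 (λ a b → a :+ b :- a := b) _ _))
      (ring 1 (λ m → m :+ m := con 2 :* m) _) (within-⊕ (ψ-partial (y + i)) (within-⊖ (ψ-partial y)))

  inner : ℕ → ℕ → F
  inner x d = S X λ m → ι (x ∸ d * m)

  inner-nonneg : ∀ x d → ι 0 ≼ inner x d
  inner-nonneg x d = S-nonneg X λ m _ _ → 0≼ι (x ∸ d * m)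

  inner-decreasing : ∀ x d → inner x (suc d) ≼ inner x d
  inner-decreasing x d = S-mono X λ m _ _ → ι-mono (ℕₚ.∸-monoʳ-≤ x (ℕₚ.m≤n+m (d * m) m))

  remainder : ℕ → (d : ℕ) → {{NonZero d}} → F
  remainder x d = ι (x % d) ⊗ (ι d ⊝ ι (x % d)) ⊗ inv d

  -- An arithmetic progression with x / d terms. The part - x does not depend on d, so it is
  -- harmless against ψ, and the remainder is less than d. This is what the linear weight x - n
  -- gains over plain counting.
  inner-value : ∀ x d {{_ : NonZero d}} → 1 ≤ d → x ≤ X → ι 2 ⊗ inner x d ≡ ι x ⊗ ι x ⊗ inv d ⊝ ι x ⊕ remainder x d
  inner-value x d 1≤d x≤X = begin
    ι 2 ⊗ inner x d ≡⟨ ⊗-cong refl (trans (S-extend (ℕₚ.≤-trans (m/n≤m x d) x≤X) λ m q<m _ → cong ι (ℕₚ.m≤n⇒m∸n≡0 (beyond m q<m)))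
      (trans (S-cong q λ m _ m≤q → trans (ι-∸ (inside m m≤q)) (cong (ι x ⊝_) (ι-* d m)))
      (trans (S-⊝ q _ _) (cong₂ _⊝_ (S-const q (ι x)) (S-⊗ q (ι d) ι))))) ⟩
    ι 2 ⊗ (ι q ⊗ ι x ⊝ ι d ⊗ S q ι) ≡⟨ ring 4 (λ q x d s → con 2 :* (q :* x :- d :* s) := con 2 :* (q :* x) :- d :* (con 2 :* s))
      _ _ _ _ ⟩
    ι 2 ⊗ (ι q ⊗ ι x) ⊝ ι d ⊗ (ι 2 ⊗ S q ι) ≡⟨ cong₂ (λ a b → ι 2 ⊗ (ι q ⊗ a) ⊝ ι d ⊗ b) x≡ (S-ι q) ⟩
    ι 2 ⊗ (ι q ⊗ (ι s ⊕ ι q ⊗ ι d)) ⊝ ι d ⊗ (ι q ⊗ (ι q ⊕ ι 1)) ≡⟨ ring 3 (λ q s d →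
      con 2 :* (q :* (s :+ q :* d)) :- d :* (q :* (q :+ con 1)) := con 2 :* s :* q :* con 1 :+ q :* q :* d :* con 1 :- s :- q :* d
      :+ s :* con 1) _ _ _ ⟩
    ι 2 ⊗ ι s ⊗ ι q ⊗ ι 1 ⊕ ι q ⊗ ι q ⊗ ι d ⊗ ι 1 ⊝ ι s ⊝ ι q ⊗ ι d ⊕ ι s ⊗ ι 1 ≡⟨ cong
      (λ u → ι 2 ⊗ ι s ⊗ ι q ⊗ u ⊕ ι q ⊗ ι q ⊗ ι d ⊗ u ⊝ ι s ⊝ ι q ⊗ ι d ⊕ ι s ⊗ u) (sym (ι-inv d 1≤d)) ⟩
    _ ≡⟨ ring 4 (λ s q d i → con 2 :* s :* q :* (d :* i) :+ q :* q :* d :* (d :* i) :- s :- q :* d :+ s :* (d :* i) :=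
      (s :+ q :* d) :* (s :+ q :* d) :* i :- (s :+ q :* d) :+ s :* (d :- s) :* i) (ι s) (ι q) (ι d) (inv d) ⟩
    (ι s ⊕ ι q ⊗ ι d) ⊗ (ι s ⊕ ι q ⊗ ι d) ⊗ inv d ⊝ (ι s ⊕ ι q ⊗ ι d) ⊕ remainder x d ≡⟨ cong
      (λ a → a ⊗ a ⊗ inv d ⊝ a ⊕ remainder x d) (sym x≡) ⟩
    ι x ⊗ ι x ⊗ inv d ⊝ ι x ⊕ remainder x d ∎
    where
    open ≡-Reasoning
    q s : ℕ
    q = x / d
    s = x % d
    x≡ : ι x ≡ ι s ⊕ ι q ⊗ ι d
    x≡ = trans (cong ι (m≡m%n+[m/n]*n x d)) (trans (ι-+ s (q * d)) (⊕-cong refl (ι-* q d)))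
    inside : ∀ m → m ≤ q → d * m ≤ x
    inside m m≤q = ℕₚ.≤-trans (ℕₚ.*-monoʳ-≤ d m≤q) (subst (_≤ x) (ℕₚ.*-comm q d) (m/n*n≤m x d))
    beyond : ∀ m → q < m → x ≤ d * m
    beyond m q<m = ℕₚ.≤-trans (ℕₚ.≤-reflexive (m≡m%n+[m/n]*n x d)) (ℕₚ.≤-trans (ℕₚ.+-monoˡ-≤ (q * d) (ℕₚ.<⇒≤ (m%n<n x d)))
      (subst (d + q * d ≤_) (ℕₚ.*-comm m d) (ℕₚ.*-monoˡ-≤ d q<m)))

  remainder-nonneg : ∀ x d {{_ : NonZero d}} → ι 0 ≼ remainder x d
  remainder-nonneg x d = 0≼⊗ (0≼⊗ (0≼ι _) (a≼b⇒0≼b-a (ι-mono (ℕₚ.<⇒≤ (m%n<n x d))))) (inv-nonneg d)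

  remainder-upper : ∀ x d {{_ : NonZero d}} → 1 ≤ d → remainder x d ≼ ι (x % d)
  remainder-upper x d p = linear 3 (λ s d i → s :* (d :* i) :≤ s :* con 1 ⨾ con 0 :≤ s :* s :* i ⊢ s :* (d :- s) :* i :≤ s) _ _ _
    (≼-reflexive (⊗-cong refl (ι-inv d p))) (0≼⊗ (square-nonneg _) (inv-nonneg d))

  private
    nonZero : ∀ {d} → 1 ≤ d → NonZero d
    nonZero = >-nonZero

  inner-upper : ∀ x d → 1 ≤ d → x ≤ X → ι 2 ⊗ inner x d ≼ ι x ⊗ ι x ⊗ inv d
  inner-upper x d p q = ≡≼ (inner-value x d {{nonZero p}} p q) (linear 3 (λ a x e → e :≤ x ⊢ a :- x :+ e :≤ a) _ _ _
    (≼-trans (remainder-upper x d {{nonZero p}} p) (ι-mono (m%n≤m x d {{nonZero p}}))))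

  smoothed : ℕ → F
  smoothed x = S X λ n → r n ⊗ ι (x ∸ n)

  L₁ : ℕ → F
  L₁ y = S y λ d → ψ d ⊗ inv d

  -- Three errors: - x against a partial sum of ψ, the remainders for d ≤ y, and the terms d > y,
  -- where the inner sums decrease in d.
  smoothed-approx : ∀ x y → x ≤ X → y ≤ X → (ι 2 ⊗ smoothed x ⊝ ι x ⊗ ι x ⊗ L₁ y) within
    (ι x ⊗ ι M ⊕ ι y ⊗ ι y ⊕ ι 2 ⊗ ι M ⊗ (ι x ⊗ ι x ⊗ inv (suc y)))
  smoothed-approx x y x≤X y≤X = subst (_within (ι x ⊗ ι M ⊕ ι y ⊗ ι y ⊕ ι 2 ⊗ ι M ⊗ (ι x ⊗ ι x ⊗ inv (suc y)))) (sym value)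
    (within-⊕ (within-⊕ (within-⊗ (nonneg-within (0≼ι x)) (within-⊖ (ψ-partial y))) remainders) tail)
    where
    e : ℕ → F
    e d = ι 2 ⊗ inner x d ⊝ (ι x ⊗ ι x ⊗ inv d ⊝ ι x)
    e-within : ∀ d → 1 ≤ d → d ≤ y → ψ d ⊗ e d within ι y
    e-within d p q = within-mono (within-⊗ (ψ-within d)
      (subst (_within ι y) (sym (trans (cong (_⊝ (ι x ⊗ ι x ⊗ inv d ⊝ ι x)) (inner-value x d {{nonZero p}} p x≤X))
      (ring 2 (λ a b → a :+ b :- a := b) _ _)))
        (within-mono (nonneg-within (remainder-nonneg x d {{nonZero p}}))
          (≼-trans (remainder-upper x d {{nonZero p}} p) (ι-mono (ℕₚ.≤-trans (ℕₚ.<⇒≤ (m%n<n x d {{nonZero p}})) q))))))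
      (≼-reflexive (⊗-identityˡ _))
    remainders : S y (λ d → ψ d ⊗ e d) within ι y ⊗ ι y
    remainders = subst (S y (λ d → ψ d ⊗ e d) within_) (S-const y (ι y)) (S-within y λ d p q → e-within d p q)
    tail : S (X ∸ y) (λ i → ψ (y + i) ⊗ (ι 2 ⊗ inner x (y + i))) within ι 2 ⊗ ι M ⊗ (ι x ⊗ ι x ⊗ inv (suc y))
    tail = within-mono (ψ-tail y (X ∸ y) (λ d → ι 2 ⊗ inner x d) (λ d _ → ⊗-monoʳ (0≼ι 2) (inner-decreasing x d))
      (λ d → 0≼⊗ (0≼ι 2) (inner-nonneg x d)))
      (⊗-monoʳ (0≼⊗ (0≼ι 2) (0≼ι M)) (inner-upper x (suc y) (s≤s z≤n) x≤X))
    value : ι 2 ⊗ smoothed x ⊝ ι x ⊗ ι x ⊗ L₁ y ≡ ι x ⊗ ⊖ S y ψ ⊕ S y (λ d → ψ d ⊗ e d) ⊕ S (X ∸ y)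
      (λ i → ψ (y + i) ⊗ (ι 2 ⊗ inner x (y + i)))
    value = begin
      ι 2 ⊗ smoothed x ⊝ ι x ⊗ ι x ⊗ L₁ y ≡⟨ cong (λ z → ι 2 ⊗ z ⊝ ι x ⊗ ι x ⊗ L₁ y) (r-sum (λ n → ι (x ∸ n)) λ n X<n →
        cong ι (ℕₚ.m≤n⇒m∸n≡0 (ℕₚ.≤-trans x≤X (ℕₚ.<⇒≤ X<n)))) ⟩
      ι 2 ⊗ S X (λ d → ψ d ⊗ inner x d) ⊝ ι x ⊗ ι x ⊗ L₁ y ≡⟨ cong (_⊝ ι x ⊗ ι x ⊗ L₁ y)
        (trans (sym (S-⊗ X _ _)) (trans (S-cong X λ d _ _ → ring 2 (λ p i → con 2 :* (p :* i) := p :* (con 2 :* i)) _ _)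
           (trans (cong (λ k → S k (λ d → ψ d ⊗ (ι 2 ⊗ inner x d))) (sym (ℕₚ.m+[n∸m]≡n y≤X))) (S-+ y (X ∸ y) _)))) ⟩
      S y (λ d → ψ d ⊗ (ι 2 ⊗ inner x d)) ⊕ _ ⊝ ι x ⊗ ι x ⊗ L₁ y ≡⟨ cong
        (λ z → z ⊕ S (X ∸ y) (λ i → ψ (y + i) ⊗ (ι 2 ⊗ inner x (y + i))) ⊝ ι x ⊗ ι x ⊗ L₁ y)
        (trans (S-cong y λ d _ _ → ring 4 (λ p i x v → p :* i := x :* x :* (p :* v) :- x :* p :+ p :* (i :- (x :* x :* v :- x)))
        (ψ d) (ι 2 ⊗ inner x d) (ι x) (inv d))
           (trans (S-⊕ y _ _) (⊕-cong (trans (S-⊝ y _ _) (cong₂ _⊝_ (S-⊗ y _ _) (S-⊗ y _ _))) refl))) ⟩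
      (ι x ⊗ ι x ⊗ L₁ y ⊝ ι x ⊗ S y ψ ⊕ S y (λ d → ψ d ⊗ e d)) ⊕ S (X ∸ y) (λ i → ψ (y + i) ⊗ (ι 2 ⊗ inner x (y + i))) ⊝ ι x ⊗ ι x
        ⊗ L₁ y
        ≡⟨ ring 5 (λ a x s e t → (a :- x :* s :+ e) :+ t :- a := x :* :- s :+ e :+ t) _ _ _ _ _ ⟩
      _ ∎ where open ≡-Reasoning

  L₁-difference : ∀ y i → (L₁ (y + i) ⊝ L₁ y) within ι 2 ⊗ ι M ⊗ inv (suc y)
  L₁-difference y i = subst (_within ι 2 ⊗ ι M ⊗ inv (suc y))
    (sym (trans (cong (_⊝ L₁ y) (S-+ y i _)) (ring 2 (λ a b → a :+ b :- a := b) _ _)))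
    (ψ-tail y i inv (λ d p → inv-antitone p (ℕₚ.n≤1+n d)) inv-nonneg)

  private
    1≼ιM : ι 1 ≼ ι M
    1≼ιM = ι-mono 1≤M

  module Cube (z : ℕ) (1≤z : 1 ≤ z) (zzz≤X : z * (z * z) ≤ X) where
    x y : ℕ
    -- With these powers of z the errors y² and x² / y balance at z⁴.
    x = z * (z * z)
    y = z * z

    Z : F
    Z = ι z

    y≤X : y ≤ X
    y≤X = ℕₚ.≤-trans (subst (_≤ x) (ℕₚ.+-identityʳ y) (ℕₚ.*-monoˡ-≤ y 1≤z)) zzz≤X

    ιy : ι y ≡ Z ⊗ Z
    ιy = ι-* z z
    ιx : ι x ≡ Z ⊗ (Z ⊗ Z)
    ιx = trans (ι-* z (z * z)) (⊗-cong refl ιy)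

    1≼Z : ι 1 ≼ Z
    1≼Z = ι-mono 1≤z
    0≼Z : ι 0 ≼ Z
    0≼Z = 0≼ι z

    cube-approx : (ι 2 ⊗ smoothed x ⊝ Z ⊗ (Z ⊗ Z) ⊗ (Z ⊗ (Z ⊗ Z)) ⊗ L₁ y) within ι 4 ⊗ ι M ⊗ (Z ⊗ Z ⊗ (Z ⊗ Z))
    cube-approx = within-mono (subst₂ (λ a b → (ι 2 ⊗ smoothed x ⊝ a ⊗ a ⊗ L₁ y) within
      (a ⊗ ι M ⊕ b ⊗ b ⊕ ι 2 ⊗ ι M ⊗ (a ⊗ a ⊗ inv (suc y)))) ιx ιy (smoothed-approx x y zzz≤X y≤X))
      (linear 3 (λ Z m v → con 0 :≤ m :* (Z :* Z :* Z) :* (Z :- con 1) ⨾ con 0 :≤ Z :* Z :* (Z :* Z) :* (m :- con 1) ⨾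
        2 • (con 0 :≤ m :* (Z :* Z :* (Z :* Z)) :* (con 1 :- v :* (Z :* Z))) ⊢
          Z :* (Z :* Z) :* m :+ Z :* Z :* (Z :* Z) :+ con 2 :* m :* (Z :* (Z :* Z) :* (Z :* (Z :* Z)) :* v) :≤ con 4 :* m :*
            (Z :* Z :* (Z :* Z))) Z (ι M) (inv (suc y))
        (0≼⊗ (0≼⊗ (0≼ι M) (0≼⊗ (0≼⊗ 0≼Z 0≼Z) 0≼Z)) (a≼b⇒0≼b-a 1≼Z)) (0≼⊗ (0≼⊗ (0≼⊗ 0≼Z 0≼Z) (0≼⊗ 0≼Z 0≼Z)) (a≼b⇒0≼b-a 1≼ιM))
        (0≼⊗ (0≼⊗ (0≼ι M) (0≼⊗ (0≼⊗ 0≼Z 0≼Z) (0≼⊗ 0≼Z 0≼Z)))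
          (a≼b⇒0≼b-a (≼-trans (⊗-monoʳ (inv-nonneg (suc y)) (≡≼ (sym ιy) (ι-mono (ℕₚ.n≤1+n y))))
          (≼-reflexive (inv-ι (suc y) (s≤s z≤n)))))))

≼-product-≥1 : ∀ {a b} → ι 1 ≼ a → ι 1 ≼ b → ι 1 ≼ a ⊗ b
≼-product-≥1 p q = ≡≼ (sym (⊗-identityˡ _)) (⊗-mono (≼-trans 0≼1 p) 0≼1 p q)

-- The squares c² with c ≡ 1 mod M force L(1, ψ) ≥ M / w⁴.
module _ (M : ℕ) where
  character-u character-w character-D character-B : ℕ
  character-u = 7 * M
  character-w = 4 * M * character-u
  character-D = (character-w * character-w) * (character-w * character-w)
  character-B = 8 * M * character-D

character-B≥1 : ∀ M {{_ : NonZero M}} → 1 ≤ character-B M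
character-B≥1 M@(suc _) = ℕₚ.*-mono-≤ {1} {8 * M} (s≤s z≤n) (ℕₚ.*-mono-≤ (ℕₚ.*-mono-≤ 1≤w 1≤w) (ℕₚ.*-mono-≤ 1≤w 1≤w))
  where
  1≤w : 1 ≤ character-w M
  1≤w = ℕₚ.*-mono-≤ {1} {4 * M} (s≤s z≤n) (s≤s z≤n)

module RealCharacterDensity (X : ℕ) (1≤X : 1 ≤ X) (lg : Logarithm X) (M : ℕ) {{M≢0 : NonZero M}} (character : RealCharacter M) where
  open VonMangoldt X 1≤X lg
  open Residues M
  open RealCharacter character
  open RealCharacterSums X 1≤X lg M character
  open RealCharacterBound X 1≤X lg M character

  private
    u w n₀ z₀ D B : ℕ
    u = character-u M
    w = character-w M
    D = character-D M
    B = character-B M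
    n₀ = w * w * u
    z₀ = w * w

    1≤u : 1 ≤ u
    1≤u = ℕₚ.*-mono-≤ {1} {7} (s≤s z≤n) 1≤M
    1≤w : 1 ≤ w
    1≤w = ℕₚ.*-mono-≤ (ℕₚ.*-mono-≤ {1} {4} (s≤s z≤n) 1≤M) 1≤u
    1≤z₀ : 1 ≤ z₀
    1≤z₀ = ℕₚ.*-mono-≤ 1≤w 1≤w
    1≤B : 1 ≤ B
    1≤B = character-B≥1 M

    8D≤ : ∀ {z} → B ≤ z → 8 * D ≤ z
    8D≤ B≤z = ℕₚ.≤-trans (ℕₚ.*-monoˡ-≤ D (ℕₚ.m≤m*n 8 M)) B≤z

    rearrange : ∀ m u w → 4 * (w * w * u * m) ≡ w * w * (4 * m * u)
    rearrange = solve-∀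

    sixth-power : ∀ w → (w * w * w) * (w * w * w) ≡ (w * w) * ((w * w) * (w * w))
    sixth-power = solve-∀

    double-square : ∀ c → (2 * c) * (2 * c) ≡ 2 * (c * c + c * c)
    double-square = solve-∀

  z₀≤ : ∀ {z} → B ≤ z → character-w M * character-w M ≤ z
  z₀≤ B≤z = ℕₚ.≤-trans (ℕₚ.m≤m*n z₀ z₀ {{>-nonZero 1≤z₀}}) (ℕₚ.≤-trans (ℕₚ.m≤n*m D 8) (8D≤ B≤z))

  module _ (small : z₀ * (z₀ * z₀) ≤ X) where
    private
      open module Z₀ = Cube z₀ 1≤z₀ small using () renaming (x to x₀; y to y₀; Z to Z₀)

      c : ℕ → ℕ
      c i = 1 + i * M

      -- 2 c ≤ 4 n₀ M = w³, which dictates w = 4 M u, while x₀ = w⁶.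
      c-small : ∀ i → i ≤ n₀ → c i * c i + c i * c i ≤ x₀
      c-small i i≤n₀ = ℕₚ.≤-trans (ℕₚ.m≤n*m _ 2) (subst₂ _≤_ (double-square (c i)) (sixth-power w) (ℕₚ.*-mono-≤ 2c≤ 2c≤))
        where
        2c≤ : 2 * c i ≤ w * w * w
        2c≤ = ℕₚ.≤-trans (ℕₚ.*-monoʳ-≤ 2 (ℕₚ.+-mono-≤ (ℕₚ.*-mono-≤ (ℕₚ.*-mono-≤ 1≤z₀ 1≤u) 1≤M) (ℕₚ.*-monoˡ-≤ M i≤n₀)))
          (ℕₚ.≤-reflexive (trans (four (n₀ * M)) (rearrange M u w)))
          where
          four : ∀ a → 2 * (a + a) ≡ 4 * a
          four = solve-∀

      -- By `r-square` each of the n₀ squares contributes at least x₀ - c² ≥ x₀ / 2.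
      squares-bound : ι n₀ ⊗ ι x₀ ≼ ι 2 ⊗ smoothed x₀
      squares-bound = ≼-trans (≡≼ (sym (S-const n₀ (ι x₀)))
        (≼-trans (S-mono n₀ λ i p q → term i p q) (≼-reflexive (S-⊗ n₀ (ι 2) _))))
        (⊗-monoʳ (0≼ι 2) (S-subsum X n₀ (λ i → c i * c i) f (λ {i} {k} e →
          ℕₚ.*-cancelʳ-≡ i k M (ℕₚ.suc-injective (square-injective e))) (λ i _ _ → s≤s z≤n)
          (λ n X<n → trans (⊗-cong refl (cong ι (ℕₚ.m≤n⇒m∸n≡0 (ℕₚ.≤-trans small (ℕₚ.<⇒≤ X<n))))) (⊗-zeroʳ _)) λ n p q →
            0≼⊗ (r-nonneg n p q) (0≼ι (x₀ ∸ n))))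
        where
        f : ℕ → F
        f n = r n ⊗ ι (x₀ ∸ n)
        term : ∀ i → 1 ≤ i → i ≤ n₀ → ι x₀ ≼ ι 2 ⊗ f (c i * c i)
        term i p q = linear 3 (λ x r d → x :≤ con 2 :* d ⨾ 2 • (con 0 :≤ (r :- con 1) :* d) ⊢ x :≤ con 2 :* (r :* d)) _ _ _
          (≼≡ (ι-mono half) (ι-* 2 _)) (0≼⊗ (a≼b⇒0≼b-a (r-square (c i) (s≤s z≤n) cc≤X coprime-c)) (0≼ι (x₀ ∸ c i * c i)))
          where
          cc≤x : c i * c i ≤ x₀
          cc≤x = ℕₚ.≤-trans (ℕₚ.m≤m+n _ _) (c-small i q)
          cc≤X : c i * c i ≤ X
          cc≤X = ℕₚ.≤-trans cc≤x small
          coprime-c : Coprime (c i) M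
          coprime-c = coprime-≈ (sym ([m+kn]%n≡m%n 1 i M)) coprime-1
          half : x₀ ≤ 2 * (x₀ ∸ c i * c i)
          half = subst₂ _≤_ (ℕₚ.m+[n∸m]≡n cc≤x) (cong (x₀ ∸ c i * c i +_) (sym (ℕₚ.+-identityʳ _)))
            (ℕₚ.+-monoˡ-≤ _ (ℕₚ.m+n≤o⇒m≤o∸n (c i * c i) (c-small i q)))

      W : F
      W = ι w

      ιM U : F
      ιM = ι M
      U = ι u

      1≼W : ι 1 ≼ W
      1≼W = ι-mono 1≤w

      ιz₀ : Z₀ ≡ W ⊗ W
      ιz₀ = ι-* w w

      ιD : ι D ≡ (W ⊗ W) ⊗ (W ⊗ W)
      ιD = trans (ι-* z₀ z₀) (⊗-cong ιz₀ ιz₀)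

      -- The squares give u w⁸, and the error of `cube-approx` is 4 M w⁸; u = 7 M leaves 3 M w⁸
      -- against x₀² L₁ = w¹² L₁.
      L₁-at-y₀ : ι 3 ⊗ ιM ≼ ι D ⊗ L₁ y₀
      L₁-at-y₀ = ≼≡ (⊗-cancelˡ (≺-≼-trans (ι0≺ι1+ 0) (≼-product-≥1 W⁴≥1 W⁴≥1)) (linear 5 (λ w u m v l →
            (w :* w :* u) :* ((w :* w) :* ((w :* w) :* (w :* w))) :≤ con 2 :* v ⨾ con 2 :* v :- (w :* w) :* ((w :* w) :* (w :* w))
              :* ((w :* w) :* ((w :* w) :* (w :* w))) :* l :≤ con 4 :* m :* ((w :* w) :* (w :* w) :* ((w :* w) :* (w :* w))) ⨾
            (w :* w :* (w :* w)) :* (w :* w :* (w :* w)) :* (con 7 :* m) :≤ (w :* w :* (w :* w)) :* (w :* w :* (w :* w)) :* u ⊢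
            (w :* w :* (w :* w)) :* (w :* w :* (w :* w)) :* (con 3 :* m) :≤ (w :* w :* (w :* w)) :* (w :* w :* (w :* w)) :*
              ((w :* w) :* (w :* w) :* l)) W U ιM (smoothed x₀) (L₁ y₀)
          (subst₂ (λ a b → a ⊗ b ≼ ι 2 ⊗ smoothed x₀) (trans (ι-* z₀ u) (⊗-cong ιz₀ refl))
            (trans Z₀.ιx (cong (λ z → z ⊗ (z ⊗ z)) ιz₀)) squares-bound)
          (subst (λ z → ι 2 ⊗ smoothed x₀ ⊝ z ⊗ (z ⊗ z) ⊗ (z ⊗ (z ⊗ z)) ⊗ L₁ y₀ ≼ ι 4 ⊗ ι M ⊗ (z ⊗ z ⊗ (z ⊗ z))) ιz₀
            (proj₂ Z₀.cube-approx))
          (≼-reflexive (⊗-cong refl (sym (ι-* 7 M)))))) (⊗-cong (sym ιD) refl)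
        where
        W⁴≥1 : ι 1 ≼ W ⊗ W ⊗ (W ⊗ W)
        W⁴≥1 = ≼-product-≥1 (≼-product-≥1 1≼W 1≼W) (≼-product-≥1 1≼W 1≼W)

      -- Since y₀ = D, passing from y₀ to y changes D L₁ by at most 2 M.
      L₁-lower : ∀ y → y₀ ≤ y → ιM ≼ ι D ⊗ L₁ y
      L₁-lower y h = subst (λ k → ιM ≼ ι D ⊗ L₁ k) (ℕₚ.m+[n∸m]≡n h)
        (linear 5 (λ m d l l′ v → con 3 :* m :≤ d :* l ⨾ con 0 :≤ d :* ((l′ :- l) :- :- (con 2 :* m :* v)) ⨾
        2 • (con 0 :≤ m :* (con 1 :- v :* d)) ⊢ m :≤ d :* l′) _ _ _ _ _
        L₁-at-y₀ (0≼⊗ (0≼ι D) (a≼b⇒0≼b-a (proj₁ (L₁-difference y₀ (y ∸ y₀)))))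
          (0≼⊗ (0≼ι M) (a≼b⇒0≼b-a (≼-trans (⊗-monoʳ (inv-nonneg (suc y₀)) (ι-mono (ℕₚ.n≤1+n D)))
          (≼-reflexive (inv-ι (suc y₀) (s≤s z≤n)))))))

    module _ (z : ℕ) (B≤z : B ≤ z) (zzz≤X : z * (z * z) ≤ X) where
      private
        1≤z : 1 ≤ z
        1≤z = ℕₚ.≤-trans 1≤B B≤z
        open Cube z 1≤z zzz≤X

        1≤x : 1 ≤ x
        1≤x = ℕₚ.*-mono-≤ 1≤z (ℕₚ.*-mono-≤ 1≤z 1≤z)

        8D≤z : 8 * D ≤ z
        8D≤z = 8D≤ B≤z

        z₀≤z : z₀ ≤ z
        z₀≤z = z₀≤ B≤z

        -- D L₁ ≥ M gives the main term M z⁶, and 8 D ≤ z² makes the error 4 M D z⁴ at most half of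
        -- it.
        smoothed-lower : Z ⊗ (Z ⊗ Z) ⊗ (Z ⊗ (Z ⊗ Z)) ≼ ι 4 ⊗ ι D ⊗ smoothed x
        smoothed-lower = linear 5 (λ Z m d v l → 2 • (con 0 :≤ d :* (con 2 :* v :- Z :* (Z :* Z) :* (Z :* (Z :* Z)) :* l :- :-
          (con 4 :* m :* (Z :* Z :* (Z :* Z))))) ⨾ 2 • (con 0 :≤ Z :* (Z :* Z) :* (Z :* (Z :* Z)) :* (d :* l :- m)) ⨾
            con 0 :≤ m :* (Z :* Z :* (Z :* Z)) :* (Z :* Z :- con 8 :* d) ⨾
              con 0 :≤ (m :- con 1) :* (Z :* (Z :* Z) :* (Z :* (Z :* Z))) ⊢ Z :* (Z :* Z) :* (Z :* (Z :* Z)) :≤ con 4 :* d :* v) Z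
              ιM (ι D) (smoothed x) (L₁ y)
          (0≼⊗ (0≼ι D) (a≼b⇒0≼b-a (proj₁ cube-approx))) (0≼⊗ Z⁶ (a≼b⇒0≼b-a (L₁-lower y (ℕₚ.*-mono-≤ z₀≤z z₀≤z))))
          (0≼⊗ (0≼⊗ (0≼ι M) (0≼⊗ (0≼⊗ 0≼Z 0≼Z) (0≼⊗ 0≼Z 0≼Z)))
            (a≼b⇒0≼b-a (≼-trans (≡≼ (sym (ι-* 8 D)) (ι-mono 8D≤z)) (≡≼ (sym (⊗-identityˡ Z)) (⊗-monoˡ 0≼Z 1≼Z)))))
          (0≼⊗ (a≼b⇒0≼b-a (ι-mono 1≤M)) Z⁶)
          where
          Z⁶ : ι 0 ≼ Z ⊗ (Z ⊗ Z) ⊗ (Z ⊗ (Z ⊗ Z))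
          Z⁶ = 0≼⊗ (0≼⊗ 0≼Z (0≼⊗ 0≼Z 0≼Z)) (0≼⊗ 0≼Z (0≼⊗ 0≼Z 0≼Z))

        partial : ℕ → F
        partial e = S X λ n → r n ⊗ ind (e * n ≤? x)

        total : F
        total = S X λ n → r n ⊗ ind (n ≤? x)

        0≺x : ι 0 ≺ ι x
        0≺x = ≺-≼-trans (ι0≺ι1+ 0) (ι-mono 1≤x)

        total-lower : ι x ≼ ι 4 ⊗ (ι D ⊗ total)
        total-lower = ⊗-cancelˡ 0≺x (≼-trans (≡≼ (cong (λ a → a ⊗ a) ιx) smoothed-lower)
          (linear 4 (λ d v x t → 4 • (con 0 :≤ d :* (x :* t :- v)) ⊢ con 4 :* d :* v :≤ x :* (con 4 :* (d :* t))) _ _ _ _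
          (0≼⊗ (0≼ι D) (a≼b⇒0≼b-a (≼≡ (S-mono X λ n p q → ≼≡ (⊗-monoʳ (r-nonneg n p q) (truncated n))
            (ring 3 (λ r x i → r :* (x :* i) := x :* (r :* i)) _ _ _)) (S-⊗ X (ι x) _))))))
          where
          truncated : ∀ n → ι (x ∸ n) ≼ ι x ⊗ ind (n ≤? x)
          truncated n with n ≤? x
          ... | yes _ = ≼≡ (ι-mono (ℕₚ.m∸n≤m x n)) (sym (⊗-identityʳ _))
          ... | no n≰x = ≼-reflexive (trans (cong ι (ℕₚ.m≤n⇒m∸n≡0 (ℕₚ.<⇒≤ (ℕₚ.≰⇒> n≰x)))) (sym (⊗-zeroʳ _)))

        -- The sum of r n over e n ≤ x is the sum of ψ d times the number of m with e d m ≤ x; this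
        -- number decreases in d and is at most x / e for d = 1.
        partial-upper : ∀ e → 1 ≤ e → partial e ≼ ιM ⊗ (ι x ⊗ inv e)
        partial-upper e 1≤e = ≼-trans (≡≼ (r-sum (λ n → ind (e * n ≤? x)) λ n X<n →
          ind-no (e * n ≤? x) (ℕₚ.<⇒≱ (ℕₚ.≤-trans (s≤s zzz≤X) (ℕₚ.≤-trans X<n (ℕₚ.m≤n*m n e {{e≢0}})))))
            (proj₂ (abel-bound ψ Φ ιM X ψ-partial (λ d _ _ → S-mono X λ m _ _ → decreasing d m) (S-nonneg X λ m _ _ →
              ind-nonneg (e * (suc X * m) ≤? x)))))
          (⊗-monoʳ (0≼ι M) (≼-trans (S-mono X λ m _ _ → counted m) (≼-trans (S-count-≤ X (_/_ x e {{e≢0}})) quotient)))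
          where
          e≢0 : NonZero e
          e≢0 = >-nonZero 1≤e
          Φ : ℕ → F
          Φ d = S X λ m → ind (e * (d * m) ≤? x)
          decreasing : ∀ d m → ind (e * (suc d * m) ≤? x) ≼ ind (e * (d * m) ≤? x)
          decreasing d m with e * (suc d * m) ≤? x
          ... | no _ = ind-nonneg (e * (d * m) ≤? x)
          ... | yes h = ≼-reflexive (sym (ind-yes (e * (d * m) ≤? x) (ℕₚ.≤-trans (ℕₚ.*-monoʳ-≤ e (ℕₚ.m≤n+m (d * m) m)) h)))
          counted : ∀ m → ind (e * (1 * m) ≤? x) ≼ ind (m ≤? _/_ x e {{e≢0}})
          counted m with e * (1 * m) ≤? x
          ... | no _ = ind-nonneg (m ≤? _/_ x e {{e≢0}})
          ... | yes h = ≼-reflexive (sym (ind-yes (m ≤? _/_ x e {{e≢0}}) (subst (_≤ _/_ x e {{e≢0}}) (m*n/n≡m m e {{e≢0}})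
            (/-monoˡ-≤ e {{e≢0}} (subst (_≤ x) (trans (cong (e *_) (ℕₚ.*-identityˡ m)) (ℕₚ.*-comm e m)) h)))))
          quotient : ι (_/_ x e {{e≢0}}) ≼ ι x ⊗ inv e
          quotient = ≡≼ (trans (sym (⊗-identityʳ _)) (trans (⊗-cong refl (sym (ι-inv e 1≤e)))
            (trans (sym (⊗-assoc _ _ _)) (⊗-cong (sym (ι-* _ e)) refl)))) (⊗-monoˡ (inv-nonneg e) (ι-mono (m/n*n≤m x e {{e≢0}})))

        z≤x : z ≤ x
        z≤x = ℕₚ.m≤m*n z (z * z) {{>-nonZero (ℕₚ.*-mono-≤ 1≤z 1≤z)}}

        B≤X : B ≤ X
        B≤X = ℕₚ.≤-trans B≤z (ℕₚ.≤-trans z≤x zzz≤X)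

      weight : F
      weight = S X λ e → Λ e ⊗ ((ι 1 ⊕ ψ e) ⊗ (ind (e ≤? x) ⊗ inv e))

      private
        weight-nonneg : ι 0 ≼ weight
        weight-nonneg = S-nonneg X λ e _ _ → 0≼⊗ (Λ-nonneg e) (0≼⊗ (1+ψ-nonneg e) (0≼⊗ (ind-nonneg (e ≤? x)) (inv-nonneg e)))

        logarithmic : F
        logarithmic = S X λ n → r n ⊗ (L n ⊗ ind (n ≤? x))

        logarithmic-upper : logarithmic ≼ ιM ⊗ ι x ⊗ weight
        logarithmic-upper = ≼-trans (≼-reflexive (r-log-sum (λ n → ind (n ≤? x)) λ n X<n →
          ind-no (n ≤? x) (ℕₚ.<⇒≱ (ℕₚ.≤-trans (s≤s zzz≤X) X<n))))
          (≼≡ (S-mono X λ e p _ → ≼≡ (⊗-monoʳ (Λ-nonneg e) (⊗-monoʳ (1+ψ-nonneg e) (bound e p)))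
            (ring 6 (λ l p m x i v → l :* (p :* (m :* x :* (i :* v))) := m :* x :* (l :* (p :* (i :* v)))) _ _ _ _ _ _))
            (S-⊗ X _ _))
          where
          bound : ∀ e → 1 ≤ e → partial e ≼ ιM ⊗ ι x ⊗ (ind (e ≤? x) ⊗ inv e)
          bound e p with e ≤? x
          ... | yes _ = ≼≡ (partial-upper e p) (ring 3 (λ m x v → m :* (x :* v) := m :* x :* (con 1 :* v)) _ _ _)
          ... | no e≰x = ≼-reflexive (trans (S-zero X λ n q _ →
            trans (⊗-cong refl (ind-no (e * n ≤? x) λ h → e≰x (ℕₚ.≤-trans (ℕₚ.m≤m*n e n {{>-nonZero q}}) h))) (⊗-zeroʳ _))
            (ring 3 (λ m x v → con 0 := m :* x :* (con 0 :* v)) ιM (ι x) (inv e)))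

        -- Only n with x / B < n ≤ x are kept, where L n ≥ L x - L B.
        logarithmic-lower : ι 0 ≼ L x ⊝ L B → (L x ⊝ L B) ⊗ (total ⊝ partial B) ≼ logarithmic
        logarithmic-lower h = ≡≼ (trans (⊗-cong refl (sym (S-⊝ X _ _))) (sym (S-⊗ X _ _))) (S-mono X λ n p q →
          ≼-trans (≼-reflexive (ring 4 (λ l r i k → l :* (r :* i :- r :* k) := r :* (l :* (i :- k))) _ _ _ _))
            (⊗-monoʳ (r-nonneg n p q) (term n p q (n ≤? x) (B * n ≤? x))))
          where
          term : ∀ n → 1 ≤ n → n ≤ X → (d : Dec (n ≤ x)) (e : Dec (B * n ≤ x)) → (L x ⊝ L B) ⊗ (ind d ⊝ ind e) ≼ L n ⊗ ind d
          term n p q (yes _) (yes _) = ≡≼ (ring 1 (λ l → l :* (con 1 :- con 1) := con 0) _) (0≼⊗ (L-prime-nonneg p q) 0≼1)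
          term n p q (yes _) (no Bn≰x) = linear 4 (λ lx lb ln lbn → lx :≤ lbn ⨾ lbn :≤ lb :+ ln ⊢
            (lx :- lb) :* (con 1 :- con 0) :≤ ln :* con 1) _ _ _ _
            (L-mono 1≤x (ℕₚ.<⇒≤ (ℕₚ.≰⇒> Bn≰x)) (ℕₚ.m≤n⇒m≤1+n (ℕₚ.*-mono-≤ B≤X q))) (≼-reflexive (L-* B n 1≤B p))
          term n p q (no n≰x) (yes h) = ⊥-elim (n≰x (ℕₚ.≤-trans (ℕₚ.m≤n*m n B {{>-nonZero 1≤B}}) h))
          term n p q (no _) (no _) = ≼-reflexive (ring 2 (λ l m → l :* (con 0 :- con 0) := m :* con 0) _ _)

      -- The dropped n ≤ x / B hold at most M x / B = x / (8 D) of the sum of r, whose total is at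
      -- least x / (4 D): hence B = 8 M D.
      character-density : L x ⊝ L B ≼ ι B ⊗ weight
      character-density with ≼-total (ι 0) (L x ⊝ L B)
      ... | inj₂ h = ≼-trans h (0≼⊗ (0≼ι B) weight-nonneg)
      ... | inj₁ h = ⊗-cancelˡ 0≺x (subst (λ b → ι x ⊗ (L x ⊝ L B) ≼ ι x ⊗ (b ⊗ weight)) (sym ιB)
          (linear 8 (λ x l m d w t p v → 8 • (con 0 :≤ d :* (m :* x :* w :- l :* (t :- p))) ⨾
            2 • (con 0 :≤ l :* (con 4 :* (d :* t) :- x)) ⨾ 8 • (con 0 :≤ d :* (l :* (m :* (x :* v) :- p))) ⨾
            x :* l :* (v :* (con 8 :* m :* d)) :≤ x :* l :* con 1 ⊢ x :* l :≤ x :* (con 8 :* m :* d :* w)) (ι x) (L x ⊝ L B) ιM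
            (ι D) weight total (partial B) (inv B)
            (0≼⊗ (0≼ι D) (a≼b⇒0≼b-a (≼-trans (logarithmic-lower h) logarithmic-upper))) (0≼⊗ h (a≼b⇒0≼b-a total-lower))
              (0≼⊗ (0≼ι D) (0≼⊗ h (a≼b⇒0≼b-a (partial-upper B 1≤B))))
            (≼-reflexive (⊗-cong refl (trans (⊗-cong refl (sym ιB)) (inv-ι B 1≤B))))))
        where
        ιB : ι B ≡ ι 8 ⊗ ιM ⊗ ι D
        ιB = trans (ι-* (8 * M) D) (⊗-cong (ι-* 8 M) refl)

-- The mass of Λ against χ₀ + ψ

module CharacterMass (X : ℕ) (1≤X : 1 ≤ X) (lg : Logarithm X) (M : ℕ) {{M≢0 : NonZero M}} (character : RealCharacter M) where
  open Moments X 1≤X lg M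
  open VonMangoldtEstimates X 1≤X lg
  open RealCharacter character
  open RealCharacterSums X 1≤X lg M character using (ψ-within; 1+ψ-nonneg)
  open RealCharacterDensity X 1≤X lg M character

  private
    B : ℕ
    B = character-B M

    g : ℕ → F
    g n = χ₀ n ⊕ ψ n

    g-nonneg : ∀ n → ι 0 ≼ g n
    g-nonneg n with coprime? n M
    ... | yes _ = 1+ψ-nonneg n
    ... | no ¬c = ≼-reflexive (sym (trans (cong (ι 0 ⊕_) (ψ-nonunit ¬c)) (⊕-identityˡ _)))

    g≼2 : ∀ n → g n ≼ ι 2
    g≼2 n = ≼≡ (⊕-mono (ind≼1 (coprime? n M)) (proj₂ (ψ-within n))) (sym (ι-+ 1 1))

  module _ (z : ℕ) (B≤z : B ≤ z) (zzz≤X : z * (z * z) ≤ X) where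
    private
      x : ℕ
      x = z * (z * z)

      1≤x : 1 ≤ x
      1≤x = ℕₚ.*-mono-≤ 1≤z (ℕₚ.*-mono-≤ 1≤z 1≤z)
        where
        1≤z : 1 ≤ z
        1≤z = ℕₚ.≤-trans (character-B≥1 M) B≤z

      t : F
      t = L x

      0≼t : ι 0 ≼ t
      0≼t = L-prime-nonneg 1≤x zzz≤X

      g-weight : F
      g-weight = S X λ e → Λ e ⊗ (g e ⊗ (ind (e ≤? x) ⊗ inv e))

      -- Powers of primes above M are units modulo M, so `Λ-few-primes` applies.
      nonunits : S X (λ e → Λ e ⊗ ((ι 1 ⊝ χ₀ e) ⊗ (ind (e ≤? x) ⊗ inv e))) ≼ ι (4 * M)
      nonunits = Λ-few-primes M _ (λ n X<n → trans (⊗-cong refl (ind-zero (n ≤? x) (ℕₚ.<⇒≱ (ℕₚ.≤-trans (s≤s zzz≤X) X<n))))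
        (⊗-zeroʳ _))
        (λ d _ → ≼-trans (⊗-mono 0≼1 (0≼⊗ (ind-nonneg (d ≤? x)) (inv-nonneg d)) (linear 1 (λ c → con 0 :≤ c ⊢ con 1 :- c :≤ con 1)
          _ (ind-nonneg (coprime? d M))) (⊗-monoˡ (inv-nonneg d) (ind≼1 (d ≤? x))))
          (≼-reflexive (ring 1 (λ i → con 1 :* (con 1 :* i) := i) _)))
        λ p j pp p≰M → ≼-reflexive (trans (⊗-cong (trans
          (cong (ι 1 ⊝_) (ind-yes (coprime? (p ^ j) M) (prime-power-coprime j pp p≰M))) (⊕-inverseʳ _)) refl) (⊗-zeroˡ _))
        where
        prime-power-coprime : ∀ {p} j → Prime p → ¬ (p ≤ M) → Coprime (p ^ j) M
        prime-power-coprime zero pp p≰M = coprime-1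
        prime-power-coprime {p} (suc j) pp p≰M = coprime-* prime-coprime (prime-power-coprime j pp p≰M)
          where
          prime-coprime : Coprime p M
          prime-coprime {i} (i∣p , i∣M) with i ≟ 1
          ... | yes e = e
          ... | no i≢1 with prime-divisor i (ℕₚ.≤∧≢⇒< (ℕₚ.n≢0⇒n>0 λ { refl → ℕₚ.<⇒≢ 1≤M (sym (0∣⇒≡0 i∣M)) }) (i≢1 ∘ sym))
          ...   | q , pq , q∣i = ⊥-elim (p≰M (subst (_≤ M) (prime∣prime pq pp (∣-trans q∣i i∣p)) (∣⇒≤ (∣-trans q∣i i∣M))))

      g-weight-lower : t ≼ ι B ⊗ (g-weight ⊕ ι (4 * M) ⊕ ι 2)
      g-weight-lower = linear 6 (λ t l b w g n → t :- l :≤ b :* w ⨾ l :≤ con 2 :* b ⨾ con 0 :≤ b :* (g :+ n :- w) ⊢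
        t :≤ b :* (g :+ n :+ con 2)) _ _ _ _ _ _
        (character-density (ℕₚ.≤-trans (ℕₚ.*-mono-≤ z₀≤z (ℕₚ.*-mono-≤ z₀≤z z₀≤z)) zzz≤X) z B≤z zzz≤X)
          (L-linear B (character-B≥1 M) (ℕₚ.m≤n⇒m≤1+n (ℕₚ.≤-trans B≤X X≤XX)))
        (0≼⊗ (0≼ι B) (a≼b⇒0≼b-a (≼-trans (≼-reflexive
          (trans (S-cong X λ e _ _ → ring 4 (λ l p c i → l :* ((con 1 :+ p) :* i) := l :* ((c :+ p) :* i) :+ l :*
          ((con 1 :- c) :* i)) _ _ _ _) (S-⊕ X _ _))) (⊕-mono ≼-refl nonunits))))
        where
        z₀≤z : character-w M * character-w M ≤ z
        z₀≤z = z₀≤ B≤z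
        B≤X : B ≤ X
        B≤X = ℕₚ.≤-trans B≤z (ℕₚ.≤-trans (ℕₚ.m≤m*n z (z * z) {{>-nonZero (ℕₚ.*-mono-≤ 1≤z 1≤z)}}) zzz≤X)
          where
          1≤z : 1 ≤ z
          1≤z = ℕₚ.≤-trans (character-B≥1 M) B≤z

    -- For σ < L n ≤ t the weight satisfies L n (2 t - L n) ≥ σ t. The n with L n ≤ σ are given up
    -- at a cost of 80 (σ + 1), by `Chebyshev-bound` and χ₀ + ψ ≤ 2.
    character-mass : ∀ {σ} → ι 0 ≼ σ → (σ ⊕ ι 4) ⊕ (σ ⊕ ι 4) ≼ L X →
      (σ ⊗ t) ⊗ t ≼ ι B ⊗ (S X (λ n → Λ n ⊗ (g n ⊗ (L n ⊗ w 1 (t ⊕ t) n))) ⊕ (σ ⊗ t) ⊗ (ι 80 ⊗ (σ ⊕ ι 1) ⊕ ι (4 * M) ⊕ ι 2))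
    character-mass {σ} 0≼σ adm = linear 7 (λ σt t b m s c g → con 0 :≤ σt :* (b :* (g :+ c) :- t) ⨾
      con 0 :≤ b :* (m :- σt :* (g :- s)) ⊢ σt :* t :≤ b :* (m :+ σt :* (s :+ c))) (σ ⊗ t) t (ι B) _ (ι 80 ⊗ (σ ⊕ ι 1))
      (ι (4 * M) ⊕ ι 2) g-weight
        (0≼⊗ σt≥0 (a≼b⇒0≼b-a (≼≡ g-weight-lower (⊗-cong refl (⊕-assoc _ _ _))))) (0≼⊗ (0≼ι B) (a≼b⇒0≼b-a lower)) |> λ h →
          ≼≡ h (⊗-cong refl (⊕-cong refl (⊗-cong refl (sym (⊕-assoc _ _ _)))))
      where
      σt≥0 : ι 0 ≼ σ ⊗ t
      σt≥0 = 0≼⊗ 0≼σ 0≼t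
      short : S X (λ n → Λ n ⊗ (g n ⊗ w 0 σ n)) ≼ ι 80 ⊗ (σ ⊕ ι 1)
      short = ≼-trans (S-mono X {g = λ n → ι 2 ⊗ (Λ n ⊗ w 0 σ n)} λ n _ _ →
        ≼-trans (⊗-monoʳ (Λ-nonneg n) (⊗-monoˡ (w-nonneg 0 σ n) (g≼2 n)))
        (≼-reflexive (ring 2 (λ l w → l :* (con 2 :* w) := con 2 :* (l :* w)) _ _)))
        (≼-trans (≼-reflexive (S-⊗ X (ι 2) _)) (≼≡ (⊗-monoʳ (0≼ι 2) (Chebyshev-bound 0≼σ adm))
          (ring 1 (λ s → con 2 :* (con 40 :* s) := con 80 :* s) _)))
      pointwise : ∀ n → 1 ≤ n → n ≤ X → (d : Dec (n ≤ x)) → (σ ⊗ t) ⊗ (ind d ⊗ inv n ⊝ w 0 σ n) ≼ L n ⊗ w 1 (t ⊕ t) n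
      pointwise n p q (no _) = ≼-trans (linear 4 (λ s i w u → con 0 :≤ s :* w ⊢ s :* (con 0 :* i :- w) :≤ con 0) _ _ _ (ι 0)
        (0≼⊗ σt≥0 (w-nonneg 0 σ n))) (0≼⊗ (L-prime-nonneg p q) (w-nonneg 1 _ n))
      pointwise n p q (yes n≤x) with ≼? (ι 0) (σ ⊝ L n)
      ... | inj₁ h = ≡≼ (trans (cong (λ y → (σ ⊗ t) ⊗ (ι 1 ⊗ inv n ⊝ y ⊗ inv n)) (pw-pos 0 h))
        (ring 2 (λ s i → s :* (con 1 :* i :- con 1 :* i) := con 0) _ _)) (0≼⊗ (L-prime-nonneg p q) (w-nonneg 1 _ n))
      ... | inj₂ h = subst₂ (λ y y′ → (σ ⊗ t) ⊗ (ι 1 ⊗ inv n ⊝ y ⊗ inv n) ≼ L n ⊗ (y′ ⊗ inv n)) (sym (pw-neg 0 h))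
        (sym (pw-pos 1 (linear 2 (λ t l → l :≤ t ⨾ con 0 :≤ t ⊢ con 0 :≤ t :+ t :- l) _ _ Ln≤t 0≼t)))
          (linear 4 (λ s t l i → con 0 :≤ i :* t :* (l :- s) ⨾ con 0 :≤ i :* l :* (t :- l) ⊢
            s :* t :* (con 1 :* i :- con 0 :* i) :≤ l :* ((t :+ t :- l) :* con 1 :* i)) _ _ _ _
            (0≼⊗ (0≼⊗ (inv-nonneg n) 0≼t) (≼≡ (a≼b⇒0≼b-a (≺⇒≼ h)) (ring 2 (λ s l → con 0 :- (s :- l) := l :- s) _ _)))
              (0≼⊗ (0≼⊗ (inv-nonneg n) (L-prime-nonneg p q)) (a≼b⇒0≼b-a Ln≤t)))
        where
        Ln≤t : L n ≼ t
        Ln≤t = L-mono p n≤x (ℕₚ.m≤n⇒m≤1+n (ℕₚ.≤-trans zzz≤X X≤XX))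
      lower : (σ ⊗ t) ⊗ (g-weight ⊝ ι 80 ⊗ (σ ⊕ ι 1)) ≼ S X (λ n → Λ n ⊗ (g n ⊗ (L n ⊗ w 1 (t ⊕ t) n)))
      lower = ≼-trans (⊗-monoʳ σt≥0 (linear 3 (λ a b c → b :≤ c ⊢ a :- c :≤ a :- b) _ _ _ short))
        (≡≼ (trans (⊗-cong refl (sym (S-⊝ X _ _))) (sym (S-⊗ X _ _))) (S-mono X λ n p q →
        ≼-trans (≼-reflexive (ring 5 (λ s l g i w → s :* (l :* (g :* i) :- l :* (g :* w)) := l :* (g :* (s :* (i :- w)))) _ _ _ _
          _)) (⊗-monoʳ (Λ-nonneg n) (⊗-monoʳ (g-nonneg n) (pointwise n p q (n ≤? x))))))

-- Dirichlet's theorem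

≺-from-gap : ∀ {a b} → a ⊕ ι 1 ≼ b → a ≺ b
≺-from-gap {a} {b} h = ⋡⇒≺ λ b≼a → ≺⇒⋡ (ι0≺ι1+ 0) (linear 2 (λ a b → a :+ con 1 :≤ b ⨾ b :≤ a ⊢ con 1 :≤ con 0) a b h b≼a)

module Dirichlet (M : ℕ) {{M≢0 : NonZero M}} {a : ℕ} (ca : Coprime a M) where
  open Residues M using (N; 1≤M; _≈_; _≈?_)

  private
    n : ℕ
    n = count (λ i → coprime? i M) M

    -- The numerals below are kept opaque because they are large.
    opaque
      B : ℕ
      B = character-B M

      B≡ : B ≡ character-B M
      B≡ = refl

      1≤B : 1 ≤ B
      1≤B = character-B≥1 M

    opaque
      j : ℕ
      -- 336 n + 1 serves `j-large`; 3840 exceeds 640 · 18 · 8 / 27, the constant that arises in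
      -- `contradiction`.
      j = 3840 * (B * B) + 336 * n + 1

      1≤j : 1 ≤ j
      1≤j = ℕₚ.m≤n+m 1 (3840 * (B * B) + 336 * n)

      J≡ : ι j ≡ ι 3840 ⊗ (ι B ⊗ ι B) ⊕ ι 336 ⊗ N ⊕ ι 1
      J≡ = trans (ι-+ (3840 * (B * B) + 336 * n) 1)
        (⊕-cong (trans (ι-+ (3840 * (B * B)) (336 * n)) (⊕-cong (trans (ι-* 3840 (B * B)) (⊗-cong refl (ι-* B B)))
        (trans (ι-* 336 n) (⊗-cong refl (sym (S-count (λ i → coprime? i M) M)))))) refl)

    -- The constants κ to κ₅ over again: their values do not depend on X, and X has to be chosen
    -- after them.
    J k k₁ k₂ k₃ k₄ k₅ threshold : F
    J = ι j
    k = ι 504 ⊗ (ι M ⊗ ι M ⊕ ι 2)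
    k₁ = ι 63 ⊗ k ⊕ ι 96 ⊗ (N ⊗ ι M)
    k₂ = ι 409 ⊗ k ⊕ ι 2784 ⊗ (N ⊗ ι M) ⊕ ι 48 ⊗ N
    k₃ = k ⊕ ι 160 ⊗ k₁ ⊕ k₂
    k₄ = ι 10 ⊗ (N ⊗ k) ⊕ ι 4 ⊗ (N ⊗ k₁) ⊕ ι 3 ⊗ (N ⊗ (N ⊗ k₃))
    k₅ = ι 5 ⊗ (N ⊗ k) ⊕ N ⊗ k₁ ⊕ ι 5 ⊗ k ⊕ k₁
    -- V ≤ 4 J τ reduces the demands κ₅ V² < τ³ and κ₄ V³ < τ⁴ to lower bounds for τ, 16 κ₅ J² and
    -- 64 κ₄ J³ with a margin.
    threshold = ι 16 ⊗ (k₅ ⊗ (J ⊗ J)) ⊕ ι 64 ⊗ (k₄ ⊗ (J ⊗ (J ⊗ J))) ⊕ ι 2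

    opaque
      3j 160B R : ℕ
      3j = 3 * j
      160B = 160 * B
      R = proj₁ (archimedean threshold)

      threshold≼R : threshold ≼ ι R
      threshold≼R = proj₂ (archimedean threshold)

      1≤3j : 1 ≤ 3j
      1≤3j = ℕₚ.*-mono-≤ {1} {3} (s≤s z≤n) 1≤j

      1≤160B : 1 ≤ 160B
      1≤160B = ℕₚ.*-mono-≤ {1} {160} (s≤s z≤n) 1≤B

      ι3j : ι 3j ≡ ι 3 ⊗ J
      ι3j = ι-* 3 j

      ι160B : ι 160B ≡ ι 160 ⊗ ι B
      ι160B = ι-* 160 B

    opaque
      t₀ : ℕ
      -- The summands lift τ above the threshold, fit T under the horizon, and give `t-large`.
      t₀ = 3j * R + 8 + 4 * B * (82 + 4 * M)

      8≤t₀ : 8 ≤ t₀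
      8≤t₀ = ℕₚ.≤-trans (ℕₚ.m≤n+m 8 (3j * R)) (ℕₚ.m≤m+n _ _)

      3jR≤t₀ : 3j * R ≤ t₀
      3jR≤t₀ = ℕₚ.≤-trans (ℕₚ.m≤m+n (3j * R) 8) (ℕₚ.m≤m+n _ _)

      4B≤t₀ : 4 * B * (82 + 4 * M) ≤ t₀
      4B≤t₀ = ℕₚ.m≤n+m _ (3j * R + 8)

      B≤t₀ : B ≤ t₀
      B≤t₀ = ℕₚ.≤-trans (ℕₚ.≤-trans (ℕₚ.m≤n*m B 4) (ℕₚ.m≤m*n (4 * B) (82 + 4 * M))) 4B≤t₀

    opaque
      z : ℕ
      -- Then x = 2 ^ (6 t₀), and L 2 ≥ 1/4 gives L x ≥ t₀.
      z = 2 ^ (2 * t₀)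

      z≡ : z ≡ 2 ^ (2 * t₀)
      z≡ = refl

      1≤z : 1 ≤ z
      1≤z = power-pos (2 * t₀) (s≤s z≤n)

      B≤z : B ≤ z
      B≤z = ℕₚ.≤-trans B≤t₀ (ℕₚ.≤-trans (ℕₚ.m≤m+n t₀ _) (ℕₚ.<⇒≤ (exponent<power (2 * t₀) ℕₚ.≤-refl)))

    opaque
      x : ℕ
      x = z * (z * z)

      x≡ : x ≡ z * (z * z)
      x≡ = refl

      1≤x : 1 ≤ x
      1≤x = ℕₚ.*-mono-≤ 1≤z (ℕₚ.*-mono-≤ 1≤z 1≤z)

    opaque
      X : ℕ
      -- L X = 5 t covers 2 (T + 4) = 4 t + 8 as soon as t ≥ 8.
      X = x ^ 5

      X≡ : X ≡ x ^ 5
      X≡ = refl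

      1≤X : 1 ≤ X
      1≤X = power-pos 5 1≤x

      x≤X : x ≤ X
      x≤X = ℕₚ.m≤m*n x (x ^ 4) {{>-nonZero (power-pos 4 1≤x)}}

    lg : Logarithm X
    lg = logarithm X

    open VonMangoldt X 1≤X lg using (L; L-*; L-^; 1≼4L2)

    t T τ : F
    t = L x
    T = t ⊕ t
    τ = inv 3j ⊗ T

    Lx≡ : t ≡ ι 6 ⊗ (ι t₀ ⊗ L 2)
    Lx≡ = trans (cong L x≡) (trans (L-* z (z * z) 1≤z (ℕₚ.*-mono-≤ 1≤z 1≤z))
      (trans (⊕-cong refl (L-* z z 1≤z 1≤z)) (trans
      (cong (λ l → l ⊕ (l ⊕ l)) (trans (cong L z≡) (trans (L-^ 2 (2 * t₀) (s≤s z≤n)) (⊗-cong (ι-* 2 t₀) refl))))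
      (ring 2 (λ t l → con 2 :* t :* l :+ (con 2 :* t :* l :+ con 2 :* t :* l) := con 6 :* (t :* l)) _ _))))

    t₀≼t : ι t₀ ≼ t
    t₀≼t = unscale 1 (linear 3 (λ t t₀ l → 2 • (con 6 :* (t₀ :* l) :≤ t) ⨾ 3 • (con 0 :≤ t₀ :* (con 4 :* l :- con 1)) ⨾
      con 0 :≤ t₀ ⊢ 2 • (t₀ :≤ t)) t (ι t₀) (L 2) (≼-reflexive (sym Lx≡)) (0≼⊗ (0≼ι t₀) (a≼b⇒0≼b-a 1≼4L2)) (0≼ι t₀))

    from-t₀ : ∀ {c} → c ≤ t₀ → ι c ≼ t
    from-t₀ h = ≼-trans (ι-mono h) t₀≼t

    8≼t : ι 8 ≼ t
    8≼t = from-t₀ 8≤t₀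

    0≼t : ι 0 ≼ t
    0≼t = ≼-trans (0≼ι 8) 8≼t

    0≼T : ι 0 ≼ T
    0≼T = 0≼⊕ 0≼t 0≼t

    horizon : (T ⊕ ι 4) ⊕ (T ⊕ ι 4) ≼ L X
    horizon = ≼≡ (linear 1 (λ t → con 8 :≤ t ⊢ (t :+ t :+ con 4) :+ (t :+ t :+ con 4) :≤ con 5 :* t) t 8≼t)
      (sym (trans (cong L X≡) (L-^ x 5 1≤x)))

    T≡ : T ≡ ι 3 ⊗ (J ⊗ τ)
    T≡ = sym (trans (ring 4 (λ h j i t → h :* (j :* (i :* t)) := (i :* (h :* j)) :* t) (ι 3) J (inv 3j) T)
      (trans (⊗-cong (trans (⊗-cong refl (sym ι3j)) (inv-ι 3j 1≤3j)) refl) (⊗-identityˡ T)))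

    threshold≼τ : threshold ≼ τ
    threshold≼τ = ≼-trans threshold≼R (≡≼ (trans (sym (⊗-identityˡ _))
      (trans (⊗-cong (sym (inv-ι 3j 1≤3j)) refl) (trans (⊗-assoc _ _ _) (⊗-cong refl (sym (ι-* 3j R))))))
      (⊗-monoʳ (inv-nonneg 3j) (≼-trans (from-t₀ 3jR≤t₀) (linear 1 (λ t → con 0 :≤ t ⊢ t :≤ t :+ t) t 0≼t))))

    open Exceptional X 1≤X lg M T 0≼T horizon using (κ₄; κ₅; V; V³; 0≼V; κ-nonneg; κ₁-nonneg; κ₃-nonneg; N-nonneg)

    k₄-nonneg : ι 0 ≼ k₄
    k₄-nonneg = 0≼⊕ (0≼⊕ (0≼⊗ (0≼ι 10) (0≼⊗ N-nonneg κ-nonneg)) (0≼⊗ (0≼ι 4) (0≼⊗ N-nonneg κ₁-nonneg)))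
      (0≼⊗ (0≼ι 3) (0≼⊗ N-nonneg (0≼⊗ N-nonneg κ₃-nonneg)))

    k₅-nonneg : ι 0 ≼ k₅
    k₅-nonneg = 0≼⊕ (0≼⊕ (0≼⊕ (0≼⊗ (0≼ι 5) (0≼⊗ N-nonneg κ-nonneg)) (0≼⊗ N-nonneg κ₁-nonneg)) (0≼⊗ (0≼ι 5) κ-nonneg)) κ₁-nonneg

    0≼J : ι 0 ≼ J
    0≼J = 0≼ι j

    5-term : ι 0 ≼ ι 16 ⊗ (k₅ ⊗ (J ⊗ J))
    5-term = 0≼⊗ (0≼ι 16) (0≼⊗ k₅-nonneg (0≼⊗ 0≼J 0≼J))

    4-term : ι 0 ≼ ι 64 ⊗ (k₄ ⊗ (J ⊗ (J ⊗ J)))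
    4-term = 0≼⊗ (0≼ι 64) (0≼⊗ k₄-nonneg (0≼⊗ 0≼J (0≼⊗ 0≼J 0≼J)))

    1≼τ : ι 1 ≼ τ
    1≼τ = linear 3 (λ a b τ → a :+ b :+ con 2 :≤ τ ⨾ con 0 :≤ a ⨾ con 0 :≤ b ⨾ con 0 :≤ con 1 ⊢ con 1 :≤ τ) _ _ τ threshold≼τ
      5-term 4-term 0≼1

    0≼τ : ι 0 ≼ τ
    0≼τ = ≼-trans 0≼1 1≼τ

    0≼Jτ : ι 0 ≼ J ⊗ τ
    0≼Jτ = 0≼⊗ 0≼J 0≼τ

    V≼4Jτ : V ≼ ι 4 ⊗ (J ⊗ τ)
    V≼4Jτ = subst (λ y → y ⊕ ι 1 ≼ ι 4 ⊗ (J ⊗ τ)) (sym T≡) (linear 1 (λ y → con 1 :≤ y ⊢ con 3 :* y :+ con 1 :≤ con 4 :* y) _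
      (≼-product-≥1 (ι-mono 1≤j) 1≼τ))

    0≼4Jτ : ι 0 ≼ ι 4 ⊗ (J ⊗ τ)
    0≼4Jτ = 0≼⊗ (0≼ι 4) 0≼Jτ

    V²≼ : V ⊗ V ≼ (ι 4 ⊗ (J ⊗ τ)) ⊗ (ι 4 ⊗ (J ⊗ τ))
    V²≼ = ⊗-mono 0≼4Jτ 0≼V V≼4Jτ V≼4Jτ

    1≼ττ : ι 1 ≼ τ ⊗ τ
    1≼ττ = ≼-product-≥1 1≼τ 1≼τ

    V²-small : κ₅ ⊗ (V ⊗ V) ≺ τ ⊗ (τ ⊗ τ)
    V²-small = ≺-from-gap (linear 5 (λ k v j τ a → con 0 :≤ k :* (con 4 :* (j :* τ) :* (con 4 :* (j :* τ)) :- v) ⨾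
      con 0 :≤ τ :* τ :* (τ :- (con 16 :* (k :* (j :* j)) :+ a :+ con 2)) ⨾ con 0 :≤ τ :* τ :* a ⨾ 2 • (con 1 :≤ τ :* τ) ⨾
      con 0 :≤ con 1 ⊢ k :* v :+ con 1 :≤ τ :* (τ :* τ)) k₅ (V ⊗ V) J τ (ι 64 ⊗ (k₄ ⊗ (J ⊗ (J ⊗ J))))
      (0≼⊗ k₅-nonneg (a≼b⇒0≼b-a V²≼)) (0≼⊗ (square-nonneg τ) (a≼b⇒0≼b-a threshold≼τ)) (0≼⊗ (square-nonneg τ) 4-term) 1≼ττ 0≼1)

    V³-small : κ₄ ⊗ V³ ≺ τ ⊗ (τ ⊗ (τ ⊗ τ))
    V³-small = ≺-from-gap (linear 5 (λ k v j τ a →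
      con 0 :≤ k :* (con 4 :* (j :* τ) :* (con 4 :* (j :* τ) :* (con 4 :* (j :* τ))) :- v) ⨾
      con 0 :≤ τ :* (τ :* τ) :* (τ :- (a :+ con 64 :* (k :* (j :* (j :* j))) :+ con 2)) ⨾ con 0 :≤ τ :* (τ :* τ) :* a ⨾
      2 • (con 1 :≤ τ :* (τ :* τ)) ⨾ con 0 :≤ con 1 ⊢ k :* v :+ con 1 :≤ τ :* (τ :* (τ :* τ))) k₄ V³ J τ (ι 16 ⊗ (k₅ ⊗ (J ⊗ J)))
      (0≼⊗ k₄-nonneg (a≼b⇒0≼b-a (⊗-mono 0≼4Jτ (0≼⊗ 0≼V 0≼V) V≼4Jτ V²≼))) (0≼⊗ 0≼τ³ (a≼b⇒0≼b-a threshold≼τ)) (0≼⊗ 0≼τ³ 5-term)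
        (≼-product-≥1 1≼τ 1≼ττ) 0≼1)
      where
      0≼τ³ : ι 0 ≼ τ ⊗ (τ ⊗ τ)
      0≼τ³ = 0≼⊗ 0≼τ (square-nonneg τ)

    j-large : ι 336 ⊗ N ⊕ ι 1 ≼ J
    j-large = ≼≡ (linear 2 (λ b n → 3840 • (con 0 :≤ b :* b) ⊢ con 336 :* n :+ con 1 :≤ con 3840 :* (b :* b) :+ con 336 :* n :+
      con 1) (ι B) N (square-nonneg (ι B))) (sym J≡)

    J-large : ι 3840 ⊗ (ι B ⊗ ι B) ⊕ ι 1 ≼ J
    J-large = ≼≡ (linear 2 (λ b n → 336 • (con 0 :≤ n) ⊢ con 3840 :* (b :* b) :+ con 1 :≤ con 3840 :* (b :* b) :+ con 336 :* n :+
      con 1) (ι B) N N-nonneg) (sym J≡)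

    σ : F
    -- 160 B σ = t makes B · 80 σ half of t in `character-mass`; `t-large` keeps the other costs
    -- below a quarter.
    σ = inv 160B ⊗ t

    0≼σ : ι 0 ≼ σ
    0≼σ = 0≼⊗ (inv-nonneg 160B) 0≼t

    σ≼T : σ ≼ T
    σ≼T = ≼-trans (⊗-monoˡ 0≼t (inv≼1 160B)) (linear 1 (λ t → con 0 :≤ t ⊢ con 1 :* t :≤ t :+ t) t 0≼t)

    σ≡ : ι 160 ⊗ (ι B ⊗ σ) ≡ t
    σ≡ = trans (ring 4 (λ h b i t → h :* (b :* (i :* t)) := (i :* (h :* b)) :* t) (ι 160) (ι B) (inv 160B) t)
      (trans (⊗-cong (trans (⊗-cong refl (sym ι160B)) (inv-ι 160B 1≤160B)) refl) (⊗-identityˡ t))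

    t-large : ι 4 ⊗ (ι B ⊗ (ι 82 ⊕ ι (4 * M))) ≼ t
    t-large = ≡≼ (sym (trans (ι-* (4 * B) (82 + 4 * M)) (trans (⊗-cong (ι-* 4 B) (ι-+ 82 (4 * M))) (⊗-assoc _ _ _))))
      (from-t₀ 4B≤t₀)

  private
    -- By `character-mass` the mass is at least t³ / (640 B²), and by `exceptional-density` at most
    -- 18 J² τ³ = 16 t³ / (3 J). So J would be at most 3414 B², against `J-large`.
    contradiction : (∀ p → Prime p → p ≤ X → ¬ (p ≈ a)) → ⊥
    contradiction none = ≺⇒⋡ (ι0≺ι1+ 0) (unscale 2 (linear 1 (λ y → 3 • (con 1 :≤ y) ⨾ con 3 :* y :≤ con 0 ⊢ 3 • (con 1 :≤ con 0))
      (t ⊗ (t ⊗ t)) (≼-product-≥1 1≼t (≼-product-≥1 1≼t 1≼t)) negative))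
      where
      open ExceptionalCharacter X 1≤X lg M T 0≼T horizon
      character : RealCharacter M
      character = exceptional-character ca none j τ T≡ 1≼τ j-large V²-small V³-small
      open Moments X 1≤X lg M using (Λ; χ₀; w)
      b mass : F
      b = ι B
      mass = S X (λ n → Λ n ⊗ ((χ₀ n ⊕ RealCharacter.ψ character n) ⊗ (L n ⊗ w 1 T n)))
      1≼t : ι 1 ≼ t
      1≼t = ≼-trans (ι-mono (s≤s z≤n)) 8≼t
      step₁ : (σ ⊗ t) ⊗ t ≼ ι 4 ⊗ (b ⊗ mass)
      step₁ = linear 5 (λ s t b e m → 4 • (s :* t :* t :≤ b :* (e :+ s :* t :* (con 80 :* (s :+ con 1) :+ m :+ con 2))) ⨾
        2 • (s :* t :* (con 160 :* (b :* s)) :≤ s :* t :* t) ⨾ con 0 :≤ s :* t :* (t :- con 4 :* (b :* (con 82 :+ m))) ⊢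
        s :* t :* t :≤ con 4 :* (b :* e)) σ t b mass (ι (4 * M))
        (subst₂ (λ c y → (σ ⊗ L y) ⊗ L y ≼ ι c ⊗ (S X
          (λ n → Λ n ⊗ ((χ₀ n ⊕ RealCharacter.ψ character n) ⊗ (L n ⊗ w 1 (L y ⊕ L y) n))) ⊕ (σ ⊗ L y) ⊗
          (ι 80 ⊗ (σ ⊕ ι 1) ⊕ ι (4 * M) ⊕ ι 2))) (sym B≡) (sym x≡)
          (CharacterMass.character-mass X 1≤X lg M character z (subst (_≤ z) B≡ B≤z) (subst (_≤ X) x≡ x≤X) 0≼σ
            (≼-trans (⊕-mono (⊕-mono σ≼T ≼-refl) (⊕-mono σ≼T ≼-refl)) horizon)))
        (≼-reflexive (⊗-cong refl σ≡)) (0≼⊗ (0≼⊗ 0≼σ 0≼t) (a≼b⇒0≼b-a t-large))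
      step₂ : t ⊗ (t ⊗ t) ≼ ι 640 ⊗ (b ⊗ b ⊗ mass)
      step₂ = linear 4 (λ s t b e → t :* t :* t :≤ t :* t :* (con 160 :* (b :* s)) ⨾
        160 • (con 0 :≤ b :* (con 4 :* (b :* e) :- s :* t :* t)) ⊢ t :* (t :* t) :≤ con 640 :* (b :* b :* e)) σ t b mass
        (≼-reflexive (⊗-cong refl (sym σ≡))) (0≼⊗ (0≼ι B) (a≼b⇒0≼b-a step₁))
      negative : ι 3 ⊗ (t ⊗ (t ⊗ t)) ≼ ι 0
      negative = linear 5 (λ y j b e x → 3 • (con 0 :≤ j :* (con 640 :* (b :* b :* e) :- y)) ⨾
        1920 • (con 0 :≤ b :* b :* j :* (con 18 :* (j :* j) :* x :- e)) ⨾
        1280 • (con 0 :≤ b :* b :* (con 8 :* y :- con 27 :* (j :* (j :* j)) :* x)) ⨾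
          3 • (con 0 :≤ y :* (j :- (con 3840 :* (b :* b) :+ con 1))) ⨾ 1280 • (con 0 :≤ b :* b :* y) ⊢ con 3 :* y :≤ con 0)
            (t ⊗ (t ⊗ t)) J b mass (τ ⊗ (τ ⊗ τ))
        (0≼⊗ 0≼J (a≼b⇒0≼b-a step₂)) (0≼⊗ (0≼⊗ (square-nonneg b) 0≼J)
          (a≼b⇒0≼b-a (exceptional-density ca none j τ T≡ 1≼τ j-large V²-small V³-small)))
        (0≼⊗ (square-nonneg b) (a≼b⇒0≼b-a (≼-reflexive
          (trans (ring 2 (λ j t → con 27 :* (j :* (j :* j)) :* (t :* (t :* t)) := con 3 :* (j :* t) :*
          (con 3 :* (j :* t) :* (con 3 :* (j :* t)))) J τ)
          (trans (cong (λ y → y ⊗ (y ⊗ y)) (sym T≡)) (ring 1 (λ t → (t :+ t) :* ((t :+ t) :* (t :+ t)) := con 8 :*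
          (t :* (t :* t))) t))))))
        (0≼⊗ 0≼y (a≼b⇒0≼b-a J-large)) (0≼⊗ (square-nonneg b) 0≼y)
        where
        0≼y : ι 0 ≼ t ⊗ (t ⊗ t)
        0≼y = 0≼⊗ 0≼t (square-nonneg t)

  dirichlet : Σ ℕ λ p → Prime p × p ≈ a
  dirichlet with search (λ p → prime? p ×-dec (p ≈? a)) X
  ... | inj₁ found = found
  ... | inj₂ none = ⊥-elim (contradiction λ p pp p≤X p≈a → none p (prime≥1 pp) p≤X (pp , p≈a))

-- The choice of the residue class

coprime-if-no-prime : ∀ {a M} {{_ : NonZero M}} → (∀ q → Prime q → q ∣ M → ¬ q ∣ a) → Coprime a M
coprime-if-no-prime {M = suc _} h {zero} (_ , 0∣M) = ⊥-elim (ℕₚ.0≢1+n (sym (0∣⇒≡0 0∣M)))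
coprime-if-no-prime h {suc zero} _ = refl
coprime-if-no-prime h {d@(suc (suc _))} (d∣a , d∣M) with prime-divisor d (s≤s (s≤s z≤n))
... | q , pq , q∣d = ⊥-elim (h q pq (∣-trans q∣d d∣M) (∣-trans q∣d d∣a))

prime∣!⇒≤ : ∀ {q} k → Prime q → q ∣ k ! → q ≤ k
prime∣!⇒≤ zero pq h = ⊥-elim (ℕₚ.<⇒≢ (prime>1 pq) (sym (∣1⇒≡1 h)))
prime∣!⇒≤ (suc k) pq h = [ ∣⇒≤ , ℕₚ.m≤n⇒m≤1+n ∘ prime∣!⇒≤ k pq ]′ (euclidsLemma (suc k) (k !) pq h)

∣! : ∀ {q k} → 1 ≤ q → q ≤ k → q ∣ k !
∣! {suc q} _ q≤k = ∣-trans (m∣m*n (q !)) (m≤n⇒m!∣n! q≤k)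

oddPrime≥3 : ∀ {q} → OddPrime q → 3 ≤ q
oddPrime≥3 (pq , odd) = ℕₚ.≤∧≢⇒< (prime>1 pq) λ { refl → odd ∣-refl }

oddPrime? : ∀ q → Dec (OddPrime q)
oddPrime? q = prime? q ×-dec ¬? (2 ∣? q)

-- Each progression meets the multiples of q at most once among t = 0, 1, 2.
avoid-two : ∀ q → OddPrime q → ∀ x d y e → ¬ q ∣ d → ¬ q ∣ e → Σ ℕ λ t → ¬ q ∣ x + t * d × ¬ q ∣ y + t * e
avoid-two q oq x d y e q∤d q∤e = pick 0 λ b₀ → pick 1 λ b₁ → pick 2 λ b₂ → ⊥-elim (clash b₀ b₁ b₂)
  where
  Bad : ℕ → Set
  Bad t = q ∣ x + t * d ⊎ q ∣ y + t * e

  Goal : Set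
  Goal = Σ ℕ λ t → ¬ q ∣ x + t * d × ¬ q ∣ y + t * e

  pick : ∀ t → (Bad t → Goal) → Goal
  pick t k with q ∣? x + t * d | q ∣? y + t * e
  ... | yes h | _ = k (inj₁ h)
  ... | no _ | yes h = k (inj₂ h)
  ... | no g | no h = t , g , h

  once : ∀ {z f} → ¬ q ∣ f → ∀ s t {{_ : NonZero t}} → t ≤ 2 → q ∣ z + s * f → q ∣ z + (s + t) * f → ⊥
  once {z} {f} q∤f s t t≤2 h h′ with euclidsLemma t f (proj₁ oq) (∣m+n∣m⇒∣n (subst (q ∣_) (split z s t f) h′) h)
    where
    split : ∀ z s t f → z + (s + t) * f ≡ (z + s * f) + t * f
    split = solve-∀
  ... | inj₁ q∣t = ℕₚ.<⇒≱ (oddPrime≥3 oq) (ℕₚ.≤-trans (∣⇒≤ q∣t) t≤2)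
  ... | inj₂ q∣f = q∤f q∣f

  1≤2 : 1 ≤ 2
  1≤2 = s≤s z≤n

  clash : Bad 0 → Bad 1 → Bad 2 → ⊥
  clash (inj₁ a) (inj₁ b) _ = once q∤d 0 1 1≤2 a b
  clash (inj₂ a) (inj₂ b) _ = once q∤e 0 1 1≤2 a b
  clash (inj₁ a) (inj₂ b) (inj₁ c) = once q∤d 0 2 ℕₚ.≤-refl a c
  clash (inj₁ a) (inj₂ b) (inj₂ c) = once {y} q∤e 1 1 1≤2 b c
  clash (inj₂ a) (inj₁ b) (inj₁ c) = once {x} q∤d 1 1 1≤2 b c
  clash (inj₂ a) (inj₁ b) (inj₂ c) = once q∤e 0 2 ℕₚ.≤-refl a c

-- At a new odd prime n = suc k, m changes by a multiple of k !, which is even and divisible by all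
-- smaller primes, so earlier choices survive; `avoid-two` finds the multiple.
avoid-odd-primes : ∀ b c n → (∀ q → OddPrime q → q < n → ¬ q ∣ b) →
  Σ ℕ λ m → 2 ∣ m × (∀ q → OddPrime q → q < n → ¬ q ∣ m × ¬ q ∣ b * m + c)
avoid-odd-primes b c zero _ = 0 , 2 ∣0 , λ _ _ ()
avoid-odd-primes b c (suc n) q∤b with avoid-odd-primes b c n (λ q oq q<n → q∤b q oq (ℕₚ.m≤n⇒m≤1+n q<n)) | oddPrime? n
... | m , 2∣m , avoids | no ¬on = m , 2∣m , step
  where
  step : ∀ q → OddPrime q → q < suc n → ¬ q ∣ m × ¬ q ∣ b * m + c
  step q oq (s≤s q≤n) with ℕₚ.m≤n⇒m<n∨m≡n q≤n
  ... | inj₁ q<n = avoids q oq q<n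
  ... | inj₂ refl = ⊥-elim (¬on oq)
avoid-odd-primes b c (suc n@(suc k)) q∤b | m , 2∣m , avoids | yes on
  with avoid-two n on m (k !) (b * m + c) (b * k !) n∤k! ([ q∤b n on ℕₚ.≤-refl , n∤k! ]′ ∘ euclidsLemma b (k !) (proj₁ on))
  where
  n∤k! : ¬ n ∣ k !
  n∤k! = ℕₚ.1+n≰n ∘ prime∣!⇒≤ k (proj₁ on)
... | t , n∤m′ , n∤bm′+c = m + t * k ! , ∣m∣n⇒∣m+n 2∣m (∣n⇒∣m*n t (∣! (s≤s z≤n) (ℕₚ.≤-pred (oddPrime≥3 on)))) , step
  where
  expand : ∀ b m t f c → b * (m + t * f) + c ≡ (b * m + c) + t * (b * f)
  expand = solve-∀

  drop : ∀ {q u v} → q ∣ v → q ∣ u + v → q ∣ u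
  drop {q} {u} {v} q∣v h = ∣m+n∣m⇒∣n (subst (q ∣_) (ℕₚ.+-comm u v) h) q∣v

  step : ∀ q → OddPrime q → q < suc n → ¬ q ∣ m + t * k ! × ¬ q ∣ b * (m + t * k !) + c
  step q oq (s≤s q≤n) with ℕₚ.m≤n⇒m<n∨m≡n q≤n
  ... | inj₂ refl = n∤m′ , n∤bm′+c ∘ subst (q ∣_) (expand b m t (k !) c)
  ... | inj₁ q<n = proj₁ (avoids q oq q<n) ∘ drop (∣n⇒∣m*n t q∣k!) ,
      proj₂ (avoids q oq q<n) ∘ drop (∣n⇒∣m*n t (∣n⇒∣m*n b q∣k!)) ∘ subst (q ∣_) (expand b m t (k !) c)
    where
    q∣k! : q ∣ k !
    q∣k! = ∣! (prime≥1 (proj₁ oq)) (ℕₚ.≤-pred q<n)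

theorem2p2 : ∀ p₁ p₂ → OddPrime p₁ → OddPrime p₂ → p₁ ≢ p₂ →
    Σ ℕ (λ p₀ → OddPrime p₀ × SmallestOddPrimeDivisor p₂ (p₀ + p₁))
theorem2p2 p₁ p₂ (pp₁ , odd₁) o₂@(pp₂ , _) p₁≢p₂ =
  p₀ , (pp₀ , p₀-odd) , o₂ , divides-sum p₂∣M (∣m∣n⇒∣m+n (m∣m*n m) (∣n⇒∣m*n p₁ p₂∣M)) , smallest
  where
  -- c represents −p₁ modulo M.
  M c : ℕ
  M = p₂ !
  c = p₁ * (M ∸ 1)

  instance
    M≢0 : NonZero M
    M≢0 = p₂ ℕₚ.!≢0

  choice : Σ ℕ λ m → 2 ∣ m × (∀ q → OddPrime q → q < p₂ → ¬ q ∣ m × ¬ q ∣ p₂ * m + c)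
  choice = avoid-odd-primes p₂ c p₂ λ q (pq , _) q<p₂ q∣p₂ → ℕₚ.<⇒≢ q<p₂ (prime∣prime pq pp₂ q∣p₂)

  m a : ℕ
  m = proj₁ choice
  a = p₂ * m + c

  p₂∣M : p₂ ∣ M
  p₂∣M = ∣! (prime≥1 pp₂) ℕₚ.≤-refl

  2∣M : 2 ∣ M
  2∣M = ∣! (s≤s z≤n) (prime>1 pp₂)

  a+p₁ : a + p₁ ≡ p₂ * m + p₁ * M
  a+p₁ = trans (ℕₚ.+-assoc (p₂ * m) c p₁) (cong (p₂ * m +_) (trans (ℕₚ.+-comm c p₁)
    (trans (sym (ℕₚ.*-suc p₁ (M ∸ 1))) (cong (p₁ *_) (ℕₚ.m+[n∸m]≡n (Residues.1≤M M))))))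

  ∣p₁ : ∀ {q} → q ∣ p₂ * m → q ∣ M → q ∣ a → q ∣ p₁
  ∣p₁ {q} h q∣M q∣a = ∣m+n∣m⇒∣n (subst (q ∣_) (sym a+p₁) (∣m∣n⇒∣m+n h (∣n⇒∣m*n p₁ q∣M))) q∣a

  -- A common prime is at most p₂. It is not 2, as p₁ is odd and m even; it is not p₂, as p₁ ≠ p₂;
  -- and smaller odd primes are excluded by the choice of m.
  a-coprime : Coprime a M
  a-coprime = coprime-if-no-prime no-common
    where
    no-common : ∀ q → Prime q → q ∣ M → ¬ q ∣ a
    no-common q pq q∣M q∣a with ℕₚ.m≤n⇒m<n∨m≡n (prime∣!⇒≤ p₂ pq q∣M) | q ≟ 2
    ... | _ | yes refl = odd₁ (∣p₁ (∣n⇒∣m*n p₂ (proj₁ (proj₂ choice))) q∣M q∣a)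
    ... | inj₁ q<p₂ | no q≢2 = proj₂ (proj₂ (proj₂ choice) q (pq , λ 2∣q → q≢2 (sym (prime∣prime prime[2] pq 2∣q))) q<p₂) q∣a
    ... | inj₂ refl | no _ = p₁≢p₂ (sym (prime∣prime pp₂ pp₁ (∣p₁ (m∣m*n m) q∣M q∣a)))

  open Residues M using (≈-+)

  prime-in-class : Σ ℕ λ p → Prime p × p % M ≡ a % M
  prime-in-class = Dirichlet.dirichlet M a-coprime

  p₀ : ℕ
  p₀ = proj₁ prime-in-class

  pp₀ : Prime p₀
  pp₀ = proj₁ (proj₂ prime-in-class)

  sum≈ : (p₀ + p₁) % M ≡ (p₂ * m + p₁ * M) % M
  sum≈ = trans (≈-+ {p₀} {a} {p₁} (proj₂ (proj₂ prime-in-class)) refl) (cong (_% M) a+p₁)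

  ∣-resp-≈ : ∀ {q x y} → q ∣ M → x % M ≡ y % M → q ∣ x → q ∣ y
  ∣-resp-≈ {q} q∣M e q∣x = ∣n∣m%n⇒∣m q∣M (subst (q ∣_) e (%-presˡ-∣ q∣x q∣M))

  divides-sum : ∀ {q} → q ∣ M → q ∣ p₂ * m + p₁ * M → q ∣ p₀ + p₁
  divides-sum q∣M = ∣-resp-≈ q∣M (sym sum≈)

  p₀-odd : Odd p₀
  p₀-odd 2∣p₀ with a-coprime (∣-resp-≈ 2∣M (proj₂ (proj₂ prime-in-class)) 2∣p₀ , 2∣M)
  ... | ()

  -- A prime q < p₂ divides M, so modulo q the sum is p₂ m, and q divides neither factor.
  smallest : ∀ q → OddPrime q → q ∣ p₀ + p₁ → p₂ ≤ q
  smallest q oq@(pq , _) q∣sum = ℕₚ.≮⇒≥ λ q<p₂ →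
    let q∣M = ∣! (prime≥1 pq) (ℕₚ.<⇒≤ q<p₂)
        q∣p₁M+p₂m = subst (q ∣_) (ℕₚ.+-comm (p₂ * m) (p₁ * M)) (∣-resp-≈ q∣M sum≈ q∣sum)
    in proj₁ (proj₂ (proj₂ choice) q oq q<p₂) (prime∣*⇒ pq pp₂ (ℕₚ.<⇒≢ q<p₂) (∣m+n∣m⇒∣n q∣p₁M+p₂m (∣n⇒∣m*n p₁ q∣M)))
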